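{- There is a $10$-approximation algorithm for regret-bounded vehicle routing.
   Context: (Additive) regret-bounded vehicle routing: an instance $(V,s,c,R)$ consists of a finite set $V$ of customers, a depot $s\notin V$, a metric $c$ on $\{s\}\cup V$, and a regret bound $R\ge 0$. The detour (regret) of a path $P$ from $s$ to $t$ is $c(P)-c(s,t)$, where $c(P)=\sum_{\{v,w\}\in E(P)}c(v,w)$ is the length of $P$. A feasible solution is a set of paths in the complete graph on $\{s\}\cup V$, each beginning at $s$ and having detour at most $R$, such that every element of $V$ belongs to one of the paths. The task is to minimize the number of paths. A $10$-approximation algorithm is a polynomial-time algorithm that, for every instance, returns a feasible solution whose number of paths is at most $10$ times the minimum possible number.
   Formalization: The metric c and the regret bound R take rational values (given in binary as input to a Turing machine) instead of real values. -}

module Defs where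

open import Data.Digit using (Bit; toDigits)
open import Data.Fin using (Fin; zero; suc; toℕ)
open import Data.Integer using (∣_∣)
open import Data.List using (List; []; _∷_; [_]; _++_; map; concatMap; foldr; length; allFin)
open import Data.List.Membership.Propositional using (_∈_)
open import Data.List.NonEmpty as List⁺ using (List⁺; _∷_)
open import Data.List.Relation.Unary.All using (All)
open import Data.List.Relation.Unary.Any using (Any)
open import Data.List.Relation.Unary.Unique.Propositional using (Unique)
open import Data.Maybe using (Maybe; just; nothing)
open import Data.Nat as ℕ using (ℕ; zero; suc)
open import Data.Product using (_×_; _,_; ∃-syntax; proj₁)
open import Data.Rational as ℚ using (ℚ; 0ℚ)
open import Data.Vec as Vec using (Vec; _∷_)
open import Function.Metric.Rational using (DistanceFunction; IsMetric)
open import Relation.Binary.PropositionalEquality using (_≡_)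

------------------------------------------------------------------------
-- Regret-bounded vehicle routing

-- zero is the depot; suc v, for v : Fin n, are the customers.
Vertex : ℕ → Set
Vertex n = Fin (suc n)

depot : ∀ {n} → Vertex n
depot = zero

-- Distances and the regret bound are rational, so that an instance is a
-- finite object which can be the input of an algorithm.
record Instance : Set where
  field
    n        : ℕ
    c        : DistanceFunction (Vertex n)
    isMetric : IsMetric _≡_ c
    R        : ℚ
    0≤R      : 0ℚ ℚ.≤ R

-- A path is given by its vertices in order; since it has a designated
-- start, this sequence is determined by the path as a graph.
VertexSequence : ℕ → Set
VertexSequence n = List⁺ (Vertex n)

Solution : ℕ → Set
Solution n = List (VertexSequence n)

module _ (I : Instance) where
  open Instance I

  pathLength : VertexSequence n → ℚ
  pathLength (v ∷ vs) = go v vs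
    where
    go : Vertex n → List (Vertex n) → ℚ
    go u []       = 0ℚ
    go u (w ∷ ws) = c u w ℚ.+ go w ws

  detour : VertexSequence n → ℚ
  detour P = pathLength P ℚ.- c depot (List⁺.last P)

  record FeasiblePath (P : VertexSequence n) : Set where
    field
      startsAtDepot : List⁺.head P ≡ depot
      isPath        : Unique (List⁺.toList P)
      detour≤R      : detour P ℚ.≤ R

  -- The field isSet makes the list represent a set of paths, whose
  -- cardinality is the length of the list.
  record Feasible (S : Solution n) : Set where
    field
      isSet         : Unique S
      feasiblePaths : All FeasiblePath S
      covers        : ∀ (v : Fin n) → Any (λ P → suc v ∈ List⁺.toList P) S

  IsMinimum : ℕ → Set
  IsMinimum k =
    (∃[ S ] Feasible S × length S ≡ k) ×
    (∀ S → Feasible S → k ℕ.≤ length S)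

------------------------------------------------------------------------
-- Deterministic multi-tape Turing machines

data Symbol : Set where
  bit                   : Bit → Symbol
  slash comma semicolon : Symbol

-- The tape alphabet: input/output symbols, a blank, and finitely many
-- work symbols.
data Letter (w : ℕ) : Set where
  blank : Letter w
  io    : Symbol → Letter w
  work  : Fin w → Letter w

data Move : Set where
  left stay right : Move

-- There is at least one tape.  A transition to nothing means halting.
record TuringMachine : Set where
  field
    extraTapes  : ℕ
    workSymbols : ℕ
    states      : ℕ
    start       : Fin states

  tapes : ℕ
  tapes = suc extraTapes

  Γ : Set
  Γ = Letter workSymbols

  field
    δ : Fin states → Vec Γ tapes → Maybe (Fin states × Vec (Γ × Move) tapes)

-- A two-way infinite tape, blank outside the stored part.  The letters
-- to the left of the head are listed starting next to the head.
record Tape (w : ℕ) : Set where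
  constructor tape
  field
    before  : List (Letter w)
    current : Letter w
    after   : List (Letter w)

open Tape public using (current)

module _ {w : ℕ} where

  blankTape : Tape w
  blankTape = tape [] blank []

  inputTape : List Symbol → Tape w
  inputTape []       = blankTape
  inputTape (a ∷ as) = tape [] (io a) (map io as)

  move : Move → Tape w → Tape w
  move left  (tape []       x rs)       = tape [] blank (x ∷ rs)
  move left  (tape (l ∷ ls) x rs)       = tape ls l (x ∷ rs)
  move stay  t                          = t
  move right (tape ls       x [])       = tape (x ∷ ls) blank []
  move right (tape ls       x (r ∷ rs)) = tape (x ∷ ls) r rs

  act : Letter w × Move → Tape w → Tape w
  act (y , m) (tape ls _ rs) = move m (tape ls y rs)

  -- The output starts at the head and extends to the right up to the
  -- first letter that is not an input/output symbol.
  readOutput : Tape w → List Symbol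
  readOutput (tape _ x rs) = go (x ∷ rs)
    where
    go : List (Letter w) → List Symbol
    go (io a ∷ ys) = a ∷ go ys
    go _           = []

module _ (M : TuringMachine) where
  open TuringMachine M

  Config : Set
  Config = Fin states × Vec (Tape workSymbols) tapes

  -- The first tape serves for both input and output.
  initial : List Symbol → Config
  initial as = start , inputTape as ∷ Vec.replicate extraTapes blankTape

  output : Config → List Symbol
  output (_ , t ∷ _) = readOutput t

  step : Config → Maybe Config
  step (q , ts) with δ q (Vec.map current ts)
  ... | nothing        = nothing
  ... | just (q′ , as) = just (q′ , Vec.zipWith act as ts)

  data HaltsIn : ℕ → Config → Config → Set where
    done : ∀ {C} → step C ≡ nothing → HaltsIn 0 C C
    next : ∀ {t C C′ D} → step C ≡ just C′ → HaltsIn t C′ D →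
           HaltsIn (suc t) C D

  ComputesWithin : ℕ → List Symbol → List Symbol → Set
  ComputesWithin b as bs =
    ∃[ t ] ∃[ D ] t ℕ.≤ b × HaltsIn t (initial as) D × output D ≡ bs

-- Polynomials with natural coefficients, constant coefficient first.
evaluate : List ℕ → ℕ → ℕ
evaluate p x = foldr (λ a r → a ℕ.+ x ℕ.* r) 0 p

------------------------------------------------------------------------
-- Encodings

-- Binary notation, least significant bit first, no superfluous zeros.
encodeℕ : ℕ → List Symbol
encodeℕ k = map bit (proj₁ (toDigits 2 k))

-- Only used for nonnegative numbers, hence no sign.
encodeℚ : ℚ → List Symbol
encodeℚ q = encodeℕ ∣ ℚ.numerator q ∣ ++ [ slash ] ++ encodeℕ (ℚ.denominatorℕ q)

-- The rows of the distance matrix, followed by the regret bound.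
encodeInstance : Instance → List Symbol
encodeInstance I = concatMap row (allFin (suc n)) ++ encodeℚ R
  where
  open Instance I
  row : Vertex n → List Symbol
  row u = concatMap (λ v → encodeℚ (c u v) ++ [ comma ]) (allFin (suc n))
          ++ [ semicolon ]

encodeSolution : ∀ {n} → Solution n → List Symbol
encodeSolution = concatMap λ P →
  concatMap (λ v → encodeℕ (toℕ v) ++ [ comma ]) (List⁺.toList P)
  ++ [ semicolon ]

------------------------------------------------------------------------
-- Approximation algorithms

IsApproximationAlgorithm : ℕ → TuringMachine → Set
IsApproximationAlgorithm α M =
  ∃[ p ] ∀ (I : Instance) →
    ∃[ S ] Feasible I S
         × (∀ opt → IsMinimum I opt → length S ℕ.≤ α ℕ.* opt)
         × ComputesWithin M (evaluate p (length (encodeInstance I)))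
             (encodeInstance I) (encodeSolution S)

{-# OPTIONS --safe #-}

-- Let g u v = c s u + c u v - c s v.  The detour of a path is the sum of g over its pairs of
-- consecutive customers, and g satisfies the triangle inequality.  It is rounded up to multiples
-- of R / M, where M = 20 (n + 1), and M + 1 units are charged for starting a path.
--
-- Suppose that k paths suffice.  Rank the vertices by their distance from s, and cut each path
-- into blocks of increasing rank, as many as possible.  Visiting only the vertex of smallest rank
-- of each block gives a flow of cost about 2 k M; the other customers are connected, within their
-- blocks, to vertices of smaller rank, and since going back in a block costs at most twice as much
-- as going forth, these edges cost about 3 k M in both directions together.  So the following
-- linear program has a solution: every customer v, if x is the flow entering v, sends 1 - x units
-- along the edges bought to vertices of smaller rank.  All numbers being small, a perceptron
-- solves it approximately in polynomial time.
--
-- The customers entered by at least 9/20 of flow are covered by chains, whose cost is at most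
-- 20/9 of that of the flow by duality with an auction.  Greedily growing a tree from them adds
-- the others at no more than 200/109 of the cost of the edges, and inserting the tree edges into
-- the chains yields a single tour.  Cut it into pieces of cost at most M: every cut saves M + 1.
-- Since 2 * 20 / 9 + 3 * 200 / 109 < 10, there are at most 10 k pieces.  All k are tried.
--
-- The algorithm is written as a function on lists of unary numbers, and compiled to a machine
-- by combinators for functions computable in polynomial time on three stacks.

module Submission where

open import Defs using (IsApproximationAlgorithm)

-- Starting a path costs `M + 1` and no step costs more, so that a step of regret above `R` is
-- priced like a new path and the number of pieces is controlled by the cost of a single tour. The
-- regret is asymmetric, which hinders tree arguments; but `g u v + g v u` is twice the distance of
-- `u` and `v`, so edges traversed in both directions have symmetric costs. For these the relaxation
-- by directed cuts is exact if the tree has to span all remaining vertices, as it does here, and no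
-- factor of two is lost. If the customers with a share of at least `t` of flow are chosen, the
-- ratio is `2 / t + 3 / (1 - t)`, with minimum 5 + 2 sqrt 6 = 9.8989...; 9/20 is close to the
-- minimiser, and the gap to 10 pays for the rounding and for the approximate solution. The guess
-- `k` is never verified: every attempt yields feasible paths, and the guess matters for their
-- number only. Since `M` is linear in `n`, everything after the rounding fits into unary notation;
-- binary numbers occur only where rounded regrets and ranks are computed from the input.

module Basics where

 open import Data.Bool using (Bool; T; _∧_; _∨_; false; if_then_else_; not; true) public
 open import Data.List
   using (List; []; [_]; _++_; _ʳ++_; _∷_; _∷ʳ′_; allFin; concat; concatMap; downFrom; filterᵇ;
          foldl; foldr; initLast; length; map; null; replicate; reverse; tabulate) public
 open import Data.List.Membership.Propositional using (_∈_; _∉_; find; lose) public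
 open import Data.List.Membership.Propositional.Properties
   using (∈-++⁺ʳ; ∈-++⁺ˡ; ∈-++⁻; ∈-allFin; ∈-concatMap⁺; ∈-concat⁺′; ∈-concat⁻′; ∈-downFrom⁺;
          ∈-downFrom⁻; ∈-filter⁺; ∈-filter⁻; ∈-map⁺; ∈-map⁻; ∈-∃++) public
 open import Data.List.Properties
   using (++-assoc; ++-identityʳ; ++-is-foldr; concatMap-++; concatMap-cong; concatMap-map;
          foldl-++; foldr-++; length-++; length-downFrom; length-map; length-replicate;
          length-reverse; length-tabulate; map-++; map-concatMap; map-tabulate; map-∘;
          reverse-++; reverse-foldr; reverse-involutive; unfold-reverse; ∷-injectiveʳ) public
 open import Data.List.Relation.Unary.Unique.Propositional using (Unique) public
 open import Data.Nat
   using (NonZero; _*_; _+_; _<?_; _<_; _<ᵇ_; _<′_; _^_; _∸_; _≟_; _≡ᵇ_; _≤?_; _≤_; _≤ᵇ_; _⊓_;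
          nonZero; pred; suc; s≤s; zero; z≤n; ℕ; ⌈_/2⌉; ⌊_/2⌋) public
 open import Data.Nat.Properties
   using (*-assoc; *-cancelʳ-<; *-cancelʳ-≤; *-cancelˡ-<; *-cancelˡ-≤; *-comm; *-distribʳ-+;
          *-distribˡ-+; *-identityʳ; *-mono-<; *-mono-≤; *-monoʳ-<; *-monoʳ-≤; *-monoˡ-<;
          *-monoˡ-≤; *-zeroʳ; +-assoc; +-cancelʳ-<; +-cancelʳ-≡; +-cancelʳ-≤; +-cancelˡ-≤;
          +-comm; +-identityʳ; +-mono-<-≤; +-mono-≤; +-mono-≤-<; +-monoʳ-≤; +-monoˡ-<; +-monoˡ-≤;
          +-suc; +-∸-assoc; 0∸n≡0; <-cmp; <-irrefl; <-trans; <-≤-trans; <ᵇ⇒<; <⇒<ᵇ; <⇒≢; <⇒≤;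
          <⇒≯; <⇒≱; [m+n]∸[m+o]≡n∸o; ^-*-assoc; ^-distribˡ-+-*; ^-identityʳ; ^-monoʳ-≤;
          ^-monoˡ-≤; m+[n∸m]≡n; m+n∸m≡n; m+n∸n≡m; m<m+n; m^n>0; module ≤-Reasoning; m∸n+n≡m;
          m∸n≤m; m≤m*n; m≤m+n; m≤n*m; m≤n+m; m≤n+m∸n; m≤n+o⇒m∸n≤o; m≤n⇒m∸n≡0; m≤n⇒m≤1+n;
          m≤n⇒m⊓n≡m; m≤n⇒∃[o]m+o≡n; m≥n⇒m⊓n≡n; m⊓n≤m; m⊓n≤n; n∸n≡0; n≤0⇒n≡0; n≤1+n; pred-mono-≤;
          suc-injective; suc-pred; ∸-monoˡ-≤; ≡ᵇ⇒≡; ≡⇒≡ᵇ; ≤-<-trans; ≤-antisym; ≤-pred; ≤-refl;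
          ≤-reflexive; ≤-total; ≤-trans; ≤ᵇ⇒≤; ≤⇒≤ᵇ; ≤⇒≯; ≤∧≢⇒<; ≮⇒≥; ≰⇒>; ⊓-glb; ⊓-sel; ⌈n/2⌉≤n;
          ⌊n/2⌋+⌈n/2⌉≡n; ⌊n/2⌋≤n; ⌊n/2⌋≤⌈n/2⌉) public
 open import Data.Nat.Tactic.RingSolver using (solve-∀) public
 open import Data.Product using (_,_; _×_; proj₁; proj₂; ∃-syntax) public
 open import Data.Sum using (_⊎_; inj₁; inj₂) public
 open import Data.Unit using (tt; ⊤) public
 open import Function using (_∘_; flip; id) public
 open import Relation.Binary.PropositionalEquality
   using (_≡_; _≢_; cong; cong₂; module ≡-Reasoning; refl; subst; subst₂; sym; trans) public
 open import Relation.Nullary using (Dec; contradiction; no; yes; ¬_) public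

open Basics

-- Programs on three stacks, compiled to Turing machines

module StackMachine where

 open import Defs
 open import Data.Fin using (Fin; zero; suc; _↑ˡ_; _↑ʳ_; splitAt)
 open import Data.Fin.Properties using (splitAt-↑ˡ; splitAt-↑ʳ)
 open import Data.Maybe as Maybe using (Maybe; just; nothing)
 open import Data.Vec as Vec using (Vec; []; _∷_)

 data Reg : Set where
   A B C : Reg

 record Store : Set where
   constructor ⟨_,_,_⟩
   field
     stackA stackB stackC : List Symbol

 get : Reg → Store → List Symbol
 get A ⟨ a , b , c ⟩ = a
 get B ⟨ a , b , c ⟩ = b
 get C ⟨ a , b , c ⟩ = c

 put : Reg → List Symbol → Store → Store
 put A s ⟨ a , b , c ⟩ = ⟨ s , b , c ⟩
 put B s ⟨ a , b , c ⟩ = ⟨ a , s , c ⟩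
 put C s ⟨ a , b , c ⟩ = ⟨ a , b , s ⟩

 top : List Symbol → Maybe Symbol
 top []      = nothing
 top (a ∷ _) = just a

 infixr 5 _⨾_

 data Prog : Set where
   push   : Reg → Symbol → Prog
   pop    : Reg → Prog
   _⨾_    : Prog → Prog → Prog
   branch : Reg → (Maybe Symbol → Bool) → Prog → Prog → Prog
   while  : Reg → (Maybe Symbol → Bool) → Prog → Prog

 -- Run p σ t σ′: the machine of p goes from σ to σ′ in exactly t steps.
 data Run : Prog → Store → ℕ → Store → Set where
   push : ∀ {ρ a σ} → Run (push ρ a) σ 2 (put ρ (a ∷ get ρ σ) σ)
   pop  : ∀ {ρ a as σ} → get ρ σ ≡ a ∷ as → Run (pop ρ) σ 1 (put ρ as σ)
   seq  : ∀ {p q σ σ′ σ″ t t′} → Run p σ t σ′ → Run q σ′ t′ σ″ →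
          Run (p ⨾ q) σ (t + t′) σ″
   then′ : ∀ {ρ f p q σ t σ′} → f (top (get ρ σ)) ≡ true → Run p σ t σ′ →
          Run (branch ρ f p q) σ (suc t) σ′
   else′ : ∀ {ρ f p q σ t σ′} → f (top (get ρ σ)) ≡ false → Run q σ t σ′ →
          Run (branch ρ f p q) σ (suc t) σ′
   stop : ∀ {ρ f p σ} → f (top (get ρ σ)) ≡ false → Run (while ρ f p) σ 1 σ
   loop : ∀ {ρ f p σ σ′ σ″ t t′} → f (top (get ρ σ)) ≡ true →
          Run p σ t σ′ → Run (while ρ f p) σ′ t′ σ″ →
          Run (while ρ f p) σ (suc (t + t′)) σ″

 Γ₀ : Set
 Γ₀ = Letter 0

 Tapes : Set
 Tapes = Vec (Tape 0) 3

 Acts : Set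
 Acts = Vec (Γ₀ × Move) 3

 heads : Tapes → Vec Γ₀ 3
 heads = Vec.map current

 perform : Acts → Tapes → Tapes
 perform = Vec.zipWith act

 symbol : Γ₀ → Maybe Symbol
 symbol (io a) = just a
 symbol _      = nothing

 under : Reg → Vec Γ₀ 3 → Maybe Symbol
 under A (x ∷ _ ∷ _ ∷ []) = symbol x
 under B (_ ∷ x ∷ _ ∷ []) = symbol x
 under C (_ ∷ _ ∷ x ∷ []) = symbol x

 idle : Vec Γ₀ 3 → Acts
 idle = Vec.map (_, stay)

 only : Reg → (Γ₀ → Γ₀ × Move) → Vec Γ₀ 3 → Acts
 only A f (x ∷ y ∷ z ∷ []) = f x ∷ (y , stay) ∷ (z , stay) ∷ []
 only B f (x ∷ y ∷ z ∷ []) = (x , stay) ∷ f y ∷ (z , stay) ∷ []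
 only C f (x ∷ y ∷ z ∷ []) = (x , stay) ∷ (y , stay) ∷ f z ∷ []

 -- Sizes count states. A push takes two, because a machine step writes before it moves: the head
 -- first moves onto the cell at its left and only then writes.
 #_ : Prog → ℕ
 # push _ _       = 2
 # pop _          = 1
 # (p ⨾ q)        = # p + # q
 # branch _ _ p q = suc (# p + # q)
 # while _ _ p    = suc (# p)

 entry : ∀ p → Fin (# p)
 entry (push _ _)       = zero
 entry (pop _)          = zero
 entry (p ⨾ q)          = entry p ↑ˡ # q
 entry (branch _ _ _ _) = zero
 entry (while _ _ _)    = zero

 Next : ℕ → Set
 Next k = Maybe (Fin k) × Acts

 relabel : ∀ {k l} → (Fin k → Fin l) → Next k → Next l
 relabel f (m , as) = Maybe.map f m , as

 -- The final step of a program is redirected to the entry of what follows, so that sequencing costs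
 -- no extra step and the running times in `Run` are exact.
 continue : ∀ {k l} → (Fin k → Fin l) → Fin l → Next k → Next l
 continue f s (just s′ , as) = just (f s′) , as
 continue f s (nothing , as) = just s , as

 -- The successor state nothing means that the program is finished.
 next-state : ∀ p → Fin (# p) → Vec Γ₀ 3 → Next (# p)
 next-seq : ∀ p q → Fin (# p) ⊎ Fin (# q) → Vec Γ₀ 3 → Next (# p + # q)
 next-branch : ∀ p q → Fin (# p) ⊎ Fin (# q) → Vec Γ₀ 3 →
               Next (suc (# p + # q))

 next-state (push ρ a) zero    ls = just (suc zero) , only ρ (_, left) ls
 next-state (push ρ a) (suc s) ls = nothing , only ρ (λ _ → io a , stay) ls
 next-state (pop ρ) _ ls = nothing , only ρ (_, right) ls
 next-state (p ⨾ q) s ls = next-seq p q (splitAt (# p) s) ls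
 next-state (branch ρ f p q) zero ls =
   just (suc (if f (under ρ ls) then entry p ↑ˡ # q else # p ↑ʳ entry q)) , idle ls
 next-state (branch ρ f p q) (suc s) ls = next-branch p q (splitAt (# p) s) ls
 next-state (while ρ f p) zero ls =
   (if f (under ρ ls) then just (suc (entry p)) else nothing) , idle ls
 next-state (while ρ f p) (suc s) ls = continue suc zero (next-state p s ls)

 next-seq p q (inj₁ s) ls = continue (_↑ˡ # q) (# p ↑ʳ entry q) (next-state p s ls)
 next-seq p q (inj₂ s) ls = relabel (# p ↑ʳ_) (next-state q s ls)

 next-branch p q (inj₁ s) ls = relabel (λ s → suc (s ↑ˡ # q)) (next-state p s ls)
 next-branch p q (inj₂ s) ls = relabel (λ s → suc (# p ↑ʳ s)) (next-state q s ls)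

 data Exec (p : Prog) : Fin (# p) → Tapes → ℕ → Tapes → Set where
   last : ∀ {s ts as} → next-state p s (heads ts) ≡ (nothing , as) →
          Exec p s ts 1 (perform as ts)
   more : ∀ {s s′ ts ts′ as t} → next-state p s (heads ts) ≡ (just s′ , as) →
          Exec p s′ (perform as ts) t ts′ → Exec p s ts (suc t) ts′

 exec-seqʳ : ∀ {p q s ts t ts′} → Exec q s ts t ts′ →
             Exec (p ⨾ q) (# p ↑ʳ s) ts t ts′
 exec-seqʳ {p} {q} {s} {ts} (last e) =
   last (trans (cong (λ z → next-seq p q z (heads ts)) (splitAt-↑ʳ (# p) (# q) s))
               (cong (relabel (# p ↑ʳ_)) e))
 exec-seqʳ {p} {q} {s} {ts} (more e r) =
   more (trans (cong (λ z → next-seq p q z (heads ts)) (splitAt-↑ʳ (# p) (# q) s))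
               (cong (relabel (# p ↑ʳ_)) e))
        (exec-seqʳ r)

 exec-seq : ∀ {p q s ts t ts′ t′ ts″} → Exec p s ts t ts′ →
            Exec q (entry q) ts′ t′ ts″ → Exec (p ⨾ q) (s ↑ˡ # q) ts (t + t′) ts″
 exec-seq {p} {q} {s} {ts} (last e) r =
   more (trans (cong (λ z → next-seq p q z (heads ts)) (splitAt-↑ˡ (# p) s (# q)))
               (cong (continue (_↑ˡ # q) (# p ↑ʳ entry q)) e))
        (exec-seqʳ r)
 exec-seq {p} {q} {s} {ts} (more e r′) r =
   more (trans (cong (λ z → next-seq p q z (heads ts)) (splitAt-↑ˡ (# p) s (# q)))
               (cong (continue (_↑ˡ # q) (# p ↑ʳ entry q)) e))
        (exec-seq r′ r)

 exec-yes : ∀ {ρ f p q s ts t ts′} → Exec p s ts t ts′ →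
            Exec (branch ρ f p q) (suc (s ↑ˡ # q)) ts t ts′
 exec-yes {_} {_} {p} {q} {s} {ts} (last e) =
   last (trans (cong (λ z → next-branch p q z (heads ts)) (splitAt-↑ˡ (# p) s (# q)))
               (cong (relabel (λ s → suc (s ↑ˡ # q))) e))
 exec-yes {_} {_} {p} {q} {s} {ts} (more e r) =
   more (trans (cong (λ z → next-branch p q z (heads ts)) (splitAt-↑ˡ (# p) s (# q)))
               (cong (relabel (λ s → suc (s ↑ˡ # q))) e))
        (exec-yes r)

 exec-no : ∀ {ρ f p q s ts t ts′} → Exec q s ts t ts′ →
           Exec (branch ρ f p q) (suc (# p ↑ʳ s)) ts t ts′
 exec-no {_} {_} {p} {q} {s} {ts} (last e) =
   last (trans (cong (λ z → next-branch p q z (heads ts)) (splitAt-↑ʳ (# p) (# q) s))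
               (cong (relabel (λ s → suc (# p ↑ʳ s))) e))
 exec-no {_} {_} {p} {q} {s} {ts} (more e r) =
   more (trans (cong (λ z → next-branch p q z (heads ts)) (splitAt-↑ʳ (# p) (# q) s))
               (cong (relabel (λ s → suc (# p ↑ʳ s))) e))
        (exec-no r)

 exec-loop : ∀ {ρ f p s ts t ts′ t′ ts″} → Exec p s ts t ts′ →
             Exec (while ρ f p) zero ts′ t′ ts″ →
             Exec (while ρ f p) (suc s) ts (t + t′) ts″
 exec-loop (last e) r    = more (cong (continue suc zero) e) r
 exec-loop (more e r′) r = more (cong (continue suc zero) e) (exec-loop r′ r)

 -- A stack grows to the left and has its top under the head. The input is thus a stack as it
 -- stands, and the output is read off the final one. Whatever lies to the left of the head may be
 -- forgotten, for a push overwrites it.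
 cells : Tape 0 → List Γ₀
 cells (tape _ x rs) = x ∷ rs

 -- The second alternative occurs on the input tape, which has no blank
 -- stored after the input.
 Holds : Tape 0 → List Symbol → Set
 Holds t s = cells t ≡ map io s ++ [ blank ] ⊎ cells t ≡ map io s

 holds-top : ∀ t s → Holds t s → symbol (current t) ≡ top s
 holds-top (tape _ _ _) []      (inj₁ refl) = refl
 holds-top (tape _ _ _) []      (inj₂ ())
 holds-top (tape _ _ _) (a ∷ s) (inj₁ refl) = refl
 holds-top (tape _ _ _) (a ∷ s) (inj₂ refl) = refl

 holds-push : ∀ t s a → Holds t s →
              Holds (act (io a , stay) (act (current t , left) t)) (a ∷ s)
 holds-push (tape []       x rs) s a (inj₁ e) = inj₁ (cong (io a ∷_) e)
 holds-push (tape []       x rs) s a (inj₂ e) = inj₂ (cong (io a ∷_) e)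
 holds-push (tape (l ∷ ls) x rs) s a (inj₁ e) = inj₁ (cong (io a ∷_) e)
 holds-push (tape (l ∷ ls) x rs) s a (inj₂ e) = inj₂ (cong (io a ∷_) e)

 holds-pop : ∀ t a s → Holds t (a ∷ s) → Holds (act (current t , right) t) s
 holds-pop (tape ls x [])       a []      (inj₁ ())
 holds-pop (tape ls x [])       a []      (inj₂ e) = inj₁ refl
 holds-pop (tape ls x [])       a (b ∷ s) (inj₁ ())
 holds-pop (tape ls x [])       a (b ∷ s) (inj₂ ())
 holds-pop (tape ls x (r ∷ rs)) a s       (inj₁ e) = inj₁ (∷-injectiveʳ e)
 holds-pop (tape ls x (r ∷ rs)) a s       (inj₂ e) = inj₂ (∷-injectiveʳ e)

 holds-output : ∀ t s → Holds t s → readOutput t ≡ s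
 holds-output (tape _ _ _) []           (inj₁ refl) = refl
 holds-output (tape _ _ _) (a ∷ [])     (inj₁ refl) = refl
 holds-output (tape l _ _) (a ∷ b ∷ s)  (inj₁ refl) =
   cong (a ∷_) (holds-output (tape l (io b) _) (b ∷ s) (inj₁ refl))
 holds-output (tape _ _ _) (a ∷ [])     (inj₂ refl) = refl
 holds-output (tape l _ _) (a ∷ b ∷ s)  (inj₂ refl) =
   cong (a ∷_) (holds-output (tape l (io b) _) (b ∷ s) (inj₂ refl))

 data Represents : Tapes → Store → Set where
   rep : ∀ {ta tb tc a b c} → Holds ta a → Holds tb b → Holds tc c →
         Represents (ta ∷ tb ∷ tc ∷ []) ⟨ a , b , c ⟩

 rep-top : ∀ {ts σ} ρ → Represents ts σ → under ρ (heads ts) ≡ top (get ρ σ)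
 rep-top A (rep {ta} {a = a} ha hb hc) = holds-top ta a ha
 rep-top B (rep {tb = tb} {b = b} ha hb hc) = holds-top tb b hb
 rep-top C (rep {tc = tc} {c = c} ha hb hc) = holds-top tc c hc

 Simulated : Prog → Tapes → ℕ → Store → Set
 Simulated p ts t σ′ = ∃[ ts′ ] Exec p (entry p) ts t ts′ × Represents ts′ σ′

 simulate-push : ∀ ρ a {ts σ} → Represents ts σ →
                 Simulated (push ρ a) ts 2 (put ρ (a ∷ get ρ σ) σ)
 simulate-push A a (rep {ta} ha hb hc) =
   _ , more refl (last refl) , rep (holds-push ta _ a ha) hb hc
 simulate-push B a (rep {tb = tb} ha hb hc) =
   _ , more refl (last refl) , rep ha (holds-push tb _ a hb) hc
 simulate-push C a (rep {tc = tc} ha hb hc) =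
   _ , more refl (last refl) , rep ha hb (holds-push tc _ a hc)

 simulate-pop : ∀ ρ {a as ts σ} → get ρ σ ≡ a ∷ as → Represents ts σ →
                Simulated (pop ρ) ts 1 (put ρ as σ)
 simulate-pop A refl (rep {ta} ha hb hc) = _ , last refl , rep (holds-pop ta _ _ ha) hb hc
 simulate-pop B refl (rep {tb = tb} ha hb hc) = _ , last refl , rep ha (holds-pop tb _ _ hb) hc
 simulate-pop C refl (rep {tc = tc} ha hb hc) = _ , last refl , rep ha hb (holds-pop tc _ _ hc)

 perform-idle : ∀ ts → perform (idle (heads ts)) ts ≡ ts
 perform-idle (_ ∷ _ ∷ _ ∷ []) = refl

 simulate : ∀ {p σ t σ′ ts} → Run p σ t σ′ → Represents ts σ → Simulated p ts t σ′
 simulate (push {ρ} {a}) h = simulate-push ρ a h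
 simulate (pop {ρ} e) h = simulate-pop ρ e h
 simulate (seq r r′) h with simulate r h
 ... | _ , x , h′ with simulate r′ h′
 ... | _ , x′ , h″ = _ , exec-seq x x′ , h″
 simulate {ts = ts} (then′ {ρ} {f} {p} {q} e r) h with simulate r h
 ... | ts′ , x , h′ = ts′ ,
       more (cong (λ b → just (suc (if b then entry p ↑ˡ # q else # p ↑ʳ entry q)) ,
                         idle (heads ts))
                  (trans (cong f (rep-top ρ h)) e))
            (subst (λ z → Exec _ _ z _ _) (sym (perform-idle ts)) (exec-yes x)) , h′
 simulate {ts = ts} (else′ {ρ} {f} {p} {q} e r) h with simulate r h
 ... | ts′ , x , h′ = ts′ ,
       more (cong (λ b → just (suc (if b then entry p ↑ˡ # q else # p ↑ʳ entry q)) ,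
                         idle (heads ts))
                  (trans (cong f (rep-top ρ h)) e))
            (subst (λ z → Exec _ _ z _ _) (sym (perform-idle ts)) (exec-no x)) , h′
 simulate {ts = ts} (stop {ρ} {f} {p} e) h = _ ,
   last (cong (λ b → (if b then just (suc (entry p)) else nothing) , idle (heads ts))
              (trans (cong f (rep-top ρ h)) e)) ,
   subst (λ z → Represents z _) (sym (perform-idle ts)) h
 simulate {ts = ts} (loop {ρ} {f} {p} e r r′) h with simulate r h
 ... | _ , x , h′ with simulate r′ h′
 ... | ts′ , x′ , h″ = ts′ ,
       more (cong (λ b → (if b then just (suc (entry p)) else nothing) , idle (heads ts))
                  (trans (cong f (rep-top ρ h)) e))
            (subst (λ z → Exec _ _ z _ _) (sym (perform-idle ts)) (exec-loop x x′)) , h″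

 -- A Turing machine halts without acting, whereas the last transition of a program acts on the
 -- tapes; hence the additional state `zero`, in which the machine stops.
 machine-δ : ∀ p → Fin (suc (# p)) → Vec Γ₀ 3 → Maybe (Fin (suc (# p)) × Acts)
 machine-δ p zero    ls = nothing
 machine-δ p (suc s) ls with next-state p s ls
 ... | just s′ , as = just (suc s′ , as)
 ... | nothing , as = just (zero , as)

 machine : Prog → TuringMachine
 machine p = record
   { extraTapes = 2 ; workSymbols = 0 ; states = suc (# p)
   ; start = suc (entry p) ; δ = machine-δ p }

 machine-more : ∀ p {s s′ ts as} → next-state p s (heads ts) ≡ (just s′ , as) →
                step (machine p) (suc s , ts) ≡ just (suc s′ , perform as ts)
 machine-more p e rewrite e = refl

 machine-last : ∀ p {s ts as} → next-state p s (heads ts) ≡ (nothing , as) →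
                step (machine p) (suc s , ts) ≡ just (zero , perform as ts)
 machine-last p e rewrite e = refl

 machine-halts : ∀ p {s ts t ts′} → Exec p s ts t ts′ →
                 HaltsIn (machine p) t (suc s , ts) (zero , ts′)
 machine-halts p (last e)   = next (machine-last p e) (done refl)
 machine-halts p (more e r) = next (machine-more p e) (machine-halts p r)

 holds-input : ∀ as → Holds (inputTape as) as
 holds-input []       = inj₁ refl
 holds-input (a ∷ as) = inj₂ refl

 machine-computes : ∀ p {as t bs b c m} → Run p ⟨ as , [] , [] ⟩ t ⟨ bs , b , c ⟩ →
                    t ≤ m → ComputesWithin (machine p) m as bs
 machine-computes p {as} r t≤m with simulate r (rep (holds-input as) (inj₁ refl) (inj₁ refl))
 ... | ta ∷ _ , x , rep ha _ _ =
       _ , _ , t≤m , machine-halts p x , holds-output ta _ ha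

-- Functions computable in polynomial time

module Polytime where

 open import Defs
 open StackMachine
 open import Data.Digit using (0b; 1b)
 open import Data.Fin using (zero; suc)
 open import Data.Maybe using (Maybe; just; nothing)

 data Tree : Set where
   nil  : Tree
   cons : Tree → Tree → Tree

 size : Tree → ℕ
 size nil        = 1
 size (cons s t) = suc (size s + size t)

 o l mark : Symbol
 o    = bit 0b
 l    = bit 1b
 mark = slash

 code : Tree → List Symbol → List Symbol
 code nil        a = o ∷ a
 code (cons s t) a = l ∷ code s (code t a)

 -- What B carries after the symbols of `code t` have been moved there one by one. Read backwards
 -- the code does not delimit itself, which is why `mark` is put below it.
 rcode : Tree → List Symbol → List Symbol
 rcode nil        b = o ∷ b
 rcode (cons s t) b = rcode t (rcode s (l ∷ b))

 Within : Prog → Store → ℕ → Store → Set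
 Within p σ n σ′ = ∃[ t ] t ≤ n × Run p σ t σ′

 weaken : ∀ {p σ m n σ′} → m ≤ n → Within p σ m σ′ → Within p σ n σ′
 weaken m≤n (t , t≤m , r) = t , ≤-trans t≤m m≤n , r

 within : ∀ {p σ m n σ′} → Within p σ m σ′ → m ≤ n → Within p σ n σ′
 within w m≤n = weaken m≤n w

 infixr 5 _⨟_

 _⨟_ : ∀ {p q σ σ′ σ″ m n} → Within p σ m σ′ → Within q σ′ n σ″ →
       Within (p ⨾ q) σ (m + n) σ″
 (_ , h , r) ⨟ (_ , h′ , r′) = _ , +-mono-≤ h h′ , seq r r′

 pushW : ∀ {ρ a σ} → Within (push ρ a) σ 2 (put ρ (a ∷ get ρ σ) σ)
 pushW = 2 , ≤-refl , push

 popW : ∀ {ρ a as σ} → get ρ σ ≡ a ∷ as → Within (pop ρ) σ 1 (put ρ as σ)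
 popW e = 1 , ≤-refl , pop e

 yesW : ∀ {ρ f p q σ n σ′} → f (top (get ρ σ)) ≡ true → Within p σ n σ′ →
        Within (branch ρ f p q) σ (suc n) σ′
 yesW e (_ , h , r) = _ , s≤s h , then′ e r

 noW : ∀ {ρ f p q σ n σ′} → f (top (get ρ σ)) ≡ false → Within q σ n σ′ →
       Within (branch ρ f p q) σ (suc n) σ′
 noW e (_ , h , r) = _ , s≤s h , else′ e r

 stopW : ∀ {ρ f p σ} → f (top (get ρ σ)) ≡ false → Within (while ρ f p) σ 1 σ
 stopW e = 1 , ≤-refl , stop e

 loopW : ∀ {ρ f p σ σ′ σ″ m n} → f (top (get ρ σ)) ≡ true →
         Within p σ m σ′ → Within (while ρ f p) σ′ n σ″ →
         Within (while ρ f p) σ (suc (m + n)) σ″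
 loopW e (_ , h , r) (_ , h′ , r′) = _ , s≤s (+-mono-≤ h h′) , loop e r r′

 isL nonempty unmarked : Maybe Symbol → Bool
 isL (just (bit (suc zero))) = true
 isL _                       = false
 nonempty (just _) = true
 nonempty nothing  = false
 unmarked (just slash) = false
 unmarked _            = true

 node-cost : ∀ k x y n → k + (k * x + (k * y + n)) ≡ k * suc (x + y) + n
 node-cost = solve-∀

 node-cost′ : ∀ k x y n → k * y + (k * x + (k + n)) ≡ k * suc (x + y) + n
 node-cost′ = solve-∀

 leaf-cost : ∀ k n → k + n ≡ k * 1 + n
 leaf-cost = solve-∀

 -- C counts, in unary, the trees which are still to be read from A.
 shift-loop toB fromB-loop fromB copy-loop back-loop dup drop-loop discard : Prog
 shift-loop = while C nonempty
   (branch A isL (pop A ⨾ push B l ⨾ push C o) (pop A ⨾ push B o ⨾ pop C))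
 toB = push B mark ⨾ push C o ⨾ shift-loop
 fromB-loop = while B unmarked
   (branch B isL (pop B ⨾ push A l) (pop B ⨾ push A o))
 fromB = fromB-loop ⨾ pop B
 copy-loop = while B unmarked
   (branch B isL (pop B ⨾ push A l ⨾ push C l) (pop B ⨾ push A o ⨾ push C o))
 back-loop = while C nonempty
   (branch C isL (pop C ⨾ push B l) (pop C ⨾ push B o))
 dup = toB ⨾ copy-loop ⨾ back-loop ⨾ fromB
 drop-loop = while C nonempty
   (branch A isL (pop A ⨾ push C o) (pop A ⨾ pop C))
 discard = push C o ⨾ drop-loop

 -- The rest of the run is an argument: in this form the two subtrees of a node are handled by
 -- composing the induction hypotheses, within one and the same loop.
 shift-tree : ∀ t {a b c n σ} → Within shift-loop ⟨ a , rcode t b , c ⟩ n σ →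
              Within shift-loop ⟨ code t a , b , o ∷ c ⟩ (7 * size t + n) σ
 shift-tree nil {n = n} w =
   weaken (≤-trans (n≤1+n _) (≤-reflexive (leaf-cost 7 n)))
     (loopW refl (noW refl (popW refl ⨟ pushW ⨟ popW refl)) w)
 shift-tree (cons s t) {n = n} w =
   weaken (≤-reflexive (node-cost 7 (size s) (size t) n))
     (loopW refl (yesW refl (popW refl ⨟ pushW ⨟ pushW)) (shift-tree s (shift-tree t w)))

 toB-run : ∀ t {a b} →
   Within toB ⟨ code t a , b , [] ⟩ (7 * size t + 5) ⟨ a , rcode t (mark ∷ b) , [] ⟩
 toB-run t = weaken (≤-reflexive (lem (size t))) (pushW ⨟ pushW ⨟ shift-tree t (stopW refl))
   where
   lem : ∀ s → 2 + (2 + (7 * s + 1)) ≡ 7 * s + 5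
   lem = solve-∀

 unshift-tree : ∀ t {a b c n σ} → Within fromB-loop ⟨ code t a , b , c ⟩ n σ →
                Within fromB-loop ⟨ a , rcode t b , c ⟩ (5 * size t + n) σ
 unshift-tree nil {n = n} w =
   weaken (≤-reflexive (leaf-cost 5 n)) (loopW refl (noW refl (popW refl ⨟ pushW)) w)
 unshift-tree (cons s t) {n = n} w =
   weaken (≤-reflexive (node-cost′ 5 (size s) (size t) n))
     (unshift-tree t (unshift-tree s (loopW refl (yesW refl (popW refl ⨟ pushW)) w)))

 fromB-run : ∀ t {a b c} →
   Within fromB ⟨ a , rcode t (mark ∷ b) , c ⟩ (5 * size t + 2) ⟨ code t a , b , c ⟩
 fromB-run t = weaken (≤-reflexive (+-assoc (5 * size t) 1 1))
                 (unshift-tree t (stopW refl) ⨟ popW refl)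

 copy-tree : ∀ t {a b c n σ} → Within copy-loop ⟨ code t a , b , code t c ⟩ n σ →
             Within copy-loop ⟨ a , rcode t b , c ⟩ (7 * size t + n) σ
 copy-tree nil {n = n} w =
   weaken (≤-reflexive (leaf-cost 7 n)) (loopW refl (noW refl (popW refl ⨟ pushW ⨟ pushW)) w)
 copy-tree (cons s t) {n = n} w =
   weaken (≤-reflexive (node-cost′ 7 (size s) (size t) n))
     (copy-tree t (copy-tree s (loopW refl (yesW refl (popW refl ⨟ pushW ⨟ pushW)) w)))

 back-tree : ∀ t {a b c n σ} → Within back-loop ⟨ a , rcode t b , c ⟩ n σ →
             Within back-loop ⟨ a , b , code t c ⟩ (5 * size t + n) σ
 back-tree nil {n = n} w =
   weaken (≤-reflexive (leaf-cost 5 n)) (loopW refl (noW refl (popW refl ⨟ pushW)) w)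
 back-tree (cons s t) {n = n} w =
   weaken (≤-reflexive (node-cost 5 (size s) (size t) n))
     (loopW refl (yesW refl (popW refl ⨟ pushW)) (back-tree s (back-tree t w)))

 dup-run : ∀ t {a b} →
   Within dup ⟨ code t a , b , [] ⟩ (24 * size t + 9) ⟨ code t (code t a) , b , [] ⟩
 dup-run t = weaken (≤-reflexive (lem (size t)))
   (toB-run t ⨟ copy-tree t (stopW refl) ⨟ back-tree t (stopW refl) ⨟ fromB-run t)
   where
   lem : ∀ s → (7 * s + 5) + ((7 * s + 1) + ((5 * s + 1) + (5 * s + 2))) ≡ 24 * s + 9
   lem = solve-∀

 drop-tree : ∀ t {a b c n σ} → Within drop-loop ⟨ a , b , c ⟩ n σ →
             Within drop-loop ⟨ code t a , b , o ∷ c ⟩ (5 * size t + n) σ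
 drop-tree nil {n = n} w =
   weaken (≤-trans (n≤1+n _) (≤-reflexive (leaf-cost 5 n)))
     (loopW refl (noW refl (popW refl ⨟ popW refl)) w)
 drop-tree (cons s t) {n = n} w =
   weaken (≤-reflexive (node-cost 5 (size s) (size t) n))
     (loopW refl (yesW refl (popW refl ⨟ pushW)) (drop-tree s (drop-tree t w)))

 discard-run : ∀ t {a b} →
   Within discard ⟨ code t a , b , [] ⟩ (5 * size t + 3) ⟨ a , b , [] ⟩
 discard-run t = weaken (≤-reflexive (lem (size t))) (pushW ⨟ drop-tree t (stopW refl))
   where
   lem : ∀ s → 2 + (5 * s + 1) ≡ 5 * s + 3
   lem = solve-∀

 emit : Tree → Prog
 emit nil        = push A o
 emit (cons s t) = emit t ⨾ emit s ⨾ push A l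

 emit-run : ∀ t {a b c} → Within (emit t) ⟨ a , b , c ⟩ (2 * size t) ⟨ code t a , b , c ⟩
 emit-run nil = pushW
 emit-run (cons s t) = weaken (≤-reflexive (lem (size s) (size t)))
   (emit-run t ⨟ emit-run s ⨟ pushW)
   where
   lem : ∀ x y → 2 * y + (2 * x + 2) ≡ 2 * suc (x + y)
   lem = solve-∀

 volume : Store → ℕ
 volume ⟨ a , b , c ⟩ = length a + length b + length c

 put-volume : ∀ ρ a σ → volume (put ρ (a ∷ get ρ σ) σ) ≡ suc (volume σ)
 put-volume A s ⟨ a , b , c ⟩ = refl
 put-volume B s ⟨ a , b , c ⟩ = cong (_+ length c) (+-suc (length a) (length b))
 put-volume C s ⟨ a , b , c ⟩ = +-suc (length a + length b) (length c)

 pop-volume : ∀ ρ {a as} σ → get ρ σ ≡ a ∷ as → volume (put ρ as σ) ≤ volume σ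
 pop-volume A ⟨ a , b , c ⟩ refl = n≤1+n _
 pop-volume B ⟨ a , b , c ⟩ refl =
   +-monoˡ-≤ (length c) (+-monoʳ-≤ (length a) (n≤1+n _))
 pop-volume C ⟨ a , b , c ⟩ refl = +-monoʳ-≤ (length a + length b) (n≤1+n _)

 -- A step adds at most one symbol, so the size of a result is bounded by the time that produced it.
 -- Closure under composition rests on this.
 run-volume : ∀ {p σ t σ′} → Run p σ t σ′ → volume σ′ ≤ t + volume σ
 run-volume (push {ρ} {a} {σ}) = ≤-trans (≤-reflexive (put-volume ρ a σ)) (n≤1+n _)
 run-volume (pop {ρ} {σ = σ} e) = ≤-trans (pop-volume ρ σ e) (n≤1+n _)
 run-volume {σ = σ} (seq {t = t} {t′} r r′) = ≤-trans (run-volume r′)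
   (≤-trans (+-monoʳ-≤ t′ (run-volume r))
     (≤-reflexive (trans (sym (+-assoc t′ t _)) (cong (_+ volume σ) (+-comm t′ t)))))
 run-volume (then′ _ r) = ≤-trans (run-volume r) (n≤1+n _)
 run-volume (else′ _ r)  = ≤-trans (run-volume r) (n≤1+n _)
 run-volume (stop _)  = n≤1+n _
 run-volume {σ = σ} (loop {t = t} {t′} _ r r′) = ≤-trans (run-volume r′)
   (≤-trans (+-monoʳ-≤ t′ (run-volume r))
     (≤-trans (≤-reflexive (trans (sym (+-assoc t′ t _)) (cong (_+ volume σ) (+-comm t′ t))))
       (n≤1+n _)))

 length-code : ∀ t a → length (code t a) ≡ size t + length a
 length-code nil        a = refl
 length-code (cons s t) a = cong suc (trans (length-code s (code t a))
   (trans (cong (size s +_) (length-code t a)) (sym (+-assoc (size s) (size t) _))))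

 -- Powers of `2 + n` dominate polynomials by their exponent alone: as the base is at least 2, the
 -- constant `k` lies below the `k`-th power, and a sum of two bounds costs one more factor.
 record Poly (f : ℕ → ℕ) : Set where
   constructor poly
   field
     degree : ℕ
     bound  : ∀ n → f n ≤ (2 + n) ^ degree

 open Poly

 1≤pow : ∀ n d → 1 ≤ (2 + n) ^ d
 1≤pow n d = m^n>0 (2 + n) d

 2^-bound : ∀ k → k ≤ 2 ^ k
 2^-bound zero    = z≤n
 2^-bound (suc k) = begin
   suc k             ≤⟨ +-mono-≤ (m^n>0 2 k) (2^-bound k) ⟩
   2 ^ k + 2 ^ k     ≡⟨ cong (2 ^ k +_) (sym (+-identityʳ _)) ⟩
   2 ^ suc k         ∎
   where open ≤-Reasoning

 infixl 6 _+ᵖ_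
 infixl 7 _*ᵖ_

 opaque
   constᵖ : ∀ k → Poly (λ _ → k)
   constᵖ k = poly k (λ n → ≤-trans (2^-bound k) (^-monoˡ-≤ k (m≤m+n 2 n)))

   idᵖ : Poly (λ n → n)
   idᵖ = poly 1 (λ n → ≤-trans (m≤n+m n 2) (≤-reflexive (sym (^-identityʳ (2 + n)))))

   _+ᵖ_ : ∀ {f g} → Poly f → Poly g → Poly (λ n → f n + g n)
   poly d p +ᵖ poly e q = poly (suc (d + e)) λ n → begin
     _                                       ≤⟨ +-mono-≤ (p n) (q n) ⟩
     (2 + n) ^ d + (2 + n) ^ e
       ≤⟨ +-mono-≤ (^-monoʳ-≤ (2 + n) (m≤m+n d e)) (^-monoʳ-≤ (2 + n) (m≤n+m e d)) ⟩
     (2 + n) ^ (d + e) + (2 + n) ^ (d + e)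
       ≤⟨ +-monoʳ-≤ ((2 + n) ^ (d + e)) (m≤m+n _ _) ⟩
     (2 + n) * (2 + n) ^ (d + e)             ∎
     where open ≤-Reasoning

   _*ᵖ_ : ∀ {f g} → Poly f → Poly g → Poly (λ n → f n * g n)
   poly d p *ᵖ poly e q = poly (d + e) λ n →
     ≤-trans (*-mono-≤ (p n) (q n)) (≤-reflexive (sym (^-distribˡ-+-* (2 + n) d e)))

   -- The new base `2 + g n` has to be bounded by a power of `2 + n` again; two more factors swallow
   -- the summand 2.
   _∘ᵖ_ : ∀ {f g} → Poly f → Poly g → Poly (λ n → f (g n))
   _∘ᵖ_ {f} {g} (poly d p) (poly e q) = poly ((2 + e) * d) λ n → begin
     f (g n)                      ≤⟨ p (g n) ⟩
     (2 + g n) ^ d                ≤⟨ ^-monoˡ-≤ d (widen n) ⟩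
     ((2 + n) ^ (2 + e)) ^ d      ≡⟨ ^-*-assoc (2 + n) (2 + e) d ⟩
     (2 + n) ^ ((2 + e) * d)      ∎
     where
     open ≤-Reasoning
     widen : ∀ n → 2 + g n ≤ (2 + n) ^ (2 + e)
     widen n = begin
       2 + g n                                    ≤⟨ +-mono-≤ (*-monoʳ-≤ 2 (1≤pow n e)) (q n) ⟩
       2 * (2 + n) ^ e + (2 + n) ^ e              ≤⟨ +-monoʳ-≤ (2 * (2 + n) ^ e) (m≤m+n _ _) ⟩
       2 * (2 + n) ^ e + 2 * (2 + n) ^ e          ≡⟨ lem ((2 + n) ^ e) ⟩
       2 * (2 * (2 + n) ^ e)
         ≤⟨ *-mono-≤ (m≤m+n 2 n) (*-monoˡ-≤ ((2 + n) ^ e) (m≤m+n 2 n)) ⟩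
       (2 + n) * ((2 + n) * (2 + n) ^ e)          ∎
       where
       lem : ∀ x → 2 * x + 2 * x ≡ 2 * (2 * x)
       lem = solve-∀

   _^ᵖ : ∀ d → Poly (λ n → (2 + n) ^ d)
   d ^ᵖ = poly d λ n → ≤-refl

   atMost : ∀ {f g} → Poly g → (∀ n → f n ≤ g n) → Poly f
   atMost (poly d p) h = poly d λ n → ≤-trans (h n) (p n)

 record Enc (X : Set) : Set where
   field enc : X → Tree

 open Enc ⦃ ... ⦄ public

 instance
   encUnit : Enc ⊤
   encUnit .enc tt = nil

   encBool : Enc Bool
   encBool .enc false = nil
   encBool .enc true  = cons nil nil

   encℕ : Enc ℕ
   encℕ .enc = go
     where
     go : ℕ → Tree
     go zero    = nil
     go (suc n) = cons nil (go n)

   encPair : ∀ {X Y} → ⦃ Enc X ⦄ → ⦃ Enc Y ⦄ → Enc (X × Y)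
   encPair .enc (x , y) = cons (enc x) (enc y)

   encList : ∀ {X} → ⦃ Enc X ⦄ → Enc (List X)
   encList .enc = go
     where
     go : List _ → Tree
     go []       = nil
     go (x ∷ xs) = cons (enc x) (go xs)

 ⟪_⟫ : ∀ {X} → ⦃ Enc X ⦄ → X → ℕ
 ⟪ x ⟫ = size (enc x)

 -- The data `a` below the argument and the whole of B survive the run, so that programs can be
 -- executed on top of waiting data. C is empty between programs; inside them it is a counter or a
 -- buffer.
 record PT {X Y : Set} ⦃ _ : Enc X ⦄ ⦃ _ : Enc Y ⦄ (f : X → Y) : Set where
   constructor pt
   field
     program : Prog
     time    : ℕ
     runs    : ∀ x {a b} → Within program ⟨ code (enc x) a , b , [] ⟩
                 ((2 + ⟪ x ⟫) ^ time) ⟨ code (enc (f x)) a , b , [] ⟩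

 open PT

 module _ {X Y : Set} ⦃ _ : Enc X ⦄ ⦃ _ : Enc Y ⦄ where

   build : {f : X → Y} {t : ℕ → ℕ} (p : Prog) → Poly t →
           (∀ x {a b} → Within p ⟨ code (enc x) a , b , [] ⟩ (t ⟪ x ⟫)
                                 ⟨ code (enc (f x)) a , b , [] ⟩) → PT f
   build p (poly d h) r = pt p d λ x → weaken (h ⟪ x ⟫) (r x)

   grow : ℕ → ℕ → ℕ
   grow d n = (2 + n) ^ d + n

   growᵖ : ∀ d → Poly (grow d)
   growᵖ d = d ^ᵖ +ᵖ idᵖ

   output-size : {f : X → Y} (F : PT f) → ∀ x → ⟪ f x ⟫ ≤ grow (time F) ⟪ x ⟫
   output-size {f} F x with runs F x {[]} {[]}
   ... | t , t≤ , r = subst (λ z → ⟪ f x ⟫ ≤ (2 + ⟪ x ⟫) ^ time F + z) (len (enc x))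
     (≤-trans (≤-reflexive (sym (len (enc (f x)))))
       (≤-trans (run-volume r) (+-monoˡ-≤ _ t≤)))
     where
     len : ∀ t → length (code t []) + 0 + 0 ≡ size t
     len t = trans (+-identityʳ _) (trans (+-identityʳ _)
               (trans (length-code t []) (+-identityʳ _)))

 pow-mono : ∀ d {m n} → m ≤ n → (2 + m) ^ d ≤ (2 + n) ^ d
 pow-mono d h = ^-monoˡ-≤ d (+-monoʳ-≤ 2 h)

 module _ {X Y Z : Set} ⦃ _ : Enc X ⦄ ⦃ _ : Enc Y ⦄ ⦃ _ : Enc Z ⦄ where
  opaque

   infixr 9 _∘P_

   _∘P_ : {g : Y → Z} {f : X → Y} → PT g → PT f → PT (λ x → g (f x))
   _∘P_ {g} {f} G F = build (program F ⨾ program G)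
     (time F ^ᵖ +ᵖ ((time G ^ᵖ) ∘ᵖ growᵖ {X} {Y} (time F)))
     λ x → runs F x ⨟ weaken (pow-mono (time G) (output-size F x)) (runs G (f x))

   pairP : {f : X → Y} {g : X → Z} → PT f → PT g → PT (λ x → f x , g x)
   pairP {f} {g} F G = build (dup ⨾ program F ⨾ toB ⨾ program G ⨾ fromB ⨾ push A l)
     ((constᵖ 24 *ᵖ idᵖ +ᵖ constᵖ 9) +ᵖ (time F ^ᵖ +ᵖ ((constᵖ 7 *ᵖ sᵖ +ᵖ constᵖ 5) +ᵖ
       (time G ^ᵖ +ᵖ ((constᵖ 5 *ᵖ sᵖ +ᵖ constᵖ 2) +ᵖ constᵖ 2)))))
     λ x → dup-run (enc x) ⨟ runs F x
         ⨟ weaken (+-monoˡ-≤ 5 (*-monoʳ-≤ 7 (output-size F x))) (toB-run (enc (f x)))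
         ⨟ runs G x
         ⨟ weaken (+-monoˡ-≤ 2 (*-monoʳ-≤ 5 (output-size F x))) (fromB-run (enc (f x)))
         ⨟ pushW
     where
     sᵖ : Poly (grow {X} {Y} (time F))
     sᵖ = growᵖ {X} {Y} (time F)

 module _ {X : Set} ⦃ _ : Enc X ⦄ where
  opaque
   idP : PT {X} id
   idP = build (emit nil ⨾ discard) (constᵖ 10)
     λ x → weaken (s≤s (s≤s (s≤s (s≤s (s≤s (s≤s (s≤s (s≤s (s≤s (s≤s z≤n))))))))))
                  (emit-run nil ⨟ discard-run nil)

 module _ {X Y : Set} ⦃ _ : Enc X ⦄ ⦃ _ : Enc Y ⦄ where
  opaque

   ext : {f g : X → Y} → (∀ x → f x ≡ g x) → PT f → PT g
   ext e F = pt (program F) (time F) λ x {a} {b} →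
     subst (λ y → Within _ _ _ ⟨ code (enc y) a , b , [] ⟩) (e x) (runs F x)

   constP : (y : Y) → PT {X} (λ _ → y)
   constP y = build (discard ⨾ emit (enc y))
     ((constᵖ 5 *ᵖ idᵖ +ᵖ constᵖ 3) +ᵖ constᵖ (2 * ⟪ y ⟫))
     λ x → discard-run (enc x) ⨟ emit-run (enc y)

   fstP : PT {X × Y} proj₁
   fstP = build (pop A ⨾ toB ⨾ discard ⨾ fromB) (constᵖ 20 +ᵖ constᵖ 20 *ᵖ idᵖ) runs-fst
     where
     fst-eq : ∀ x y → 1 + ((7 * x + 5) + ((5 * y + 3) + (5 * x + 2))) + (29 + 8 * x + 15 * y)
              ≡ 20 + 20 * suc (x + y)
     fst-eq = solve-∀
     fst-cost : ∀ x y → 1 + ((7 * x + 5) + ((5 * y + 3) + (5 * x + 2))) ≤ 20 + 20 * suc (x + y)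
     fst-cost x y = ≤-trans (m≤m+n _ (29 + 8 * x + 15 * y)) (≤-reflexive (fst-eq x y))
     runs-fst : ∀ (z : X × Y) {a b} → Within (pop A ⨾ toB ⨾ discard ⨾ fromB) ⟨ code (enc z) a , b , [] ⟩
       (20 + 20 * ⟪ z ⟫) ⟨ code (enc (proj₁ z)) a , b , [] ⟩
     runs-fst (x , y) = weaken (fst-cost ⟪ x ⟫ ⟪ y ⟫)
       (popW refl ⨟ toB-run (enc x) ⨟ discard-run (enc y) ⨟ fromB-run (enc x))

   sndP : PT {X × Y} proj₂
   sndP = build (pop A ⨾ discard) (constᵖ 20 +ᵖ constᵖ 20 *ᵖ idᵖ) runs-snd
     where
     snd-eq : ∀ x y → 1 + (5 * x + 3) + (36 + 15 * x + 20 * y) ≡ 20 + 20 * suc (x + y)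
     snd-eq = solve-∀
     snd-cost : ∀ x y → 1 + (5 * x + 3) ≤ 20 + 20 * suc (x + y)
     snd-cost x y = ≤-trans (m≤m+n _ (36 + 15 * x + 20 * y)) (≤-reflexive (snd-eq x y))
     runs-snd : ∀ (z : X × Y) {a b} → Within (pop A ⨾ discard) ⟨ code (enc z) a , b , [] ⟩
       (20 + 20 * ⟪ z ⟫) ⟨ code (enc (proj₂ z)) a , b , [] ⟩
     runs-snd (x , y) = weaken (snd-cost ⟪ x ⟫ ⟪ y ⟫) (popW refl ⨟ discard-run (enc x))

   -- Two types may share encodings, as do ℕ and List ⊤.
   coerceP : ∀ {Z : Set} ⦃ _ : Enc Z ⦄ {f : X → Y} (g : X → Z) →
             (∀ x → enc (f x) ≡ enc (g x)) → PT f → PT g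
   coerceP g e F = pt (program F) (time F) λ x {a} {b} →
     subst (λ y → Within _ _ _ ⟨ code y a , b , [] ⟩) (e x) (runs F x)

 module _ {X Y : Set} ⦃ _ : Enc X ⦄ ⦃ _ : Enc Y ⦄ where
  opaque

   private
     true-cost : ∀ p q → 5 + p ≤ 10 + (p + q)
     true-cost p q = +-mono-≤ (m≤m+n 5 5) (m≤m+n p q)

     false-cost : ∀ p q → 3 + q ≤ 10 + (p + q)
     false-cost p q = +-mono-≤ (m≤m+n 3 7) (m≤n+m q p)

     choose : {f g : X → Y} → PT f → PT g →
              PT {Bool × X} (λ (b , x) → if b then f x else g x)
     choose {f} {g} F G = build
       (pop A ⨾ branch A isL (pop A ⨾ pop A ⨾ pop A ⨾ program F) (pop A ⨾ program G))
       (constᵖ 10 +ᵖ (time F ^ᵖ +ᵖ time G ^ᵖ)) runs-choose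
       where
       runs-choose : ∀ (x : Bool × X) {a b} → Within
         (pop A ⨾ branch A isL (pop A ⨾ pop A ⨾ pop A ⨾ program F) (pop A ⨾ program G))
          ⟨ code (enc x) a , b , [] ⟩
         (10 + ((2 + ⟪ x ⟫) ^ time F + (2 + ⟪ x ⟫) ^ time G))
         ⟨ code (enc (if proj₁ x then f (proj₂ x) else g (proj₂ x))) a , b , [] ⟩
       runs-choose (true , x) =
         weaken (true-cost ((2 + ⟪ (true , x) ⟫) ^ time F) ((2 + ⟪ (true , x) ⟫) ^ time G))
           (popW refl ⨟ yesW refl (popW refl ⨟ popW refl ⨟ popW refl ⨟
             weaken (pow-mono (time F) (m≤n+m ⟪ x ⟫ 4)) (runs F x)))
       runs-choose (false , x) =
         weaken (false-cost ((2 + ⟪ (false , x) ⟫) ^ time F) ((2 + ⟪ (false , x) ⟫) ^ time G))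
           (popW refl ⨟ noW refl (popW refl ⨟
             weaken (pow-mono (time G) (m≤n+m ⟪ x ⟫ 2)) (runs G x)))

   ifP : {c : X → Bool} {f g : X → Y} → PT c → PT f → PT g →
         PT (λ x → if c x then f x else g x)
   ifP c F G = choose F G ∘P pairP c idP

 module _ {X Y Z : Set} ⦃ _ : Enc X ⦄ ⦃ _ : Enc Y ⦄ ⦃ _ : Enc Z ⦄ where

   elim : (Z → Y) → (X → List X → Z → Y) → List X → Z → Y
   elim f g []       z = f z
   elim f g (x ∷ xs) z = g x xs z

   opaque
    private
     nil-cost : ∀ p q → 3 + p ≤ 10 + (p + q)
     nil-cost p q = +-mono-≤ (m≤m+n 3 7) (m≤m+n p q)

     cons-cost : ∀ p q → 4 + q ≤ 10 + (p + q)
     cons-cost p q = +-mono-≤ (m≤m+n 4 6) (m≤n+m q p)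

     choose : {f : Z → Y} {g : X → List X → Z → Y} → PT f →
              PT {(X × List X) × Z} (λ ((x , xs) , z) → g x xs z) →
              PT {List X × Z} (λ (xs , z) → elim f g xs z)
     choose {f} {g} F G = build
       (pop A ⨾ branch A isL (push A l ⨾ program G) (pop A ⨾ program F))
       (constᵖ 10 +ᵖ (time F ^ᵖ +ᵖ time G ^ᵖ)) runs-choose
       where
       runs-choose : ∀ (x : List X × Z) {a b} → Within
         (pop A ⨾ branch A isL (push A l ⨾ program G) (pop A ⨾ program F))
          ⟨ code (enc x) a , b , [] ⟩
         (10 + ((2 + ⟪ x ⟫) ^ time F + (2 + ⟪ x ⟫) ^ time G))
         ⟨ code (enc (elim f g (proj₁ x) (proj₂ x))) a , b , [] ⟩
       runs-choose (x ∷ xs , z) =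
         weaken (cons-cost ((2 + ⟪ (x ∷ xs , z) ⟫) ^ time F) ((2 + ⟪ (x ∷ xs , z) ⟫) ^ time G))
           (popW refl ⨟ yesW refl (pushW ⨟ runs G ((x , xs) , z)))
       runs-choose ([] , z) =
         weaken (nil-cost ((2 + (2 + ⟪ z ⟫)) ^ time F) ((2 + (2 + ⟪ z ⟫)) ^ time G))
           (popW refl ⨟ noW refl (popW refl ⨟
             weaken (pow-mono (time F) (m≤n+m ⟪ z ⟫ 2)) (runs F z)))

    elimP : {h : Z → List X} {f : Z → Y} {g : X → List X → Z → Y} → PT h → PT f →
            PT {(X × List X) × Z} (λ ((x , xs) , z) → g x xs z) →
            PT (λ z → elim f g (h z) z)
    elimP H F G = choose F G ∘P pairP H idP

 -- Loops over a list; the size of the state has to stay polynomial.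
 module _ {S X : Set} ⦃ _ : Enc S ⦄ ⦃ _ : Enc X ⦄ where

   private
     -- The list stays on A and the state is parked on B. Popping the cons symbol exposes the head
     -- of the list; with the state fetched above it, a single `l` makes both a pair, and the tail
     -- waits below.
     body : Prog → Prog
     body p = pop A ⨾ fromB ⨾ push A l ⨾ p ⨾ toB

     iterate : Prog → Prog
     iterate p = while A isL (body p)

     round-cost : ℕ → ℕ → ℕ
     round-cost d N = 30 + 12 * N + (3 + (N + N)) ^ d

     round-eq : ∀ N p → suc (1 + ((5 * N + 2) + (2 + (p + (7 * N + 5))))) + 19 ≡ 30 + 12 * N + p
     round-eq = solve-∀

     round-≤ : ∀ d {s x y N} → s ≤ N → x ≤ N → y ≤ N →
       suc (1 + ((5 * s + 2) + (2 + ((2 + suc (s + x)) ^ d + (7 * y + 5))))) ≤ round-cost d N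
     round-≤ d {s} {x} {y} {N} s≤ x≤ y≤ = begin
       suc (1 + ((5 * s + 2) + (2 + ((2 + suc (s + x)) ^ d + (7 * y + 5)))))
         ≤⟨ s≤s (s≤s (+-mono-≤ (+-monoˡ-≤ 2 (*-monoʳ-≤ 5 s≤)) (s≤s (s≤s (+-mono-≤
              (^-monoˡ-≤ d (+-monoʳ-≤ 3 (+-mono-≤ s≤ x≤))) (+-monoˡ-≤ 5 (*-monoʳ-≤ 7 y≤))))))) ⟩
       suc (1 + ((5 * N + 2) + (2 + ((3 + (N + N)) ^ d + (7 * N + 5)))))       ≤⟨ m≤m+n _ 19 ⟩
       suc (1 + ((5 * N + 2) + (2 + ((3 + (N + N)) ^ d + (7 * N + 5))))) + 19
         ≡⟨ round-eq N ((3 + (N + N)) ^ d) ⟩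
       round-cost d N                                                          ∎
       where open ≤-Reasoning

     iterate-run : ∀ {h : S → X → S} (H : PT {S × X} (λ (s , x) → h s x)) N xs s {a b} →
       (∀ ys zs → xs ≡ ys ++ zs → ⟪ foldl h s ys ⟫ ≤ N) → ⟪ xs ⟫ ≤ N →
       Within (iterate (program H)) ⟨ code (enc xs) a , rcode (enc s) (mark ∷ b) , [] ⟩
         (suc (length xs * round-cost (time H) N))
         ⟨ o ∷ a , rcode (enc (foldl h s xs)) (mark ∷ b) , [] ⟩
     iterate-run H N [] s small short = stopW refl
     iterate-run {h} H N (x ∷ xs) s {a} {b} small short =
       weaken (whole-cost (round-≤ (time H) s≤ x≤ hs≤)) (loopW refl one-round rest)
       where
       s≤ : ⟪ s ⟫ ≤ N
       s≤ = small [] (x ∷ xs) refl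
       hs≤ : ⟪ h s x ⟫ ≤ N
       hs≤ = small (x ∷ []) xs refl
       x≤ : ⟪ x ⟫ ≤ N
       x≤ = ≤-trans (≤-trans (m≤m+n ⟪ x ⟫ ⟪ xs ⟫) (n≤1+n _)) short
       one-round : Within (body (program H))
         ⟨ code (enc (x ∷ xs)) a , rcode (enc s) (mark ∷ b) , [] ⟩
         (1 + ((5 * ⟪ s ⟫ + 2) + (2 + ((2 + suc (⟪ s ⟫ + ⟪ x ⟫)) ^ time H + (7 * ⟪ h s x ⟫ + 5)))))
         ⟨ code (enc xs) a , rcode (enc (h s x)) (mark ∷ b) , [] ⟩
       one-round = popW refl ⨟ fromB-run (enc s) ⨟ pushW ⨟ runs H (s , x) ⨟ toB-run (enc (h s x))
       rest = iterate-run H N xs (h s x) {a} {b} (λ ys zs e → small (x ∷ ys) zs (cong (x ∷_) e))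
                (≤-trans (m≤n+m ⟪ xs ⟫ _) short)
       whole-cost : ∀ {r} → suc r ≤ round-cost (time H) N →
         suc (r + suc (length xs * round-cost (time H) N)) ≤
         suc (round-cost (time H) N + length xs * round-cost (time H) N)
       whole-cost {r} h = s≤s (≤-trans (≤-reflexive (+-suc r _))
         (+-monoˡ-≤ (length xs * round-cost (time H) N) h))

     length≤ : (xs : List X) → length xs ≤ ⟪ xs ⟫
     length≤ []       = z≤n
     length≤ (x ∷ xs) = s≤s (≤-trans (length≤ xs) (m≤n+m ⟪ xs ⟫ ⟪ x ⟫))

   module _ {G : Set} ⦃ _ : Enc G ⦄ where
    opaque
     loopP : {h : S → X → S} {init : G → S} {list : G → List X} →
       PT {S × X} (λ (s , x) → h s x) → PT init → PT list →
       {t : ℕ → ℕ} → Poly t →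
       (∀ g ys zs → list g ≡ ys ++ zs → ⟪ foldl h (init g) ys ⟫ ≤ t ⟪ g ⟫) →
       PT (λ g → foldl h (init g) (list g))
     loopP {h} {init} {list} H I L {t} tᵖ small = build loop-program
       (time (pairP I L) ^ᵖ +ᵖ (constᵖ 1 +ᵖ (toᵖ +ᵖ (itᵖ +ᵖ (constᵖ 1 +ᵖ fromᵖ))))) runs-loop
       where
       loop-program : Prog
       loop-program =
         program (pairP I L) ⨾ pop A ⨾ toB ⨾ iterate (program H) ⨾ pop A ⨾ fromB
       N : ℕ → ℕ
       N n = t n + grow {G} {List X} (time L) n
       Nᵖ : Poly N
       Nᵖ = tᵖ +ᵖ growᵖ {G} {List X} (time L)
       Cᵖ : Poly (λ n → round-cost (time H) (N n))
       Cᵖ = atMost ((constᵖ 30 +ᵖ constᵖ 12 *ᵖ Nᵖ) +ᵖ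
                    ((time H ^ᵖ) ∘ᵖ (constᵖ 1 +ᵖ (Nᵖ +ᵖ Nᵖ)))) (λ n → ≤-refl)
       to-time it-time from-time : ℕ → ℕ
       to-time n   = 7 * N n + 5
       it-time n   = suc (N n * round-cost (time H) (N n))
       from-time n = 5 * N n + 2
       toᵖ : Poly to-time
       toᵖ = atMost (constᵖ 7 *ᵖ Nᵖ +ᵖ constᵖ 5) (λ n → ≤-refl)
       itᵖ : Poly it-time
       itᵖ = atMost (constᵖ 1 +ᵖ Nᵖ *ᵖ Cᵖ) (λ n → ≤-refl)
       fromᵖ : Poly from-time
       fromᵖ = atMost (constᵖ 5 *ᵖ Nᵖ +ᵖ constᵖ 2) (λ n → ≤-refl)
       init≤ : ∀ g → ⟪ init g ⟫ ≤ N ⟪ g ⟫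
       init≤ g = ≤-trans (small g [] (list g) refl) (m≤m+n _ _)
       list≤ : ∀ g → ⟪ list g ⟫ ≤ N ⟪ g ⟫
       list≤ g = ≤-trans (output-size L g) (m≤n+m _ (t ⟪ g ⟫))
       final≤ : ∀ g → ⟪ foldl h (init g) (list g) ⟫ ≤ N ⟪ g ⟫
       final≤ g = ≤-trans (small g (list g) [] (sym (++-identityʳ (list g)))) (m≤m+n _ _)
       to-run : ∀ g {a b} → Within toB ⟨ code (enc (init g)) a , b , [] ⟩ (to-time ⟪ g ⟫)
                  ⟨ a , rcode (enc (init g)) (mark ∷ b) , [] ⟩
       to-run g = weaken (+-monoˡ-≤ 5 (*-monoʳ-≤ 7 (init≤ g))) (toB-run (enc (init g)))
       it-run : ∀ g {a b} → Within (iterate (program H))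
                  ⟨ code (enc (list g)) a , rcode (enc (init g)) (mark ∷ b) , [] ⟩ (it-time ⟪ g ⟫)
                  ⟨ o ∷ a , rcode (enc (foldl h (init g) (list g))) (mark ∷ b) , [] ⟩
       it-run g = weaken (s≤s (*-monoˡ-≤ (round-cost (time H) (N ⟪ g ⟫))
                      (≤-trans (length≤ (list g)) (list≤ g))))
             (iterate-run H (N ⟪ g ⟫) (list g) (init g)
               (λ ys zs e → ≤-trans (small g ys zs e) (m≤m+n (t ⟪ g ⟫) _)) (list≤ g))
       from-run : ∀ g {a b} → Within fromB
                    ⟨ a , rcode (enc (foldl h (init g) (list g))) (mark ∷ b) , [] ⟩ (from-time ⟪ g ⟫)
                    ⟨ code (enc (foldl h (init g) (list g))) a , b , [] ⟩
       from-run g = weaken (+-monoˡ-≤ 2 (*-monoʳ-≤ 5 (final≤ g)))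
                      (fromB-run (enc (foldl h (init g) (list g))))
       runs-loop : ∀ g {a b} → Within loop-program ⟨ code (enc g) a , b , [] ⟩
         ((2 + ⟪ g ⟫) ^ time (pairP I L) + (1 + (to-time ⟪ g ⟫ + (it-time ⟪ g ⟫ + (1 + from-time ⟪ g ⟫)))))
         ⟨ code (enc (foldl h (init g) (list g))) a , b , [] ⟩
       runs-loop g = within
         (runs (pairP I L) g ⨟ popW refl ⨟ to-run g ⨟ it-run g ⨟ popW refl ⨟ from-run g) ≤-refl

-- List programs and unary arithmetic in polynomial time

module PolytimeLists where

 open Polytime

 open PT
 open Poly

 ∑ : ∀ {X : Set} → List X → (X → ℕ) → ℕ
 ∑ []       f = 0
 ∑ (x ∷ xs) f = f x + ∑ xs f

 nth : ∀ {X : Set} → X → List X → ℕ → X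
 nth d []       i       = d
 nth d (x ∷ xs) zero    = x
 nth d (x ∷ xs) (suc i) = nth d xs i

 every : ∀ {X : Set} → (X → Bool) → List X → Bool
 every p []       = true
 every p (x ∷ xs) = p x ∧ every p xs

 take₁ : ∀ {X : Set} → List X → List X
 take₁ []      = []
 take₁ (x ∷ _) = x ∷ []

 module _ {X : Set} ⦃ _ : Enc X ⦄ where

   size-++ : (xs ys : List X) → suc ⟪ xs ++ ys ⟫ ≡ ⟪ xs ⟫ + ⟪ ys ⟫
   size-++ []       ys = refl
   size-++ (x ∷ xs) ys = cong suc (trans (sym (+-suc ⟪ x ⟫ _))
     (trans (cong (⟪ x ⟫ +_) (size-++ xs ys)) (sym (+-assoc ⟪ x ⟫ ⟪ xs ⟫ ⟪ ys ⟫))))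

   1≤size : (x : X) → 1 ≤ ⟪ x ⟫
   1≤size x with enc x
   ... | nil      = s≤s z≤n
   ... | cons _ _ = s≤s z≤n

   size-++≤ : (xs ys : List X) → ⟪ xs ++ ys ⟫ ≤ ⟪ xs ⟫ + ⟪ ys ⟫
   size-++≤ xs ys = ≤-trans (n≤1+n _) (≤-reflexive (size-++ xs ys))

   size-prefix : (xs ys : List X) → ⟪ xs ⟫ ≤ ⟪ xs ++ ys ⟫
   size-prefix []       ys = 1≤size′ ys
     where
     1≤size′ : (ys : List X) → 1 ≤ ⟪ ys ⟫
     1≤size′ []      = s≤s z≤n
     1≤size′ (_ ∷ _) = s≤s z≤n
   size-prefix (x ∷ xs) ys = s≤s (+-monoʳ-≤ ⟪ x ⟫ (size-prefix xs ys))

   size-suffix : (xs ys : List X) → ⟪ ys ⟫ ≤ ⟪ xs ++ ys ⟫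
   size-suffix []       ys = ≤-refl
   size-suffix (x ∷ xs) ys =
     ≤-trans (size-suffix xs ys) (≤-trans (m≤n+m _ ⟪ x ⟫) (n≤1+n _))

   length≤size : (xs : List X) → length xs ≤ ⟪ xs ⟫
   length≤size []       = z≤n
   length≤size (x ∷ xs) = s≤s (≤-trans (length≤size xs) (m≤n+m ⟪ xs ⟫ ⟪ x ⟫))

   size-reverse-onto : (ys s : List X) → suc ⟪ foldl (flip _∷_) s ys ⟫ ≡ ⟪ s ⟫ + ⟪ ys ⟫
   size-reverse-onto []       s = +-comm 1 ⟪ s ⟫
   size-reverse-onto (y ∷ ys) s = trans (size-reverse-onto ys (y ∷ s)) (lem ⟪ s ⟫ ⟪ y ⟫ ⟪ ys ⟫)
     where
     lem : ∀ s y t → suc (y + s) + t ≡ s + suc (y + t)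
     lem = solve-∀

   size-filter : (p : X → Bool) (xs : List X) → ⟪ filterᵇ p xs ⟫ ≤ ⟪ xs ⟫
   size-filter p [] = ≤-refl
   size-filter p (x ∷ xs) with p x
   ... | true  = s≤s (+-monoʳ-≤ ⟪ x ⟫ (size-filter p xs))
   ... | false = ≤-trans (size-filter p xs) (≤-trans (m≤n+m _ ⟪ x ⟫) (n≤1+n _))

   size-take₁ : (xs : List X) → ⟪ take₁ xs ⟫ ≤ ⟪ xs ⟫
   size-take₁ []       = ≤-refl
   size-take₁ (x ∷ xs) = s≤s (+-monoʳ-≤ ⟪ x ⟫ (size-prefix [] xs))

   size-const-list : ∀ b (xs : List X) → (∀ ys x zs → xs ≡ ys ++ x ∷ zs → ⟪ x ⟫ ≤ b) →
                     ⟪ xs ⟫ ≤ suc (length xs * suc b)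
   size-const-list b []       h = s≤s z≤n
   size-const-list b (x ∷ xs) h = s≤s (≤-trans
     (+-mono-≤ (h [] x xs refl) (size-const-list b xs λ ys z zs e → h (x ∷ ys) z zs (cong (x ∷_) e)))
     (≤-reflexive (+-suc b (length xs * suc b))))

 sizeℕ : ∀ n → ⟪ n ⟫ ≡ suc (n + n)
 sizeℕ zero    = refl
 sizeℕ (suc n) = cong suc (cong suc (trans (sizeℕ n) (sym (+-suc n n))))

 v0 : ∀ {X Y : Set} ⦃ _ : Enc X ⦄ ⦃ _ : Enc Y ⦄ → PT {X × Y} proj₁
 v0 = fstP

 w1 : ∀ {X Y : Set} ⦃ _ : Enc X ⦄ ⦃ _ : Enc Y ⦄ → PT {X × Y} proj₂
 w1 = sndP

 module _ {X Y Z : Set} ⦃ _ : Enc X ⦄ ⦃ _ : Enc Y ⦄ ⦃ _ : Enc Z ⦄ where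
   v1 : PT {X × Y × Z} (λ g → proj₁ (proj₂ g))
   v1 = fstP ∘P sndP

   w2 : PT {X × Y × Z} (λ g → proj₂ (proj₂ g))
   w2 = sndP ∘P sndP

 module _ {X Y Z U : Set} ⦃ _ : Enc X ⦄ ⦃ _ : Enc Y ⦄ ⦃ _ : Enc Z ⦄ ⦃ _ : Enc U ⦄ where
   v2 : PT {X × Y × Z × U} (λ g → proj₁ (proj₂ (proj₂ g)))
   v2 = fstP ∘P w2

   w3 : PT {X × Y × Z × U} (λ g → proj₂ (proj₂ (proj₂ g)))
   w3 = sndP ∘P w2

 module _ {G X : Set} ⦃ _ : Enc G ⦄ ⦃ _ : Enc X ⦄ where
  opaque

   nilP : PT {G} {List X} (λ _ → [])
   nilP = constP []

   consP : {x : G → X} {xs : G → List X} → PT x → PT xs → PT (λ g → x g ∷ xs g)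
   consP X XS = coerceP _ (λ _ → refl) (pairP X XS)

   reverseP : {xs : G → List X} → PT xs → PT (λ g → reverse (xs g))
   reverseP {xs} XS = loopP
     (coerceP (λ (s , x) → x ∷ s) (λ _ → refl) (pairP sndP fstP)) nilP XS
     (growᵖ {G} {List X} (time XS))
     λ g ys zs e → ≤-pred (≤-trans (≤-reflexive (size-reverse-onto ys []))
       (s≤s (≤-trans (size-prefix ys zs)
         (≤-trans (≤-reflexive (cong ⟪_⟫ (sym e))) (output-size XS g)))))

 module _ {G S X : Set} ⦃ _ : Enc G ⦄ ⦃ _ : Enc S ⦄ ⦃ _ : Enc X ⦄ where

   private
     -- The parameters `g` of a loop travel in its state, where the body can reach them.
     carry : (S × X × G → S) → S × G → X → S × G
     carry f (s , g) x = f (s , x , g) , g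

     foldl-carry : ∀ f s g xs →
       foldl (carry f) (s , g) xs ≡ (foldl (λ s x → f (s , x , g)) s xs , g)
     foldl-carry f s g []       = refl
     foldl-carry f s g (x ∷ xs) = foldl-carry f (f (s , x , g)) g xs

   opaque
     foldlP : {f : S × X × G → S} {init : G → S} {list : G → List X} →
       PT f → PT init → PT list → {t : ℕ → ℕ} → Poly t →
       (∀ g ys zs → list g ≡ ys ++ zs →
         ⟪ foldl (λ s x → f (s , x , g)) (init g) ys ⟫ ≤ t ⟪ g ⟫) →
       PT (λ g → foldl (λ s x → f (s , x , g)) (init g) (list g))
     foldlP {f} {init} {list} F I L {t} tᵖ small =
       ext (λ g → cong proj₁ (foldl-carry f (init g) g (list g)))
         (fstP ∘P loopP {h = carry f}
           (pairP (F ∘P pairP (fstP ∘P fstP) (pairP sndP (sndP ∘P fstP))) (sndP ∘P fstP))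
           (pairP I idP) L {λ n → suc (t n + n)} (atMost (constᵖ 1 +ᵖ (tᵖ +ᵖ idᵖ)) (λ n → ≤-refl))
           λ g ys zs e → subst (λ z → ⟪ z ⟫ ≤ suc (t ⟪ g ⟫ + ⟪ g ⟫))
             (sym (foldl-carry f (init g) g ys)) (s≤s (+-monoˡ-≤ ⟪ g ⟫ (small g ys zs e))))

     foldrP : {f : X × S × G → S} {init : G → S} {list : G → List X} →
       PT f → PT init → PT list → {t : ℕ → ℕ} → Poly t →
       (∀ g ys zs → list g ≡ ys ++ zs →
         ⟪ foldr (λ x s → f (x , s , g)) (init g) zs ⟫ ≤ t ⟪ g ⟫) →
       PT (λ g → foldr (λ x s → f (x , s , g)) (init g) (list g))
     foldrP {f} {init} {list} F I L {t} tᵖ small =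
       ext (λ g → trans (sym (reverse-foldr _ (init g) (reverse (list g))))
                        (cong (foldr (λ x s → f (x , s , g)) (init g)) (reverse-involutive (list g))))
         (foldlP {f = λ (s , x , g) → f (x , s , g)} (F ∘P pairP v1 (pairP v0 w2)) I (reverseP L) tᵖ
           λ g ys zs e → subst (λ z → ⟪ z ⟫ ≤ t ⟪ g ⟫) (reverse-foldr _ (init g) ys)
             (small g (reverse zs) (reverse ys)
               (trans (sym (reverse-involutive (list g))) (trans (cong reverse e) (reverse-++ ys zs)))))

   private
     -- If the amount added in a round does not depend on the state, growth is additive and stays
     -- polynomial, whereas growth by a factor would compound. This covers most of the loops of the
     -- algorithm.
     accumulated : (f : S × X × G → S) (q : ℕ → ℕ) (d : ℕ) → (∀ n → q n ≤ (2 + n) ^ d) →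
       (∀ s x g → ⟪ f (s , x , g) ⟫ ≤ ⟪ s ⟫ + q ⟪ (x , g) ⟫) → ∀ g N s ys → ⟪ ys ⟫ ≤ N →
       ⟪ foldl (λ s x → f (s , x , g)) s ys ⟫ ≤ ⟪ s ⟫ + length ys * (2 + (1 + (N + ⟪ g ⟫))) ^ d
     accumulated f q d q≤ h g N s [] l≤ = m≤m+n _ _
     accumulated f q d q≤ h g N s (x ∷ ys) l≤ = begin
       ⟪ foldl (λ s x → f (s , x , g)) (f (s , x , g)) ys ⟫
         ≤⟨ accumulated f q d q≤ h g N (f (s , x , g)) ys (≤-trans (m≤n+m _ _) l≤) ⟩
       ⟪ f (s , x , g) ⟫ + length ys * c
         ≤⟨ +-monoˡ-≤ _ (h s x g) ⟩
       ⟪ s ⟫ + q ⟪ (x , g) ⟫ + length ys * c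
         ≤⟨ +-monoˡ-≤ (length ys * c) (+-monoʳ-≤ ⟪ s ⟫ (≤-trans (q≤ _)
              (^-monoˡ-≤ d (+-monoʳ-≤ 3 (+-monoˡ-≤ ⟪ g ⟫
                (≤-trans (≤-trans (m≤m+n ⟪ x ⟫ ⟪ ys ⟫) (n≤1+n _)) l≤)))))) ⟩
       ⟪ s ⟫ + c + length ys * c      ≡⟨ +-assoc ⟪ s ⟫ c _ ⟩
       ⟪ s ⟫ + (c + length ys * c)    ∎
       where
       open ≤-Reasoning
       c : ℕ
       c = (2 + (1 + (N + ⟪ g ⟫))) ^ d

   opaque
     foldlP⁺ : {f : S × X × G → S} {init : G → S} {list : G → List X} →
       PT f → PT init → PT list → {q : ℕ → ℕ} → Poly q →
       (∀ s x g → ⟪ f (s , x , g) ⟫ ≤ ⟪ s ⟫ + q ⟪ (x , g) ⟫) →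
       PT (λ g → foldl (λ s x → f (s , x , g)) (init g) (list g))
     foldlP⁺ {f} {init} {list} F I L {q} (poly d q≤) h =
       foldlP F I L {λ n → iᵇ n + lᵇ n * (2 + (1 + (lᵇ n + n))) ^ d}
         (atMost (iᵖ +ᵖ lᵖ *ᵖ ((d ^ᵖ) ∘ᵖ (constᵖ 1 +ᵖ (lᵖ +ᵖ idᵖ)))) (λ n → ≤-refl))
         λ g ys zs e → ≤-trans
           (accumulated f q d q≤ h g (lᵇ ⟪ g ⟫) (init g) ys (≤-trans (size-prefix ys zs)
             (≤-trans (≤-reflexive (cong ⟪_⟫ (sym e))) (output-size L g))))
           (+-mono-≤ (output-size I g) (*-monoˡ-≤ _
             (≤-trans (length≤size ys) (≤-trans (size-prefix ys zs)
               (≤-trans (≤-reflexive (cong ⟪_⟫ (sym e))) (output-size L g))))))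
       where
       iᵇ lᵇ : ℕ → ℕ
       iᵇ = grow {G} {S} (time I)
       lᵇ = grow {G} {List X} (time L)
       iᵖ : Poly iᵇ
       iᵖ = growᵖ {G} {S} (time I)
       lᵖ : Poly lᵇ
       lᵖ = growᵖ {G} {List X} (time L)

     foldrP⁺ : {f : X × S × G → S} {init : G → S} {list : G → List X} →
       PT f → PT init → PT list → {q : ℕ → ℕ} → Poly q →
       (∀ s x g → ⟪ f (x , s , g) ⟫ ≤ ⟪ s ⟫ + q ⟪ (x , g) ⟫) →
       PT (λ g → foldr (λ x s → f (x , s , g)) (init g) (list g))
     foldrP⁺ {f} {init} {list} F I L q h =
       ext (λ g → trans (sym (reverse-foldr _ (init g) (reverse (list g))))
                        (cong (foldr (λ x s → f (x , s , g)) (init g)) (reverse-involutive (list g))))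
         (foldlP⁺ {f = λ (s , x , g) → f (x , s , g)} (F ∘P pairP v1 (pairP v0 w2)) I (reverseP L) q h)

 module _ {G X : Set} ⦃ _ : Enc G ⦄ ⦃ _ : Enc X ⦄ where

  opaque

   appendP : {xs ys : G → List X} → PT xs → PT ys → PT (λ g → xs g ++ ys g)
   appendP {xs} {ys} XS YS =
     ext (λ g → sym (++-is-foldr (xs g) (ys g)))
       (foldrP {f = λ (x , s , g) → x ∷ s} (consP v0 v1) YS XS
         (growᵖ {G} {List X} (time XS) +ᵖ growᵖ {G} {List X} (time YS))
         λ g us vs e → ≤-trans (≤-reflexive (cong ⟪_⟫ (sym (++-is-foldr vs (ys g)))))
           (≤-trans (size-++≤ vs (ys g)) (+-mono-≤
             (≤-trans (size-suffix us vs) (≤-trans (≤-reflexive (cong ⟪_⟫ (sym e))) (output-size XS g)))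
             (output-size YS g))))

 module _ {G X Y : Set} ⦃ _ : Enc G ⦄ ⦃ _ : Enc X ⦄ ⦃ _ : Enc Y ⦄ where

  private
   join-all : (f : X × G → List Y) → G → List X → List Y
   join-all f g = foldr (λ x s → f (x , g) ++ s) []

   join-all-concatMap : ∀ f g xs → join-all f g xs ≡ concatMap (λ x → f (x , g)) xs
   join-all-concatMap f g []       = refl
   join-all-concatMap f g (x ∷ xs) = cong (f (x , g) ++_) (join-all-concatMap f g xs)

  opaque
   concatMapP : {f : X × G → List Y} {xs : G → List X} → PT f → PT xs →
                PT (λ g → concatMap (λ x → f (x , g)) (xs g))
   concatMapP {f} {xs} F XS =
     ext (λ g → join-all-concatMap f g (xs g))
       (foldrP⁺ {f = λ (x , s , g) → f (x , g) ++ s} (appendP (F ∘P pairP v0 w2) v1) nilP XS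
         (growᵖ {X × G} {List Y} (time F))
         λ s x g → ≤-trans (size-++≤ (f (x , g)) s)
           (≤-trans (≤-reflexive (+-comm _ ⟪ s ⟫)) (+-monoʳ-≤ ⟪ s ⟫ (output-size F (x , g)))))

  opaque
   mapP : {f : X × G → Y} {xs : G → List X} → PT f → PT xs →
          PT (λ g → map (λ x → f (x , g)) (xs g))
   mapP {f} {xs} F XS = ext (λ g → singles g (xs g)) (concatMapP (consP F nilP) XS)
     where
     singles : ∀ g xs → concatMap (λ x → f (x , g) ∷ []) xs ≡ map (λ x → f (x , g)) xs
     singles g []       = refl
     singles g (x ∷ xs) = cong (f (x , g) ∷_) (singles g xs)

 module _ {G X : Set} ⦃ _ : Enc G ⦄ ⦃ _ : Enc X ⦄ where

  opaque
   filterP : {p : X × G → Bool} {xs : G → List X} → PT p → PT xs →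
             PT (λ g → filterᵇ (λ x → p (x , g)) (xs g))
   filterP {p} {xs} P XS = ext (λ g → select g (xs g)) (concatMapP (ifP P (consP v0 nilP) nilP) XS)
     where
     select : ∀ g xs → concatMap (λ x → if p (x , g) then x ∷ [] else []) xs
                     ≡ filterᵇ (λ x → p (x , g)) xs
     select g [] = refl
     select g (x ∷ xs) with p (x , g)
     ... | true  = cong (x ∷_) (select g xs)
     ... | false = select g xs

   take₁P : {xs : G → List X} → PT xs → PT (λ g → take₁ (xs g))
   take₁P {xs} XS = ext (λ g → lem (xs g) g) (elimP {h = xs} {f = λ _ → []} {g = λ x _ _ → x ∷ []} XS nilP
                      (consP (fstP ∘P fstP) nilP))
     where
     lem : ∀ (xs : List X) (g : G) → elim (λ _ → []) (λ x _ _ → x ∷ []) xs g ≡ take₁ xs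
     lem []      g = refl
     lem (_ ∷ _) g = refl

   nullP : {xs : G → List X} → PT xs → PT (λ g → null (xs g))
   nullP {xs} XS = ext (λ g → lem (xs g) g) (elimP {h = xs} {f = λ _ → true} {g = λ _ _ _ → false} XS
                     (constP true) (constP false))
     where
     lem : ∀ (xs : List X) (g : G) → elim (λ _ → true) (λ _ _ _ → false) xs g ≡ null xs
     lem []      g = refl
     lem (_ ∷ _) g = refl

 module _ {G : Set} ⦃ _ : Enc G ⦄ where

  units-enc : ∀ n → enc n ≡ enc (replicate n tt)
  units-enc zero    = refl
  units-enc (suc n) = cong (cons nil) (units-enc n)

  length-enc : ∀ (us : List ⊤) → enc us ≡ enc (length us)
  length-enc []       = refl
  length-enc (_ ∷ us) = cong (cons nil) (length-enc us)

  opaque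
   notP : {p : G → Bool} → PT p → PT (λ g → not (p g))
   notP {p} P = ext (λ g → lem (p g)) (ifP P (constP false) (constP true))
     where
     lem : ∀ b → (if b then false else true) ≡ not b
     lem false = refl
     lem true  = refl

   andP : {p q : G → Bool} → PT p → PT q → PT (λ g → p g ∧ q g)
   andP {p} {q} P Q = ext (λ g → lem (p g)) (ifP P Q (constP false))
     where
     lem : ∀ b {c} → (if b then c else false) ≡ b ∧ c
     lem false = refl
     lem true  = refl

   orP : {p q : G → Bool} → PT p → PT q → PT (λ g → p g ∨ q g)
   orP {p} {q} P Q = ext (λ g → lem (p g)) (ifP P (constP true) Q)
     where
     lem : ∀ b {c} → (if b then true else c) ≡ b ∨ c
     lem false = refl
     lem true  = refl

   unitsP : {m : G → ℕ} → PT m → PT (λ g → replicate (m g) tt)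
   unitsP {m} M = coerceP _ (λ g → units-enc (m g)) M

   countP : {us : G → List ⊤} → PT us → PT (λ g → length (us g))
   countP {us} U = coerceP _ (λ g → length-enc (us g)) U

   sucP : {m : G → ℕ} → PT m → PT (λ g → suc (m g))
   sucP M = coerceP _ (λ _ → refl) (pairP (constP tt) M)

  opaque
   predP : {m : G → ℕ} → PT m → PT (λ g → pred (m g))
   predP {m} M = ext (λ g → lem (m g) g)
     (countP (elimP {h = λ g → replicate (m g) tt} {f = λ _ → []} {g = λ _ us _ → us}
       (unitsP M) nilP (sndP ∘P fstP)))
     where
     lem : ∀ m (g : G) → length (elim (λ _ → []) (λ _ us _ → us) (replicate m tt) g) ≡ pred m
     lem zero    g = refl
     lem (suc m) g = length-replicate m

  opaque
   plusP : {m n : G → ℕ} → PT m → PT n → PT (λ g → m g + n g)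
   plusP {m} {n} M N = ext
     (λ g → trans (length-++ (replicate (m g) tt)) (cong₂ _+_ (length-replicate (m g)) (length-replicate (n g))))
     (countP (appendP (unitsP M) (unitsP N)))

 module _ {G X : Set} ⦃ _ : Enc G ⦄ ⦃ _ : Enc X ⦄ where

  opaque
   sumP : {f : X × G → ℕ} {xs : G → List X} → PT f → PT xs → PT (λ g → ∑ (xs g) (λ x → f (x , g)))
   sumP {f} {xs} F XS = ext (λ g → lem g (xs g)) (countP (concatMapP (unitsP F) XS))
     where
     lem : ∀ g xs → length (concatMap (λ x → replicate (f (x , g)) tt) xs) ≡ ∑ xs (λ x → f (x , g))
     lem g []       = refl
     lem g (x ∷ xs) = trans (length-++ (replicate (f (x , g)) tt))
       (cong₂ _+_ (length-replicate (f (x , g))) (lem g xs))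

  opaque
   lengthP : {xs : G → List X} → PT xs → PT (λ g → length (xs g))
   lengthP {xs} XS = ext (λ g → lem (xs g)) (sumP {f = λ _ → 1} (constP 1) XS)
     where
     lem : (xs : List X) → ∑ xs (λ _ → 1) ≡ length xs
     lem []       = refl
     lem (x ∷ xs) = cong suc (lem xs)

   everyP : {p : X × G → Bool} {xs : G → List X} → PT p → PT xs →
            PT (λ g → every (λ x → p (x , g)) (xs g))
   everyP {p} {xs} P XS = ext (λ g → lem g (xs g)) (nullP (filterP (notP P) XS))
     where
     lem : ∀ g xs → null (filterᵇ (λ x → not (p (x , g))) xs) ≡ every (λ x → p (x , g)) xs
     lem g [] = refl
     lem g (x ∷ xs) with p (x , g)
     ... | true  = lem g xs
     ... | false = refl

 module _ {G : Set} ⦃ _ : Enc G ⦄ where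

  opaque
   timesP : {m n : G → ℕ} → PT m → PT n → PT (λ g → m g * n g)
   timesP {m} {n} M N = ext (λ g → lem (m g) (n g)) (sumP {f = λ (_ , g) → n g} (N ∘P sndP) (unitsP M))
     where
     lem : ∀ m n → ∑ (replicate m tt) (λ _ → n) ≡ m * n
     lem zero    n = refl
     lem (suc m) n = cong (n +_) (lem m n)

   monusP : {m n : G → ℕ} → PT m → PT n → PT (λ g → m g ∸ n g)
   monusP {m} {n} M N = ext (λ g → lem (m g) (n g))
     (foldlP {f = λ (s , _ , _) → pred s} (predP fstP) M (unitsP N) (growᵖ {G} {ℕ} (time M))
       λ g ys zs e → ≤-trans (shrink (m g) ys) (output-size M g))
     where
     lem : ∀ m n → foldl (λ s _ → pred s) m (replicate n tt) ≡ m ∸ n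
     lem m zero          = refl
     lem zero (suc n)    = trans (lem zero n) (0∸n≡0 n)
     lem (suc m) (suc n) = lem m n
     size-pred : ∀ m → ⟪ pred m ⟫ ≤ ⟪ m ⟫
     size-pred zero    = ≤-refl
     size-pred (suc m) = m≤n+m ⟪ m ⟫ 2
     shrink : ∀ m (ys : List ⊤) → ⟪ foldl (λ s _ → pred s) m ys ⟫ ≤ ⟪ m ⟫
     shrink m []       = ≤-refl
     shrink m (_ ∷ ys) = ≤-trans (shrink (pred m) ys) (size-pred m)

  opaque
   leP : {m n : G → ℕ} → PT m → PT n → PT (λ g → m g ≤ᵇ n g)
   leP {m} {n} M N = ext (λ g → lem (m g) (n g)) (nullP (unitsP (monusP M N)))
     where
     lem : ∀ m n → null (replicate (m ∸ n) tt) ≡ (m ≤ᵇ n)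
     lem zero          zero    = refl
     lem zero          (suc n) = refl
     lem (suc m)       zero    = refl
     lem (suc zero)    (suc n) = trans (cong (λ z → null (replicate z tt)) (0∸n≡0 n)) refl
     lem (suc (suc m)) (suc n) = lem (suc m) n

  opaque
   ltP : {m n : G → ℕ} → PT m → PT n → PT (λ g → m g <ᵇ n g)
   ltP M N = leP (sucP M) N

   eqP : {m n : G → ℕ} → PT m → PT n → PT (λ g → m g ≡ᵇ n g)
   eqP {m} {n} M N = ext (λ g → lem (m g) (n g)) (andP (leP M N) (leP N M))
     where
     lem : ∀ m n → (m ≤ᵇ n) ∧ (n ≤ᵇ m) ≡ (m ≡ᵇ n)
     lem zero          zero          = refl
     lem zero          (suc n)       = refl
     lem (suc m)       zero          = refl
     lem (suc zero)    (suc zero)    = refl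
     lem (suc zero)    (suc (suc n)) = refl
     lem (suc (suc m)) (suc zero)    = refl
     lem (suc (suc m)) (suc (suc n)) = lem (suc m) (suc n)

   downFromP : {m : G → ℕ} → PT m → PT (λ g → downFrom (m g))
   downFromP {m} M = ext (λ g → trans (lem (replicate (m g) tt)) (cong downFrom (length-replicate (m g))))
     (foldrP {f = λ (_ , s , _) → length s ∷ s} (consP (lengthP v1) v1) nilP (unitsP M)
       {λ n → suc (mᵇ n * suc (suc (mᵇ n + mᵇ n)))}
       (atMost (constᵖ 1 +ᵖ mᵖ *ᵖ (constᵖ 2 +ᵖ (mᵖ +ᵖ mᵖ))) (λ n → ≤-refl))
       λ g ys zs e → ≤-trans (≤-reflexive (cong ⟪_⟫ (lem zs)))
         (≤-trans (size-down (length zs)) (s≤s (square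
           (≤-trans (≤-trans (m≤n+m (length zs) (length ys))
              (≤-reflexive (trans (sym (length-++ ys)) (trans (cong length (sym e)) (length-replicate (m g))))))
              (≤-trans (≤-trans (m≤m+n (m g) (m g)) (n≤1+n _))
                (≤-trans (≤-reflexive (sym (sizeℕ (m g)))) (output-size M g))))))))
     where
     mᵇ : ℕ → ℕ
     mᵇ = grow {G} {ℕ} (time M)
     mᵖ : Poly mᵇ
     mᵖ = growᵖ {G} {ℕ} (time M)
     lem : (us : List ⊤) → foldr (λ _ s → length s ∷ s) [] us ≡ downFrom (length us)
     lem []       = refl
     lem (_ ∷ us) rewrite lem us = cong (_∷ downFrom (length us)) (length-downFrom (length us))
     square : ∀ {x y} → x ≤ y → x * suc (suc (x + x)) ≤ y * suc (suc (y + y))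
     square h = *-mono-≤ h (s≤s (s≤s (+-mono-≤ h h)))
     size-down : ∀ n → ⟪ downFrom n ⟫ ≤ suc (n * suc (suc (n + n)))
     size-down zero = s≤s z≤n
     size-down (suc n) = s≤s (≤-trans
       (+-mono-≤ (≤-reflexive (sizeℕ n)) (size-down n))
       (≤-trans (m≤m+n _ (2 + n * 2)) (≤-reflexive (eq n))))
       where
       eq : ∀ n → suc (n + n) + suc (n * suc (suc (n + n))) + (2 + n * 2)
            ≡ suc n * suc (suc (suc n + suc n))
       eq = solve-∀

 module _ {G X : Set} ⦃ _ : Enc G ⦄ ⦃ _ : Enc X ⦄ where

  private
   tail : List X → List X
   tail []       = []
   tail (_ ∷ xs) = xs

  opaque
   private
    tail-stateP : PT {List X × ⊤ × G} (λ (s , _ , _) → tail s)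
    tail-stateP = ext (λ g → lem (proj₁ g) g) (elimP {h = proj₁} {f = λ _ → []} {g = λ _ us _ → us} fstP nilP
                      (sndP ∘P fstP))
     where
     lem : ∀ (xs : List X) (g : List X × ⊤ × G) → elim (λ _ → []) (λ _ us _ → us) xs g ≡ tail xs
     lem []      g = refl
     lem (_ ∷ _) g = refl

   nthP : {d : G → X} {xs : G → List X} {i : G → ℕ} → PT d → PT xs → PT i →
          PT (λ g → nth (d g) (xs g) (i g))
   nthP {d} {xs} {i} D XS I = ext (λ g → lem (d g) (xs g) (i g) g refl)
     (elimP {h = λ g → foldl (λ s _ → tail s) (xs g) (replicate (i g) tt)}
       {f = d} {g = λ x _ _ → x}
       (foldlP {f = λ (s , _ , _) → tail s} tail-stateP XS (unitsP I) (growᵖ {G} {List X} (time XS))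
         λ g ys zs e → ≤-trans (shrink (xs g) ys) (output-size XS g))
       D (fstP ∘P fstP))
     where
     shrink : ∀ xs (ys : List ⊤) → ⟪ foldl (λ s _ → tail s) xs ys ⟫ ≤ ⟪ xs ⟫
     shrink xs       []       = ≤-refl
     shrink []       (_ ∷ ys) = shrink [] ys
     shrink (x ∷ xs) (_ ∷ ys) = ≤-trans (shrink xs ys) (≤-trans (m≤n+m _ ⟪ x ⟫) (n≤1+n _))
     tails : ∀ i → foldl (λ s _ → tail s) [] (replicate i tt) ≡ []
     tails zero    = refl
     tails (suc i) = tails i
     lem : ∀ y xs i g → d g ≡ y →
           elim d (λ x _ _ → x) (foldl (λ s _ → tail s) xs (replicate i tt)) g ≡ nth y xs i
     lem y [] i g e rewrite tails i = e
     lem y (x ∷ xs) zero g e = refl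
     lem y (x ∷ xs) (suc i) g e = lem y xs i g e

-- The approximation algorithm

module Algorithm where

 open PolytimeLists

 δ : Bool → ℕ
 δ b = if b then 1 else 0

 _⊗_ : ∀ {X Y : Set} → List X → List Y → List (X × Y)
 xs ⊗ ys = concatMap (λ x → map (x ,_) ys) xs

 infixr 6 _⊗_

 member : ℕ → List ℕ → Bool
 member v xs = not (every (λ x → not (x ≡ᵇ v)) xs)

 occurrences : ℕ → List ℕ → ℕ
 occurrences v xs = ∑ xs (λ x → δ (x ≡ᵇ v))

 module Perceptron {Row Col : Set} (rows : List Row) (cols : List Col)
                   (pos neg : Row → Col → ℕ) (pos₀ neg₀ : Row → ℕ) where

   -- The constraints are ∑ y (pos ρ) + pos₀ ρ ≤ ∑ y (neg ρ) + neg₀ ρ for a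
   -- list y of columns; after t rounds they are summed up.
   excess : ℕ → List Col → Row → ℕ
   excess t h ρ = (∑ h (pos ρ) + t * pos₀ ρ) ∸ (∑ h (neg ρ) + t * neg₀ ρ)

   -- The excesses, taken as weights, merge all constraints into one inequality. A column is
   -- selected if its coefficient there is favourable, so that `play` adds the best choice among all
   -- subsets of the columns.
   improving : ℕ → List Col → Col → Bool
   improving t h c = ∑ rows (λ ρ → excess t h ρ * pos ρ c)
                  <ᵇ ∑ rows (λ ρ → excess t h ρ * neg ρ c)

   play : ℕ × List Col → ℕ × List Col
   play (t , h) = suc t , filterᵇ (improving t h) cols ++ h

   plays : ℕ → ℕ × List Col
   plays T = foldl (λ s _ → play s) (0 , []) (replicate T tt)

 greedy : ∀ {X : Set} → (List X → X → Bool) → List X → ℕ → List X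
 greedy ok xs T = foldl (λ h _ → take₁ (filterᵇ (ok h) xs) ++ h) [] (replicate T tt)

 -- The test for a single occurrence always succeeds on a tour. It makes the list grow by at most
 -- one vertex on any input, as the bound on the running time demands.
 insert : List ℕ → ℕ × ℕ → List ℕ
 insert xs (u , v) =
   if occurrences u xs ≡ᵇ 1
   then concatMap (λ x → if x ≡ᵇ u then x ∷ v ∷ [] else x ∷ []) xs
   else xs

 -- Vertices are numbered from 0 to n, where 0 is the depot; r is the
 -- regret in units of R / M, rounded up and capped at suc M, but
 -- r 0 v = suc M is the price of a new path.
 module Core (n M : ℕ) (r : ℕ → ℕ → ℕ) (rank : ℕ → ℕ) where

   us vs : List ℕ
   us = downFrom (suc n)
   vs = map suc (downFrom n)

   -- The price of leaving a tour at `u` for `v` and returning to `u`.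
   ω : ℕ → ℕ → ℕ
   ω u v = r u v + r v u

   before : ℕ → ℕ → Bool
   before u v = rank u <ᵇ rank v

   Col Row : Set
   Col = ℕ × ℕ × ℕ
   Row = ℕ × ℕ × ℕ × ℕ

   -- The linear program.  (0 , u , v) is the flow on the arc from u to v,
   -- (1 , a , b) the amount of the tree edge from a to b, and
   -- (suc v , a , b) the part of it that connects v to a vertex of
   -- smaller rank.
   opaque
     cols : List Col
     cols = downFrom (2 + n) ⊗ us ⊗ us

     cols-≡ : cols ≡ downFrom (2 + n) ⊗ us ⊗ us
     cols-≡ = refl

     rows : List Row
     rows = map (λ v → 0 , v , 0 , 0) vs
         ++ (1 , 0 , 0 , 0) ∷ (2 , 0 , 0 , 0)
         ∷ map (3 ,_) (vs ⊗ us ⊗ us)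
         ++ map (λ (v , a) → 4 , v , a , 0) (filterᵇ (λ (v , a) → rank v ≤ᵇ rank a) (vs ⊗ vs))

     rows-≡ : rows ≡ map (λ v → 0 , v , 0 , 0) vs
         ++ (1 , 0 , 0 , 0) ∷ (2 , 0 , 0 , 0)
         ∷ map (3 ,_) (vs ⊗ us ⊗ us)
         ++ map (λ (v , a) → 4 , v , a , 0) (filterᵇ (λ (v , a) → rank v ≤ᵇ rank a) (vs ⊗ vs))
     rows-≡ = refl

   -- The kinds of rows: 0, flow is not created at a customer, though it may vanish; 1 and 2, the
   -- budgets of the flow and of the tree; 3, a commodity uses only tree edges that are bought; 4,
   -- the commodity of `v` is conserved at every `a` whose rank is not smaller, with supply 1 minus
   -- the inflow at `v` itself. Vertices of smaller rank than `v` are sinks, as they have no row of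
   -- this kind.
   pos neg : Row → Col → ℕ
   pos (0 , v , a , b) (t , x , y) = δ ((t ≡ᵇ 0) ∧ (x ≡ᵇ v) ∧ before x y)
   pos (1 , v , a , b) (t , x , y) = if (t ≡ᵇ 0) ∧ before x y then r x y else 0
   pos (2 , v , a , b) (t , x , y) = if t ≡ᵇ 1 then ω x y else 0
   pos (3 , v , a , b) (t , x , y) = δ ((t ≡ᵇ suc v) ∧ (x ≡ᵇ a) ∧ (y ≡ᵇ b))
   pos (_ , v , a , b) (t , x , y) = δ ((t ≡ᵇ suc v) ∧ (y ≡ᵇ a))

   enters : ℕ → Col → ℕ
   enters v (t , x , y) = δ ((t ≡ᵇ 0) ∧ (y ≡ᵇ v) ∧ before x y)

   neg (0 , v , a , b) c           = enters v c
   neg (1 , v , a , b) c           = 0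
   neg (2 , v , a , b) c           = 0
   neg (3 , v , a , b) (t , x , y) = δ ((t ≡ᵇ 1) ∧ (x ≡ᵇ a) ∧ (y ≡ᵇ b))
   neg (_ , v , a , b) (t , x , y) =
     δ ((t ≡ᵇ suc v) ∧ (x ≡ᵇ a)) + (if v ≡ᵇ a then enters v (t , x , y) else 0)

   pos₀ : Row → ℕ
   pos₀ (0 , _)         = 0
   pos₀ (1 , _)         = 0
   pos₀ (2 , _)         = 0
   pos₀ (3 , _)         = 0
   pos₀ (_ , v , a , _) = δ (v ≡ᵇ a)

   module Guess (k : ℕ) where

     -- What `k` paths need. The flow pays `M + 1` to start a path and `M` for its detour; the tree
     -- pays `M` per path forth and twice as much back. Rounding up adds at most one unit per
     -- customer in either direction.
     flow-budget tree-budget : ℕ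
     flow-budget = k * suc (M + M) + n
     tree-budget = 3 * (k * M) + 2 * n

     neg₀ : Row → ℕ
     neg₀ (1 , _) = flow-budget
     neg₀ (2 , _) = tree-budget
     neg₀ _       = 0

     open Perceptron rows cols pos neg pos₀ neg₀ public

     opaque
       -- Bounds either side of a constraint even if all the columns are taken; it enters the growth
       -- of the potential.
       width : ℕ
       width = length cols * (2 * suc M) + (flow-budget + tree-budget) + 1

       width-≡ : width ≡ length cols * (2 * suc M) + (flow-budget + tree-budget) + 1
       width-≡ = refl

       -- Covers two errors: the `n * suc M` of the duality argument, and the error `40 * (N * N)`
       -- of a cut, with `N = suc n`, which may consume one part in 110 of the flow across it.
       precision : ℕ
       precision = 400 * (suc n * suc n) * suc M

       precision-≡ : precision ≡ 400 * (suc n * suc n) * suc M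
       precision-≡ = refl

     opaque
       -- After `t` rounds the squares of the excesses sum to at most `t` times the growth per
       -- round, so that an excess is of the order of the square root of `t`. This number of rounds
       -- makes it at most the fraction `1 / precision` of `t`.
       rounds : ℕ
       rounds = precision * precision * (length rows * (2 * (width * width)))

       rounds-≡ : rounds ≡ precision * precision * (length rows * (2 * (width * width)))
       rounds-≡ = refl

     history : List Col
     history = proj₂ (plays rounds)

     chosen : ℕ → Bool
     chosen v = 9 * rounds ≤ᵇ 20 * ∑ history (enters v)

   -- The chosen vertices ws are covered by chains, by means of an auction in
   -- which each of them bids for its predecessor.
   module Round (ws : List ℕ) where

     -- The list of all bids, the latest first, is the state of the auction: a bid raises the price
     -- of its item by one and takes the item from its owner. The default 0 means that nobody has
     -- bid.
     price owner : List (ℕ × ℕ) → ℕ → ℕ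
     price h u = ∑ h (λ e → δ (proj₂ e ≡ᵇ u))
     owner h u = nth 0 (map proj₁ (filterᵇ (λ e → proj₂ e ≡ᵇ u) h)) 0

     free : List (ℕ × ℕ) → ℕ → Bool
     free h v = every (λ u → not (owner h u ≡ᵇ v)) ws

     -- The alternative to buying a predecessor is a new path at the price `suc M`, so offers stop
     -- at `M`.
     bid : List (ℕ × ℕ) → ℕ × ℕ → Bool
     bid h (v , u) = before u v ∧ free h v ∧ (r u v + price h u ≤ᵇ M) ∧
       every (λ u′ → not (before u′ v) ∨ (r u v + price h u ≤ᵇ r u′ v + price h u′)) ws

     opaque
       bids : List (ℕ × ℕ)
       -- No price exceeds `suc M`, so there are at most `n * suc M` bids; with one further round
       -- the auction ends when nobody is willing to bid.
       bids = greedy bid (ws ⊗ ws) (n * suc M + 1)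

     -- A vertex that owns nothing gets the default 0, the depot: a new path starts with it.
     predecessor : ℕ → ℕ
     predecessor v = nth 0 (filterᵇ (λ u → owner bids u ≡ᵇ v) ws) 0

     inTree : List (ℕ × ℕ) → ℕ → Bool
     inTree h v = (v ≡ᵇ 0) ∨ member v ws ∨ member v (map proj₂ h)

     crossing : List (ℕ × ℕ) → ℕ × ℕ → Bool
     crossing h (u , v) = inTree h u ∧ not (inTree h v)

     -- Prim's rule: a cheapest edge from the tree, to which the depot and the chosen vertices
     -- belong from the start, to a vertex outside.
     link : List (ℕ × ℕ) → ℕ × ℕ → Bool
     link h (u , v) = crossing h (u , v) ∧
       every (λ e → not (crossing h e) ∨ (ω u v ≤ᵇ ω (proj₁ e) (proj₂ e))) (us ⊗ vs)

     opaque
       links : List (ℕ × ℕ)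
       links = greedy link (us ⊗ vs) n

     -- Increasing rank guarantees that a predecessor is in the tour when its successor is inserted.
     sorted : List ℕ
     sorted = concatMap (λ i → filterᵇ (λ v → rank v ≡ᵇ i) ws) (reverse (downFrom (suc n)))

     tour : List ℕ
     -- `links` has the latest edge first; in the reversed order the source of an edge is present
     -- when its target is inserted.
     tour = foldl insert (0 ∷ []) (map (λ v → predecessor v , v) sorted ++ reverse links)

     -- The length of each piece is kept, and its first vertex.
     Piece : Set
     Piece = ℕ × ℕ × List ℕ

     extend : ℕ → List Piece → List Piece
     extend x []                 = (0 , x , x ∷ []) ∷ []
     extend x ((c , y , p) ∷ ps) =
       if c + r x y ≤ᵇ M then (c + r x y , x , x ∷ p) ∷ ps
       else (0 , x , x ∷ []) ∷ (c , y , p) ∷ ps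

     cut : ℕ → List Piece → List Piece
     cut x ps = if x ≡ᵇ 0 then ps else extend x ps

     pieces : List (List ℕ)
     pieces = map (λ p → proj₂ (proj₂ p)) (foldr cut [] tour)

   opaque
     attempt : ℕ → List (List ℕ)
     attempt k = Round.pieces (filterᵇ (Guess.chosen k) vs)

     attempt-≡ : ∀ k → attempt k ≡ Round.pieces (filterᵇ (Guess.chosen k) vs)
     attempt-≡ k = refl

   -- Like every attempt, `attempt 0` is feasible; the optimum is therefore at most its length and
   -- among the guesses.
   attempts : List (List (List ℕ))
   attempts = map attempt (downFrom (suc (length (attempt 0))))

   opaque
     best : List (List ℕ)
     best = nth [] (filterᵇ (λ S → every (λ S′ → length S ≤ᵇ length S′) attempts) attempts) 0

     best-≡ : best ≡ nth [] (filterᵇ (λ S → every (λ S′ → length S ≤ᵇ length S′) attempts) attempts) 0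
     best-≡ = refl

-- The algorithm runs in polynomial time

module AlgorithmPolytime where

 open Polytime
 open PolytimeLists
 open Algorithm

 open PT
 open Poly

 grow-mono : ∀ d {m n} → m ≤ n → (2 + m) ^ d + m ≤ (2 + n) ^ d + n
 grow-mono d h = +-mono-≤ (pow-mono d h) h

 size-snd : ∀ {X Y : Set} ⦃ _ : Enc X ⦄ ⦃ _ : Enc Y ⦄ (x : X) (y : Y) → ⟪ y ⟫ ≤ ⟪ (x , y) ⟫
 size-snd x y = ≤-trans (m≤n+m ⟪ y ⟫ ⟪ x ⟫) (n≤1+n _)

 δP : ∀ {G : Set} ⦃ _ : Enc G ⦄ {b : G → Bool} → PT b → PT (λ g → δ (b g))
 δP b = ifP b (constP 1) (constP 0)

 module _ {G : Set} ⦃ _ : Enc G ⦄ where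

  opaque
   memberP : {v : G → ℕ} {xs : G → List ℕ} → PT v → PT xs → PT (λ g → member (v g) (xs g))
   memberP V XS = notP (everyP (notP (eqP v0 (V ∘P sndP))) XS)

   occurrencesP : {v : G → ℕ} {xs : G → List ℕ} → PT v → PT xs →
                  PT (λ g → occurrences (v g) (xs g))
   occurrencesP V XS = sumP (δP (eqP v0 (V ∘P sndP))) XS

 module _ {G X Y : Set} ⦃ _ : Enc G ⦄ ⦃ _ : Enc X ⦄ ⦃ _ : Enc Y ⦄ where
  opaque
   productP : {xs : G → List X} {ys : G → List Y} → PT xs → PT ys → PT (λ g → xs g ⊗ ys g)
   productP {xs} {ys} XS YS =
     concatMapP {f = λ (x , g) → map (x ,_) (ys g)} {xs = xs}
       (mapP {f = λ (y , x , g) → x , y} (pairP v1 v0) (YS ∘P sndP)) XS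

 module _ {G X : Set} ⦃ _ : Enc G ⦄ ⦃ _ : Enc X ⦄ where

  opaque
   greedyP : {ok : G → List X → X → Bool} {xs : G → List X} {T : G → ℕ} →
     PT {X × List X × G} (λ (x , h , g) → ok g h x) → PT xs → PT T →
     PT (λ g → greedy (ok g) (xs g) (T g))
   greedyP {ok} {xs} OK XS TP = foldlP⁺
     {f = λ (h , _ , g) → take₁ (filterᵇ (ok g h) (xs g)) ++ h}
     (appendP (take₁P (filterP {p = λ (x , h , _ , g) → ok g h x}
                 (OK ∘P pairP v0 (pairP v1 w3)) (XS ∘P w2))) v0)
     nilP (unitsP TP) (growᵖ {G} {List X} (time XS))
     λ h u g → ≤-trans (size-++≤ (take₁ (filterᵇ (ok g h) (xs g))) h)
       (≤-trans (≤-reflexive (+-comm _ ⟪ h ⟫)) (+-monoʳ-≤ ⟪ h ⟫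
         (≤-trans (size-take₁ (filterᵇ (ok g h) (xs g)))
           (≤-trans (size-filter (ok g h) (xs g))
             (≤-trans (output-size XS g) (grow-mono (time XS) (size-snd u g)))))))

 module _ {X Y : Set} ⦃ _ : Enc X ⦄ ⦃ _ : Enc Y ⦄ where
   by-cases : {f g : X → Y} → PT f → (∀ x → f x ≡ g x) → PT g
   by-cases F e = ext e F

 module PerceptronP {G Row Col : Set} ⦃ _ : Enc G ⦄ ⦃ _ : Enc Row ⦄ ⦃ _ : Enc Col ⦄
   {rows : G → List Row} {cols : G → List Col} {pos neg : G → Row → Col → ℕ}
   {pos₀ neg₀ : G → Row → ℕ} (rowsP : PT rows) (colsP : PT cols)
   (posP : PT {Row × Col × G} (λ (ρ , c , g) → pos g ρ c))
   (negP : PT {Row × Col × G} (λ (ρ , c , g) → neg g ρ c))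
   (pos₀P : PT {Row × G} (λ (ρ , g) → pos₀ g ρ))
   (neg₀P : PT {Row × G} (λ (ρ , g) → neg₀ g ρ)) where

   module L (g : G) = Perceptron (rows g) (cols g) (pos g) (neg g) (pos₀ g) (neg₀ g)

   opaque
     excessP : PT {Row × (ℕ × List Col) × G} (λ (ρ , (t , h) , g) → L.excess g t h ρ)
     excessP = monusP
       (plusP (sumP {f = λ (c , ρ , _ , g) → pos g ρ c} (posP ∘P pairP v1 (pairP v0 w3)) (sndP ∘P v1))
              (timesP (fstP ∘P v1) (pos₀P ∘P pairP v0 w2)))
       (plusP (sumP {f = λ (c , ρ , _ , g) → neg g ρ c} (negP ∘P pairP v1 (pairP v0 w3)) (sndP ∘P v1))
              (timesP (fstP ∘P v1) (neg₀P ∘P pairP v0 w2)))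

   opaque
     improvingP : PT {Col × (ℕ × List Col) × G} (λ (c , (t , h) , g) → L.improving g t h c)
     improvingP = ltP
       (sumP {f = λ (ρ , c , (t , h) , g) → L.excess g t h ρ * pos g ρ c}
         (timesP (excessP ∘P pairP v0 (pairP v2 w3)) (posP ∘P pairP v0 (pairP v1 w3))) (rowsP ∘P w2))
       (sumP {f = λ (ρ , c , (t , h) , g) → L.excess g t h ρ * neg g ρ c}
         (timesP (excessP ∘P pairP v0 (pairP v2 w3)) (negP ∘P pairP v0 (pairP v1 w3))) (rowsP ∘P w2))

   opaque
     playsP : {T : G → ℕ} → PT T → PT (λ g → L.plays g (T g))
     playsP TP = foldlP⁺ {f = λ (s , _ , g) → L.play g s}
       (pairP (sucP (fstP ∘P v0))
         (appendP (filterP {p = λ (c , s , _ , g) → L.improving g (proj₁ s) (proj₂ s) c}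
           (improvingP ∘P pairP v0 (pairP v1 w3)) (colsP ∘P w2)) (sndP ∘P v0)))
       (pairP (constP 0) nilP) (unitsP TP)
       (constᵖ 2 +ᵖ growᵖ {G} {List Col} (time colsP))
       λ (t , h) u g → ≤-trans
         (s≤s (s≤s (s≤s (+-monoʳ-≤ ⟪ t ⟫ (≤-trans (size-++≤ (filterᵇ (L.improving g t h) (cols g)) h)
           (+-monoˡ-≤ ⟪ h ⟫ (≤-trans (size-filter (L.improving g t h) (cols g))
             (≤-trans (output-size colsP g) (grow-mono (time colsP) (size-snd u g))))))))))
         (≤-reflexive (lem ⟪ t ⟫ ⟪ h ⟫ _))
       where
       lem : ∀ t h c → 3 + (t + (c + h)) ≡ suc (t + h) + (2 + c)
       lem = solve-∀

 module CoreP {I : Set} ⦃ _ : Enc I ⦄ {n M : I → ℕ} {r : I → ℕ → ℕ → ℕ} {rank : I → ℕ → ℕ}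
   (nP : PT n) (MP : PT M) (rP : PT {ℕ × ℕ × I} (λ (u , v , i) → r i u v))
   (rankP : PT {ℕ × I} (λ (v , i) → rank i v)) where

   module C (i : I) = Core (n i) (M i) (r i) (rank i)

   Col Row : Set
   Col = ℕ × ℕ × ℕ
   Row = ℕ × ℕ × ℕ × ℕ

   opaque
     usP : PT (λ i → C.us i)
     usP = downFromP (sucP nP)

     vsP : PT (λ i → C.vs i)
     vsP = mapP {f = λ (x , _) → suc x} (sucP fstP) (downFromP nP)

   module _ {G : Set} ⦃ _ : Enc G ⦄ {i : G → I} {u v : G → ℕ} where
    opaque
     beforeP : PT u → PT v → PT i → PT (λ g → C.before (i g) (u g) (v g))
     beforeP U V J = ltP (rankP ∘P pairP U J) (rankP ∘P pairP V J)

     ωP : PT u → PT v → PT i → PT (λ g → C.ω (i g) (u g) (v g))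
     ωP U V J = plusP (rP ∘P pairP U (pairP V J)) (rP ∘P pairP V (pairP U J))

   opaque
     colsP : PT (λ i → C.cols i)
     colsP = ext (λ i → sym (C.cols-≡ i)) (productP (downFromP (sucP (sucP nP))) (productP usP usP))

     rowsP : PT (λ i → C.rows i)
     rowsP = ext (λ i → sym (C.rows-≡ i)) (appendP (mapP {f = λ (v , _) → 0 , v , 0 , 0} (pairP (constP 0) (pairP v0 (constP (0 , 0)))) vsP)
       (consP (constP (1 , 0 , 0 , 0)) (consP (constP (2 , 0 , 0 , 0))
         (appendP (mapP {f = λ (x , _) → 3 , x} (pairP (constP 3) v0) (productP vsP (productP usP usP)))
           (mapP {f = λ ((v , a) , _) → 4 , v , a , 0}
             (pairP (constP 4) (pairP (fstP ∘P v0) (pairP (sndP ∘P v0) (constP 0))))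
             (filterP {p = λ ((v , a) , i) → rank i v ≤ᵇ rank i a}
               (leP (rankP ∘P pairP (fstP ∘P v0) w1) (rankP ∘P pairP (sndP ∘P v0) w1))
               (productP vsP vsP)))))))

   private
     Entry : Set
     Entry = Row × Col × I
     row-v : PT {Entry} (λ ((_ , v , _) , _) → v)
     row-v = v1 ∘P v0
     row-a : PT {Entry} (λ ((_ , _ , a , _) , _) → a)
     row-a = v2 ∘P v0
     row-b : PT {Entry} (λ ((_ , _ , _ , b) , _) → b)
     row-b = w3 ∘P v0
     col-t : PT {Entry} (λ (_ , (t , _) , _) → t)
     col-t = v0 ∘P v1
     col-x : PT {Entry} (λ (_ , (_ , x , _) , _) → x)
     col-x = v1 ∘P v1
     col-y : PT {Entry} (λ (_ , (_ , _ , y) , _) → y)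
     col-y = w2 ∘P v1
     tag-is : ∀ m → PT {Entry} (λ ((s , _) , _) → s ≡ᵇ m)
     tag-is m = eqP (v0 ∘P v0) (constP m)
     flow-arc : PT {Entry} (λ (_ , (_ , x , y) , i) → C.before i x y)
     flow-arc = beforeP col-x col-y w2

   opaque
     posP : PT {Row × Col × I} (λ (ρ , c , i) → C.pos i ρ c)
     posP = by-cases
       (ifP (tag-is 0) (δP (andP (eqP col-t (constP 0)) (andP (eqP col-x row-v) flow-arc)))
       (ifP (tag-is 1) (ifP (andP (eqP col-t (constP 0)) flow-arc) (rP ∘P pairP col-x (pairP col-y w2)) (constP 0))
       (ifP (tag-is 2) (ifP (eqP col-t (constP 1)) (ωP col-x col-y w2) (constP 0))
       (ifP (tag-is 3) (δP (andP (eqP col-t (sucP row-v)) (andP (eqP col-x row-a) (eqP col-y row-b))))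
         (δP (andP (eqP col-t (sucP row-v)) (eqP col-y row-a))))))) λ where
         ((0 , _) , _) → refl
         ((1 , _) , _) → refl
         ((2 , _) , _) → refl
         ((3 , _) , _) → refl
         ((suc (suc (suc (suc _))) , _) , _) → refl

     entersP : PT {ℕ × Col × I} (λ (v , c , i) → C.enters i v c)
     entersP = δP (andP (eqP (v0 ∘P v1) (constP 0)) (andP (eqP (w2 ∘P v1) v0)
                 (beforeP (v1 ∘P v1) (w2 ∘P v1) w2)))

   opaque
     negP : PT {Row × Col × I} (λ (ρ , c , i) → C.neg i ρ c)
     negP = by-cases
       (ifP (tag-is 0) (entersP ∘P pairP row-v w1)
       (ifP (tag-is 1) (constP 0)
       (ifP (tag-is 2) (constP 0)
       (ifP (tag-is 3) (δP (andP (eqP col-t (constP 1)) (andP (eqP col-x row-a) (eqP col-y row-b))))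
         (plusP (δP (andP (eqP col-t (sucP row-v)) (eqP col-x row-a)))
                (ifP (eqP row-v row-a) (entersP ∘P pairP row-v w1) (constP 0))))))) λ where
         ((0 , _) , _) → refl
         ((1 , _) , _) → refl
         ((2 , _) , _) → refl
         ((3 , _) , _) → refl
         ((suc (suc (suc (suc _))) , _) , _) → refl

     pos₀P : PT {Row × I} (λ (ρ , i) → C.pos₀ i ρ)
     pos₀P = by-cases (ifP (leP (v0 ∘P v0) (constP 3)) (constP 0) (δP (eqP (v1 ∘P v0) (v2 ∘P v0)))) λ where
         ((0 , _) , _) → refl
         ((1 , _) , _) → refl
         ((2 , _) , _) → refl
         ((3 , _) , _) → refl
         ((suc (suc (suc (suc _))) , _) , _) → refl

   J : Set
   J = ℕ × I

   module Q (j : J) = C.Guess (proj₂ j) (proj₁ j)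

   opaque
     flow-budgetP : PT (λ j → Q.flow-budget j)
     flow-budgetP = plusP (timesP v0 (sucP (plusP (MP ∘P w1) (MP ∘P w1)))) (nP ∘P w1)

     tree-budgetP : PT (λ j → Q.tree-budget j)
     tree-budgetP = plusP (timesP (constP 3) (timesP v0 (MP ∘P w1))) (timesP (constP 2) (nP ∘P w1))

   opaque
     neg₀P : PT {Row × J} (λ (ρ , j) → Q.neg₀ j ρ)
     neg₀P = by-cases (ifP (eqP (v0 ∘P v0) (constP 1)) (flow-budgetP ∘P w1)
                    (ifP (eqP (v0 ∘P v0) (constP 2)) (tree-budgetP ∘P w1) (constP 0))) λ where
         ((0 , _) , _) → refl
         ((1 , _) , _) → refl
         ((2 , _) , _) → refl
         ((suc (suc (suc _)) , _) , _) → refl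

     widthP : PT (λ j → Q.width j)
     widthP = ext (λ j → sym (Q.width-≡ j)) (plusP (plusP (timesP (lengthP (colsP ∘P w1)) (timesP (constP 2) (sucP (MP ∘P w1))))
                           (plusP flow-budgetP tree-budgetP)) (constP 1))

     precisionP : PT (λ j → Q.precision j)
     precisionP = ext (λ j → sym (Q.precision-≡ j))
       (timesP (timesP (constP 400) (timesP (sucP (nP ∘P w1)) (sucP (nP ∘P w1)))) (sucP (MP ∘P w1)))

   opaque
     roundsP : PT (λ j → Q.rounds j)
     roundsP = ext (λ j → sym (Q.rounds-≡ j)) (timesP (timesP precisionP precisionP)
       (timesP (lengthP (rowsP ∘P w1)) (timesP (constP 2) (timesP widthP widthP))))

   module PP = PerceptronP {G = J} (rowsP ∘P w1) (colsP ∘P w1)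
     (posP ∘P pairP v0 (pairP v1 w3)) (negP ∘P pairP v0 (pairP v1 w3)) (pos₀P ∘P pairP v0 w2) neg₀P

   opaque
     historyP : PT (λ j → Q.history j)
     historyP = sndP ∘P PP.playsP roundsP

   opaque
     chosenP : PT {ℕ × J} (λ (v , j) → Q.chosen j v)
     chosenP = leP (timesP (constP 9) (roundsP ∘P w1)) (timesP (constP 20)
       (sumP {f = λ (c , v , j) → C.enters (proj₂ j) v c} (entersP ∘P pairP v1 (pairP v0 w3)) (historyP ∘P w1)))

   K : Set
   K = List ℕ × I

   module Rd (κ : K) = C.Round (proj₂ κ) (proj₁ κ)

   private
     Bids : Set
     Bids = List (ℕ × ℕ)

   opaque
     priceP : PT {ℕ × Bids × K} (λ (u , h , κ) → Rd.price κ h u)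
     priceP = sumP {f = λ (e , u , _) → δ (proj₂ e ≡ᵇ u)} (δP (eqP (sndP ∘P v0) v1)) v1

     ownerP : PT {ℕ × Bids × K} (λ (u , h , κ) → Rd.owner κ h u)
     ownerP = nthP (constP 0) (mapP {f = λ (e , _) → proj₁ e} (fstP ∘P v0)
       (filterP {p = λ (e , u , _) → proj₂ e ≡ᵇ u} (eqP (sndP ∘P v0) v1) v1)) (constP 0)

   opaque
     freeP : PT {ℕ × Bids × K} (λ (v , h , κ) → Rd.free κ h v)
     freeP = everyP {p = λ (u , v , h , κ) → not (Rd.owner κ h u ≡ᵇ v)}
       (notP (eqP (ownerP ∘P pairP v0 w2) v1)) (v0 ∘P w2)

   private
     offerP : PT {ℕ × (ℕ × ℕ) × Bids × K}
       (λ (u , (v , _) , h , κ) → r (proj₂ κ) u v + Rd.price κ h u)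
     offerP = plusP (rP ∘P pairP v0 (pairP (fstP ∘P v1) (sndP ∘P w3))) (priceP ∘P pairP v0 w2)

   opaque
     bidP : PT {(ℕ × ℕ) × Bids × K} (λ (e , h , κ) → Rd.bid κ h e)
     bidP = andP (beforeP (sndP ∘P v0) (fstP ∘P v0) (sndP ∘P w2))
       (andP (freeP ∘P pairP (fstP ∘P v0) w1)
       (andP (leP (offerP ∘P pairP (sndP ∘P v0) idP) (MP ∘P (sndP ∘P w2)))
         (everyP {p = λ (u′ , (v , u) , h , κ) → not (C.before (proj₂ κ) u′ v) ∨
                    (r (proj₂ κ) u v + Rd.price κ h u ≤ᵇ r (proj₂ κ) u′ v + Rd.price κ h u′)}
           (orP (notP (beforeP v0 (fstP ∘P v1) (sndP ∘P w3)))
                (leP (offerP ∘P pairP (sndP ∘P v1) w1) offerP))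
           (fstP ∘P w2))))

   opaque
     unfolding Core.Round.bids
     bidsP : PT {K} (λ κ → Rd.bids κ)
     bidsP = greedyP {ok = λ κ → Rd.bid κ} bidP (productP fstP fstP)
       (plusP (timesP (nP ∘P w1) (sucP (MP ∘P w1))) (constP 1))

   opaque
     predecessorP : PT {ℕ × K} (λ (v , κ) → Rd.predecessor κ v)
     predecessorP = nthP (constP 0)
       (filterP {p = λ (u , v , κ) → Rd.owner κ (Rd.bids κ) u ≡ᵇ v}
         (eqP (ownerP ∘P pairP v0 (pairP (bidsP ∘P w2) w2)) v1) (v0 ∘P w1)) (constP 0)

     inTreeP : PT {ℕ × Bids × K} (λ (v , h , κ) → Rd.inTree κ h v)
     inTreeP = orP (eqP v0 (constP 0)) (orP (memberP v0 (fstP ∘P w2))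
       (memberP v0 (mapP {f = λ (e , _) → proj₂ e} (sndP ∘P v0) v1)))

   opaque
     crossingP : PT {(ℕ × ℕ) × Bids × K} (λ (e , h , κ) → Rd.crossing κ h e)
     crossingP = andP (inTreeP ∘P pairP (fstP ∘P v0) w1) (notP (inTreeP ∘P pairP (sndP ∘P v0) w1))

   opaque
     linkP : PT {(ℕ × ℕ) × Bids × K} (λ (e , h , κ) → Rd.link κ h e)
     linkP = andP crossingP
       (everyP {p = λ (e , (u , v) , h , κ) → not (Rd.crossing κ h e) ∨
                  (C.ω (proj₂ κ) u v ≤ᵇ C.ω (proj₂ κ) (proj₁ e) (proj₂ e))}
         (orP (notP (crossingP ∘P pairP v0 w2))
              (leP (ωP (fstP ∘P v1) (sndP ∘P v1) (sndP ∘P w3)) (ωP (fstP ∘P v0) (sndP ∘P v0) (sndP ∘P w3))))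
         (productP usP vsP ∘P (sndP ∘P w2)))

   opaque
     unfolding Core.Round.links
     linksP : PT {K} (λ κ → Rd.links κ)
     linksP = greedyP {ok = λ κ → Rd.link κ} linkP (productP usP vsP ∘P sndP) (nP ∘P sndP)

     sortedP : PT {K} (λ κ → Rd.sorted κ)
     sortedP = concatMapP {f = λ (i , κ) → filterᵇ (λ v → rank (proj₂ κ) v ≡ᵇ i) (proj₁ κ)}
       (filterP {p = λ (v , i , κ) → rank (proj₂ κ) v ≡ᵇ i} (eqP (rankP ∘P pairP v0 (sndP ∘P w2)) v1)
         (fstP ∘P w1)) (reverseP (downFromP (sucP (nP ∘P w1))))

   opaque
     insertP : PT {List ℕ × (ℕ × ℕ) × K} (λ (xs , e , _) → insert xs e)
     insertP = ifP (eqP (occurrencesP (fstP ∘P v1) v0) (constP 1))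
       (concatMapP {f = λ (x , xs , (u , v) , _) → if x ≡ᵇ u then x ∷ v ∷ [] else x ∷ []}
         (ifP (eqP v0 (fstP ∘P v2)) (consP v0 (consP (sndP ∘P v2) nilP)) (consP v0 nilP)) v0)
       v0

   private
     add : ℕ → ℕ → List ℕ → List ℕ
     add u v = concatMap (λ x → if x ≡ᵇ u then x ∷ v ∷ [] else x ∷ [])

     size-add : ∀ u v xs → ⟪ add u v xs ⟫ ≡ ⟪ xs ⟫ + occurrences u xs * suc ⟪ v ⟫
     size-add u v [] = refl
     size-add u v (x ∷ xs) with x ≡ᵇ u
     ... | false = cong suc (trans (cong (⟪ x ⟫ +_) (size-add u v xs)) (sym (+-assoc ⟪ x ⟫ _ _)))
     ... | true  = cong suc (trans (cong (λ z → ⟪ x ⟫ + suc (⟪ v ⟫ + z)) (size-add u v xs))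
                     (lem ⟪ x ⟫ ⟪ v ⟫ ⟪ xs ⟫ (occurrences u xs * suc ⟪ v ⟫)))
       where
       lem : ∀ x v s k → x + suc (v + (s + k)) ≡ x + s + (suc v + k)
       lem = solve-∀

     size-insert : ∀ xs u v → ⟪ insert xs (u , v) ⟫ ≤ ⟪ xs ⟫ + suc ⟪ v ⟫
     size-insert xs u v with occurrences u xs ≡ᵇ 1 in e
     ... | false = m≤m+n _ _
     ... | true  = ≤-reflexive (trans (size-add u v xs) (cong (⟪ xs ⟫ +_)
                     (trans (cong (_* suc ⟪ v ⟫) (≡ᵇ⇒≡ (occurrences u xs) 1 (subst T (sym e) tt)))
                            (+-identityʳ _))))

   opaque
     tourP : PT {K} (λ κ → Rd.tour κ)
     tourP = foldlP⁺ {f = λ (xs , e , κ) → insert xs e} insertP (constP (0 ∷ []))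
       (appendP (mapP {f = λ (v , κ) → Rd.predecessor κ v , v} (pairP predecessorP v0) sortedP)
                (reverseP linksP))
       idᵖ λ xs (u , v) κ → ≤-trans (size-insert xs u v) (+-monoʳ-≤ ⟪ xs ⟫
         (≤-trans (s≤s (m≤n+m ⟪ v ⟫ ⟪ u ⟫)) (≤-trans (m≤m+n _ ⟪ κ ⟫) (n≤1+n _))))

   private
     Piece : Set
     Piece = ℕ × ℕ × List ℕ

     Cutting : Set
     Cutting = ℕ × List Piece × K

     joined : I → Piece → ℕ → ℕ
     joined i (c , y , _) x = c + r i x y

     extend-cons : I → ℕ → Piece → List Piece → List Piece
     extend-cons i x q ps = if joined i q x ≤ᵇ M i
       then (joined i q x , x , x ∷ proj₂ (proj₂ q)) ∷ ps
       else (0 , x , x ∷ []) ∷ q ∷ ps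

   opaque
     cutP : PT {Cutting} (λ (x , ps , κ) → Rd.cut κ x ps)
     cutP = ifP (eqP v0 (constP 0)) v1 (ext eq
         (elimP {h = λ (_ , ps , _) → ps} {f = λ (x , _) → (0 , x , x ∷ []) ∷ []}
           {g = λ q ps (x , _ , κ) → extend-cons (proj₂ κ) x q ps} v1
           (consP (pairP (constP 0) (pairP v0 (consP v0 nilP))) nilP)
           (ifP (leP jP (MP ∘P iP)) (consP (pairP jP (pairP xP (consP xP (w2 ∘P qP)))) (sndP ∘P fstP))
             (consP (pairP (constP 0) (pairP xP (consP xP nilP))) (consP qP (sndP ∘P fstP))))))
       where
       qP : PT {(Piece × List Piece) × Cutting} (λ ((q , _) , _) → q)
       qP = fstP ∘P fstP
       xP : PT {(Piece × List Piece) × Cutting} (λ (_ , x , _) → x)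
       xP = fstP ∘P sndP
       iP : PT {(Piece × List Piece) × Cutting} (λ (_ , _ , _ , κ) → proj₂ κ)
       iP = (sndP ∘P w2) ∘P sndP
       jP : PT {(Piece × List Piece) × Cutting} (λ ((q , _) , x , _ , κ) → joined (proj₂ κ) q x)
       jP = plusP (fstP ∘P qP) (rP ∘P pairP xP (pairP (v1 ∘P qP) iP))
       eq : (g : Cutting) → elim (λ (x , _) → (0 , x , x ∷ []) ∷ [])
              (λ q ps (x , _ , κ) → extend-cons (proj₂ κ) x q ps) (proj₁ (proj₂ g)) g
            ≡ Rd.extend (proj₂ (proj₂ g)) (proj₁ g) (proj₁ (proj₂ g))
       eq (x , [] , κ)     = refl
       eq (x , q ∷ ps , κ) = refl

   private
     -- The recorded length of a piece changes by an amount that depends on the state, but the test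
     -- keeps the new length below `M`, which does not.
     size-extend : ∀ κ x ps → ⟪ Rd.extend κ x ps ⟫ ≤ ⟪ ps ⟫ + (10 + (⟪ M (proj₂ κ) ⟫ + 2 * ⟪ x ⟫))
     size-extend κ x [] = ≤-trans (m≤m+n _ (4 + ⟪ M (proj₂ κ) ⟫)) (≤-reflexive (lem ⟪ x ⟫ ⟪ M (proj₂ κ) ⟫))
       where
       lem : ∀ x m → suc (suc (1 + suc (x + suc (x + 1))) + 1) + (4 + m) ≡ 1 + (10 + (m + 2 * x))
       lem = solve-∀
     size-extend κ x ((c , y , p) ∷ ps) with c + r (proj₂ κ) x y ≤ᵇ M (proj₂ κ) in e
     ... | false = ≤-trans (m≤m+n _ (4 + m)) (≤-reflexive (lem ⟪ x ⟫ _ m))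
       where
       m : ℕ
       m = ⟪ M (proj₂ κ) ⟫
       lem : ∀ x s m → suc (suc (1 + suc (x + suc (x + 1))) + s) + (4 + m) ≡ s + (10 + (m + 2 * x))
       lem = solve-∀
     ... | true  = ≤-trans (s≤s (+-monoˡ-≤ ⟪ ps ⟫ (s≤s (+-monoˡ-≤ _ small))))
                     (≤-trans (m≤m+n _ (9 + ⟪ c ⟫ + ⟪ y ⟫)) (≤-reflexive (lem ⟪ x ⟫ ⟪ c ⟫ ⟪ y ⟫ ⟪ p ⟫ ⟪ ps ⟫ m)))
       where
       m : ℕ
       m = ⟪ M (proj₂ κ) ⟫
       j≤ : c + r (proj₂ κ) x y ≤ M (proj₂ κ)
       j≤ = ≤ᵇ⇒≤ _ _ (subst T (sym e) tt)
       small : ⟪ c + r (proj₂ κ) x y ⟫ ≤ m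
       small = ≤-trans (≤-reflexive (sizeℕ (c + r (proj₂ κ) x y)))
         (≤-trans (s≤s (+-mono-≤ j≤ j≤)) (≤-reflexive (sym (sizeℕ (M (proj₂ κ))))))
       lem : ∀ x c y p s m → suc (suc (m + suc (x + suc (x + p))) + s) + (9 + c + y)
                            ≡ suc (suc (c + suc (y + p)) + s) + (10 + (m + 2 * x))
       lem = solve-∀

     size-cut : ∀ κ x ps → ⟪ Rd.cut κ x ps ⟫ ≤ ⟪ ps ⟫ + (10 + (⟪ M (proj₂ κ) ⟫ + 2 * ⟪ x ⟫))
     size-cut κ x ps with x ≡ᵇ 0
     ... | true  = m≤m+n _ _
     ... | false = size-extend κ x ps

   opaque
     piecesP : PT {K} (λ κ → Rd.pieces κ)
     piecesP = mapP {f = λ (p , _) → proj₂ (proj₂ p)} (w2 ∘P v0)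
       (foldrP⁺ {f = λ (x , s , κ) → Rd.cut κ x s} cutP nilP tourP
         (constᵖ 10 +ᵖ (growᵖ {K} {ℕ} (time (MP ∘P sndP)) +ᵖ constᵖ 2 *ᵖ idᵖ))
         λ ps x κ → ≤-trans (size-cut κ x ps) (+-monoʳ-≤ ⟪ ps ⟫ (+-monoʳ-≤ 10 (+-mono-≤
           (≤-trans (output-size (MP ∘P sndP) κ) (grow-mono (time (MP ∘P sndP)) (size-snd x κ)))
           (*-monoʳ-≤ 2 (≤-trans (m≤m+n ⟪ x ⟫ ⟪ κ ⟫) (n≤1+n _)))))))

   opaque
     unfolding Core.attempt
     attemptP : PT {J} (λ j → C.attempt (proj₂ j) (proj₁ j))
     attemptP = piecesP ∘P pairP (filterP {p = λ (v , j) → Q.chosen j v} chosenP (vsP ∘P sndP)) sndP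

   opaque
     attemptsP : PT {I} (λ i → C.attempts i)
     attemptsP = mapP {f = λ (k , i) → C.attempt i k} attemptP
       (downFromP (sucP (lengthP (attemptP ∘P pairP (constP 0) idP))))

   opaque
     bestP : PT {I} (λ i → C.best i)
     bestP = ext (λ i → sym (C.best-≡ i)) (nthP nilP
       (filterP {p = λ (S , i) → every (λ S′ → length S ≤ᵇ length S′) (C.attempts i)}
         (everyP {p = λ (S′ , S , i) → length S ≤ᵇ length S′} (leP (lengthP v1) (lengthP v0)) (attemptsP ∘P sndP))
         attemptsP) (constP 0))

open import Data.List.Relation.Unary.All as All using (All; []; _∷_)
import Data.List.Relation.Unary.All.Properties as All
import Data.List.Relation.Unary.AllPairs as AllPairs using (map)
open import Data.List.Relation.Unary.AllPairs using (AllPairs; []; _∷_)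
import Data.List.Relation.Unary.AllPairs.Properties as AllPairs
open import Data.List.Relation.Unary.Any as Any using (Any; here; there)
import Data.List.Relation.Unary.Unique.Propositional.Properties as Unique

-- Finite sums and the convergence of the perceptron

module Sums where

 open PolytimeLists
 open Algorithm

 -- Stands in for subtraction: an inequality is proved with a common summand `z` on both sides, and
 -- the rearrangements are left to the ring solver.
 linear : ∀ z {a b s t} → s ≤ t → z + a ≡ s → t ≡ z + b → a ≤ b
 linear z {a} {b} s≤t e f =
   +-cancelˡ-≤ z a b (≤-trans (≤-reflexive e) (≤-trans s≤t (≤-reflexive f)))

 module _ {X : Set} where

   ∑-cong : ∀ (xs : List X) {f g} → (∀ x → f x ≡ g x) → ∑ xs f ≡ ∑ xs g
   ∑-cong []       e = refl
   ∑-cong (x ∷ xs) e = cong₂ _+_ (e x) (∑-cong xs e)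

   ∑-cong∈ : ∀ (xs : List X) {f g} → (∀ x → x ∈ xs → f x ≡ g x) → ∑ xs f ≡ ∑ xs g
   ∑-cong∈ []       e = refl
   ∑-cong∈ (x ∷ xs) e = cong₂ _+_ (e x (here refl)) (∑-cong∈ xs λ y y∈ → e y (there y∈))

   ∑-mono∈ : ∀ (xs : List X) {f g} → (∀ x → x ∈ xs → f x ≤ g x) → ∑ xs f ≤ ∑ xs g
   ∑-mono∈ []       h = z≤n
   ∑-mono∈ (x ∷ xs) h = +-mono-≤ (h x (here refl)) (∑-mono∈ xs λ y y∈ → h y (there y∈))

   ∑-mono : ∀ (xs : List X) {f g} → (∀ x → f x ≤ g x) → ∑ xs f ≤ ∑ xs g
   ∑-mono xs h = ∑-mono∈ xs λ x _ → h x

   ∑-zero : ∀ (xs : List X) {f} → (∀ x → x ∈ xs → f x ≡ 0) → ∑ xs f ≡ 0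
   ∑-zero []       h = refl
   ∑-zero (x ∷ xs) h = cong₂ _+_ (h x (here refl)) (∑-zero xs λ y y∈ → h y (there y∈))

   ∑-+ : ∀ (xs : List X) f g → ∑ xs (λ x → f x + g x) ≡ ∑ xs f + ∑ xs g
   ∑-+ []       f g = refl
   ∑-+ (x ∷ xs) f g = trans (cong (f x + g x +_) (∑-+ xs f g)) (lem (f x) (g x) (∑ xs f) (∑ xs g))
     where
     lem : ∀ a b c d → a + b + (c + d) ≡ a + c + (b + d)
     lem = solve-∀

   ∑-*ˡ : ∀ (xs : List X) c f → ∑ xs (λ x → c * f x) ≡ c * ∑ xs f
   ∑-*ˡ []       c f = sym (*-zeroʳ c)
   ∑-*ˡ (x ∷ xs) c f = trans (cong (c * f x +_) (∑-*ˡ xs c f)) (sym (*-distribˡ-+ c (f x) (∑ xs f)))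

   ∑-*ʳ : ∀ (xs : List X) c f → ∑ xs (λ x → f x * c) ≡ ∑ xs f * c
   ∑-*ʳ []       c f = refl
   ∑-*ʳ (x ∷ xs) c f = trans (cong (f x * c +_) (∑-*ʳ xs c f)) (sym (*-distribʳ-+ c (f x) (∑ xs f)))

   ∑-const : ∀ (xs : List X) c → ∑ xs (λ _ → c) ≡ length xs * c
   ∑-const []       c = refl
   ∑-const (x ∷ xs) c = cong (c +_) (∑-const xs c)

   ∑-++ : ∀ (xs ys : List X) f → ∑ (xs ++ ys) f ≡ ∑ xs f + ∑ ys f
   ∑-++ []       ys f = refl
   ∑-++ (x ∷ xs) ys f = trans (cong (f x +_) (∑-++ xs ys f)) (sym (+-assoc (f x) _ _))

   ∑-filter : ∀ p (xs : List X) f → ∑ (filterᵇ p xs) f ≡ ∑ xs (λ x → if p x then f x else 0)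
   ∑-filter p []       f = refl
   ∑-filter p (x ∷ xs) f with p x
   ... | true  = cong (f x +_) (∑-filter p xs f)
   ... | false = ∑-filter p xs f

   ∑-filter≤ : ∀ p (xs : List X) f → ∑ (filterᵇ p xs) f ≤ ∑ xs f
   ∑-filter≤ p xs f = ≤-trans (≤-reflexive (∑-filter p xs f)) (∑-mono xs λ x → lem (p x) (f x))
     where
     lem : ∀ b m → (if b then m else 0) ≤ m
     lem true  m = ≤-refl
     lem false m = z≤n

   ∑-member : ∀ {xs : List X} {x} f → x ∈ xs → f x ≤ ∑ xs f
   ∑-member f (here refl) = m≤m+n _ _
   ∑-member f (there x∈)  = ≤-trans (∑-member f x∈) (m≤n+m _ _)

 module _ {X Y : Set} where

   ∑-swap : ∀ (xs : List X) (ys : List Y) (f : X → Y → ℕ) →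
            ∑ xs (λ x → ∑ ys (f x)) ≡ ∑ ys (λ y → ∑ xs (λ x → f x y))
   ∑-swap []       ys f = sym (∑-zero ys (λ _ _ → refl))
   ∑-swap (x ∷ xs) ys f = trans (cong (∑ ys (f x) +_) (∑-swap xs ys f)) (sym (∑-+ ys (f x) (λ y → ∑ xs (λ x → f x y))))

   ∑-map : ∀ (g : X → Y) xs (f : Y → ℕ) → ∑ (map g xs) f ≡ ∑ xs (λ x → f (g x))
   ∑-map g []       f = refl
   ∑-map g (x ∷ xs) f = cong (f (g x) +_) (∑-map g xs f)

   ∑-concatMap : ∀ (g : X → List Y) xs (f : Y → ℕ) → ∑ (concatMap g xs) f ≡ ∑ xs (λ x → ∑ (g x) f)
   ∑-concatMap g []       f = refl
   ∑-concatMap g (x ∷ xs) f = trans (∑-++ (g x) (concatMap g xs) f) (cong (∑ (g x) f +_) (∑-concatMap g xs f))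

 infix 4 _≼_

 -- ∑ xs f ≤ ∑ ys f for all f: xs is a submultiset of ys.
 _≼_ : ∀ {X : Set} → List X → List X → Set
 xs ≼ ys = ∀ f → ∑ xs f ≤ ∑ ys f

 ≼-unique : ∀ {X : Set} {xs ys : List X} → Unique xs → (∀ {x} → x ∈ xs → x ∈ ys) → xs ≼ ys
 ≼-unique {xs = []} u h f = z≤n
 ≼-unique {xs = x ∷ xs} (x∉ ∷ u) h f with ∈-∃++ (h (here refl))
 ... | as , bs , refl = begin
   f x + ∑ xs f                ≤⟨ +-monoʳ-≤ (f x) (≼-unique u sub f) ⟩
   f x + ∑ (as ++ bs) f        ≡⟨ cong (f x +_) (∑-++ as bs f) ⟩
   f x + (∑ as f + ∑ bs f)     ≡⟨ lem (f x) (∑ as f) (∑ bs f) ⟩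
   ∑ as f + (f x + ∑ bs f)     ≡⟨ ∑-++ as (x ∷ bs) f ⟨
   ∑ (as ++ x ∷ bs) f          ∎
   where
   open ≤-Reasoning
   lem : ∀ a b c → a + (b + c) ≡ b + (a + c)
   lem = solve-∀
   sub : ∀ {y} → y ∈ xs → y ∈ as ++ bs
   sub {y} y∈ with ∈-++⁻ as (h (there y∈))
   ... | inj₁ y∈as = ∈-++⁺ˡ y∈as
   ... | inj₂ (here refl) = contradiction refl (All.lookup x∉ y∈)
   ... | inj₂ (there y∈bs) = ∈-++⁺ʳ as y∈bs

 -- Moving against the violated constraints, weighted by their excess, the
 -- sum of the squares of the excesses grows only linearly.
 module PerceptronBound {Row Col : Set} (rows : List Row) (cols : List Col)
   (pos neg : Row → Col → ℕ) (pos₀ neg₀ : Row → ℕ) (H : ℕ)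
   (pos≤H : ∀ ρ → ρ ∈ rows → ∑ cols (pos ρ) + pos₀ ρ ≤ H)
   (neg≤H : ∀ ρ → ρ ∈ rows → ∑ cols (neg ρ) + neg₀ ρ ≤ H)
   (E : List Col) (E≼cols : E ≼ cols)
   (feasible : ∀ ρ → ρ ∈ rows → ∑ E (pos ρ) + pos₀ ρ ≤ ∑ E (neg ρ) + neg₀ ρ) where

   open Perceptron rows cols pos neg pos₀ neg₀

   growth : ℕ
   growth = length rows * (2 * (H * H))

   potential : ℕ × List Col → ℕ
   potential (t , h) = ∑ rows λ ρ → excess t h ρ * excess t h ρ

   private
     -- For `m ≤ x` this is the binomial formula. For `x ≤ m` the truncated square vanishes, and
     -- twice a product is at most the sum of the squares.
     square-monus : ∀ x m → (x ∸ m) * (x ∸ m) + 2 * (x * m) ≤ x * x + m * m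
     square-monus x m with ≤-total m x
     ... | inj₁ m≤x with m≤n⇒∃[o]m+o≡n m≤x
     ...   | d , refl rewrite m+n∸m≡n m d = ≤-reflexive (eq m d)
       where
       eq : ∀ m d → d * d + 2 * ((m + d) * m) ≡ (m + d) * (m + d) + m * m
       eq = solve-∀
     square-monus x m | inj₂ x≤m with m≤n⇒∃[o]m+o≡n x≤m
     ... | d , refl rewrite m≤n⇒m∸n≡0 x≤m = ≤-trans (m≤m+n _ (d * d)) (≤-reflexive (eq x d))
       where
       eq : ∀ x d → 2 * (x * (x + d)) + d * d ≡ x * x + (x + d) * (x + d)
       eq = solve-∀

     -- Expanding the square of `q + p - m` leaves cross terms, which the best response will make
     -- harmless, and two squares bounded by the width.
     row-step : ∀ P N p m → p ≤ H → m ≤ H →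
       ((P + p) ∸ (N + m)) * ((P + p) ∸ (N + m)) + 2 * ((P ∸ N) * m)
       ≤ (P ∸ N) * (P ∸ N) + 2 * ((P ∸ N) * p) + 2 * (H * H)
     row-step P N p m p≤ m≤ = begin
       ((P + p) ∸ (N + m)) * ((P + p) ∸ (N + m)) + 2 * (q * m)
         ≤⟨ +-mono-≤ (*-mono-≤ less less) (*-monoʳ-≤ 2 (*-monoˡ-≤ m (m≤m+n q p))) ⟩
       (q + p ∸ m) * (q + p ∸ m) + 2 * ((q + p) * m)  ≤⟨ square-monus (q + p) m ⟩
       (q + p) * (q + p) + m * m                      ≡⟨ eq q p m ⟩
       q * q + 2 * (q * p) + (p * p + m * m)
         ≤⟨ +-monoʳ-≤ (q * q + 2 * (q * p)) (+-mono-≤ (*-mono-≤ p≤ p≤) (*-mono-≤ m≤ m≤)) ⟩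
       q * q + 2 * (q * p) + (H * H + H * H)          ≡⟨ cong (q * q + 2 * (q * p) +_) (eq₂ (H * H)) ⟩
       q * q + 2 * (q * p) + 2 * (H * H)              ∎
       where
       open ≤-Reasoning
       q : ℕ
       q = P ∸ N
       eq : ∀ q p m → (q + p) * (q + p) + m * m ≡ q * q + 2 * (q * p) + (p * p + m * m)
       eq = solve-∀
       eq₂ : ∀ h → h + h ≡ 2 * h
       eq₂ = solve-∀
       less : (P + p) ∸ (N + m) ≤ q + p ∸ m
       less = begin
         (P + p) ∸ (N + m)          ≤⟨ ∸-monoˡ-≤ (N + m) (+-monoˡ-≤ p (m≤n+m∸n P N)) ⟩
         (N + q + p) ∸ (N + m)      ≡⟨ cong (_∸ (N + m)) (+-assoc N q p) ⟩
         (N + (q + p)) ∸ (N + m)    ≡⟨ [m+n]∸[m+o]≡n∸o N (q + p) m ⟩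
         q + p ∸ m                  ∎

   module Step (t : ℕ) (h : List Col) where

     y : List Col
     y = filterᵇ (improving t h) cols

     q : Row → ℕ
     q = excess t h

     RP RN : Col → ℕ
     RP c = ∑ rows λ ρ → q ρ * pos ρ c
     RN c = ∑ rows λ ρ → q ρ * neg ρ c

     total : (Row → Col → ℕ) → (Row → ℕ) → List Col → Row → ℕ
     total a a₀ z ρ = ∑ z (a ρ) + a₀ ρ

     weigh : ∀ a a₀ z → ∑ rows (λ ρ → q ρ * total a a₀ z ρ)
             ≡ ∑ z (λ c → ∑ rows λ ρ → q ρ * a ρ c) + ∑ rows (λ ρ → q ρ * a₀ ρ)
     weigh a a₀ z = begin
       ∑ rows (λ ρ → q ρ * total a a₀ z ρ)
         ≡⟨ ∑-cong rows (λ ρ → *-distribˡ-+ (q ρ) (∑ z (a ρ)) (a₀ ρ)) ⟩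
       ∑ rows (λ ρ → q ρ * ∑ z (a ρ) + q ρ * a₀ ρ)     ≡⟨ ∑-+ rows _ _ ⟩
       ∑ rows (λ ρ → q ρ * ∑ z (a ρ)) + ∑ rows (λ ρ → q ρ * a₀ ρ)
         ≡⟨ cong (_+ _) (∑-cong rows λ ρ → sym (∑-*ˡ z (q ρ) (a ρ))) ⟩
       ∑ rows (λ ρ → ∑ z (λ c → q ρ * a ρ c)) + ∑ rows (λ ρ → q ρ * a₀ ρ)
         ≡⟨ cong (_+ _) (∑-swap rows z (λ ρ c → q ρ * a ρ c)) ⟩
       ∑ z (λ c → ∑ rows λ ρ → q ρ * a ρ c) + ∑ rows (λ ρ → q ρ * a₀ ρ) ∎
       where open ≡-Reasoning

     -- `E` chooses among the same columns, so its gain `∑ E RN - ∑ E RP` is at most the sum of all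
     -- positive gains, and exactly these are collected by `y`.
     best-response : ∑ y RP + ∑ E RN ≤ ∑ y RN + ∑ E RP
     best-response = begin
       ∑ y RP + ∑ E RN                                   ≤⟨ +-monoʳ-≤ _ (∑-mono E λ c → m≤n+m∸n (RN c) (RP c)) ⟩
       ∑ y RP + ∑ E (λ c → RP c + (RN c ∸ RP c))         ≡⟨ cong (∑ y RP +_) (∑-+ E RP _) ⟩
       ∑ y RP + (∑ E RP + ∑ E (λ c → RN c ∸ RP c))       ≤⟨ +-monoʳ-≤ (∑ y RP) (+-monoʳ-≤ (∑ E RP) (E≼cols _)) ⟩
       ∑ y RP + (∑ E RP + ∑ cols (λ c → RN c ∸ RP c))    ≡⟨ cong (λ z → ∑ y RP + (∑ E RP + z)) gains ⟩
       ∑ y RP + (∑ E RP + ∑ y (λ c → RN c ∸ RP c))       ≡⟨ lem (∑ y RP) (∑ E RP) _ ⟩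
       ∑ y RP + ∑ y (λ c → RN c ∸ RP c) + ∑ E RP         ≡⟨ cong (_+ ∑ E RP) (sym (∑-+ y RP _)) ⟩
       ∑ y (λ c → RP c + (RN c ∸ RP c)) + ∑ E RP         ≡⟨ cong (_+ ∑ E RP) exact ⟩
       ∑ y RN + ∑ E RP                                   ∎
       where
       open ≤-Reasoning
       lem : ∀ a b c → a + (b + c) ≡ a + c + b
       lem = solve-∀
       gain : ∀ c → RN c ∸ RP c ≡ (if RP c <ᵇ RN c then RN c ∸ RP c else 0)
       gain c with RP c <? RN c
       ... | yes lt with RP c <ᵇ RN c | <⇒<ᵇ lt
       ...   | true | _ = refl
       gain c | no nlt with RP c <ᵇ RN c in e
       ... | true  = contradiction (<ᵇ⇒< (RP c) (RN c) (subst T (sym e) tt)) nlt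
       ... | false = m≤n⇒m∸n≡0 (≮⇒≥ nlt)
       gains : ∑ cols (λ c → RN c ∸ RP c) ≡ ∑ y (λ c → RN c ∸ RP c)
       gains = trans (∑-cong cols gain) (sym (∑-filter (improving t h) cols _))
       recover : ∀ c → (if RP c <ᵇ RN c then RP c + (RN c ∸ RP c) else 0) ≡ (if RP c <ᵇ RN c then RN c else 0)
       recover c with RP c <ᵇ RN c in e
       ... | true  = m+[n∸m]≡n (<⇒≤ (<ᵇ⇒< (RP c) (RN c) (subst T (sym e) tt)))
       ... | false = refl
       exact : ∑ y (λ c → RP c + (RN c ∸ RP c)) ≡ ∑ y RN
       exact = trans (∑-filter (improving t h) cols _)
         (trans (∑-cong cols recover) (sym (∑-filter (improving t h) cols RN)))

     -- The weighted constraints add up to one inequality. It holds for `E` and therefore for the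
     -- best response `y`.
     descent : ∑ rows (λ ρ → q ρ * total pos pos₀ y ρ) ≤ ∑ rows (λ ρ → q ρ * total neg neg₀ y ρ)
     descent = begin
       ∑ rows (λ ρ → q ρ * total pos pos₀ y ρ)   ≡⟨ weigh pos pos₀ y ⟩
       ∑ y RP + Q₊                              ≤⟨ linear (∑ E RP + ∑ E RN) (+-mono-≤ best-response optimal)
                                                    (eq (∑ y RP) Q₊ (∑ E RP) (∑ E RN))
                                                    (eq′ (∑ y RN) Q₋ (∑ E RP) (∑ E RN)) ⟩
       ∑ y RN + Q₋                              ≡⟨ weigh neg neg₀ y ⟨
       ∑ rows (λ ρ → q ρ * total neg neg₀ y ρ)   ∎
       where
       open ≤-Reasoning
       Q₊ Q₋ : ℕ
       Q₊ = ∑ rows (λ ρ → q ρ * pos₀ ρ)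
       Q₋ = ∑ rows (λ ρ → q ρ * neg₀ ρ)
       optimal : ∑ E RP + Q₊ ≤ ∑ E RN + Q₋
       optimal = subst₂ _≤_ (weigh pos pos₀ E) (weigh neg neg₀ E)
         (∑-mono∈ rows λ ρ ρ∈ → *-monoʳ-≤ (q ρ) (feasible ρ ρ∈))
         where open import Relation.Binary.PropositionalEquality using (subst₂)
       eq : ∀ a b c d → c + d + (a + b) ≡ a + d + (c + b)
       eq = solve-∀
       eq′ : ∀ a b c d → (a + c) + (d + b) ≡ c + d + (a + b)
       eq′ = solve-∀

     new-excess : ∀ ρ → excess (suc t) (y ++ h) ρ ≡
       ((∑ h (pos ρ) + t * pos₀ ρ) + total pos pos₀ y ρ) ∸ ((∑ h (neg ρ) + t * neg₀ ρ) + total neg neg₀ y ρ)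
     new-excess ρ = cong₂ _∸_ (regroup pos pos₀) (regroup neg neg₀)
       where
       lem : ∀ a b c d → a + b + (c + d) ≡ b + d + (a + c)
       lem = solve-∀
       regroup : ∀ a a₀ → ∑ (y ++ h) (a ρ) + suc t * a₀ ρ ≡ (∑ h (a ρ) + t * a₀ ρ) + total a a₀ y ρ
       regroup a a₀ = trans (cong (_+ suc t * a₀ ρ) (∑-++ y h (a ρ))) (lem (∑ y (a ρ)) _ (a₀ ρ) _)

     -- The cross term of a row is `2 * q ρ` times the violation of the row at `y`. Summed over the
     -- rows these are at most zero by `descent`, so that only the bounded squares remain.
     potential-step : potential (play (t , h)) ≤ potential (t , h) + growth
     potential-step = linear (2 * ∑ rows (λ ρ → q ρ * total neg neg₀ y ρ))
       (begin
         ∑ rows (λ ρ → excess (suc t) (y ++ h) ρ * excess (suc t) (y ++ h) ρ + 2 * (q ρ * total neg neg₀ y ρ))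
           ≤⟨ ∑-mono∈ rows (λ ρ ρ∈ → ≤-trans
                (≤-reflexive (cong (λ z → z * z + 2 * (q ρ * total neg neg₀ y ρ)) (new-excess ρ)))
                (row-step (∑ h (pos ρ) + t * pos₀ ρ) (∑ h (neg ρ) + t * neg₀ ρ) _ _
                  (≤-trans (+-monoˡ-≤ (pos₀ ρ) (∑-filter≤ (improving t h) cols (pos ρ))) (pos≤H ρ ρ∈))
                  (≤-trans (+-monoˡ-≤ (neg₀ ρ) (∑-filter≤ (improving t h) cols (neg ρ))) (neg≤H ρ ρ∈)))) ⟩
         ∑ rows (λ ρ → q ρ * q ρ + 2 * (q ρ * total pos pos₀ y ρ) + 2 * (H * H))
           ≡⟨ trans (∑-+ rows _ _) (cong₂ _+_ (∑-+ rows _ _) (∑-const rows _)) ⟩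
         potential (t , h) + ∑ rows (λ ρ → 2 * (q ρ * total pos pos₀ y ρ)) + growth
           ≡⟨ cong (λ z → potential (t , h) + z + growth) (∑-*ˡ rows 2 _) ⟩
         potential (t , h) + 2 * ∑ rows (λ ρ → q ρ * total pos pos₀ y ρ) + growth
           ≤⟨ +-monoˡ-≤ growth (+-monoʳ-≤ (potential (t , h)) (*-monoʳ-≤ 2 descent)) ⟩
         potential (t , h) + 2 * ∑ rows (λ ρ → q ρ * total neg neg₀ y ρ) + growth ∎)
       (trans (+-comm _ (potential (suc t , y ++ h)))
         (trans (cong (potential (suc t , y ++ h) +_) (sym (∑-*ˡ rows 2 _))) (sym (∑-+ rows _ _))))
       (lem (potential (t , h)) _ growth)
       where
       open ≤-Reasoning
       lem : ∀ a b c → a + b + c ≡ b + (a + c)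
       lem = solve-∀

   private
     plays-from : ∀ s m → potential (foldl (λ s (_ : ⊤) → play s) s (replicate m tt)) ≤ potential s + m * growth
     plays-from s zero    = m≤m+n _ 0
     plays-from s@(t , h) (suc m) = begin
       potential (foldl (λ s _ → play s) (play s) (replicate m tt))   ≤⟨ plays-from (play s) m ⟩
       potential (play s) + m * growth                                ≤⟨ +-monoˡ-≤ (m * growth) (Step.potential-step t h) ⟩
       potential s + growth + m * growth                              ≡⟨ +-assoc (potential s) growth _ ⟩
       potential s + (growth + m * growth)                            ∎
       where open ≤-Reasoning

     count-plays : ∀ s m → proj₁ (foldl (λ s (_ : ⊤) → play s) s (replicate m tt)) ≡ m + proj₁ s
     count-plays s zero    = refl
     count-plays s (suc m) = trans (count-plays (play s) m) (+-suc m (proj₁ s))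

     square-cancel : ∀ a b → a * a ≤ b * b → a ≤ b
     square-cancel a b h with a ≤? b
     ... | yes a≤b = a≤b
     ... | no  a≰b = contradiction (*-mono-< (≰⇒> a≰b) (≰⇒> a≰b)) (≤⇒≯ h)

   -- The square of a single excess is at most the potential, hence at most `τ * growth`; multiplied
   -- by `K * K` this is `τ * τ`, by the choice of `τ`.
   nearly-feasible : ∀ K → let τ = K * K * growth ; h = proj₂ (plays τ) in ∀ ρ → ρ ∈ rows →
     K * (∑ h (pos ρ) + τ * pos₀ ρ) ≤ K * (∑ h (neg ρ) + τ * neg₀ ρ) + τ
   nearly-feasible K ρ ρ∈ = begin
     K * P               ≤⟨ *-monoʳ-≤ K (m≤n+m∸n P N) ⟩
     K * (N + (P ∸ N))   ≡⟨ *-distribˡ-+ K N (P ∸ N) ⟩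
     K * N + K * (P ∸ N) ≤⟨ +-monoʳ-≤ (K * N) (square-cancel (K * (P ∸ N)) τ squares) ⟩
     K * N + τ           ∎
     where
     open ≤-Reasoning
     τ : ℕ
     τ = K * K * growth
     h : List Col
     h = proj₂ (plays τ)
     P N : ℕ
     P = ∑ h (pos ρ) + τ * pos₀ ρ
     N = ∑ h (neg ρ) + τ * neg₀ ρ
     at-first : potential (0 , []) ≡ 0
     at-first = ∑-zero rows λ _ _ → refl
     clock : proj₁ (plays τ) ≡ τ
     clock = trans (count-plays (0 , []) τ) (+-identityʳ τ)
     regroup : ∀ k e → k * e * (k * e) ≡ k * k * (e * e)
     regroup = solve-∀
     regroup′ : ∀ k t g → k * k * (t * g) ≡ k * k * g * t
     regroup′ = solve-∀
     squares : K * (P ∸ N) * (K * (P ∸ N)) ≤ τ * τ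
     squares = begin
       K * (P ∸ N) * (K * (P ∸ N))      ≡⟨ regroup K (P ∸ N) ⟩
       K * K * ((P ∸ N) * (P ∸ N))
         ≤⟨ *-monoʳ-≤ (K * K) (∑-member (λ ρ → excess τ h ρ * excess τ h ρ) ρ∈) ⟩
       K * K * potential (τ , h)        ≡⟨ cong (λ z → K * K * potential (z , h)) (sym clock) ⟩
       K * K * potential (plays τ)
         ≤⟨ *-monoʳ-≤ (K * K) (plays-from (0 , []) τ) ⟩
       K * K * (potential (0 , []) + τ * growth) ≡⟨ cong (λ z → K * K * (z + τ * growth)) at-first ⟩
       K * K * (τ * growth)             ≡⟨ regroup′ K τ growth ⟩
       τ * τ                            ∎

-- Boolean tests, minima and greedy lists

module Selection where

 open PolytimeLists
 open Algorithm
 open Sums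

 true⇒T : ∀ {b} → b ≡ true → T b
 true⇒T refl = tt

 T⇒true : ∀ {b} → T b → b ≡ true
 T⇒true {true} _ = refl

 ∧-true : ∀ {a b} → a ∧ b ≡ true → a ≡ true × b ≡ true
 ∧-true {true} e = refl , e

 true-∧ : ∀ {a b} → a ≡ true → b ≡ true → a ∧ b ≡ true
 true-∧ refl e = e

 not-true : ∀ {b} → not b ≡ true → b ≡ false
 not-true {false} _ = refl

 true-not : ∀ {b} → b ≡ false → not b ≡ true
 true-not refl = refl

 imp-true : ∀ {a b} → not a ∨ b ≡ true → a ≡ true → b ≡ true
 imp-true e refl = e

 true-imp : ∀ {a b} → (a ≡ true → b ≡ true) → not a ∨ b ≡ true
 true-imp {false} h = refl
 true-imp {true}  h = h refl

 ≤ᵇ-true : ∀ {m n} → (m ≤ᵇ n) ≡ true → m ≤ n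
 ≤ᵇ-true {m} {n} e = ≤ᵇ⇒≤ m n (true⇒T e)

 true-≤ᵇ : ∀ {m n} → m ≤ n → (m ≤ᵇ n) ≡ true
 true-≤ᵇ h = T⇒true (≤⇒≤ᵇ h)

 <ᵇ-true : ∀ {m n} → (m <ᵇ n) ≡ true → m < n
 <ᵇ-true {m} {n} e = <ᵇ⇒< m n (true⇒T e)

 true-<ᵇ : ∀ {m n} → m < n → (m <ᵇ n) ≡ true
 true-<ᵇ h = T⇒true (<⇒<ᵇ h)

 ≡ᵇ-true : ∀ {m n} → (m ≡ᵇ n) ≡ true → m ≡ n
 ≡ᵇ-true {m} {n} e = ≡ᵇ⇒≡ m n (true⇒T e)

 true-≡ᵇ : ∀ {m n} → m ≡ n → (m ≡ᵇ n) ≡ true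
 true-≡ᵇ {m} {n} h = T⇒true (≡⇒≡ᵇ m n h)

 false-≡ᵇ : ∀ {m n} → m ≢ n → (m ≡ᵇ n) ≡ false
 false-≡ᵇ {m} {n} h with m ≡ᵇ n in e
 ... | true  = contradiction (≡ᵇ-true e) h
 ... | false = refl

 ≡ᵇ-sym : ∀ m n → (m ≡ᵇ n) ≡ (n ≡ᵇ m)
 ≡ᵇ-sym zero    zero    = refl
 ≡ᵇ-sym zero    (suc n) = refl
 ≡ᵇ-sym (suc m) zero    = refl
 ≡ᵇ-sym (suc m) (suc n) = ≡ᵇ-sym m n

 δ≤1 : ∀ b → δ b ≤ 1
 δ≤1 true  = ≤-refl
 δ≤1 false = z≤n

 module _ {X : Set} where

   every-true : ∀ {p : X → Bool} {xs x} → every p xs ≡ true → x ∈ xs → p x ≡ true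
   every-true e (here refl) = proj₁ (∧-true e)
   every-true {p} {y ∷ xs} e (there x∈) = every-true {p} {xs} (proj₂ (∧-true {p y} e)) x∈

   true-every : ∀ {p : X → Bool} xs → (∀ x → x ∈ xs → p x ≡ true) → every p xs ≡ true
   true-every []       h = refl
   true-every (x ∷ xs) h = true-∧ (h x (here refl)) (true-every xs λ y y∈ → h y (there y∈))

   ∈-filterᵇ⁺ : ∀ {p : X → Bool} {xs x} → x ∈ xs → p x ≡ true → x ∈ filterᵇ p xs
   ∈-filterᵇ⁺ x∈ e = ∈-filter⁺ _ x∈ (true⇒T e)

   ∈-filterᵇ⁻ : ∀ {p : X → Bool} {xs x} → x ∈ filterᵇ p xs → x ∈ xs × p x ≡ true
   ∈-filterᵇ⁻ {p} {xs} x∈ with ∈-filter⁻ _ {xs = xs} x∈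
   ... | x∈xs , t = x∈xs , T⇒true t

   empty-filter : ∀ {p : X → Bool} {xs} → filterᵇ p xs ≡ [] → ∀ x → x ∈ xs → p x ≡ false
   empty-filter {p} {xs} e x x∈ with p x in px
   ... | false = refl
   ... | true  with subst (x ∈_) e (∈-filterᵇ⁺ x∈ px)
   ...   | ()

   argmin : ∀ (p : X → Bool) (f : X → ℕ) xs {x} → x ∈ xs → p x ≡ true →
            ∃[ y ] y ∈ xs × p y ≡ true × f y ≤ f x × (∀ z → z ∈ xs → p z ≡ true → f y ≤ f z)
   argmin p f xs {x} x∈ px = search (f x) x x∈ px ≤-refl
     where
     search : ∀ k y → y ∈ xs → p y ≡ true → f y ≤ k →
       ∃[ y ] y ∈ xs × p y ≡ true × f y ≤ k × (∀ z → z ∈ xs → p z ≡ true → f y ≤ f z)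
     search k y y∈ py fy≤k with every (λ z → not (p z) ∨ (f y ≤ᵇ f z)) xs in e
     ... | true = y , y∈ , py , fy≤k , λ z z∈ pz →
                  ≤ᵇ-true (imp-true (every-true {p = λ z → not (p z) ∨ (f y ≤ᵇ f z)} {xs} e z∈) pz)
     ... | false with filterᵇ (λ z → p z ∧ (f z <ᵇ f y)) xs in e′
     ...   | [] = contradiction (trans (sym e) (true-every xs λ z z∈ → true-imp {p z} λ pz →
                    true-≤ᵇ {f y} {f z} (≮⇒≥ λ lt → contradiction
                      (trans (sym (empty-filter e′ z z∈)) (true-∧ {p z} pz (true-<ᵇ lt))) λ ()))) λ ()
     ...   | z ∷ _ with ∈-filterᵇ⁻ {xs = xs} (subst (z ∈_) (sym e′) (here refl))
     search zero y y∈ py fy≤k | false | z ∷ _ | z∈ , pz =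
       contradiction (<-≤-trans (<ᵇ-true (proj₂ (∧-true {p z} pz))) fy≤k) λ ()
     search (suc k) y y∈ py fy≤k | false | z ∷ _ | z∈ , pz
       with search k z z∈ (proj₁ (∧-true {p z} pz)) (≤-pred (<-≤-trans (<ᵇ-true (proj₂ (∧-true {p z} pz))) fy≤k))
     ... | w , w∈ , pw , fw≤ , m = w , w∈ , pw , m≤n⇒m≤1+n fw≤ , m

 module _ {X Y : Set} where

   ∈-⊗⁺ : ∀ {xs : List X} {ys : List Y} {x y} → x ∈ xs → y ∈ ys → (x , y) ∈ xs ⊗ ys
   ∈-⊗⁺ {x ∷ xs} {ys} (here refl) y∈ = ∈-++⁺ˡ (∈-map⁺ (x ,_) y∈)
   ∈-⊗⁺ {x ∷ xs} {ys} (there x∈)  y∈ = ∈-++⁺ʳ (map (x ,_) ys) (∈-⊗⁺ x∈ y∈)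

   ∈-⊗⁻ : ∀ (xs : List X) {ys : List Y} {x y} → (x , y) ∈ xs ⊗ ys → x ∈ xs × y ∈ ys
   ∈-⊗⁻ (x ∷ xs) {ys} p with ∈-++⁻ (map (x ,_) ys) p
   ... | inj₂ q with ∈-⊗⁻ xs q
   ...   | x∈ , y∈ = there x∈ , y∈
   ∈-⊗⁻ (x ∷ xs) {ys} p | inj₁ q with ∈-map⁻ (x ,_) q
   ... | y , y∈ , refl = here refl , y∈

 occurrences-∉ : ∀ {v xs} → v ∉ xs → occurrences v xs ≡ 0
 occurrences-∉ {v} {xs} v∉ = ∑-zero xs λ x x∈ →
   cong δ (false-≡ᵇ {x} {v} λ { refl → v∉ x∈ })

 occurrences-∈ : ∀ {v xs} → v ∈ xs → 1 ≤ occurrences v xs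
 occurrences-∈ {v} {xs} v∈ = ≤-trans (≤-reflexive (sym (cong δ (true-≡ᵇ {v} refl))))
   (∑-member (λ x → δ (x ≡ᵇ v)) v∈)

 occurrences-unique : ∀ v {xs} → Unique xs → occurrences v xs ≤ 1
 occurrences-unique v [] = z≤n
 occurrences-unique v {x ∷ xs} (x∉ ∷ u) with x ≡ᵇ v in e
 ... | false = occurrences-unique v u
 ... | true  = s≤s (≤-reflexive (occurrences-∉ λ v∈ → All.lookup x∉ v∈ (≡ᵇ-true e)))

 occurrences-unique-∈ : ∀ {v xs} → Unique xs → v ∈ xs → occurrences v xs ≡ 1
 occurrences-unique-∈ {v} u v∈ = ≤-antisym (occurrences-unique v u) (occurrences-∈ v∈)

 member-∈ : ∀ {v} xs → member v xs ≡ true → v ∈ xs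
 member-∈ {v} (x ∷ xs) e with x ≡ᵇ v in e′
 ... | true  = here (sym (≡ᵇ-true e′))
 ... | false = there (member-∈ xs e)

 ∈-member : ∀ {v xs} → v ∈ xs → member v xs ≡ true
 ∈-member {v} {x ∷ xs} (here refl) rewrite true-≡ᵇ {v} refl = refl
 ∈-member {v} {x ∷ xs} (there v∈) with x ≡ᵇ v
 ... | true  = refl
 ... | false = ∈-member v∈

 ∉-member : ∀ {v xs} → v ∉ xs → member v xs ≡ false
 ∉-member {v} {xs} v∉ with member v xs in e
 ... | true  = contradiction (member-∈ xs e) v∉
 ... | false = refl

 member-∉ : ∀ {v xs} → member v xs ≡ false → v ∉ xs
 member-∉ e v∈ = contradiction (trans (sym e) (∈-member v∈)) λ ()

 select : ∀ {xs y} → Unique xs → y ∈ xs → ∀ (g : ℕ → ℕ) → ∑ xs (λ a → δ (y ≡ᵇ a) * g a) ≡ g y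
 select {x ∷ xs} {y} (x∉ ∷ u) (here refl) g rewrite true-≡ᵇ {y} refl =
   trans (cong₂ _+_ (+-identityʳ (g y)) (∑-zero xs λ z z∈ →
     cong (λ b → δ b * g z) (false-≡ᵇ (All.lookup x∉ z∈)))) (+-identityʳ (g y))
 select {x ∷ xs} {y} (x∉ ∷ u) (there y∈) g
   rewrite false-≡ᵇ {y} {x} (λ e → All.lookup x∉ y∈ (sym e)) = select u y∈ g

 select-≤ : ∀ {xs} y → Unique xs → ∀ (g : ℕ → ℕ) → ∑ xs (λ a → δ (y ≡ᵇ a) * g a) ≤ g y
 select-≤ {[]} y u g = z≤n
 select-≤ {x ∷ xs} y (x∉ ∷ u) g with y ≡ᵇ x in e
 ... | false = select-≤ y u g
 ... | true rewrite ≡ᵇ-true {y} e = ≤-reflexive (trans (cong₂ _+_ (+-identityʳ (g x))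
       (∑-zero xs λ z z∈ → cong (λ b → δ b * g z) (false-≡ᵇ (All.lookup x∉ z∈)))) (+-identityʳ (g x)))

 -- The elements of a greedy list, the latest first, were admissible when
 -- they were added.
 data Admissible {X : Set} (ok : List X → X → Bool) (xs : List X) : List X → Set where
   []  : Admissible ok xs []
   add : ∀ {x h} → x ∈ xs → ok h x ≡ true → Admissible ok xs h → Admissible ok xs (x ∷ h)

 module _ {X : Set} (ok : List X → X → Bool) (xs : List X) where

   private
     advance : List X → List X
     advance h = take₁ (filterᵇ (ok h) xs) ++ h

     from : List X → ℕ → List X
     from h m = foldl (λ h (_ : ⊤) → advance h) h (replicate m tt)

     Stuck : List X → Set
     Stuck h = ∀ x → x ∈ xs → ok h x ≡ false

     stuck-fixed : ∀ h m → filterᵇ (ok h) xs ≡ [] → from h m ≡ h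
     stuck-fixed h zero    e = refl
     stuck-fixed h (suc m) e rewrite e = stuck-fixed h m e

     outcome : ∀ h m → Admissible ok xs h → Admissible ok xs (from h m) ×
               (length (from h m) ≡ m + length h ⊎ Stuck (from h m))
     outcome h zero    a = a , inj₁ refl
     outcome h (suc m) a with filterᵇ (ok h) xs in e
     ... | [] = subst (λ z → Admissible ok xs z × (length z ≡ suc m + length h ⊎ Stuck z))
                  (sym (stuck-fixed h m e)) (a , inj₂ (empty-filter e))
     ... | x ∷ _ with ∈-filterᵇ⁻ {xs = xs} (subst (x ∈_) (sym e) (here refl))
     ...   | x∈ , okx with outcome (x ∷ h) m (add x∈ okx a)
     ...     | a′ , inj₁ l = a′ , inj₁ (trans l (+-suc m (length h)))
     ...     | a′ , inj₂ s = a′ , inj₂ s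

   greedy-admissible : ∀ m → Admissible ok xs (greedy ok xs m)
   greedy-admissible m = proj₁ (outcome [] m [])

   -- Once nothing is admissible the list stays the same for ever; before that, every round adds an
   -- element.
   greedy-outcome : ∀ m → length (greedy ok xs m) ≡ m ⊎ (∀ x → x ∈ xs → ok (greedy ok xs m) x ≡ false)
   greedy-outcome m with proj₂ (outcome [] m [])
   ... | inj₁ l = inj₁ (trans l (+-identityʳ m))
   ... | inj₂ s = inj₂ s

-- Costs of sequences, rounding, and repeated visits

module Sequences where

 open PolytimeLists
 open Algorithm
 open Sums
 open Selection

 history-∈ : ∀ {Row Col : Set} (rows : List Row) (cols : List Col) pos neg pos₀ neg₀ m {c} →
   c ∈ proj₂ (Perceptron.plays rows cols pos neg pos₀ neg₀ m) → c ∈ cols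
 history-∈ rows cols pos neg pos₀ neg₀ m = from (0 , []) m λ ()
   where
   open Perceptron rows cols pos neg pos₀ neg₀
   from : ∀ s m → (∀ {c} → c ∈ proj₂ s → c ∈ cols) →
          ∀ {c} → c ∈ proj₂ (foldl (λ s (_ : ⊤) → play s) s (replicate m tt)) → c ∈ cols
   from s zero    ok c∈ = ok c∈
   from s@(t , h) (suc m) ok c∈ = from (play s) m ok′ c∈
     where
     ok′ : ∀ {c} → c ∈ filterᵇ (improving t h) cols ++ h → c ∈ cols
     ok′ c∈ with ∈-++⁻ (filterᵇ (improving t h) cols) c∈
     ... | inj₁ c∈f = proj₁ (∈-filterᵇ⁻ {xs = cols} c∈f)
     ... | inj₂ c∈h = ok c∈h

 -- For `S` without repetitions, the indicator of the arcs that leave `S`.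
 leaving : List ℕ → ℕ → ℕ → ℕ
 leaving S x y = occurrences x S * (1 ∸ occurrences y S)

 record Regret (n M : ℕ) (r : ℕ → ℕ → ℕ) (rank : ℕ → ℕ) : Set where
   field
     triangle : ∀ u v w → r u w ≤ r u v + r v w
     capped   : ∀ u v → r u v ≤ suc M
     depot-r  : ∀ v → r 0 v ≡ suc M
     rank-inj : ∀ {u v} → u ≤ n → v ≤ n → rank u ≡ rank v → u ≡ v
     rank≤n   : ∀ {v} → v ≤ n → rank v ≤ n
     rank-0   : rank 0 ≡ 0

 cost : (ℕ → ℕ → ℕ) → List ℕ → ℕ
 cost g []           = 0
 cost g (x ∷ [])     = 0
 cost g (x ∷ y ∷ ys) = g x y + cost g (y ∷ ys)

 -- The arc that an insertion after `u` destroys; there is none if `u` comes last.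
 hop : (ℕ → ℕ → ℕ) → ℕ → List ℕ → ℕ
 hop g u []      = 0
 hop g u (b ∷ _) = g u b

 cost-∷ : ∀ g u bs → cost g (u ∷ bs) ≡ hop g u bs + cost g bs
 cost-∷ g u []       = refl
 cost-∷ g u (b ∷ bs) = refl

 cost-mono : ∀ {f g} → (∀ x y → f x y ≤ g x y) → ∀ xs → cost f xs ≤ cost g xs
 cost-mono h []           = z≤n
 cost-mono h (x ∷ [])     = z≤n
 cost-mono h (x ∷ y ∷ ys) = +-mono-≤ (h x y) (cost-mono h (y ∷ ys))

 cost-insert : ∀ g as u v bs →
   cost g (as ++ u ∷ v ∷ bs) + hop g u bs ≡ cost g (as ++ u ∷ bs) + (g u v + hop g v bs)
 cost-insert g [] u v bs = trans (cong (λ z → g u v + z + hop g u bs) (cost-∷ g v bs))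
   (trans (lem (g u v) (hop g v bs) (cost g bs) (hop g u bs))
     (cong (_+ (g u v + hop g v bs)) (sym (cost-∷ g u bs))))
   where
   lem : ∀ a b c d → a + (b + c) + d ≡ d + c + (a + b)
   lem = solve-∀
 cost-insert g (a ∷ []) u v bs = trans (+-assoc (g a u) _ _)
   (trans (cong (g a u +_) (cost-insert g [] u v bs)) (sym (+-assoc (g a u) _ _)))
 cost-insert g (a ∷ b ∷ as) u v bs = trans (+-assoc (g a b) _ _)
   (trans (cong (g a b +_) (cost-insert g (b ∷ as) u v bs)) (sym (+-assoc (g a b) _ _)))

 insert-split : ∀ {xs u} v → Unique xs → u ∈ xs → ∃[ as ] ∃[ bs ]
   xs ≡ as ++ u ∷ bs × insert xs (u , v) ≡ as ++ u ∷ v ∷ bs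
 insert-split {xs} {u} v un u∈ with ∈-∃++ u∈
 ... | as , bs , refl rewrite occurrences-unique-∈ un u∈ = as , bs , refl , scan as un
   where
   double : ℕ → List ℕ
   double x = if x ≡ᵇ u then x ∷ v ∷ [] else x ∷ []
   skip : ∀ zs → u ∉ zs → concatMap double zs ≡ zs
   skip []       u∉ = refl
   skip (z ∷ zs) u∉ rewrite false-≡ᵇ {z} {u} (λ e → u∉ (here (sym e))) =
     cong (z ∷_) (skip zs λ u∈ → u∉ (there u∈))
   scan : ∀ as → Unique (as ++ u ∷ bs) → concatMap double (as ++ u ∷ bs) ≡ as ++ u ∷ v ∷ bs
   scan [] (u∉ ∷ _) rewrite true-≡ᵇ {u} refl = cong (λ z → u ∷ v ∷ z) (skip bs λ u∈ → All.lookup u∉ u∈ refl)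
   scan (a ∷ as) (a∉ ∷ un) rewrite false-≡ᵇ {a} {u} (λ e → All.lookup a∉ (∈-++⁺ʳ as (here refl)) e) =
     cong (a ∷_) (scan as un)

 insert-unique : ∀ (as : List ℕ) {u v bs} → v ∉ as ++ u ∷ bs → Unique (as ++ u ∷ bs) → Unique (as ++ u ∷ v ∷ bs)
 insert-unique [] {u} {v} {bs} v∉ (u∉ ∷ un) =
   ((λ { refl → v∉ (here refl) }) ∷ u∉) ∷ All.tabulate (λ {x} x∈ → avoid x∈) ∷ un
   where
   avoid : ∀ {x} → x ∈ bs → v ≢ x
   avoid x∈ refl = v∉ (there x∈)
 insert-unique (a ∷ as) {u} {v} {bs} v∉ (a∉ ∷ un) =
   All.tabulate (λ {x} x∈ → avoid x∈) ∷ insert-unique as (λ z → v∉ (there z)) un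
   where
   avoid : ∀ {x} → x ∈ as ++ u ∷ v ∷ bs → a ≢ x
   avoid x∈ with ∈-++⁻ as x∈
   ... | inj₁ y = All.lookup a∉ (∈-++⁺ˡ y)
   ... | inj₂ (here refl) = All.lookup a∉ (∈-++⁺ʳ as (here {xs = bs} refl))
   ... | inj₂ (there (here refl)) = λ { refl → v∉ (here refl) }
   ... | inj₂ (there (there y)) = All.lookup a∉ (∈-++⁺ʳ as (there {x = u} y))

 insert-∈⁻ : ∀ (as : List ℕ) {u v bs x} → x ∈ as ++ u ∷ v ∷ bs → x ≡ v ⊎ x ∈ as ++ u ∷ bs
 insert-∈⁻ as {u} {v} {bs} x∈ with ∈-++⁻ as x∈
 ... | inj₁ y = inj₂ (∈-++⁺ˡ {xs = as} {ys = u ∷ bs} y)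
 ... | inj₂ (here refl) = inj₂ (∈-++⁺ʳ as (here {xs = bs} refl))
 ... | inj₂ (there (here refl)) = inj₁ refl
 ... | inj₂ (there (there y)) = inj₂ (∈-++⁺ʳ as (there {x = u} y))

 insert-∈⁺ : ∀ (as : List ℕ) {u v bs x} → x ∈ as ++ u ∷ bs → x ∈ as ++ u ∷ v ∷ bs
 insert-∈⁺ as {u} {v} {bs} x∈ with ∈-++⁻ as x∈
 ... | inj₁ y = ∈-++⁺ˡ {xs = as} {ys = u ∷ v ∷ bs} y
 ... | inj₂ (here refl) = ∈-++⁺ʳ as (here {xs = v ∷ bs} refl)
 ... | inj₂ (there y) = ∈-++⁺ʳ as (there {x = u} (there {x = v} y))

 insert-new : ∀ (as : List ℕ) {u v bs} → v ∈ as ++ u ∷ v ∷ bs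
 insert-new as {u} {v} {bs} = ∈-++⁺ʳ as (there {x = u} (here {xs = bs} refl))

 -- The layer-cake formula: a bounded number is the sum of the indicators of its thresholds.
 thresholds : ∀ m w → ∑ (downFrom m) (λ j → δ (j <ᵇ w)) ≡ m ⊓ w
 thresholds zero    w = refl
 thresholds (suc m) w with m <? w
 ... | yes lt rewrite true-<ᵇ lt | thresholds m w | m≤n⇒m⊓n≡m (<⇒≤ lt) | m≤n⇒m⊓n≡m lt = refl
 ... | no  ge with m <ᵇ w in e
 ...   | true  = contradiction (<ᵇ-true e) ge
 ...   | false rewrite thresholds m w | m≥n⇒m⊓n≡n (≮⇒≥ ge) | m≥n⇒m⊓n≡n (m≤n⇒m≤1+n (≮⇒≥ ge)) = refl

 allPairs-split : ∀ {X : Set} {R : X → X → Set} p {v q} → AllPairs R (p ++ v ∷ q) → All (R v) q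
 allPairs-split []      (h ∷ _) = h
 allPairs-split (_ ∷ p) (_ ∷ h) = allPairs-split p h

 record Pieces (n M : ℕ) (r : ℕ → ℕ → ℕ) (ps : List (List ℕ)) : Set where
   field
     short    : All (λ p → (∃[ y ] ∃[ ys ] p ≡ y ∷ ys) × cost r p ≤ M) ps
     inside   : ∀ {v} → v ∈ concat ps → 1 ≤ v × v ≤ n
     distinct : Unique (concat ps)
     complete : ∀ {v} → 1 ≤ v → v ≤ n → v ∈ concat ps

 -- The chains account for 2 * 20 / 9 pieces per path, the tree for
 -- 3 * 200 / 109; what remains is less than M.
 ratio-arithmetic : ∀ {n M} l C S Ω k → M ≡ 20 * suc n → l * suc M ≤ C + Ω → C ≤ S + n →
   9 * S ≤ 20 * (k * suc (M + M) + n + 2) → 109 * Ω ≤ 200 * (3 * (k * M) + 2 * n + 1) → l ≤ 10 * k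
 ratio-arithmetic {n} {M} l C S Ω k M-≡ few chain potential tree = ≤-pred (*-cancelʳ-< (suc M) l (1 + 10 * k)
   -- 981 = 9 * 109 clears both denominators. The flow and the tree together use 9760 / 981 < 10
   -- times `k * M`. The terms linear in `n` are absorbed by the 1 in `1 + 10 * k`, which is worth
   -- `suc M`; this is why `M` is a multiple of `suc n`.
   (*-cancelˡ-< 981 (l * suc M) ((1 + 10 * k) * suc M) (begin-strict
     981 * (l * suc M)      ≤⟨ *-monoʳ-≤ 981 few ⟩
     981 * (C + Ω)          ≤⟨ *-monoʳ-≤ 981 (+-monoˡ-≤ Ω chain) ⟩
     981 * (S + n + Ω)      ≡⟨ eq₁ S Ω n ⟩
     109 * (9 * S) + 9 * (109 * Ω) + 981 * n
       ≤⟨ +-monoˡ-≤ (981 * n) (+-mono-≤ (*-monoʳ-≤ 109 potential) (*-monoʳ-≤ 9 tree)) ⟩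
     109 * (20 * (k * suc (M + M) + n + 2)) + 9 * (200 * (3 * (k * M) + 2 * n + 1)) + 981 * n
       <⟨ m<m+n _ (≤-trans (s≤s z≤n) (m≤n+m 14441 (50 * (k * M) + 7630 * k + 12859 * n))) ⟩
     109 * (20 * (k * suc (M + M) + n + 2)) + 9 * (200 * (3 * (k * M) + 2 * n + 1)) + 981 * n
       + (50 * (k * M) + 7630 * k + 12859 * n + 14441)
       ≡⟨ eq₂ k n M-≡ ⟩
     981 * ((1 + 10 * k) * suc M) ∎)))
   where
   open ≤-Reasoning
   eq₁ : ∀ s o n → 981 * (s + n + o) ≡ 109 * (9 * s) + 9 * (109 * o) + 981 * n
   eq₁ = solve-∀
   eq₂ : ∀ k n {M} → M ≡ 20 * suc n →
         109 * (20 * (k * suc (M + M) + n + 2)) + 9 * (200 * (3 * (k * M) + 2 * n + 1)) + 981 * n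
       + (50 * (k * M) + 7630 * k + 12859 * n + 14441) ≡ 981 * ((1 + 10 * k) * suc M)
   eq₂ k n refl = expand k n
     where
     expand : ∀ k n → 109 * (20 * (k * suc (20 * suc n + 20 * suc n) + n + 2)) + 9 * (200 * (3 * (k * (20 * suc n)) + 2 * n + 1)) + 981 * n
       + (50 * (k * (20 * suc n)) + 7630 * k + 12859 * n + 14441) ≡ 981 * ((1 + 10 * k) * suc (20 * suc n))
     expand = solve-∀

 count-below : ∀ m b (p : ℕ → Bool) → (∀ j → p j ≡ true → j < b) → ∑ (downFrom m) (λ j → δ (p j)) ≤ b
 count-below m b p h = ≤-trans (∑-mono (downFrom m) each) (≤-trans (≤-reflexive (thresholds m b)) (m⊓n≤n m b))
   where
   each : ∀ j → δ (p j) ≤ δ (j <ᵇ b)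
   each j with p j in e
   ... | false = z≤n
   ... | true  = ≤-reflexive (sym (cong δ (true-<ᵇ (h j e))))

 count-above : ∀ m b (p : ℕ → Bool) → (∀ j → j < b → p j ≡ true) → m ⊓ b ≤ ∑ (downFrom m) (λ j → δ (p j))
 count-above m b p h = ≤-trans (≤-reflexive (sym (thresholds m b))) (∑-mono (downFrom m) each)
   where
   each : ∀ j → δ (j <ᵇ b) ≤ δ (p j)
   each j with j <ᵇ b in e
   ... | false = z≤n
   ... | true  = ≤-reflexive (sym (cong δ (h j (<ᵇ-true e))))

 ∑-strict : ∀ {X : Set} {xs : List X} {f g : X → ℕ} {x} → (∀ x → f x ≤ g x) → x ∈ xs → f x < g x →
            ∑ xs f < ∑ xs g
 ∑-strict {xs = _ ∷ xs} h (here refl) lt = +-mono-<-≤ lt (∑-mono xs h)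
 ∑-strict {xs = y ∷ xs} h (there x∈)  lt = +-mono-≤-< (h y) (∑-strict h x∈ lt)

 module Scaling (M R : ℕ) where

   -- The least j ≤ M with M x ≤ j R, if there is one, and suc M otherwise.
   scale : ℕ → ℕ
   scale x = ∑ (downFrom (suc M)) (λ j → δ (j * R <ᵇ M * x))

   scale-≤ : ∀ x → scale x ≤ suc M
   scale-≤ x = ≤-trans (∑-mono (downFrom (suc M)) λ j → δ≤1 _)
     (≤-reflexive (trans (∑-const (downFrom (suc M)) 1) (trans (*-identityʳ _) (length-downFrom (suc M)))))

   scale-mono : ∀ {x y} → x ≤ y → scale x ≤ scale y
   scale-mono {x} {y} h = ∑-mono (downFrom (suc M)) each
     where
     each : ∀ j → δ (j * R <ᵇ M * x) ≤ δ (j * R <ᵇ M * y)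
     each j with j * R <ᵇ M * x in e
     ... | false = z≤n
     ... | true  = ≤-reflexive (sym (cong δ (true-<ᵇ (<-≤-trans (<ᵇ-true {j * R} e) (*-monoʳ-≤ M h)))))

   scale-exceeds : ∀ {x} → scale x ≤ M → M * x ≤ scale x * R
   scale-exceeds {x} h = ≮⇒≥ λ lt → <⇒≱ ≤-refl (≤-trans
     (≤-reflexive (sym (m≥n⇒m⊓n≡n (s≤s h))))
     (count-above (suc M) (suc (scale x)) (λ j → j * R <ᵇ M * x)
       λ j j≤ → true-<ᵇ (≤-<-trans (*-monoˡ-≤ R (≤-pred j≤)) lt)))

   scale-tight : ∀ x → pred (scale x) * R ≤ M * x
   scale-tight x with scale x in e
   ... | zero  = z≤n
   ... | suc b = ≮⇒≥ λ lt → <⇒≱ ≤-refl (≤-trans (≤-reflexive (sym e))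
           (count-below (suc M) b (λ j → j * R <ᵇ M * x)
             λ j p → *-cancelʳ-< R j b (<-trans (<ᵇ-true {j * R} p) lt)))

   -- Below the cap the sum of two roundings is a multiple of `R / M` that is no less than the sum,
   -- so the rounding of the sum cannot exceed it.
   scale-+ : ∀ x y → scale (x + y) ≤ scale x + scale y
   scale-+ x y with scale x ≤? M | scale y ≤? M
   ... | no h | _ = ≤-trans (scale-≤ (x + y)) (≤-trans (≰⇒> h) (m≤m+n (scale x) (scale y)))
   ... | _ | no h = ≤-trans (scale-≤ (x + y)) (≤-trans (≰⇒> h) (m≤n+m (scale y) (scale x)))
   ... | yes hx | yes hy = count-below (suc M) (scale x + scale y) (λ j → j * R <ᵇ M * (x + y))
           λ j p → *-cancelʳ-< R j _ (<-≤-trans (<ᵇ-true {j * R} p)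
             (≤-trans (≤-reflexive (*-distribˡ-+ M x y))
               (≤-trans (+-mono-≤ (scale-exceeds hx) (scale-exceeds hy))
                 (≤-reflexive (sym (*-distribʳ-+ R (scale x) (scale y)))))))

   scale-0 : ∀ {x} → x ≡ 0 → scale x ≡ 0
   scale-0 refl rewrite *-zeroʳ M = ∑-zero (downFrom (suc M)) λ j _ → cong δ (none (j * R))
     where
     none : ∀ m → (m <ᵇ 0) ≡ false
     none zero    = refl
     none (suc m) = refl

   -- Rounding up adds at most one unit per term. If `R` is zero there is no unit to divide by, but
   -- then all the terms vanish.
   scale-sum : ∀ {X : Set} (xs : List X) f c → ∑ xs f ≤ c * R → ∑ xs (λ x → scale (f x)) ≤ c * M + length xs
   scale-sum xs f c h with R ≟ 0
   ... | yes refl = ≤-trans (≤-reflexive (∑-zero xs λ x x∈ → scale-0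
           (n≤0⇒n≡0 (≤-trans (∑-member f x∈) (≤-trans h (≤-reflexive (*-zeroʳ c))))))) z≤n
   ... | no nz = ≤-trans (∑-mono xs λ x → suc-pred-≤ (scale (f x))) (≤-trans (≤-reflexive (∑-+ xs _ (λ _ → 1)))
           (+-mono-≤ most (≤-reflexive (trans (∑-const xs 1) (*-identityʳ _)))))
     where
     suc-pred-≤ : ∀ m → m ≤ pred m + 1
     suc-pred-≤ zero    = z≤n
     suc-pred-≤ (suc m) = ≤-reflexive (+-comm 1 m)
     cancelR : ∀ R → R ≢ 0 → ∀ {a b} → a * R ≤ b * R → a ≤ b
     cancelR zero    nz h = contradiction refl nz
     cancelR (suc R) nz {a} {b} h = *-cancelʳ-≤ a b (suc R) h
     lem : ∀ m c r → m * (c * r) ≡ c * m * r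
     lem = solve-∀
     most : ∑ xs (λ x → pred (scale (f x))) ≤ c * M
     most = cancelR R nz (≤-trans (≤-reflexive (sym (∑-*ʳ xs R _)))
       (≤-trans (∑-mono xs λ x → scale-tight (f x)) (≤-trans (≤-reflexive (∑-*ˡ xs M f))
         (≤-trans (*-monoʳ-≤ M h) (≤-reflexive (lem M c R))))))

 -- g is the regret, D the distance from the depot.
 record Distances (g : ℕ → ℕ → ℕ) (D : ℕ → ℕ) : Set where
   field
     g-triangle : ∀ u v w → g u w ≤ g u v + g v w
     g-turn     : ∀ u v → g u v + 2 * D v ≡ g v u + 2 * D u
     D-depot    : D 0 ≡ 0

 nearer : (ℕ → ℕ) → ℕ → ℕ → Bool
 nearer D u v = (D u <ᵇ D v) ∨ ((D u ≤ᵇ D v) ∧ (u <ᵇ v))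

 record Rounded (n M R : ℕ) (g : ℕ → ℕ → ℕ) (D : ℕ → ℕ) (r : ℕ → ℕ → ℕ) (rank : ℕ → ℕ) : Set where
   field
     distances : Distances g D
     r-≡       : ∀ u v → r u v ≡ (if u ≡ᵇ 0 then suc M else Scaling.scale M R (g u v))
     rank-≡    : ∀ v → rank v ≡ ∑ (downFrom (suc n)) (λ u → δ (nearer D u v))

 edges : List ℕ → List (ℕ × ℕ)
 edges []           = []
 edges (x ∷ [])     = []
 edges (x ∷ y ∷ ys) = (x , y) ∷ edges (y ∷ ys)

 cost-edges : ∀ h xs → cost h xs ≡ ∑ (edges xs) (λ e → h (proj₁ e) (proj₂ e))
 cost-edges h []           = refl
 cost-edges h (x ∷ [])     = refl
 cost-edges h (x ∷ y ∷ ys) = cong (h x y +_) (cost-edges h (y ∷ ys))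

 length-edges : ∀ xs → length (edges xs) ≤ length xs
 length-edges []           = z≤n
 length-edges (x ∷ [])     = z≤n
 length-edges (x ∷ y ∷ ys) = s≤s (length-edges (y ∷ ys))

 cost-+ : ∀ f h xs → cost (λ x y → f x y + h x y) xs ≡ cost f xs + cost h xs
 cost-+ f h []           = refl
 cost-+ f h (x ∷ [])     = refl
 cost-+ f h (x ∷ y ∷ ys) = trans (cong (f x y + h x y +_) (cost-+ f h (y ∷ ys)))
   (lem (f x y) (h x y) (cost f (y ∷ ys)) (cost h (y ∷ ys)))
   where
   lem : ∀ a b c d → a + b + (c + d) ≡ a + c + (b + d)
   lem = solve-∀

 cost-join : ∀ h x xs y ys → ∃[ z ] z ∈ x ∷ xs ×
   cost h ((x ∷ xs) ++ y ∷ ys) ≡ cost h (x ∷ xs) + (h z y + cost h (y ∷ ys))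
 cost-join h x []       y ys = x , here refl , refl
 cost-join h x (w ∷ xs) y ys with cost-join h w xs y ys
 ... | z , z∈ , e = z , there z∈ , trans (cong (h x w +_) e) (sym (+-assoc (h x w) _ _))

 cost-parts : ∀ h xs ys → cost h xs + cost h ys ≤ cost h (xs ++ ys)
 cost-parts h []       ys = ≤-refl
 cost-parts h (x ∷ xs) [] = ≤-reflexive (trans (+-identityʳ _) (cong (cost h) (sym (++-identityʳ (x ∷ xs)))))
 cost-parts h (x ∷ xs) (y ∷ ys) with cost-join h x xs y ys
 ... | z , _ , e = ≤-trans (+-monoʳ-≤ (cost h (x ∷ xs)) (m≤n+m _ (h z y))) (≤-reflexive (sym e))

 cost-through : ∀ h as m bs → cost h (as ++ m ∷ bs) ≡ cost h (as ++ m ∷ []) + cost h (m ∷ bs)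
 cost-through h []           m bs = refl
 cost-through h (a ∷ [])     m bs = cong (_+ cost h (m ∷ bs)) (sym (+-identityʳ (h a m)))
 cost-through h (a ∷ b ∷ as) m bs = trans (cong (h a b +_) (cost-through h (b ∷ as) m bs)) (sym (+-assoc (h a b) _ _))

 cost-snoc : ∀ h xs y z → cost h ((xs ++ y ∷ []) ++ z ∷ []) ≡ cost h (xs ++ y ∷ []) + h y z
 cost-snoc h []           y z = +-comm (h y z) 0
 cost-snoc h (x ∷ [])     y z = cong₂ _+_ (sym (+-identityʳ (h x y))) (+-identityʳ (h y z))
 cost-snoc h (x ∷ w ∷ xs) y z = trans (cong (h x w +_) (cost-snoc h (w ∷ xs) y z)) (sym (+-assoc (h x w) _ _))

 cost-reverse : ∀ h as m → cost h (m ∷ reverse as) ≡ cost (flip h) (as ++ m ∷ [])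
 cost-reverse h as m = trans (cong (cost h) (trans (cong (m ∷_) refl) (sym (reverse-snoc as m)))) (reversed (as ++ m ∷ []))
   where
   reverse-snoc : ∀ as m → reverse (as ++ m ∷ []) ≡ m ∷ reverse as
   reverse-snoc as m = reverse-++ as (m ∷ [])
   reversed : ∀ xs → cost h (reverse xs) ≡ cost (flip h) xs
   reversed []           = refl
   reversed (x ∷ [])     = refl
   reversed (x ∷ y ∷ ys) = begin
     cost h (reverse (x ∷ y ∷ ys))                   ≡⟨ cong (cost h) (trans (unfold-reverse x (y ∷ ys)) (cong (_++ x ∷ []) (unfold-reverse y ys))) ⟩
     cost h ((reverse ys ++ y ∷ []) ++ x ∷ [])       ≡⟨ cost-snoc h (reverse ys) y x ⟩
     cost h (reverse ys ++ y ∷ []) + h y x           ≡⟨ cong (_+ h y x) (trans (cong (cost h) (sym (unfold-reverse y ys))) (reversed (y ∷ ys))) ⟩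
     cost (flip h) (y ∷ ys) + h y x                  ≡⟨ +-comm _ (h y x) ⟩
     h y x + cost (flip h) (y ∷ ys)                  ∎
     where open ≡-Reasoning

 cost-skip : ∀ {h} → (∀ u v w → h u w ≤ h u v + h v w) → ∀ x ys zs → cost h (x ∷ zs) ≤ cost h (x ∷ ys ++ zs)
 cost-skip tri x []       zs = ≤-refl
 cost-skip {h} tri x (y ∷ ys) zs = ≤-trans (detour-≤ zs) (+-monoʳ-≤ (h x y) (cost-skip tri y ys zs))
   where
   detour-≤ : ∀ zs → cost h (x ∷ zs) ≤ h x y + cost h (y ∷ zs)
   detour-≤ []       = z≤n
   detour-≤ (z ∷ zs) = ≤-trans (+-monoˡ-≤ _ (tri x y z)) (≤-reflexive (+-assoc (h x y) (h y z) _))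

 -- The arcs of a path m ∷ ss, directed towards m, and those which lead
 -- from v to m.
 climbs : ℕ → List ℕ → List (ℕ × ℕ)
 climbs m []       = []
 climbs m (s ∷ ss) = (s , m) ∷ climbs s ss

 climb : ℕ → List ℕ → ℕ → List (ℕ × ℕ)
 climb m []       v = []
 climb m (s ∷ ss) v = if member v (s ∷ ss) then (s , m) ∷ climb s ss v else []

 climb≼ : ∀ m ss v → climb m ss v ≼ climbs m ss
 climb≼ m []       v f = z≤n
 climb≼ m (s ∷ ss) v f with member v (s ∷ ss)
 ... | true  = +-monoʳ-≤ (f (s , m)) (climb≼ s ss v f)
 ... | false = z≤n

 climb-∉ : ∀ m ss {v} → v ∉ ss → climb m ss v ≡ []
 climb-∉ m []       v∉ = refl
 climb-∉ m (s ∷ ss) {v} v∉ rewrite ∉-member {v} {s ∷ ss} v∉ = refl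

 climbs-cost : ∀ h m ss → ∑ (climbs m ss) (λ e → h (proj₁ e) (proj₂ e)) ≡ cost (flip h) (m ∷ ss)
 climbs-cost h m []       = refl
 climbs-cost h m (s ∷ ss) = cong (h s m +_) (climbs-cost h s ss)

 climbs-sources : ∀ m ss → map proj₁ (climbs m ss) ≡ ss
 climbs-sources m []       = refl
 climbs-sources m (s ∷ ss) = cong (s ∷_) (climbs-sources s ss)

 climbs-∈ : ∀ m ss {x y} → (x , y) ∈ climbs m ss → x ∈ m ∷ ss × y ∈ m ∷ ss
 climbs-∈ m (s ∷ ss) (here refl) = there (here refl) , here refl
 climbs-∈ m (s ∷ ss) (there e∈) with climbs-∈ s ss e∈
 ... | x∈ , y∈ = there x∈ , there y∈

 -- `climb m ss v` is a path from `v` to `m`: as many arcs enter a vertex as leave it, apart from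
 -- the two ends, for which the additional terms stand.
 climb-balance : ∀ m ss {v} → Unique ss → v ∈ ss → ∀ a →
   ∑ (climb m ss v) (λ e → δ (proj₂ e ≡ᵇ a)) + δ (v ≡ᵇ a) ≡ ∑ (climb m ss v) (λ e → δ (proj₁ e ≡ᵇ a)) + δ (m ≡ᵇ a)
 climb-balance m (s ∷ ss) {v} (s∉ ∷ un) v∈ a rewrite ∈-member {v} {s ∷ ss} v∈ = step-up v∈
   where
   lem : ∀ a b c → a + b + c ≡ a + (b + c)
   lem = solve-∀
   lem′ : ∀ m x s → m + (x + s) ≡ s + x + m
   lem′ = solve-∀
   step-up : v ∈ s ∷ ss →
     δ (m ≡ᵇ a) + ∑ (climb s ss v) (λ e → δ (proj₂ e ≡ᵇ a)) + δ (v ≡ᵇ a) ≡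
     δ (s ≡ᵇ a) + ∑ (climb s ss v) (λ e → δ (proj₁ e ≡ᵇ a)) + δ (m ≡ᵇ a)
   step-up (here refl) rewrite climb-∉ s ss (λ v∈ss → All.lookup s∉ v∈ss refl) =
     trans (lem (δ (m ≡ᵇ a)) 0 (δ (s ≡ᵇ a))) (lem′ (δ (m ≡ᵇ a)) 0 (δ (s ≡ᵇ a)))
   step-up (there v∈ss) = trans (lem (δ (m ≡ᵇ a)) _ _)
     (trans (cong (δ (m ≡ᵇ a) +_) (climb-balance s ss un v∈ss a)) (lem′ (δ (m ≡ᵇ a)) _ (δ (s ≡ᵇ a))))

 occurrences-Unique : ∀ {xs} → (∀ v → occurrences v xs ≤ 1) → Unique xs
 occurrences-Unique {[]}     h = []
 occurrences-Unique {x ∷ xs} h = All.tabulate (λ { {y} y∈ refl →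
     contradiction (≤-trans (+-mono-≤ (≤-reflexive (sym (cong δ (true-≡ᵇ {x} refl)))) (occurrences-∈ y∈)) (h x)) λ { (s≤s ()) } })
   ∷ occurrences-Unique λ v → ≤-trans (m≤n+m _ (δ (x ≡ᵇ v))) (h v)

 unique-by : ∀ {X : Set} (f : X → ℕ) xs → (∀ v → ∑ xs (λ x → δ (f x ≡ᵇ v)) ≤ 1) → Unique xs
 unique-by f xs h = AllPairs.map (λ ne → λ { refl → ne refl }) (AllPairs.map⁻
   (occurrences-Unique {map f xs} λ v → ≤-trans (≤-reflexive (∑-map f xs (λ x → δ (x ≡ᵇ v)))) (h v)))

 edges-∈ : ∀ xs {x y} → (x , y) ∈ edges xs → x ∈ xs × y ∈ xs
 edges-∈ (x ∷ y ∷ ys) (here refl) = here refl , there (here refl)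
 edges-∈ (x ∷ y ∷ ys) (there e∈) with edges-∈ (y ∷ ys) e∈
 ... | a , b = there a , there b

 edges-targets : ∀ x xs v → ∑ (edges (x ∷ xs)) (λ e → δ (proj₂ e ≡ᵇ v)) ≡ occurrences v xs
 edges-targets x []       v = refl
 edges-targets x (y ∷ ys) v = cong (δ (y ≡ᵇ v) +_) (edges-targets y ys v)

 edges-sources : ∀ x xs v → ∑ (edges (x ∷ xs)) (λ e → δ (proj₁ e ≡ᵇ v)) ≤ δ (x ≡ᵇ v) + occurrences v xs
 edges-sources x []       v = z≤n
 edges-sources x (y ∷ ys) v = +-monoʳ-≤ (δ (x ≡ᵇ v)) (edges-sources y ys v)

 length-∑ : ∀ {X Y : Set} (f : X → List Y) xs → length (concatMap f xs) ≡ ∑ xs (λ x → length (f x))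
 length-∑ f []       = refl
 length-∑ f (x ∷ xs) = trans (length-++ (f x)) (cong (length (f x) +_) (length-∑ f xs))

 δ-∧ : ∀ a b → δ (a ∧ b) ≡ δ a * δ b
 δ-∧ true  b = sym (+-identityʳ (δ b))
 δ-∧ false b = refl

 module _ {X : Set} where

   nth-0-∈ : ∀ {d : X} {xs x} → x ∈ xs → nth d xs 0 ∈ xs
   nth-0-∈ (here _)  = here refl
   nth-0-∈ (there _) = here refl

 module Best (f : ℕ → List (List ℕ)) (m : ℕ) (S₀ : List (List ℕ))
   (S₀-≡ : S₀ ≡ nth [] (filterᵇ (λ S → every (λ S′ → length S ≤ᵇ length S′) (map f (downFrom (suc m)))) (map f (downFrom (suc m)))) 0) where

   private
     candidates : List (List (List ℕ))
     candidates = map f (downFrom (suc m))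

     shortest : List (List ℕ) → Bool
     shortest S = every (λ S′ → length S ≤ᵇ length S′) candidates

     candidate : ∀ {k} → k ≤ m → f k ∈ candidates
     candidate h = ∈-map⁺ f (∈-downFrom⁺ (s≤s h))

     S₀∈ : S₀ ∈ filterᵇ shortest candidates
     S₀∈ with argmin (λ _ → true) length candidates (candidate {m} ≤-refl) refl
     ... | S , S∈ , _ , _ , least = subst (_∈ filterᵇ shortest candidates) (sym S₀-≡)
       (nth-0-∈ (∈-filterᵇ⁺ {p = shortest} {xs = candidates} S∈ (true-every candidates λ S′ S′∈ → true-≤ᵇ {length S} (least S′ S′∈ refl))))

   best-attempt : ∃[ k ] S₀ ≡ f k
   best-attempt with ∈-map⁻ f (proj₁ (∈-filterᵇ⁻ {p = shortest} {xs = candidates} S₀∈))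
   ... | k , _ , e = k , e

   best-least : ∀ k → k ≤ m → length S₀ ≤ length (f k)
   best-least k h = ≤ᵇ-true {length S₀} (every-true {p = λ S′ → length S₀ ≤ᵇ length S′} {candidates}
     (proj₂ (∈-filterᵇ⁻ {p = shortest} {xs = candidates} S₀∈)) (candidate h))

   best-ratio : ∀ {k l} → k ≡ l → l ≤ m → length (f k) ≤ 10 * k → length S₀ ≤ 10 * l
   best-ratio {k} refl h bound = ≤-trans (best-least k h) bound

 unique-parts : ∀ {X : Set} {xs ys : List X} → Unique (xs ++ ys) → Unique xs × Unique ys × (∀ {v} → v ∈ xs → v ∉ ys)
 unique-parts {xs = []} u = [] , u , λ ()
 unique-parts {xs = x ∷ xs} (x∉ ∷ u) with unique-parts {xs = xs} u
 ... | ux , uy , disjoint = All.tabulate (λ v∈ → All.lookup x∉ (∈-++⁺ˡ v∈)) ∷ ux , uy ,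
   λ { (here refl) v∈ → All.lookup x∉ (∈-++⁺ʳ xs v∈) refl ; (there h) v∈ → disjoint h v∈ }

 unique-++ : ∀ {X : Set} {xs ys : List X} → Unique xs → Unique ys → (∀ {v} → v ∈ xs → v ∉ ys) → Unique (xs ++ ys)
 unique-++ ux uy disjoint = Unique.++⁺ ux uy λ (a , b) → disjoint a b

 -- Given paths may share customers, whereas the linear program wants each customer once. All visits
 -- but the first are skipped, which by the triangle inequality does not raise the regret; a path
 -- that becomes empty is kept, so that the number of paths is unchanged.
 unvisited : List ℕ → List (List ℕ) → List (List ℕ)
 unvisited seen []       = []
 unvisited seen (p ∷ ps) = filterᵇ (λ v → not (member v seen)) p ∷ unvisited (seen ++ p) ps

 unvisited-length : ∀ seen ps → length (unvisited seen ps) ≡ length ps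
 unvisited-length seen []       = refl
 unvisited-length seen (p ∷ ps) = cong suc (unvisited-length (seen ++ p) ps)

 unvisited-∈ : ∀ seen ps {v} → v ∈ concat (unvisited seen ps) → v ∉ seen × v ∈ concat ps
 unvisited-∈ seen (p ∷ ps) {v} v∈ with ∈-++⁻ (filterᵇ (λ v → not (member v seen)) p) v∈
 ... | inj₁ a with ∈-filterᵇ⁻ {xs = p} a
 ...   | v∈p , e = (λ v∈s → contradiction (trans (sym e) (cong not (∈-member v∈s))) λ ()) , ∈-++⁺ˡ v∈p
 unvisited-∈ seen (p ∷ ps) {v} v∈ | inj₂ b with unvisited-∈ (seen ++ p) ps b
 ...   | ∉ , ∈ps = (λ v∈s → ∉ (∈-++⁺ˡ v∈s)) , ∈-++⁺ʳ p ∈ps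

 unvisited-complete : ∀ seen ps {v} → v ∈ concat ps → v ∈ seen ⊎ v ∈ concat (unvisited seen ps)
 unvisited-complete seen (p ∷ ps) {v} v∈ with ∈-++⁻ p v∈
 ... | inj₁ v∈p with member v seen in e
 ...   | true  = inj₁ (member-∈ seen e)
 ...   | false = inj₂ (∈-++⁺ˡ (∈-filterᵇ⁺ {xs = p} v∈p (cong not e)))
 unvisited-complete seen (p ∷ ps) {v} v∈ | inj₂ v∈ps with unvisited-complete (seen ++ p) ps v∈ps
 ...   | inj₂ b = inj₂ (∈-++⁺ʳ (filterᵇ (λ v → not (member v seen)) p) b)
 ...   | inj₁ a with ∈-++⁻ seen a
 ...     | inj₁ v∈s = inj₁ v∈s
 ...     | inj₂ v∈p with member v seen in e
 ...       | true  = inj₁ (member-∈ seen e)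
 ...       | false = inj₂ (∈-++⁺ˡ (∈-filterᵇ⁺ {xs = p} v∈p (cong not e)))

 unvisited-unique : ∀ seen ps → All Unique ps → Unique (concat (unvisited seen ps))
 unvisited-unique seen []       []       = []
 unvisited-unique seen (p ∷ ps) (u ∷ us) = unique-++ (Unique.filter⁺ _ u) (unvisited-unique (seen ++ p) ps us)
   λ v∈ v∈′ → proj₁ (unvisited-∈ (seen ++ p) ps v∈′) (∈-++⁺ʳ seen (proj₁ (∈-filterᵇ⁻ {xs = p} v∈)))

 module _ {h : ℕ → ℕ → ℕ} (tri : ∀ u v w → h u w ≤ h u v + h v w) (keep : ℕ → Bool) where

   private
     cost-tail : ∀ x ys → cost h (x ∷ filterᵇ keep ys) ≤ cost h (x ∷ ys)
     cost-tail x []       = z≤n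
     cost-tail x (y ∷ ys) with keep y
     ... | true  = +-monoʳ-≤ (h x y) (cost-tail y ys)
     ... | false = ≤-trans (cost-tail x ys) (cost-skip {h} tri x (y ∷ []) ys)

   cost-filter : ∀ xs → cost h (filterᵇ keep xs) ≤ cost h xs
   cost-filter []       = z≤n
   cost-filter (x ∷ xs) with keep x
   ... | true  = cost-tail x xs
   ... | false = ≤-trans (cost-filter xs) (≤-trans (m≤n+m _ (hop h x xs)) (≤-reflexive (sym (cost-∷ h x xs))))

 unvisited-cost : ∀ {h : ℕ → ℕ → ℕ} (tri : ∀ u v w → h u w ≤ h u v + h v w) {R} seen ps →
   All (λ p → cost h p ≤ R) ps → All (λ p → cost h p ≤ R) (unvisited seen ps)
 unvisited-cost tri seen []       []       = []
 unvisited-cost tri seen (p ∷ ps) (c ∷ cs) =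
   ≤-trans (cost-filter tri (λ v → not (member v seen)) p) c ∷ unvisited-cost tri (seen ++ p) ps cs

-- Comparison of binary numbers

module BinaryNumbers where

 open Polytime
 open PolytimeLists
 open Algorithm
 open AlgorithmPolytime
 open Sums
 open Selection
 open Sequences
 open import Relation.Binary.Definitions using (tri<; tri≈; tri>)

 open PT
 open Poly

 -- Binary numbers are represented by lists of exponents, such that no
 -- carries are needed to add and multiply them.
 value : List ℕ → ℕ
 value xs = ∑ xs (λ e → 2 ^ e)

 product-of : List ℕ → List ℕ → List ℕ
 product-of xs ys = concatMap (λ x → map (λ y → x + y) ys) xs

 multiple : ℕ → List ℕ → List ℕ
 multiple m xs = concatMap (λ _ → xs) (replicate m tt)

 value-++ : ∀ xs ys → value (xs ++ ys) ≡ value xs + value ys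
 value-++ xs ys = ∑-++ xs ys _

 value-product : ∀ xs ys → value (product-of xs ys) ≡ value xs * value ys
 value-product xs ys = trans (∑-concatMap (λ x → map (λ y → x + y) ys) xs _)
   (trans (∑-cong xs λ x → trans (∑-map (λ y → x + y) ys _)
     (trans (∑-cong ys λ y → ^-distribˡ-+-* 2 x y) (∑-*ˡ ys (2 ^ x) _))) (∑-*ʳ xs (value ys) _))

 value-multiple : ∀ m xs → value (multiple m xs) ≡ m * value xs
 value-multiple zero    xs = refl
 value-multiple (suc m) xs = trans (∑-++ xs (multiple m xs) _) (cong (value xs +_) (value-multiple m xs))

 -- Comparison, starting with the least significant digits; at most one of
 -- the two carries is not zero.
 carry : List ℕ → List ℕ → ℕ × ℕ → ℕ → ℕ × ℕ
 carry xs ys (c , d) i =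
   ⌈ (c + occurrences i xs) ∸ (d + occurrences i ys) /2⌉ ,
   ⌊ (d + occurrences i ys) ∸ (c + occurrences i xs) /2⌋

 carries : List ℕ → List ℕ → ℕ × ℕ
 -- The sum of all exponents is no less than any of them, so no digit is missed; it is polynomial,
 -- exponents being written in unary.
 carries xs ys = foldl (carry xs ys) (0 , 0) (reverse (downFrom (suc (∑ xs id + ∑ ys id))))

 at-most : List ℕ → List ℕ → Bool
 at-most xs ys = proj₁ (carries xs ys) ≤ᵇ proj₂ (carries xs ys)

 less : List ℕ → List ℕ → Bool
 less xs ys = not (at-most ys xs)

 private
   -- The part of the value at the digits from `i` on, divided by `2 ^ i`: what is still to be
   -- compared when the lower digits have become carries.
   above : ℕ → List ℕ → ℕ
   above i xs = ∑ xs (λ e → if i ≤ᵇ e then 2 ^ (e ∸ i) else 0)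

   above-step : ∀ i xs → above i xs ≡ occurrences i xs + 2 * above (suc i) xs
   above-step i xs = trans (∑-cong xs each) (trans (∑-+ xs _ _) (cong (occurrences i xs +_) (∑-*ˡ xs 2 _)))
     where
     each : ∀ e → (if i ≤ᵇ e then 2 ^ (e ∸ i) else 0) ≡ δ (e ≡ᵇ i) + 2 * (if i <ᵇ e then 2 ^ (e ∸ suc i) else 0)
     each e with <-cmp e i
     ... | tri< lt ne _ with i ≤ᵇ e in p | i <ᵇ e in q
     ...   | true  | _     = contradiction (≤ᵇ-true {i} p) (<⇒≱ lt)
     ...   | false | true  = contradiction (<ᵇ-true {i} q) (<⇒≯ lt)
     ...   | false | false rewrite false-≡ᵇ ne = refl
     each e | tri≈ _ refl _ rewrite true-≡ᵇ {e} refl | true-≤ᵇ {e} ≤-refl | n∸n≡0 e with e <ᵇ e in q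
     ...   | true  = contradiction (<ᵇ-true {e} q) (<-irrefl refl)
     ...   | false = refl
     each e | tri> _ ne lt rewrite false-≡ᵇ ne | true-≤ᵇ {i} {e} (<⇒≤ lt) | true-<ᵇ {i} {e} lt =
       cong (2 ^_) (trans (cong (_∸ i) (sym (m+[n∸m]≡n lt))) (m+n∸m≡n′ (e ∸ suc i)))
       where
       m+n∸m≡n′ : ∀ k → suc i + k ∸ i ≡ suc k
       m+n∸m≡n′ k = trans (cong (_∸ i) (sym (+-suc i k))) (m+n∸m≡n i (suc k))

   above-end : ∀ N xs → ∑ xs id < N → above N xs ≡ 0
   above-end N xs lt = ∑-zero xs λ e e∈ → outside e (≤-<-trans (∑-member id e∈) lt)
     where
     outside : ∀ e → e < N → (if N ≤ᵇ e then 2 ^ (e ∸ N) else 0) ≡ 0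
     outside e lt with N ≤ᵇ e in p
     ... | true  = contradiction (≤ᵇ-true {N} p) (<⇒≱ lt)
     ... | false = refl

   halves : ∀ m → m ≡ ⌊ m /2⌋ + ⌈ m /2⌉
   halves m = sym (⌊n/2⌋+⌈n/2⌉≡n m)

   half-≤ : ∀ m → ⌈ m /2⌉ ≤ suc ⌊ m /2⌋
   half-≤ zero          = z≤n
   half-≤ (suc zero)    = s≤s z≤n
   half-≤ (suc (suc m)) = s≤s (half-≤ m)

   double-cancel : ∀ {a b} → 2 * a ≤ suc (2 * b) → a ≤ b
   double-cancel {a} {b} h = ≮⇒≥ λ lt → <⇒≱ (≤-refl {suc (suc (2 * b))})
     (≤-trans (≤-reflexive (lem b)) (≤-trans (*-monoʳ-≤ 2 lt) h))
     where
     lem : ∀ b → suc (suc (2 * b)) ≡ 2 * suc b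
     lem = solve-∀

   -- The hypothesis says that `X - Y` is at most half of `b - a`. As `X - Y` is an integer this
   -- half may be rounded down; accordingly a surplus of `a` is rounded up and one of `b` down.
   down : ∀ a b X Y → a + 2 * X ≤ b + 2 * Y → ⌈ a ∸ b /2⌉ + X ≤ ⌊ b ∸ a /2⌋ + Y
   down a b X Y h with ≤-total a b
   ... | inj₁ a≤b with m≤n⇒∃[o]m+o≡n a≤b
   ...   | e , refl rewrite m≤n⇒m∸n≡0 a≤b | m+n∸m≡n a e = double-cancel
           (≤-trans (+-cancelˡ-≤ a _ _ (≤-trans h (≤-reflexive (+-assoc a e (2 * Y)))))
             (≤-trans (+-monoˡ-≤ (2 * Y) (≤-trans (≤-reflexive (halves e)) (+-monoʳ-≤ ⌊ e /2⌋ (half-≤ e))))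
               (≤-reflexive (lem ⌊ e /2⌋ Y))))
     where
     lem : ∀ f Y → f + suc f + 2 * Y ≡ suc (2 * (f + Y))
     lem = solve-∀
   down a b X Y h | inj₂ b≤a with m≤n⇒∃[o]m+o≡n b≤a
   ... | e , refl rewrite m≤n⇒m∸n≡0 b≤a | m+n∸m≡n b e = double-cancel
           (≤-trans (≤-reflexive (lem ⌈ e /2⌉ X)) (≤-trans (+-monoˡ-≤ (2 * X)
             (≤-trans (+-monoʳ-≤ ⌈ e /2⌉ (half-≤ e)) (≤-reflexive (trans (+-suc ⌈ e /2⌉ ⌊ e /2⌋)
               (cong suc (trans (+-comm ⌈ e /2⌉ ⌊ e /2⌋) (sym (halves e))))))))
             (s≤s (+-cancelˡ-≤ b _ _ (≤-trans (≤-reflexive (sym (+-assoc b e (2 * X)))) h)))))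
     where
     lem : ∀ c X → 2 * (c + X) ≡ c + c + 2 * X
     lem = solve-∀

   up : ∀ a b X Y → ⌈ a ∸ b /2⌉ + X ≤ ⌊ b ∸ a /2⌋ + Y → a + 2 * X ≤ b + 2 * Y
   up a b X Y h with ≤-total a b
   ... | inj₁ a≤b with m≤n⇒∃[o]m+o≡n a≤b
   ...   | e , refl rewrite m≤n⇒m∸n≡0 a≤b | m+n∸m≡n a e =
           ≤-trans (+-monoʳ-≤ a (≤-trans (*-monoʳ-≤ 2 h) (≤-trans (≤-reflexive (lem ⌊ e /2⌋ Y))
             (+-monoˡ-≤ (2 * Y) (≤-trans (+-monoʳ-≤ ⌊ e /2⌋ (⌊n/2⌋≤⌈n/2⌉ e)) (≤-reflexive (sym (halves e))))))))
             (≤-reflexive (sym (+-assoc a e (2 * Y))))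
     where
     lem : ∀ f Y → 2 * (f + Y) ≡ f + f + 2 * Y
     lem = solve-∀
   up a b X Y h | inj₂ b≤a with m≤n⇒∃[o]m+o≡n b≤a
   ... | e , refl rewrite m≤n⇒m∸n≡0 b≤a | m+n∸m≡n b e =
           ≤-trans (≤-reflexive (+-assoc b e (2 * X))) (+-monoʳ-≤ b (≤-trans
             (+-monoˡ-≤ (2 * X) (≤-trans (≤-reflexive (halves e)) (+-monoˡ-≤ ⌈ e /2⌉ (⌊n/2⌋≤⌈n/2⌉ e))))
             (≤-trans (≤-reflexive (lem ⌈ e /2⌉ X)) (*-monoʳ-≤ 2 h))))
     where
     lem : ∀ c X → c + c + 2 * X ≡ 2 * (c + X)
     lem = solve-∀

   module Carries (xs ys : List ℕ) where

     after : ℕ → ℕ × ℕ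
     after m = foldl (carry xs ys) (0 , 0) (reverse (downFrom m))

     after-suc : ∀ m → after (suc m) ≡ carry xs ys (after m) m
     after-suc m = trans (cong (foldl (carry xs ys) (0 , 0)) (unfold-reverse m (downFrom m)))
       (foldl-++ (carry xs ys) (0 , 0) (reverse (downFrom m)) (m ∷ []))

     -- At 0 this compares the values, and beyond the last digit it compares the carries alone; each
     -- digit leads to an equivalent statement.
     Holds≤ : ℕ → Set
     Holds≤ m = proj₁ (after m) + above m xs ≤ proj₂ (after m) + above m ys

     regroup : ∀ m c zs → c + above m zs ≡ (c + occurrences m zs) + 2 * above (suc m) zs
     regroup m c zs = trans (cong (c +_) (above-step m zs)) (sym (+-assoc c _ _))

     forward : ∀ m → value xs ≤ value ys → Holds≤ m
     forward zero    h = h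
     forward (suc m) h rewrite after-suc m = down (proj₁ (after m) + occurrences m xs) (proj₂ (after m) + occurrences m ys) (above (suc m) xs) (above (suc m) ys)
       (subst₂ _≤_ (regroup m (proj₁ (after m)) xs) (regroup m (proj₂ (after m)) ys) (forward m h))

     backward : ∀ m → Holds≤ m → value xs ≤ value ys
     backward zero    h = h
     backward (suc m) h rewrite after-suc m = backward m
       (subst₂ _≤_ (sym (regroup m (proj₁ (after m)) xs)) (sym (regroup m (proj₂ (after m)) ys)) (up (proj₁ (after m) + occurrences m xs) (proj₂ (after m) + occurrences m ys) (above (suc m) xs) (above (suc m) ys) h))

 at-most-≡ : ∀ xs ys → at-most xs ys ≡ (value xs ≤ᵇ value ys)
 at-most-≡ xs ys = agree (at-most xs ys) (value xs ≤ᵇ value ys)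
   (λ e → true-≤ᵇ {value xs} (backward N (final⁻ (≤ᵇ-true {proj₁ (after N)} e))))
   (λ e → true-≤ᵇ {proj₁ (after N)} (final⁺ (forward N (≤ᵇ-true {value xs} e))))
   where
   open Carries xs ys
   N : ℕ
   N = suc (∑ xs id + ∑ ys id)
   end-x : above N xs ≡ 0
   end-x = above-end N xs (s≤s (m≤m+n _ _))
   end-y : above N ys ≡ 0
   end-y = above-end N ys (s≤s (m≤n+m _ (∑ xs id)))
   final⁻ : proj₁ (after N) ≤ proj₂ (after N) → Holds≤ N
   final⁻ h rewrite end-x | end-y = +-monoˡ-≤ 0 h
   final⁺ : Holds≤ N → proj₁ (after N) ≤ proj₂ (after N)
   final⁺ h rewrite end-x | end-y = +-cancelʳ-≤ 0 _ _ h
   agree : ∀ a b → (a ≡ true → b ≡ true) → (b ≡ true → a ≡ true) → a ≡ b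
   agree true  true  _ _ = refl
   agree false false _ _ = refl
   agree true  false f _ with f refl
   ... | ()
   agree false true  _ g with g refl
   ... | ()

 less-≡ : ∀ xs ys → less xs ys ≡ (value xs <ᵇ value ys)
 less-≡ xs ys = trans (cong not (at-most-≡ ys xs)) (lem (value ys) (value xs))
   where
   lem : ∀ a b → not (a ≤ᵇ b) ≡ (b <ᵇ a)
   lem zero          b       = lem₀ b
     where
     lem₀ : ∀ b → false ≡ (b <ᵇ 0)
     lem₀ zero    = refl
     lem₀ (suc b) = refl
   lem (suc a)       zero    = refl
   lem (suc zero)    (suc b) = lem zero b
   lem (suc (suc a)) (suc b) = lem (suc a) b

 -- The least significant digit comes first.
 exponents : List ℕ → List ℕ
 exponents bs = concatMap (λ i → if nth 0 bs i ≡ᵇ 1 then i ∷ [] else []) (downFrom (length bs))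

 binary : List ℕ → ℕ
 binary []       = 0
 binary (b ∷ bs) = δ (b ≡ᵇ 1) + 2 * binary bs

 ∑-shift : ∀ m f → ∑ (downFrom (suc m)) f ≡ f 0 + ∑ (downFrom m) (λ i → f (suc i))
 ∑-shift zero    f = refl
 ∑-shift (suc m) f = trans (cong (f (suc m) +_) (∑-shift m f)) (lem (f (suc m)) (f 0) _)
   where
   lem : ∀ a b c → a + (b + c) ≡ b + (a + c)
   lem = solve-∀

 value-exponents : ∀ bs → value (exponents bs) ≡ binary bs
 value-exponents bs = trans (∑-concatMap (λ i → if nth 0 bs i ≡ᵇ 1 then i ∷ [] else []) (downFrom (length bs)) _)
   (trans (∑-cong (downFrom (length bs)) λ i → lem (nth 0 bs i ≡ᵇ 1) i) (digits bs))
   where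
   lem : ∀ b i → ∑ (if b then i ∷ [] else []) (λ e → 2 ^ e) ≡ δ b * 2 ^ i
   lem true  i = refl
   lem false i = refl
   double : ∀ a b → a * (2 * b) ≡ 2 * (a * b)
   double = solve-∀
   digits : ∀ bs → ∑ (downFrom (length bs)) (λ i → δ (nth 0 bs i ≡ᵇ 1) * 2 ^ i) ≡ binary bs
   digits []       = refl
   digits (b ∷ bs) = trans (∑-shift (length bs) _) (cong₂ _+_ (*-identityʳ (δ (b ≡ᵇ 1)))
     (trans (∑-cong (downFrom (length bs)) λ i → double (δ (nth 0 bs i ≡ᵇ 1)) (2 ^ i))
       (trans (∑-*ˡ (downFrom (length bs)) 2 _) (cong (2 *_) (digits bs)))))

 module _ {G : Set} ⦃ _ : Enc G ⦄ where

   private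
     half-sum : ∀ m → ∑ (downFrom m) (λ h → δ (suc (h + h) <ᵇ m)) ≡ ⌊ m /2⌋
     half-sum m = ≤-antisym
       (count-below m ⌊ m /2⌋ (λ h → suc (h + h) <ᵇ m) λ j e → half-< j m (<ᵇ-true {suc (j + j)} e))
       (≤-trans (≤-reflexive (sym (m≥n⇒m⊓n≡n (⌊n/2⌋≤n m))))
         (count-above m ⌊ m /2⌋ (λ h → suc (h + h) <ᵇ m) λ j h → true-<ᵇ (<-half j m h)))
       where
       half-< : ∀ j m → suc (j + j) < m → j < ⌊ m /2⌋
       half-< zero    (suc (suc m)) h = s≤s z≤n
       half-< (suc j) (suc (suc m)) (s≤s (s≤s h)) = s≤s (half-< j m (≤-trans (≤-reflexive (cong suc (sym (+-suc j j)))) h))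
       half-< zero    (suc zero)    (s≤s ())
       half-< (suc j) (suc zero)    (s≤s ())
       <-half : ∀ j m → j < ⌊ m /2⌋ → suc (j + j) < m
       <-half zero    (suc (suc m)) h = s≤s (s≤s z≤n)
       <-half (suc j) (suc (suc m)) (s≤s h) = s≤s (s≤s (≤-trans (≤-reflexive (cong suc (+-suc j j))) (<-half j m h)))

   opaque
     halfP : {m : G → ℕ} → PT m → PT (λ g → ⌊ m g /2⌋)
     halfP {m} F = ext (λ g → half-sum (m g))
       (sumP {f = λ (h , g) → δ (suc (h + h) <ᵇ m g)} (δP (ltP (sucP (plusP v0 v0)) (F ∘P w1))) (downFromP F))

   opaque
     ceilingP : {m : G → ℕ} → PT m → PT (λ g → ⌈ m g /2⌉)
     ceilingP F = halfP (sucP F)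

     product-ofP : {xs ys : G → List ℕ} → PT xs → PT ys → PT (λ g → product-of (xs g) (ys g))
     product-ofP {xs} {ys} X Y = concatMapP {f = λ (x , g) → map (λ y → x + y) (ys g)}
       (mapP {f = λ (y , x , _) → x + y} (plusP v1 v0) (Y ∘P w1)) X

     multipleP : {m : G → ℕ} {xs : G → List ℕ} → PT m → PT xs → PT (λ g → multiple (m g) (xs g))
     multipleP {m} {xs} F X = concatMapP {f = λ (_ , g) → xs g} (X ∘P w1) (unitsP F)

     exponentsP : {bs : G → List ℕ} → PT bs → PT (λ g → exponents (bs g))
     exponentsP {bs} F = concatMapP {f = λ (i , g) → if nth 0 (bs g) i ≡ᵇ 1 then i ∷ [] else []}
       (ifP (eqP (nthP (constP 0) (F ∘P w1) v0) (constP 1)) (consP v0 nilP) nilP) (downFromP (lengthP F))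

 private
   -- A carry exceeds the previous one by at most the number of occurrences of the current digit, so
   -- the growth is additive.
   carry-size : ∀ (s : ℕ × ℕ) i (xs ys : List ℕ) →
     ⟪ carry xs ys s i ⟫ ≤ ⟪ s ⟫ + 2 * ⟪ (i , xs , ys) ⟫
   carry-size (c , d) i xs ys = begin
     suc (⟪ c′ ⟫ + ⟪ d′ ⟫)            ≡⟨ cong suc (cong₂ _+_ (sizeℕ c′) (sizeℕ d′)) ⟩
     suc (suc (c′ + c′) + suc (d′ + d′))
       ≤⟨ s≤s (+-mono-≤ (s≤s (+-mono-≤ c≤ c≤)) (s≤s (+-mono-≤ d≤ d≤))) ⟩
     suc (suc ((c + p) + (c + p)) + suc ((d + q) + (d + q)))     ≡⟨ lem c d p q ⟩
     suc (suc (c + c) + suc (d + d)) + 2 * (p + q)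
       ≤⟨ +-mono-≤ (≤-reflexive (cong suc (sym (cong₂ _+_ (sizeℕ c) (sizeℕ d)))))
            (*-monoʳ-≤ 2 (≤-trans (+-mono-≤ (few xs) (few ys)) (≤-trans (n≤1+n _)
              (≤-trans (m≤n+m _ ⟪ i ⟫) (n≤1+n _))))) ⟩
     ⟪ (c , d) ⟫ + 2 * ⟪ (i , xs , ys) ⟫ ∎
     where
     open ≤-Reasoning
     p q c′ d′ : ℕ
     p = occurrences i xs
     q = occurrences i ys
     c′ = ⌈ (c + p) ∸ (d + q) /2⌉
     d′ = ⌊ (d + q) ∸ (c + p) /2⌋
     c≤ : c′ ≤ c + p
     c≤ = ≤-trans (⌈n/2⌉≤n _) (m∸n≤m (c + p) (d + q))
     d≤ : d′ ≤ d + q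
     d≤ = ≤-trans (⌊n/2⌋≤n _) (m∸n≤m (d + q) (c + p))
     few : ∀ zs → occurrences i zs ≤ ⟪ zs ⟫
     few zs = ≤-trans (∑-mono zs λ z → δ≤1 (z ≡ᵇ i))
       (≤-trans (≤-reflexive (trans (∑-const zs 1) (*-identityʳ _))) (length≤size zs))
     lem : ∀ c d p q → suc (suc ((c + p) + (c + p)) + suc ((d + q) + (d + q)))
                     ≡ suc (suc (c + c) + suc (d + d)) + 2 * (p + q)
     lem = solve-∀

 opaque
   at-most-pair : PT {List ℕ × List ℕ} (λ (xs , ys) → at-most xs ys)
   at-most-pair = leP (fstP ∘P carriesP) (sndP ∘P carriesP)
     where
     carriesP : PT {List ℕ × List ℕ} (λ (xs , ys) → carries xs ys)
     carriesP = foldlP⁺ {f = λ (s , i , xs , ys) → carry xs ys s i}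
       (pairP
         (ceilingP (monusP (plusP (fstP ∘P v0) (occurrencesP v1 v2)) (plusP (sndP ∘P v0) (occurrencesP v1 w3))))
         (halfP (monusP (plusP (sndP ∘P v0) (occurrencesP v1 w3)) (plusP (fstP ∘P v0) (occurrencesP v1 v2)))))
       (constP (0 , 0))
       (reverseP (downFromP (sucP (plusP (sumP {f = λ (x , _) → x} v0 fstP) (sumP {f = λ (x , _) → x} v0 sndP)))))
       (constᵖ 2 *ᵖ idᵖ)
       λ s i (xs , ys) → carry-size s i xs ys

 module _ {G : Set} ⦃ _ : Enc G ⦄ where
   opaque
     lessP : {xs ys : G → List ℕ} → PT xs → PT ys → PT (λ g → less (xs g) (ys g))
     lessP X Y = notP (at-most-pair ∘P pairP Y X)

-- Reading the instance and writing the solution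

module Encodings where

 open Polytime
 open PolytimeLists
 open Algorithm
 open AlgorithmPolytime
 open BinaryNumbers
 open import Defs
 open import Data.Fin using (suc; toℕ)

 open PT
 open Poly

 Rows : Set
 Rows = List (List (List ℕ))

 -- A table has `suc n` rows for the vertices and one more for the bound.
 count-of unit-of : Rows → ℕ
 count-of ρ = length ρ ∸ 2
 unit-of ρ = 20 * suc (count-of ρ)

 cell : Rows → ℕ → ℕ → List ℕ
 cell ρ u j = exponents (nth [] (nth [] ρ u) j)

 -- Every number denotes a vertex in this way, so that the properties of the metric hold without
 -- conditions on the range.
 clamp : Rows → ℕ → ℕ
 clamp ρ u = u ∸ (u ∸ count-of ρ)

 upper lower : Rows → ℕ → ℕ → List ℕ
 upper ρ u v = cell ρ (clamp ρ u) (clamp ρ v + clamp ρ v)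
 lower ρ u v = cell ρ (clamp ρ u) (suc (clamp ρ v + clamp ρ v))

 bound-upper bound-lower : Rows → List ℕ
 bound-upper ρ = cell ρ (suc (count-of ρ)) 0
 bound-lower ρ = cell ρ (suc (count-of ρ)) 1

 -- j R < M (c(s,u) + c(u,v) - c(s,v)), multiplied by the denominators.
 exceeds : Rows → ℕ → ℕ → ℕ → Bool
 exceeds ρ u v j = less
   (multiple j (product-of (bound-upper ρ) (product-of (lower ρ 0 u) (product-of (lower ρ u v) (lower ρ 0 v))))
     ++ multiple (unit-of ρ) (product-of (upper ρ 0 v) (product-of (lower ρ 0 u) (product-of (lower ρ u v) (bound-lower ρ)))))
   (multiple (unit-of ρ) (product-of
     (product-of (upper ρ 0 u) (lower ρ u v) ++ product-of (upper ρ u v) (lower ρ 0 u))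
     (product-of (lower ρ 0 v) (bound-lower ρ))))

 nearer? : Rows → ℕ → ℕ → Bool
 nearer? ρ u v = less (product-of (upper ρ 0 u) (lower ρ 0 v)) (product-of (upper ρ 0 v) (lower ρ 0 u))

 regret-of : Rows → ℕ → ℕ → ℕ
 regret-of ρ u v =
   if u ≡ᵇ 0 then suc (unit-of ρ) else ∑ (downFrom (suc (unit-of ρ))) (λ j → δ (exceeds ρ u v j))

 rank-of : Rows → ℕ → ℕ
 rank-of ρ v = ∑ (downFrom (suc (count-of ρ))) λ u →
   δ (nearer? ρ u v ∨ (not (nearer? ρ v u) ∧ (u <ᵇ v)))

 best-of : Rows → List (List ℕ)
 best-of ρ = Core.best (count-of ρ) (unit-of ρ) (regret-of ρ) (rank-of ρ)

 symbol-code : Symbol → ℕ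
 symbol-code (bit b)   = toℕ b
 symbol-code slash     = 2
 symbol-code comma     = 3
 symbol-code semicolon = 4

 Partial : Set
 Partial = List ℕ × List (List ℕ) × Rows

 -- The input is folded from the right: a separator ends the number to its right. The comma that
 -- terminates the last entry of a row therefore produces one empty entry at its end.
 read : ℕ → Partial → Partial
 read s (cur , row , rows) =
   if s ≤ᵇ 1 then (s ∷ cur , row , rows)
   else if s ≡ᵇ 4 then ([] , [] , (cur ∷ row) ∷ rows)
   else ([] , cur ∷ row , rows)

 finish : Partial → Rows
 finish (cur , row , rows) = (cur ∷ row) ∷ rows

 parse : List ℕ → Rows
 parse xs = finish (foldr read ([] , [] , []) xs)

 increment : List ℕ → List ℕ
 increment []       = 1 ∷ []
 increment (b ∷ bs) = if b ≡ᵇ 0 then 1 ∷ bs else 0 ∷ increment bs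

 -- Counting up is affordable, vertices being unary numbers anyway. The start is `0 ∷ []` because
 -- the notation of zero is not empty.
 numeral : ℕ → List ℕ
 numeral n = foldr (λ _ bs → increment bs) (0 ∷ []) (replicate n tt)

 write : List (List ℕ) → List ℕ
 write S = concatMap (λ P → concatMap (λ v → numeral v ++ 3 ∷ []) (0 ∷ P) ++ 4 ∷ []) S

 answer : List ℕ → List ℕ
 answer xs = write (best-of (parse xs))

 opaque
   countP-of : PT count-of
   countP-of = monusP (lengthP idP) (constP 2)

   unitP-of : PT unit-of
   unitP-of = timesP (constP 20) (sucP (monusP (lengthP idP) (constP 2)))

 module _ {G : Set} ⦃ _ : Enc G ⦄ {ρ : G → Rows} where
  opaque
   cellP : {u j : G → ℕ} → PT ρ → PT u → PT j → PT (λ g → cell (ρ g) (u g) (j g))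
   cellP R U J = exponentsP (nthP nilP (nthP nilP R U) J)

   clampP : {u : G → ℕ} → PT ρ → PT u → PT (λ g → clamp (ρ g) (u g))
   clampP R U = monusP U (monusP U (countP-of ∘P R))

 module _ {G : Set} ⦃ _ : Enc G ⦄ {ρ : G → Rows} where
  opaque
   upperP : {u v : G → ℕ} → PT ρ → PT u → PT v → PT (λ g → upper (ρ g) (u g) (v g))
   upperP R U V = cellP R (clampP R U) (plusP (clampP R V) (clampP R V))

   lowerP : {u v : G → ℕ} → PT ρ → PT u → PT v → PT (λ g → lower (ρ g) (u g) (v g))
   lowerP R U V = cellP R (clampP R U) (sucP (plusP (clampP R V) (clampP R V)))

   bound-upperP : PT ρ → PT (λ g → bound-upper (ρ g))
   bound-upperP R = cellP R (sucP (countP-of ∘P R)) (constP 0)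

   bound-lowerP : PT ρ → PT (λ g → bound-lower (ρ g))
   bound-lowerP R = cellP R (sucP (countP-of ∘P R)) (constP 1)

 private
   infixr 6 _×P_
   _×P_ : ∀ {G : Set} ⦃ _ : Enc G ⦄ {xs ys : G → List ℕ} → PT xs → PT ys → PT (λ g → product-of (xs g) (ys g))
   _×P_ = product-ofP

 opaque
   exceedsP : PT {ℕ × ℕ × ℕ × Rows} (λ (j , u , v , ρ) → exceeds ρ u v j)
   exceedsP = lessP
     (appendP (multipleP v0 (bound-upperP w3 ×P lowerP w3 (constP 0) v1 ×P lowerP w3 v1 v2 ×P lowerP w3 (constP 0) v2))
       (multipleP (unitP-of ∘P w3) (upperP w3 (constP 0) v2 ×P lowerP w3 (constP 0) v1 ×P lowerP w3 v1 v2 ×P bound-lowerP w3)))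
     (multipleP (unitP-of ∘P w3)
       (appendP (upperP w3 (constP 0) v1 ×P lowerP w3 v1 v2) (upperP w3 v1 v2 ×P lowerP w3 (constP 0) v1)
         ×P lowerP w3 (constP 0) v2 ×P bound-lowerP w3))

   nearerP : PT {ℕ × ℕ × Rows} (λ (u , v , ρ) → nearer? ρ u v)
   nearerP = lessP (upperP w2 (constP 0) v0 ×P lowerP w2 (constP 0) v1) (upperP w2 (constP 0) v1 ×P lowerP w2 (constP 0) v0)

 opaque
   regretP : PT {ℕ × ℕ × Rows} (λ (u , v , ρ) → regret-of ρ u v)
   regretP = ifP (eqP v0 (constP 0)) (sucP (unitP-of ∘P w2))
     (sumP {f = λ (j , u , v , ρ) → δ (exceeds ρ u v j)} (δP exceedsP) (downFromP (sucP (unitP-of ∘P w2))))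

   rankP-of : PT {ℕ × Rows} (λ (v , ρ) → rank-of ρ v)
   rankP-of = sumP {f = λ (u , v , ρ) → δ (nearer? ρ u v ∨ (not (nearer? ρ v u) ∧ (u <ᵇ v)))}
     (δP (orP nearerP (andP (notP (nearerP ∘P pairP v1 (pairP v0 w2))) (ltP v0 v1))))
     (downFromP (sucP (countP-of ∘P w1)))

 opaque
   parseP : PT parse
   parseP = consP (consP (fstP ∘P scanned) (fstP ∘P (sndP ∘P scanned))) (sndP ∘P (sndP ∘P scanned))
     where
     readP : PT {ℕ × Partial × List ℕ} (λ (s , st , _) → read s st)
     readP = ifP (leP v0 (constP 1)) (pairP (consP v0 (fstP ∘P v1)) (sndP ∘P v1))
       (ifP (eqP v0 (constP 4))
         (pairP (constP []) (pairP (constP []) (consP (consP (fstP ∘P v1) (v1 ∘P v1)) (w2 ∘P v1))))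
         (pairP (constP []) (pairP (consP (fstP ∘P v1) (v1 ∘P v1)) (w2 ∘P v1))))
     read-size : ∀ (st : Partial) s (g : List ℕ) → ⟪ read s st ⟫ ≤ ⟪ st ⟫ + (5 + ⟪ (s , g) ⟫)
     read-size (cur , row , rows) s g with s ≤ᵇ 1
     ... | true  = ≤-trans (m≤m+n _ (5 + ⟪ g ⟫)) (≤-reflexive (lem ⟪ s ⟫ ⟪ cur ⟫ ⟪ row ⟫ ⟪ rows ⟫ ⟪ g ⟫))
       where
       lem : ∀ s c r w g → suc (suc (s + c) + suc (r + w)) + (5 + g) ≡ suc (c + suc (r + w)) + (5 + suc (s + g))
       lem = solve-∀
     ... | false with s ≡ᵇ 4
     ...   | true  = ≤-trans (m≤m+n _ (2 + ⟪ s ⟫ + ⟪ g ⟫)) (≤-reflexive (lem ⟪ s ⟫ ⟪ cur ⟫ ⟪ row ⟫ ⟪ rows ⟫ ⟪ g ⟫))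
       where
       lem : ∀ s c r w g → suc (1 + suc (1 + suc (suc (c + r) + w))) + (2 + s + g) ≡ suc (c + suc (r + w)) + (5 + suc (s + g))
       lem = solve-∀
     ...   | false = ≤-trans (m≤m+n _ (4 + ⟪ s ⟫ + ⟪ g ⟫)) (≤-reflexive (lem ⟪ s ⟫ ⟪ cur ⟫ ⟪ row ⟫ ⟪ rows ⟫ ⟪ g ⟫))
       where
       lem : ∀ s c r w g → suc (1 + suc (suc (c + r) + w)) + (4 + s + g) ≡ suc (c + suc (r + w)) + (5 + suc (s + g))
       lem = solve-∀
     scanned : PT {List ℕ} (λ xs → foldr read ([] , [] , []) xs)
     scanned = foldrP⁺ {f = λ (s , st , _) → read s st} readP (constP ([] , [] , [])) idP
       (constᵖ 5 +ᵖ idᵖ) read-size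

 private
   -- `increment` needs the unchanged tail besides the incremented one, so the fold computes both.
   suffixes : List ℕ → List ℕ × List ℕ
   suffixes = foldr (λ b s → b ∷ proj₁ s , (if b ≡ᵇ 0 then 1 ∷ proj₁ s else 0 ∷ proj₂ s)) ([] , 1 ∷ [])

   suffixes-≡ : ∀ bs → suffixes bs ≡ (bs , increment bs)
   suffixes-≡ []       = refl
   suffixes-≡ (b ∷ bs) rewrite suffixes-≡ bs = refl

   increment-size : ∀ bs → ⟪ increment bs ⟫ ≤ ⟪ bs ⟫ + 4
   increment-size [] = ≤-refl
   increment-size (b ∷ bs) with b ≡ᵇ 0
   ... | true  = ≤-trans (m≤m+n _ (suc ⟪ b ⟫)) (≤-reflexive (lem ⟪ b ⟫ ⟪ bs ⟫))
     where
     lem : ∀ b s → suc (3 + s) + suc b ≡ suc (b + s) + 4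
     lem = solve-∀
   ... | false = s≤s (≤-trans (s≤s (increment-size bs))
       (≤-trans (+-monoˡ-≤ _ (1≤size b)) (≤-reflexive (sym (+-assoc ⟪ b ⟫ ⟪ bs ⟫ 4)))))

 opaque
   incrementP : PT increment
   incrementP = ext (λ bs → cong proj₂ (suffixes-≡ bs)) (sndP ∘P foldrP
     {f = λ (b , s , _) → b ∷ proj₁ s , (if b ≡ᵇ 0 then 1 ∷ proj₁ s else 0 ∷ proj₂ s)}
     (pairP (consP v0 (fstP ∘P v1)) (ifP (eqP v0 (constP 0)) (consP (constP 1) (fstP ∘P v1)) (consP (constP 0) (sndP ∘P v1))))
     (constP ([] , 1 ∷ [])) idP (constᵖ 1 +ᵖ (idᵖ +ᵖ (idᵖ +ᵖ constᵖ 4)))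
     λ bs ys zs e → ≤-trans (≤-reflexive (cong ⟪_⟫ (suffixes-≡ zs)))
       (s≤s (+-mono-≤ (small bs ys zs e) (≤-trans (increment-size zs) (+-monoˡ-≤ 4 (small bs ys zs e))))))
     where
     small : ∀ (bs ys zs : List ℕ) → bs ≡ ys ++ zs → ⟪ zs ⟫ ≤ ⟪ bs ⟫
     small bs ys zs refl = size-suffix ys zs

 opaque
   numeralP : PT numeral
   numeralP = foldrP⁺ {f = λ (_ , bs , _) → increment bs} (incrementP ∘P v1) (constP (0 ∷ [])) (unitsP idP)
     (constᵖ 4) λ bs _ _ → increment-size bs

 opaque
   writeP : PT write
   writeP = concatMapP {f = λ (P , _) → concatMap (λ v → numeral v ++ 3 ∷ []) (0 ∷ P) ++ 4 ∷ []}
     (appendP (concatMapP {f = λ (v , _) → numeral v ++ 3 ∷ []} (appendP (numeralP ∘P v0) (constP (3 ∷ [])))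
         (consP (constP 0) v0)) (constP (4 ∷ [])))
     idP

 opaque
   answerP : PT answer
   answerP = writeP ∘P (CoreP.bestP countP-of unitP-of regretP rankP-of ∘P parseP)

-- Conversion between tape contents and trees, and the time bound

module InputOutput where

 open StackMachine
 open Polytime
 open PolytimeLists
 open Encodings
 open import Defs
 open import Data.Fin using (zero; suc)
 open import Data.Maybe using (Maybe; just; nothing)

 open PT
 open Poly

 is : Symbol → Maybe Symbol → Bool
 is s nothing  = false
 is s (just a) = symbol-code a ≡ᵇ symbol-code s

 dispatch : Reg → (Symbol → Prog) → Prog
 dispatch ρ k = branch ρ (is o) (k o) (branch ρ (is l) (k l) (branch ρ (is slash) (k slash)
   (branch ρ (is comma) (k comma) (k semicolon))))

 dispatch-run : ∀ ρ k s {as σ n σ′} → get ρ σ ≡ s ∷ as → Within (k s) σ n σ′ →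
                Within (dispatch ρ k) σ (4 + n) σ′
 dispatch-run ρ k (bit zero) e w =
   weaken (≤-trans (n≤1+n _) (≤-trans (n≤1+n _) (n≤1+n _))) (yesW (cong (is o ∘ top) e) w)
 dispatch-run ρ k (bit (suc zero)) e w =
   weaken (≤-trans (n≤1+n _) (n≤1+n _)) (noW (cong (is o ∘ top) e) (yesW (cong (is l ∘ top) e) w))
 dispatch-run ρ k slash e w =
   weaken (n≤1+n _) (noW (cong (is o ∘ top) e) (noW (cong (is l ∘ top) e) (yesW (cong (is slash ∘ top) e) w)))
 dispatch-run ρ k comma e w =
   noW (cong (is o ∘ top) e) (noW (cong (is l ∘ top) e) (noW (cong (is slash ∘ top) e) (yesW (cong (is comma ∘ top) e) w)))
 dispatch-run ρ k semicolon e w =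
   noW (cong (is o ∘ top) e) (noW (cong (is l ∘ top) e) (noW (cong (is slash ∘ top) e) (noW (cong (is comma ∘ top) e) w)))

 AtoB BtoA load : Prog
 AtoB = while A nonempty (dispatch A (λ s → pop A ⨾ push B s))
 BtoA = while B nonempty (dispatch B (λ s → pop B ⨾ push A s))
 load = while B nonempty (dispatch B (λ s → pop B ⨾ emit (enc (symbol-code s)) ⨾ push A l))

 one-more : ∀ k m → suc (k + (suc k * m + 1)) ≡ suc k * suc m + 1
 one-more = solve-∀

 AtoB-run : ∀ as {b c} → Within AtoB ⟨ as , b , c ⟩ (8 * length as + 1) ⟨ [] , as ʳ++ b , c ⟩
 AtoB-run []       = stopW refl
 AtoB-run (a ∷ as) = weaken (≤-reflexive (one-more 7 (length as)))
   (loopW refl (dispatch-run A (λ s → pop A ⨾ push B s) a refl (popW {A} refl ⨟ pushW {B})) (AtoB-run as))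

 BtoA-run : ∀ bs {a c} → Within BtoA ⟨ a , bs , c ⟩ (8 * length bs + 1) ⟨ bs ʳ++ a , [] , c ⟩
 BtoA-run []       = stopW refl
 BtoA-run (b ∷ bs) = weaken (≤-reflexive (one-more 7 (length bs)))
   (loopW refl (dispatch-run B (λ s → pop B ⨾ push A s) b refl (popW {B} refl ⨟ pushW {A})) (BtoA-run bs))

 symbols : List Symbol → Tree
 symbols as = enc (map symbol-code as)

 symbol-size : ∀ s → size (enc (symbol-code s)) ≤ 9
 symbol-size (bit zero)       = m≤m+n 1 8
 symbol-size (bit (suc zero)) = m≤m+n 3 6
 symbol-size slash            = m≤m+n 5 4
 symbol-size comma            = m≤m+n 7 2
 symbol-size semicolon        = ≤-refl

 symbols-size : ∀ as → size (symbols as) ≤ 10 * length as + 1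
 symbols-size []       = ≤-refl
 symbols-size (a ∷ as) = ≤-trans (s≤s (+-mono-≤ (symbol-size a) (symbols-size as)))
   (≤-reflexive (lem (length as)))
   where
   lem : ∀ m → suc (9 + (10 * m + 1)) ≡ 10 * suc m + 1
   lem = solve-∀

 load-run : ∀ bs as {c} → Within load ⟨ code (symbols as) [] , bs , c ⟩ (26 * length bs + 1)
              ⟨ code (symbols (bs ʳ++ as)) [] , [] , c ⟩
 load-run []       as = stopW refl
 load-run (b ∷ bs) as = weaken (≤-reflexive (one-more 25 (length bs)))
   (loopW refl (dispatch-run B (λ s → pop B ⨾ emit (enc (symbol-code s)) ⨾ push A l) b refl (popW {B} refl ⨟
     weaken (*-monoʳ-≤ 2 (symbol-size b)) (emit-run (enc (symbol-code b))) ⨟ pushW)) (load-run bs (b ∷ as)))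

 input-program : Prog
 input-program = AtoB ⨾ push A o ⨾ load

 input-run : ∀ as {c} → Within input-program ⟨ as , [] , c ⟩ (34 * length as + 4) ⟨ code (symbols as) [] , [] , c ⟩
 input-run as {c} = within (AtoB-run as ⨟ pushW ⨟ subst (λ z → Within load ⟨ o ∷ [] , as ʳ++ [] , c ⟩ (26 * length (as ʳ++ []) + 1) ⟨ code (symbols z) [] , [] , c ⟩)
     back (load-run (as ʳ++ []) []))
   (≤-reflexive (trans (cong (λ m → 8 * length as + 1 + (2 + (26 * m + 1))) (length-reverse as)) (lem (length as))))
   where
   back : (as ʳ++ []) ʳ++ [] ≡ as
   back = reverse-involutive as
   lem : ∀ m → 8 * m + 1 + (2 + (26 * m + 1)) ≡ 34 * m + 4
   lem = solve-∀

 read-symbol : List Symbol → Prog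
 read-symbol []       = pop A
 read-symbol (s ∷ ss) = branch A isL (pop A ⨾ pop A ⨾ read-symbol ss) (pop A ⨾ push B s)

 unload : Prog
 unload = while A isL (pop A ⨾ read-symbol (o ∷ l ∷ slash ∷ comma ∷ semicolon ∷ []))

 read-symbol-run : ∀ s {a b c} → Within (read-symbol (o ∷ l ∷ slash ∷ comma ∷ semicolon ∷ []))
   ⟨ code (enc (symbol-code s)) a , b , c ⟩ 16 ⟨ a , s ∷ b , c ⟩
 read-symbol-run (bit zero) = weaken (m≤m+n 4 12) (noW refl (popW refl ⨟ pushW))
 read-symbol-run (bit (suc zero)) = weaken (m≤m+n 7 9)
   (yesW refl (popW refl ⨟ popW refl ⨟ noW refl (popW refl ⨟ pushW)))
 read-symbol-run slash = weaken (m≤m+n 10 6)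
   (yesW refl (popW refl ⨟ popW refl ⨟ yesW refl (popW refl ⨟ popW refl ⨟ noW refl (popW refl ⨟ pushW))))
 read-symbol-run comma = weaken (m≤m+n 13 3)
   (yesW refl (popW refl ⨟ popW refl ⨟ yesW refl (popW refl ⨟ popW refl ⨟
     yesW refl (popW refl ⨟ popW refl ⨟ noW refl (popW refl ⨟ pushW)))))
 read-symbol-run semicolon =
   yesW refl (popW refl ⨟ popW refl ⨟ yesW refl (popW refl ⨟ popW refl ⨟
     yesW refl (popW refl ⨟ popW refl ⨟ yesW refl (popW refl ⨟ popW refl ⨟ noW refl (popW refl ⨟ pushW)))))

 unload-run : ∀ bs {b c} → Within unload ⟨ code (symbols bs) [] , b , c ⟩ (18 * length bs + 1) ⟨ o ∷ [] , bs ʳ++ b , c ⟩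
 unload-run []       = stopW refl
 unload-run (b ∷ bs) = weaken (≤-reflexive (one-more 17 (length bs)))
   (loopW refl (popW refl ⨟ read-symbol-run b) (unload-run bs))

 output-program : Prog
 output-program = unload ⨾ pop A ⨾ BtoA

 output-run : ∀ bs → Within output-program ⟨ code (symbols bs) [] , [] , [] ⟩ (26 * length bs + 3) ⟨ bs , [] , [] ⟩
 output-run bs = within (unload-run bs ⨟ popW refl ⨟
     subst (λ z → Within BtoA ⟨ [] , bs ʳ++ [] , [] ⟩ (8 * length (bs ʳ++ []) + 1) ⟨ z , [] , [] ⟩) (reverse-involutive bs) (BtoA-run (bs ʳ++ [])))
   (≤-reflexive (trans (cong (λ m → 18 * length bs + 1 + (1 + (8 * m + 1))) (length-reverse bs)) (lem (length bs))))
   where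
   lem : ∀ m → 18 * m + 1 + (1 + (8 * m + 1)) ≡ 26 * m + 3
   lem = solve-∀

 -- The coefficients of `c` plus `2 + x` times the polynomial; `c` also carries the coefficient
 -- shifted from the previous position.
 times-linear : ℕ → List ℕ → List ℕ
 times-linear c []       = c ∷ []
 times-linear c (a ∷ as) = c + 2 * a ∷ times-linear a as

 evaluate-linear : ∀ c as x → evaluate (times-linear c as) x ≡ c + (2 + x) * evaluate as x
 evaluate-linear c []       x = cong (c +_) (trans (*-zeroʳ x) (sym (*-zeroʳ (2 + x))))
 evaluate-linear c (a ∷ as) x = trans (cong (λ z → c + 2 * a + x * z) (evaluate-linear a as x))
   (lem c a x (evaluate as x))
   where
   lem : ∀ c a x e → c + 2 * a + x * (a + (2 + x) * e) ≡ c + (2 + x) * (a + x * e)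
   lem = solve-∀

 power : ℕ → List ℕ
 power zero    = 1 ∷ []
 power (suc d) = times-linear 0 (power d)

 evaluate-power : ∀ d x → evaluate (power d) x ≡ (2 + x) ^ d
 evaluate-power zero    x = cong suc (*-zeroʳ x)
 evaluate-power (suc d) x = trans (evaluate-linear 0 (power d) x) (cong ((2 + x) *_) (evaluate-power d x))

 module Machine {f : List ℕ → List ℕ} (F : PT f) where

   whole : Prog
   whole = input-program ⨾ program F ⨾ output-program

   steps : ℕ → ℕ
   steps m = (34 * m + 4) + ((2 + (10 * m + 1)) ^ time F + (26 * grow {List ℕ} {List ℕ} (time F) (10 * m + 1) + 3))

   stepsᵖ : Poly steps
   stepsᵖ = atMost ((constᵖ 34 *ᵖ idᵖ +ᵖ constᵖ 4) +ᵖ ((time F ^ᵖ) ∘ᵖ sᵖ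
       +ᵖ (constᵖ 26 *ᵖ (growᵖ {List ℕ} {List ℕ} (time F) ∘ᵖ sᵖ) +ᵖ constᵖ 3))) λ m → ≤-refl
     where
     sᵖ : Poly (λ m → 10 * m + 1)
     sᵖ = constᵖ 10 *ᵖ idᵖ +ᵖ constᵖ 1

   whole-computes : ∀ as bs → f (map symbol-code as) ≡ map symbol-code bs →
     ComputesWithin (machine whole) (evaluate (power (degree stepsᵖ)) (length as)) as bs
   whole-computes as bs e = machine-computes whole (proj₂ (proj₂ total))
     (≤-trans (proj₁ (proj₂ total)) (≤-trans (bound stepsᵖ (length as))
       (≤-reflexive (sym (evaluate-power (degree stepsᵖ) (length as))))))
     where
     grow-mono : ∀ {m m′} → m ≤ m′ → grow {List ℕ} {List ℕ} (time F) m ≤ grow {List ℕ} {List ℕ} (time F) m′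
     grow-mono h = +-mono-≤ (pow-mono (time F) h) h
     length-≤ : length bs ≤ grow {List ℕ} {List ℕ} (time F) (10 * length as + 1)
     length-≤ = ≤-trans (≤-reflexive (sym (length-map symbol-code bs))) (≤-trans (length≤size (map symbol-code bs))
       (≤-trans (≤-reflexive (cong ⟪_⟫ (sym e))) (≤-trans (output-size F (map symbol-code as)) (grow-mono (symbols-size as)))))
     total : Within whole ⟨ as , [] , [] ⟩ (steps (length as)) ⟨ bs , [] , [] ⟩
     total = input-run as
       ⨟ weaken (^-monoˡ-≤ (time F) (+-monoʳ-≤ 2 (symbols-size as)))
           (subst (λ z → Within (program F) _ _ ⟨ code (enc z) [] , [] , [] ⟩) e (runs F (map symbol-code as)))
       ⨟ weaken (+-monoˡ-≤ 3 (*-monoʳ-≤ 26 length-≤)) (output-run bs)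

-- Correctness of the encodings

module Parsing where

 open PolytimeLists
 open Algorithm
 open BinaryNumbers
 open Encodings
 open import Defs
 open import Data.Digit using (Bit; toDigits; fromDigits)
 open import Data.Fin using (Fin; zero; suc; toℕ)
 open import Data.Integer using (∣_∣)
 open import Data.List.NonEmpty using (_∷_)
 open import Data.Nat.DivMod using (_divMod_; result)
 open import Data.Nat.Induction using (<′-wellFounded′; <′-Rec; Acc; acc)
 open import Data.Rational as ℚ using (ℚ)

 data Canonical : ℕ → List Bit → Set where
   one  : ∀ {n} r → n ≡ toℕ r + 0 → Canonical n (r ∷ [])
   more : ∀ {x ds} r → Canonical (suc x) ds → Canonical (toℕ r + suc x * 2) (r ∷ ds)

 -- The recursion of toDigits is a local function of the library and cannot
 -- be named; the three placeholders below are its instances for arbitrary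
 -- accessibility proofs, and unification determines them.
 private
   expansion : ∀ n → <′-Rec (Acc _<′_) n → List Bit
   uniform-expansion : Bit → ∀ x → (∀ y → Acc _<′_ y) → List Bit
   positive-expansion : Bit → ∀ x → Acc _<′_ (suc x) → List Bit

 toDigits-canonical : ∀ n → Canonical n (proj₁ (toDigits 2 n))

 private
   expansion-canonical : ∀ n (rs : <′-Rec (Acc _<′_) n) → Canonical n (expansion n rs)
   uniform-canonical : ∀ n (a : ∀ y → Acc _<′_ y) → Canonical n (expansion n (λ {y} _ → a y))
   uniform-canonical⁺ : ∀ r x a → Canonical (suc x) (uniform-expansion r x a)
   positive-canonical : ∀ r x a → Canonical (suc x) (positive-expansion r x a)
   expansion = _
   uniform-expansion = _
   positive-expansion = _

 toDigits-canonical n with <′-wellFounded′ n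
 ... | rs = expansion-canonical n (λ {y} → rs {y})

 uniform-canonical n a with n divMod 2
 ... | result zero    r e    = one r e
 ... | result (suc x) r refl = more r (uniform-canonical⁺ r x a)

 uniform-canonical⁺ r x a with a (suc x)
 ... | a′ = positive-canonical r x a′

 positive-canonical r x (acc rs) with suc x divMod 2
 ... | result zero    r          e    = one r e
 ... | result (suc y) zero       refl = more zero (positive-canonical zero y (rs _))
 ... | result (suc y) (suc zero) refl = more (suc zero) (positive-canonical (suc zero) y (rs _))

 expansion-canonical n rs with n divMod 2
 ... | result zero    r e    = one r e
 ... | result (suc x) r refl = more r (positive-canonical r x (rs _))

 numeral-double : ∀ x → numeral (suc x * 2) ≡ 0 ∷ numeral (suc x)
 numeral-double zero    = refl
 numeral-double (suc x) = cong (increment ∘ increment) (numeral-double x)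

 canonical-numeral : ∀ {n ds} → Canonical n ds → map toℕ ds ≡ numeral n
 canonical-numeral (one zero       refl)   = refl
 canonical-numeral (one (suc zero) refl)   = refl
 canonical-numeral (more {x} zero c)       = trans (cong (0 ∷_) (canonical-numeral c)) (sym (numeral-double x))
 canonical-numeral (more {x} (suc zero) c) = trans (cong (1 ∷_) (canonical-numeral c)) (cong increment (sym (numeral-double x)))

 digits : ℕ → List ℕ
 digits k = map symbol-code (encodeℕ k)

 digits-toℕ : ∀ k → digits k ≡ map toℕ (proj₁ (toDigits 2 k))
 digits-toℕ k = sym (map-∘ (proj₁ (toDigits 2 k)))

 digits-numeral : ∀ k → digits k ≡ numeral k
 digits-numeral k = trans (digits-toℕ k) (canonical-numeral (toDigits-canonical k))

 binary-digits : ∀ k → binary (digits k) ≡ k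
 binary-digits k = trans (cong binary (digits-toℕ k))
   (trans (from (proj₁ (toDigits 2 k))) (proj₂ (toDigits 2 k)))
   where
   bit-value : ∀ (d : Bit) → δ (toℕ d ≡ᵇ 1) ≡ toℕ d
   bit-value zero       = refl
   bit-value (suc zero) = refl
   from : ∀ ds → binary (map toℕ ds) ≡ fromDigits ds
   from []       = refl
   from (d ∷ ds) = cong₂ _+_ (bit-value d) (trans (cong (2 *_) (from ds)) (*-comm 2 (fromDigits ds)))

 numerator-digits denominator-digits : ℚ → List ℕ
 numerator-digits q   = digits ∣ ℚ.numerator q ∣
 denominator-digits q = digits (ℚ.denominatorℕ q)

 read-digits : ∀ k cur row rows → foldr read (cur , row , rows) (digits k) ≡ (digits k ++ cur , row , rows)
 read-digits k cur row rows = subst (λ ds → foldr read (cur , row , rows) ds ≡ (ds ++ cur , row , rows))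
   (sym (digits-toℕ k)) (each (proj₁ (toDigits 2 k)))
   where
   each : ∀ ds → foldr read (cur , row , rows) (map toℕ ds) ≡ (map toℕ ds ++ cur , row , rows)
   each []              = refl
   each (zero ∷ ds)     = cong (read 0) (each ds)
   each (suc zero ∷ ds) = cong (read 1) (each ds)

 fraction : ℚ → List ℕ
 fraction q = map symbol-code (encodeℚ q)

 read-fraction : ∀ q cur row rows → foldr read (cur , row , rows) (fraction q) ≡
                 (numerator-digits q , (denominator-digits q ++ cur) ∷ row , rows)
 read-fraction q cur row rows = begin
   foldr read st (fraction q)
     ≡⟨ cong (foldr read st) (map-++ symbol-code (encodeℕ ∣ ℚ.numerator q ∣) _) ⟩
   foldr read st (numerator-digits q ++ 2 ∷ denominator-digits q)
     ≡⟨ foldr-++ read st (numerator-digits q) _ ⟩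
   foldr read (read 2 (foldr read st (denominator-digits q))) (numerator-digits q)
     ≡⟨ cong (λ s → foldr read (read 2 s) (numerator-digits q)) (read-digits (ℚ.denominatorℕ q) cur row rows) ⟩
   foldr read ([] , (denominator-digits q ++ cur) ∷ row , rows) (numerator-digits q)
     ≡⟨ read-digits ∣ ℚ.numerator q ∣ [] _ rows ⟩
   (numerator-digits q ++ [] , (denominator-digits q ++ cur) ∷ row , rows)
     ≡⟨ cong (_, (denominator-digits q ++ cur) ∷ row , rows) (++-identityʳ _) ⟩
   (numerator-digits q , (denominator-digits q ++ cur) ∷ row , rows) ∎
   where
   open ≡-Reasoning
   st : Partial
   st = cur , row , rows

 module _ {X : Set} where

   entries : (X → ℚ) → List X → List (List ℕ)
   entries q = concatMap (λ x → numerator-digits (q x) ∷ denominator-digits (q x) ∷ [])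

   -- After the fold the leftmost number is still open; the statement is about the table that
   -- results when `finish` closes it.
   read-entries : ∀ (q : X → ℚ) xs cur row rows →
     finish (foldr read (cur , row , rows) (concatMap (λ x → fraction (q x) ++ 3 ∷ []) xs))
       ≡ (entries q xs ++ cur ∷ row) ∷ rows
   read-entries q []       cur row rows = refl
   read-entries q (x ∷ xs) cur row rows
     rewrite foldr-++ read (cur , row , rows) (fraction (q x) ++ 3 ∷ []) (concatMap (λ x → fraction (q x) ++ 3 ∷ []) xs)
           | foldr-++ read (foldr read (cur , row , rows) (concatMap (λ x → fraction (q x) ++ 3 ∷ []) xs)) (fraction (q x)) (3 ∷ [])
     with foldr read (cur , row , rows) (concatMap (λ x → fraction (q x) ++ 3 ∷ []) xs) | read-entries q xs cur row rows
   ... | cur′ , row′ , rows′ | e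
     rewrite read-fraction (q x) [] (cur′ ∷ row′) rows′ | ++-identityʳ (denominator-digits (q x)) =
       cong (prepend (numerator-digits (q x)) (denominator-digits (q x))) e
     where
     prepend : List ℕ → List ℕ → Rows → Rows
     prepend a b []       = []
     prepend a b (r ∷ rs) = (a ∷ b ∷ r) ∷ rs

 module _ {X Y : Set} where

   read-rows : ∀ (q : Y → X → ℚ) xs ys st →
     finish (foldr read st (concatMap (λ y → concatMap (λ x → fraction (q y x) ++ 3 ∷ []) xs ++ 4 ∷ []) ys))
       ≡ map (λ y → entries (q y) xs ++ [] ∷ []) ys ++ finish st
   read-rows q xs []       st = refl
   read-rows q xs (y ∷ ys) st
     rewrite foldr-++ read st (concatMap (λ x → fraction (q y x) ++ 3 ∷ []) xs ++ 4 ∷ [])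
               (concatMap (λ y → concatMap (λ x → fraction (q y x) ++ 3 ∷ []) xs ++ 4 ∷ []) ys)
           | foldr-++ read (foldr read st (concatMap (λ y → concatMap (λ x → fraction (q y x) ++ 3 ∷ []) xs ++ 4 ∷ []) ys))
               (concatMap (λ x → fraction (q y x) ++ 3 ∷ []) xs) (4 ∷ [])
     with foldr read st (concatMap (λ y → concatMap (λ x → fraction (q y x) ++ 3 ∷ []) xs ++ 4 ∷ []) ys) | read-rows q xs ys st
   ... | cur , row , rows | e = trans (read-entries (q y) xs [] [] ((cur ∷ row) ∷ rows)) (cong (_ ∷_) e)

 table : (I : Instance) → Rows
 table I = map (λ u → entries (c u) (allFin (suc n)) ++ [] ∷ []) (allFin (suc n))
     ++ (numerator-digits R ∷ denominator-digits R ∷ []) ∷ []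
   where open Instance I

 parse-encoding : ∀ I → parse (map symbol-code (encodeInstance I)) ≡ table I
 parse-encoding I = begin
   parse (map symbol-code (encodeInstance I))
     ≡⟨ cong parse (trans (map-++ symbol-code _ (encodeℚ R)) (cong (_++ fraction R)
          (trans (map-concatMap symbol-code _ V) (concatMap-cong row-codes V)))) ⟩
   parse (concatMap (λ u → concatMap (λ v → fraction (c u v) ++ 3 ∷ []) V ++ 4 ∷ []) V ++ fraction R)
     ≡⟨ cong finish (foldr-++ read ([] , [] , []) (concatMap (λ u → concatMap (λ v → fraction (c u v) ++ 3 ∷ []) V ++ 4 ∷ []) V) (fraction R)) ⟩
   finish (foldr read (foldr read ([] , [] , []) (fraction R)) (concatMap (λ u → concatMap (λ v → fraction (c u v) ++ 3 ∷ []) V ++ 4 ∷ []) V))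
     ≡⟨ read-rows c V V _ ⟩
   map (λ u → entries (c u) V ++ [] ∷ []) V ++ finish (foldr read ([] , [] , []) (fraction R))
     ≡⟨ cong (λ s → map (λ u → entries (c u) V ++ [] ∷ []) V ++ finish s) (trans (read-fraction R [] [] [])
          (cong (λ ds → numerator-digits R , ds ∷ [] , []) (++-identityʳ (denominator-digits R)))) ⟩
   table I ∎
   where
   open ≡-Reasoning
   open Instance I
   V : List (Vertex n)
   V = allFin (suc n)
   row-codes : ∀ u → map symbol-code (concatMap (λ v → encodeℚ (c u v) ++ [ comma ]) V ++ [ semicolon ])
             ≡ concatMap (λ v → fraction (c u v) ++ 3 ∷ []) V ++ 4 ∷ []
   row-codes u = trans (map-++ symbol-code (concatMap (λ v → encodeℚ (c u v) ++ [ comma ]) V) _) (cong (_++ 4 ∷ [])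
     (trans (map-concatMap symbol-code _ V) (concatMap-cong (λ v → map-++ symbol-code (encodeℚ (c u v)) _) V)))

 -- Numbers above n stand for n.
 vertex : ∀ {n} → ℕ → Vertex n
 vertex         zero    = zero
 vertex {zero}  (suc u) = zero
 vertex {suc n} (suc u) = suc (vertex u)

 toℕ-vertex : ∀ {n} u → toℕ (vertex {n} u) ≡ u ∸ (u ∸ n)
 toℕ-vertex {n}     zero    = sym (0∸n≡0 (0 ∸ n))
 toℕ-vertex {zero}  (suc u) = sym (n∸n≡0 u)
 toℕ-vertex {suc n} (suc u) = trans (cong suc (toℕ-vertex u)) (sym (+-∸-assoc 1 (m∸n≤m u n)))

 toℕ-vertex-≤ : ∀ {n u} → u ≤ n → toℕ (vertex {n} u) ≡ u
 toℕ-vertex-≤ {n} {u} h = trans (toℕ-vertex u) (cong (u ∸_) (m≤n⇒m∸n≡0 h))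

 vertex-toℕ : ∀ {n} (v : Vertex n) → vertex (toℕ v) ≡ v
 vertex-toℕ         zero    = refl
 vertex-toℕ {suc n} (suc v) = cong suc (vertex-toℕ v)

 module _ {X : Set} where

   nth-tabulate : ∀ {m} d (f : Fin m → X) zs i → nth d (tabulate f ++ zs) (toℕ i) ≡ f i
   nth-tabulate d f zs zero    = refl
   nth-tabulate d f zs (suc i) = nth-tabulate d (f ∘ suc) zs i

   nth-tabulate-end : ∀ {m} d (f : Fin m → X) z → nth d (tabulate f ++ z ∷ []) m ≡ z
   nth-tabulate-end {zero}  d f z = refl
   nth-tabulate-end {suc m} d f z = nth-tabulate-end d (f ∘ suc) z

   nth-even : ∀ {m} d (f g : Fin m → X) zs i →
     nth d (concatMap (λ i → f i ∷ g i ∷ []) (allFin m) ++ zs) (toℕ i + toℕ i) ≡ f i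
   nth-odd : ∀ {m} d (f g : Fin m → X) zs i →
     nth d (concatMap (λ i → f i ∷ g i ∷ []) (allFin m) ++ zs) (suc (toℕ i + toℕ i)) ≡ g i

   private
     shift : ∀ {m} (f g : Fin (suc m) → X) →
       concatMap (λ i → f i ∷ g i ∷ []) (tabulate suc) ≡ concatMap (λ i → f (suc i) ∷ g (suc i) ∷ []) (allFin m)
     shift f g = trans (cong (concatMap (λ i → f i ∷ g i ∷ [])) (sym (map-tabulate id suc)))
       (concatMap-map (λ i → f i ∷ g i ∷ []) suc (allFin _))

   nth-even d f g zs zero    = refl
   nth-even d f g zs (suc i) rewrite +-suc (toℕ i) (toℕ i) | shift f g = nth-even d (f ∘ suc) (g ∘ suc) zs i
   nth-odd d f g zs zero    = refl
   nth-odd d f g zs (suc i) rewrite +-suc (toℕ i) (toℕ i) | shift f g = nth-odd d (f ∘ suc) (g ∘ suc) zs i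

 module Lookup (I : Instance) where

   open Instance I

   count-table : count-of (table I) ≡ n
   count-table = trans (cong (_∸ 2) (trans (length-++ (map (λ u → entries (c u) (allFin (suc n)) ++ [] ∷ []) (allFin (suc n))))
     (trans (+-comm _ 1) (cong suc (trans (length-map _ (allFin (suc n))) (length-tabulate id)))))) refl

   private
     rowsℚ : Vertex n → List (List ℕ)
     rowsℚ u = entries (c u) (allFin (suc n)) ++ [] ∷ []

     row-lookup : ∀ u → nth [] (table I) (clamp (table I) u) ≡ rowsℚ (vertex u)
     row-lookup u = trans (cong (nth [] (table I)) (trans (cong (λ m → u ∸ (u ∸ m)) count-table) (sym (toℕ-vertex u))))
       (trans (cong (λ xs → nth [] (xs ++ (numerator-digits R ∷ denominator-digits R ∷ []) ∷ []) (toℕ (vertex {n} u))) (map-tabulate id rowsℚ))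
         (nth-tabulate [] rowsℚ _ (vertex u)))

     bound-lookup : nth [] (table I) (suc (count-of (table I))) ≡ numerator-digits R ∷ denominator-digits R ∷ []
     bound-lookup = trans (cong (nth [] (table I)) (cong suc count-table))
       (trans (cong (λ xs → nth [] (xs ++ (numerator-digits R ∷ denominator-digits R ∷ []) ∷ []) (suc n)) (map-tabulate id rowsℚ))
         (nth-tabulate-end [] rowsℚ _))

     read-value : ∀ {xs k} → xs ≡ digits k → value (exponents xs) ≡ k
     read-value {k = k} refl = trans (value-exponents (digits k)) (binary-digits k)

     clamp-vertex : ∀ v → clamp (table I) v ≡ toℕ (vertex {n} v)
     clamp-vertex v = trans (cong (λ m → v ∸ (v ∸ m)) count-table) (sym (toℕ-vertex v))

   value-upper : ∀ u v → value (upper (table I) u v) ≡ ∣ ℚ.numerator (c (vertex u) (vertex v)) ∣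
   value-upper u v = read-value (trans (cong₂ (nth []) (row-lookup u) (cong (λ x → x + x) (clamp-vertex v)))
     (nth-even [] (λ v → numerator-digits (c (vertex u) v)) (λ v → denominator-digits (c (vertex u) v)) _ (vertex v)))

   value-lower : ∀ u v → value (lower (table I) u v) ≡ ℚ.denominatorℕ (c (vertex u) (vertex v))
   value-lower u v = read-value (trans (cong₂ (nth []) (row-lookup u) (cong (λ x → suc (x + x)) (clamp-vertex v)))
     (nth-odd [] (λ v → numerator-digits (c (vertex u) v)) (λ v → denominator-digits (c (vertex u) v)) _ (vertex v)))

   value-bound-upper : value (bound-upper (table I)) ≡ ∣ ℚ.numerator R ∣
   value-bound-upper = read-value (cong (λ r → nth [] r 0) bound-lookup)

   value-bound-lower : value (bound-lower (table I)) ≡ ℚ.denominatorℕ R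
   value-bound-lower = read-value (cong (λ r → nth [] r 1) bound-lookup)

 paths : ∀ {n} → List (List ℕ) → Solution n
 paths = map (λ p → depot ∷ map vertex p)

 encode-paths : ∀ {n} S → All (All (_≤ n)) S → map symbol-code (encodeSolution (paths {n} S)) ≡ write S
 encode-paths []      []       = refl
 encode-paths {n} (p ∷ S) (p≤ ∷ S≤) = trans (map-++ symbol-code ((concatMap (λ v → encodeℕ (toℕ v) ++ [ comma ]) (depot ∷ map (vertex {n}) p)) ++ [ semicolon ]) _)
   (cong₂ _++_ (trans (map-++ symbol-code (concatMap (λ v → encodeℕ (toℕ v) ++ [ comma ]) (depot ∷ map (vertex {n}) p)) _)
       (cong (_++ 4 ∷ []) (trans (map-++ symbol-code (encodeℕ 0 ++ [ comma ]) _)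
         (cong₂ _++_ (visit 0) (visits p p≤)))))
     (encode-paths S S≤))
   where
   visit : ∀ k → map symbol-code (encodeℕ k ++ [ comma ]) ≡ numeral k ++ 3 ∷ []
   visit k = trans (map-++ symbol-code (encodeℕ k) _) (cong (_++ 3 ∷ []) (digits-numeral k))
   visits : ∀ p → All (_≤ n) p → map symbol-code (concatMap (λ v → encodeℕ (toℕ v) ++ [ comma ]) (map (vertex {n}) p))
          ≡ concatMap (λ v → numeral v ++ 3 ∷ []) p
   visits []      []        = refl
   visits (v ∷ p) (v≤ ∷ p≤) = trans (map-++ symbol-code (encodeℕ (toℕ (vertex {n} v)) ++ [ comma ]) _)
     (cong₂ _++_ (trans (cong (λ k → map symbol-code (encodeℕ k ++ [ comma ])) (toℕ-vertex-≤ v≤)) (visit v)) (visits p p≤))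

-- Analysis of the algorithm for a given rounded regret

module Vertices (n M : ℕ) (r : ℕ → ℕ → ℕ) (rank : ℕ → ℕ) where

 open PolytimeLists
 open Algorithm
 open Sums
 open Selection
 open Sequences
 open import Relation.Binary.Definitions using (tri<; tri≈; tri>)
 open import Data.List.Relation.Unary.Any.Properties using (reverse⁺)

 open Core n M r rank public

 us-unique : Unique us
 us-unique = Unique.downFrom⁺ (suc n)

 vs-unique : Unique vs
 vs-unique = Unique.map⁺ suc-injective (Unique.downFrom⁺ n)

 ∈us : ∀ {v} → v ≤ n → v ∈ us
 ∈us v≤n = ∈-downFrom⁺ (s≤s v≤n)

 us≤ : ∀ {v} → v ∈ us → v ≤ n
 us≤ v∈ = ≤-pred (∈-downFrom⁻ v∈)

 ∈vs : ∀ {v} → 1 ≤ v → v ≤ n → v ∈ vs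
 ∈vs (s≤s z≤n) (s≤s v≤n) = ∈-map⁺ suc (∈-downFrom⁺ (s≤s v≤n))

 vs-bounds : ∀ {v} → v ∈ vs → 1 ≤ v × v ≤ n
 vs-bounds v∈ with ∈-map⁻ suc v∈
 ... | w , w∈ , refl = s≤s z≤n , ∈-downFrom⁻ w∈

 vs⊆us : ∀ {v} → v ∈ vs → v ∈ us
 vs⊆us v∈ = ∈us (proj₂ (vs-bounds v∈))

 length-vs : length vs ≡ n
 length-vs = trans (length-map suc (downFrom n)) (length-downFrom n)

 length-≼ : ∀ {X : Set} (xs ys : List X) → xs ≼ ys → length xs ≤ length ys
 length-≼ xs ys s = ≤-trans (≤-reflexive (count xs))
   (≤-trans (s (λ _ → 1)) (≤-reflexive (sym (count ys))))
   where
   count : ∀ zs → length zs ≡ ∑ zs (λ _ → 1)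
   count zs = sym (trans (∑-const zs 1) (*-identityʳ (length zs)))

 before-< : ∀ {u v} → before u v ≡ true → rank u < rank v
 before-< {u} {v} e = <ᵇ-true {rank u} {rank v} e

 module WithRegret (regret : Regret n M r rank) where

  open Regret regret

  -- Duality and cuts for the approximate solution

  module LinearProgram (k K τ : ℕ) (h : List (ℕ × ℕ × ℕ))
    (h∈us : ∀ {t x y} → (t , x , y) ∈ h → x ∈ us × y ∈ us)
    (rows-hold : ∀ ρ → ρ ∈ rows →
      K * (∑ h (pos ρ) + τ * pos₀ ρ) ≤ K * (∑ h (neg ρ) + τ * Guess.neg₀ k ρ) + τ) where

   open Guess k using (flow-budget; tree-budget; neg₀)

   private
     ∈rows : ∀ {ρ} → ρ ∈ _ → ρ ∈ rows
     ∈rows {ρ} = subst (ρ ∈_) (sym rows-≡)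

   -- Integrates `f` over the arcs of one kind. The solution is kept multiplied by the number of
   -- rounds `τ` and thus integral. That `part g` is additive and monotone is all that the bound on
   -- the tree will need to know.
   part : (ℕ → ℕ → ℕ → Bool) → (ℕ → ℕ → ℕ) → ℕ
   part g f = ∑ h λ (t , x , y) → if g t x y then f x y else 0

   part-mono : ∀ g {f f′} → (∀ t x y → x ∈ us → y ∈ us → g t x y ≡ true → f x y ≤ f′ x y) →
               part g f ≤ part g f′
   part-mono g {f} {f′} le = ∑-mono∈ h each
     where
     each : ∀ c → c ∈ h → (if g (proj₁ c) (proj₁ (proj₂ c)) (proj₂ (proj₂ c)) then f (proj₁ (proj₂ c)) (proj₂ (proj₂ c)) else 0)
       ≤ (if g (proj₁ c) (proj₁ (proj₂ c)) (proj₂ (proj₂ c)) then f′ (proj₁ (proj₂ c)) (proj₂ (proj₂ c)) else 0)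
     each (t , x , y) c∈ with g t x y in e
     ... | true  = le t x y (proj₁ (h∈us c∈)) (proj₂ (h∈us c∈)) e
     ... | false = z≤n

   part-cong : ∀ g {f f′} → (∀ t x y → x ∈ us → y ∈ us → g t x y ≡ true → f x y ≡ f′ x y) →
               part g f ≡ part g f′
   part-cong g eq = ≤-antisym (part-mono g λ t x y x∈ y∈ e → ≤-reflexive (eq t x y x∈ y∈ e))
                              (part-mono g λ t x y x∈ y∈ e → ≤-reflexive (sym (eq t x y x∈ y∈ e)))

   part-+ : ∀ g f f′ → part g (λ x y → f x y + f′ x y) ≡ part g f + part g f′
   part-+ g f f′ = trans (∑-cong h λ (t , x , y) → lem (g t x y)) (∑-+ h _ _)
     where
     lem : ∀ b {m o} → (if b then m + o else 0) ≡ (if b then m else 0) + (if b then o else 0)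
     lem true  = refl
     lem false = refl

   part-* : ∀ g c f → part g (λ x y → c * f x y) ≡ c * part g f
   part-* g c f = trans (∑-cong h λ (t , x , y) → lem (g t x y)) (∑-*ˡ h c _)
     where
     lem : ∀ b {m} → (if b then c * m else 0) ≡ c * (if b then m else 0)
     lem true  = refl
     lem false = sym (*-zeroʳ c)

   part-∑ : ∀ g (zs : List ℕ) (f : ℕ → ℕ → ℕ → ℕ) → part g (λ x y → ∑ zs (λ a → f a x y)) ≡ ∑ zs (λ a → part g (f a))
   part-∑ g zs f = trans (∑-cong h λ (t , x , y) → lem (g t x y)) (∑-swap h zs _)
     where
     lem : ∀ b {m : ℕ → ℕ} → (if b then ∑ zs m else 0) ≡ ∑ zs (λ a → if b then m a else 0)
     lem true  = refl
     lem false = sym (∑-zero zs λ _ _ → refl)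

   on-flow on-tree : ℕ → ℕ → ℕ → Bool
   on-flow t x y = (t ≡ᵇ 0) ∧ before x y
   on-tree t x y = t ≡ᵇ 1

   on-commodity : ℕ → ℕ → ℕ → ℕ → Bool
   on-commodity v t x y = t ≡ᵇ suc v

   inflow outflow : ℕ → ℕ
   inflow v = ∑ h (enters v)
   outflow v = ∑ h (pos (0 , v , 0 , 0))

   private
     gate : ∀ a b c → δ (a ∧ b ∧ c) ≡ (if a ∧ c then δ b else 0)
     gate false b     c     = refl
     gate true  false false = refl
     gate true  false true  = refl
     gate true  true  false = refl
     gate true  true  true  = refl

     gate₂ : ∀ a b c → δ (a ∧ b ∧ c) ≡ (if a then δ b * δ c else 0)
     gate₂ false b     c = refl
     gate₂ true  false c = refl
     gate₂ true  true  c = sym (+-identityʳ (δ c))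

     gate₁ : ∀ a b → δ (a ∧ b) ≡ (if a then δ b else 0)
     gate₁ false b = refl
     gate₁ true  b = refl

   inflow-part : ∀ v → inflow v ≡ part on-flow (λ x y → δ (y ≡ᵇ v))
   inflow-part v = ∑-cong h λ (t , x , y) → gate (t ≡ᵇ 0) (y ≡ᵇ v) (before x y)

   outflow-part : ∀ v → outflow v ≡ part on-flow (λ x y → δ (x ≡ᵇ v))
   outflow-part v = ∑-cong h λ (t , x , y) → gate (t ≡ᵇ 0) (x ≡ᵇ v) (before x y)

   row₀ : ∀ {v} → v ∈ vs → K * outflow v ≤ K * inflow v + τ
   row₀ {v} v∈ = ≤-trans (≤-reflexive (cong (K *_) (simplify (outflow v))))
     (≤-trans (rows-hold _ (∈rows (∈-++⁺ˡ (∈-map⁺ (λ v → 0 , v , 0 , 0) v∈))))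
       (≤-reflexive (cong (λ z → K * z + τ) (sym (simplify (inflow v))))))
     where
     simplify : ∀ a → a ≡ a + τ * 0
     simplify a = sym (trans (cong (a +_) (*-zeroʳ τ)) (+-identityʳ a))

   row₁ : K * part on-flow r ≤ K * (τ * flow-budget) + τ
   row₁ = ≤-trans (≤-reflexive (cong (K *_) (sym (trans (cong (part on-flow r +_) (*-zeroʳ τ)) (+-identityʳ _)))))
     (≤-trans (rows-hold (1 , 0 , 0 , 0) (∈rows (∈-++⁺ʳ (map (λ v → 0 , v , 0 , 0) vs) (here refl))))
       (≤-reflexive (cong (λ z → K * (z + τ * flow-budget) + τ) (∑-zero h λ _ _ → refl))))

   row₂ : K * part on-tree ω ≤ K * (τ * tree-budget) + τ
   row₂ = ≤-trans (≤-reflexive (cong (K *_) (sym (trans (cong (part on-tree ω +_) (*-zeroʳ τ)) (+-identityʳ _)))))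
     (≤-trans (rows-hold (2 , 0 , 0 , 0) (∈rows (∈-++⁺ʳ (map (λ v → 0 , v , 0 , 0) vs) (there (here refl)))))
       (≤-reflexive (cong (λ z → K * (z + τ * tree-budget) + τ) (∑-zero h λ _ _ → refl))))

   single : ℕ → ℕ → ℕ → ℕ → ℕ
   single a b x y = δ (x ≡ᵇ a) * δ (y ≡ᵇ b)

   row₃ : ∀ {v a b} → v ∈ vs → a ∈ us → b ∈ us →
          K * part (on-commodity v) (single a b) ≤ K * part on-tree (single a b) + τ
   row₃ {v} {a} {b} v∈ a∈ b∈ = ≤-trans (≤-reflexive (cong (K *_) (simplify _ _
       (∑-cong h λ (t , x , y) → sym (gate₂ (t ≡ᵇ suc v) (x ≡ᵇ a) (y ≡ᵇ b))))))
     (≤-trans (rows-hold (3 , v , a , b) (∈rows (∈-++⁺ʳ (map (λ v → 0 , v , 0 , 0) vs) (there (there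
                (∈-++⁺ˡ (∈-map⁺ (3 ,_) (∈-⊗⁺ v∈ (∈-⊗⁺ a∈ b∈)))))))))
       (≤-reflexive (cong (λ z → K * z + τ) (sym (simplify _ _
         (∑-cong h λ (t , x , y) → sym (gate₂ (t ≡ᵇ 1) (x ≡ᵇ a) (y ≡ᵇ b))))))))
     where
     simplify : ∀ a b → a ≡ b → a ≡ b + τ * 0
     simplify a b e = trans e (sym (trans (cong (b +_) (*-zeroʳ τ)) (+-identityʳ b)))

   row₄ : ∀ {v a} → v ∈ vs → a ∈ vs → rank v ≤ rank a →
     K * (part (on-commodity v) (λ x y → δ (y ≡ᵇ a)) + τ * δ (v ≡ᵇ a)) ≤
     K * (part (on-commodity v) (λ x y → δ (x ≡ᵇ a)) + δ (v ≡ᵇ a) * inflow v) + τ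
   row₄ {v} {a} v∈ a∈ v≤a = ≤-trans (≤-reflexive (cong (λ z → K * (z + τ * δ (v ≡ᵇ a)))
       (∑-cong h λ (t , x , y) → sym (gate₁ (t ≡ᵇ suc v) (y ≡ᵇ a)))))
     (≤-trans (rows-hold (4 , v , a , 0) (∈rows (∈-++⁺ʳ (map (λ v → 0 , v , 0 , 0) vs) (there (there
                (∈-++⁺ʳ (map (3 ,_) (vs ⊗ us ⊗ us)) (∈-map⁺ (λ (v , a) → 4 , v , a , 0)
                  (∈-filterᵇ⁺ (∈-⊗⁺ v∈ a∈) (true-≤ᵇ {rank v} {rank a} v≤a)))))))))
       (≤-reflexive (cong (λ z → K * z + τ) (trans (cong (∑ h (neg (4 , v , a , 0)) +_) (*-zeroʳ τ))
         (trans (+-identityʳ _) (trans (∑-+ h _ _) (cong₂ _+_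
           (∑-cong h λ (t , x , y) → gate₁ (t ≡ᵇ suc v) (x ≡ᵇ a))
           (trans (∑-cong h λ c → if-δ (v ≡ᵇ a) (enters v c)) (∑-*ˡ h (δ (v ≡ᵇ a)) (enters v))))))))))
     where
     if-δ : ∀ b m → (if b then m else 0) ≡ δ b * m
     if-δ true  m = sym (+-identityʳ m)
     if-δ false m = refl

   -- Weak duality for the flow: A and B are potentials at the entrance and
   -- at the exit of each vertex.
   module Potentials (A B : ℕ → ℕ) (B0 : B 0 ≡ 0) (B≤A : ∀ v → B v ≤ A v) (A≤ : ∀ v → A v ≤ suc M)
     (arc : ∀ u v → u ∈ us → v ∈ us → before u v ≡ true → A v ≤ r u v + B u) where

     private
       weighted-inflow : ∑ vs (λ v → A v * inflow v) ≤ part on-flow (λ x y → A y)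
       weighted-inflow = begin
         ∑ vs (λ v → A v * inflow v)                       ≡⟨ ∑-cong vs (λ v → trans (cong (A v *_) (inflow-part v)) (sym (part-* on-flow (A v) _))) ⟩
         ∑ vs (λ v → part on-flow (λ x y → A v * δ (y ≡ᵇ v))) ≡⟨ part-∑ on-flow vs _ ⟨
         part on-flow (λ x y → ∑ vs (λ v → A v * δ (y ≡ᵇ v))) ≤⟨ part-mono on-flow (λ t x y _ _ _ →
              ≤-trans (≤-reflexive (∑-cong vs λ v → *-comm (A v) _)) (select-≤ y vs-unique A)) ⟩
         part on-flow (λ x y → A y)                        ∎
         where open ≤-Reasoning

       weighted-outflow : part on-flow (λ x y → B x) ≤ ∑ vs (λ v → B v * outflow v)
       weighted-outflow = begin
         part on-flow (λ x y → B x)                        ≤⟨ part-mono on-flow (λ t x y x∈ _ _ → spread x x∈) ⟩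
         part on-flow (λ x y → ∑ vs (λ v → B v * δ (x ≡ᵇ v))) ≡⟨ part-∑ on-flow vs _ ⟩
         ∑ vs (λ v → part on-flow (λ x y → B v * δ (x ≡ᵇ v))) ≡⟨ ∑-cong vs (λ v → trans (part-* on-flow (B v) _) (cong (B v *_) (sym (outflow-part v)))) ⟩
         ∑ vs (λ v → B v * outflow v)                      ∎
         where
         open ≤-Reasoning
         spread : ∀ x → x ∈ us → B x ≤ ∑ vs (λ v → B v * δ (x ≡ᵇ v))
         spread zero    x∈ = ≤-trans (≤-reflexive B0) z≤n
         spread (suc x) x∈ = ≤-reflexive (trans (sym (select vs-unique (∈vs (s≤s z≤n) (us≤ x∈)) B))
                               (∑-cong vs λ v → *-comm _ (B v)))

       weighted-inflow≥ : part on-flow (λ x y → A y) ≤ part on-flow r + part on-flow (λ x y → B x)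
       weighted-inflow≥ = ≤-trans
         (part-mono on-flow λ t x y x∈ y∈ e → arc x y x∈ y∈ (proj₂ (∧-true {t ≡ᵇ 0} e)))
         (≤-reflexive (part-+ on-flow r (λ x y → B x)))

     -- An arc from `u` to `v` costs at least `A v - B u`. Summed over the flow, a vertex counts `A`
     -- times its inflow and loses `B` times its outflow; as the outflow may exceed the inflow by
     -- `τ / K`, the last term appears.
     duality : K * ∑ vs (λ v → (A v ∸ B v) * inflow v) ≤ K * part on-flow r + n * suc M * τ
     duality = linear (K * ∑ vs (λ v → B v * inflow v)) (begin
         K * ∑ vs (λ v → A v * inflow v)
           ≤⟨ *-monoʳ-≤ K (≤-trans weighted-inflow (≤-trans weighted-inflow≥ (+-monoʳ-≤ _ weighted-outflow))) ⟩
         K * (part on-flow r + ∑ vs (λ v → B v * outflow v))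
           ≡⟨ trans (*-distribˡ-+ K (part on-flow r) _) (cong (K * part on-flow r +_)
                (trans (sym (∑-*ˡ vs K _)) (∑-cong vs λ v → lem K (B v) (outflow v)))) ⟩
         K * part on-flow r + ∑ vs (λ v → B v * (K * outflow v))
           ≤⟨ +-monoʳ-≤ _ (∑-mono∈ vs λ v v∈ → *-monoʳ-≤ (B v) (row₀ v∈)) ⟩
         K * part on-flow r + ∑ vs (λ v → B v * (K * inflow v + τ))
           ≡⟨ cong (K * part on-flow r +_) (trans (∑-cong vs λ v → lem₂ K (B v) (inflow v) τ)
                (trans (∑-+ vs _ _) (cong₂ _+_ (∑-*ˡ vs K _) (∑-*ʳ vs τ B)))) ⟩
         K * part on-flow r + (K * ∑ vs (λ v → B v * inflow v) + ∑ vs B * τ)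
           ≤⟨ +-monoʳ-≤ (K * part on-flow r) (+-monoʳ-≤ _ (*-monoˡ-≤ τ
                (≤-trans (∑-mono vs λ v → ≤-trans (B≤A v) (A≤ v))
                  (≤-reflexive (trans (∑-const vs (suc M)) (cong (_* suc M) length-vs)))))) ⟩
         K * part on-flow r + (K * ∑ vs (λ v → B v * inflow v) + n * suc M * τ) ∎)
       (trans (sym (*-distribˡ-+ K _ _)) (cong (K *_) (trans (sym (∑-+ vs _ _))
         (∑-cong vs λ v → trans (sym (*-distribʳ-+ (inflow v) (B v) (A v ∸ B v)))
           (cong (_* inflow v) (m+[n∸m]≡n (B≤A v)))))))
       (lem₃ (K * part on-flow r) (K * ∑ vs (λ v → B v * inflow v)) (n * suc M * τ))
       where
       open ≤-Reasoning
       lem : ∀ K b x → K * (b * x) ≡ b * (K * x)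
       lem = solve-∀
       lem₂ : ∀ K b x t → b * (K * x + t) ≡ K * (b * x) + b * t
       lem₂ = solve-∀
       lem₃ : ∀ a b c → a + (b + c) ≡ b + (a + c)
       lem₃ = solve-∀

   -- Every set avoiding the chosen vertices is left by much of the tree:
   -- its vertex of smallest rank has to be connected to a smaller one.
   module Cut (S : List ℕ) (S-unique : Unique S) (S⊆vs : ∀ {v} → v ∈ S → v ∈ vs)
     (unchosen : ∀ {v} → v ∈ S → 20 * inflow v ≤ 9 * τ) where

     private
       N : ℕ
       N = suc n

       S⊆us : ∀ {v} → v ∈ S → v ∈ us
       S⊆us v∈ = vs⊆us (S⊆vs v∈)

       length-S : length S ≤ N
       length-S = ≤-trans (length-≼ S us (≼-unique S-unique S⊆us)) (≤-reflexive (length-downFrom N))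

       total : ∀ g (x : ℕ → ℕ → ℕ) → ∑ S (λ a → part g (λ y z → δ (x y z ≡ᵇ a))) ≡ part g (λ y z → occurrences (x y z) S)
       total g x = trans (sym (part-∑ g S _)) (part-cong g λ t y z _ _ _ →
         ∑-cong S λ a → cong δ (≡ᵇ-sym (x y z) a))

       -- Splits the arcs that leave `S` into single arcs, to which the capacity constraints apply.
       expand : ∀ g → part g (leaving S) ≡ ∑ S (λ a → ∑ us (λ b → (1 ∸ occurrences b S) * part g (single a b)))
       expand g = begin
         part g (leaving S)
           ≡⟨ part-cong g (λ t x y _ y∈ _ → sym (split x y y∈)) ⟩
         part g (λ x y → ∑ S (λ a → ∑ us (λ b → (1 ∸ occurrences b S) * single a b x y)))
           ≡⟨ part-∑ g S (λ a x y → ∑ us (λ b → (1 ∸ occurrences b S) * single a b x y)) ⟩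
         ∑ S (λ a → part g (λ x y → ∑ us (λ b → (1 ∸ occurrences b S) * single a b x y)))
           ≡⟨ ∑-cong S (λ a → trans (part-∑ g us (λ b x y → (1 ∸ occurrences b S) * single a b x y)) (∑-cong us λ b → part-* g (1 ∸ occurrences b S) (single a b))) ⟩
         ∑ S (λ a → ∑ us (λ b → (1 ∸ occurrences b S) * part g (single a b))) ∎
         where
         open ≡-Reasoning
         lem : ∀ w p q → w * (p * q) ≡ p * (q * w)
         lem = solve-∀
         split : ∀ x y → y ∈ us → ∑ S (λ a → ∑ us (λ b → (1 ∸ occurrences b S) * single a b x y)) ≡ leaving S x y
         split x y y∈ = begin
           ∑ S (λ a → ∑ us (λ b → (1 ∸ occurrences b S) * (δ (x ≡ᵇ a) * δ (y ≡ᵇ b))))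
             ≡⟨ ∑-cong S (λ a → trans (∑-cong us λ b → lem (1 ∸ occurrences b S) (δ (x ≡ᵇ a)) (δ (y ≡ᵇ b)))
                  (trans (∑-*ˡ us (δ (x ≡ᵇ a)) _) (cong (δ (x ≡ᵇ a) *_) (select us-unique y∈ (λ b → 1 ∸ occurrences b S))))) ⟩
           ∑ S (λ a → δ (x ≡ᵇ a) * (1 ∸ occurrences y S))
             ≡⟨ trans (∑-*ʳ S (1 ∸ occurrences y S) _) (cong (_* (1 ∸ occurrences y S)) (∑-cong S λ a → cong δ (≡ᵇ-sym x a))) ⟩
           leaving S x y ∎

       -- Each of the at most `N * N` arcs contributes the error of its own capacity constraint.
       commodity-leaves : ∀ {v} → v ∈ vs →
         K * part (on-commodity v) (leaving S) ≤ K * part on-tree (leaving S) + N * (N * τ)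
       commodity-leaves {v} v∈ = begin
         K * part (on-commodity v) (leaving S)
           ≡⟨ trans (cong (K *_) (expand (on-commodity v))) (inner (on-commodity v)) ⟩
         ∑ S (λ a → ∑ us (λ b → (1 ∸ occurrences b S) * (K * part (on-commodity v) (single a b))))
           ≤⟨ ∑-mono∈ S (λ a a∈ → ∑-mono∈ us λ b b∈ → *-monoʳ-≤ (1 ∸ occurrences b S) (row₃ v∈ (S⊆us a∈) b∈)) ⟩
         ∑ S (λ a → ∑ us (λ b → (1 ∸ occurrences b S) * (K * part on-tree (single a b) + τ)))
           ≤⟨ ∑-mono S (λ a → ∑-mono us λ b → ≤-trans (≤-reflexive (*-distribˡ-+ (1 ∸ occurrences b S) _ τ))
                (+-monoʳ-≤ _ (≤-trans (*-monoˡ-≤ τ (m∸n≤m 1 (occurrences b S))) (≤-reflexive (+-identityʳ τ))))) ⟩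
         ∑ S (λ a → ∑ us (λ b → (1 ∸ occurrences b S) * (K * part on-tree (single a b)) + τ))
           ≡⟨ trans (∑-cong S λ a → ∑-+ us (λ b → (1 ∸ occurrences b S) * (K * part on-tree (single a b))) (λ _ → τ))
                (∑-+ S _ _) ⟩
         ∑ S (λ a → ∑ us (λ b → (1 ∸ occurrences b S) * (K * part on-tree (single a b)))) + ∑ S (λ _ → ∑ us (λ _ → τ))
           ≡⟨ cong₂ _+_ (sym (trans (cong (K *_) (expand on-tree)) (inner on-tree)))
                (trans (∑-const S _) (cong (length S *_) (trans (∑-const us τ) (cong (_* τ) (length-downFrom N))))) ⟩
         K * part on-tree (leaving S) + length S * (N * τ)
           ≤⟨ +-monoʳ-≤ _ (*-monoˡ-≤ (N * τ) length-S) ⟩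
         K * part on-tree (leaving S) + N * (N * τ) ∎
         where
         open ≤-Reasoning
         lem : ∀ K w x → K * (w * x) ≡ w * (K * x)
         lem = solve-∀
         inner : ∀ g → K * ∑ S (λ a → ∑ us (λ b → (1 ∸ occurrences b S) * part g (single a b)))
                     ≡ ∑ S (λ a → ∑ us (λ b → (1 ∸ occurrences b S) * (K * part g (single a b))))
         inner g = trans (sym (∑-*ˡ S K _)) (∑-cong S λ a →
           trans (sym (∑-*ˡ us K _)) (∑-cong us λ b → lem K (1 ∸ occurrences b S) (part g (single a b))))

       -- Conservation is demanded except at vertices of smaller rank than `v`. By the choice of `v`
       -- there are none in `S`, and the constraints can be summed over all of `S`.
       conserved : ∀ {v} → v ∈ S → (∀ a → a ∈ S → rank v ≤ rank a) →
         K * (part (on-commodity v) (λ x y → occurrences y S) + τ) ≤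
         K * (part (on-commodity v) (λ x y → occurrences x S) + inflow v) + N * τ
       conserved {v} v∈ least = begin
         K * (part F (λ x y → occurrences y S) + τ)
           ≡⟨ cong (K *_) (cong₂ _+_ (sym (total F (λ x y → y))) (sym (select S-unique v∈ (λ _ → τ)))) ⟩
         K * (∑ S (λ a → part F (λ x y → δ (y ≡ᵇ a))) + ∑ S (λ a → δ (v ≡ᵇ a) * τ))
           ≡⟨ trans (cong (K *_) (sym (∑-+ S _ _))) (sym (∑-*ˡ S K _)) ⟩
         ∑ S (λ a → K * (part F (λ x y → δ (y ≡ᵇ a)) + δ (v ≡ᵇ a) * τ))
           ≤⟨ ∑-mono∈ S (λ a a∈ → ≤-trans
                (≤-reflexive (cong (λ z → K * (part F (λ x y → δ (y ≡ᵇ a)) + z)) (*-comm (δ (v ≡ᵇ a)) τ)))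
                (row₄ (S⊆vs v∈) (S⊆vs a∈) (least a a∈))) ⟩
         ∑ S (λ a → K * (part F (λ x y → δ (x ≡ᵇ a)) + δ (v ≡ᵇ a) * inflow v) + τ)
           ≡⟨ trans (∑-+ S _ _) (cong₂ _+_ (∑-*ˡ S K _) (∑-const S τ)) ⟩
         K * ∑ S (λ a → part F (λ x y → δ (x ≡ᵇ a)) + δ (v ≡ᵇ a) * inflow v) + length S * τ
           ≤⟨ +-mono-≤ (≤-reflexive (cong (K *_) (trans (∑-+ S _ _)
                (cong₂ _+_ (total F (λ x y → x)) (select S-unique v∈ (λ _ → inflow v))))))
                (*-monoˡ-≤ τ length-S) ⟩
         K * (part F (λ x y → occurrences x S) + inflow v) + N * τ ∎
         where
         open ≤-Reasoning
         F : ℕ → ℕ → ℕ → Bool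
         F = on-commodity v

       leaves : ∀ g → part g (λ x y → occurrences x S) ≤ part g (λ x y → occurrences y S) + part g (leaving S)
       leaves g = ≤-trans (part-mono g λ t x y _ _ _ → lem (occurrences y S) (occurrences-unique x S-unique))
                          (≤-reflexive (part-+ g _ (leaving S)))
         where
         lem : ∀ b {a} → a ≤ 1 → a ≤ b + a * (1 ∸ b)
         lem zero    {a} _ = ≤-reflexive (sym (*-identityʳ a))
         lem (suc b) a≤1 = ≤-trans a≤1 (s≤s z≤n)

     -- 11 is 20 - 9: the vertex of smallest rank in `S` is entered by at most 9/20 of flow, and it
     -- sends the rest out of `S`. The errors of conservation and of the capacities contribute
     -- `20 * N` and `20 * (N * N)`, together at most `40 * (N * N)`.
     cut-bound : ∀ {s} → s ∈ S → 11 * (K * τ) ≤ 20 * (K * part on-tree (leaving S)) + 40 * (N * N * τ)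
     cut-bound s∈ with argmin (λ _ → true) rank S s∈ refl
     ... | v , v∈ , _ , _ , least = linear (20 * (K * Y) + 9 * (K * τ)) (begin
         20 * (K * (Y + τ))
           ≤⟨ *-monoʳ-≤ 20 (conserved v∈ λ a a∈ → least a a∈ refl) ⟩
         20 * (K * (X + inflow v) + N * τ)
           ≤⟨ *-monoʳ-≤ 20 (+-monoˡ-≤ (N * τ) (*-monoʳ-≤ K (+-monoˡ-≤ (inflow v) (leaves (on-commodity v))))) ⟩
         20 * (K * (Y + L + inflow v) + N * τ)
           ≡⟨ lem₁ K Y L (inflow v) N τ ⟩
         20 * (K * Y) + (20 * (K * L) + (K * (20 * inflow v) + 20 * (N * τ)))
           ≤⟨ +-monoʳ-≤ (20 * (K * Y)) (+-mono-≤ (*-monoʳ-≤ 20 (commodity-leaves (S⊆vs v∈)))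
                (+-mono-≤ (*-monoʳ-≤ K (unchosen v∈)) (*-monoʳ-≤ 20 (m≤m*n (N * τ) N)))) ⟩
         20 * (K * Y) + (20 * (K * Z + N * (N * τ)) + (K * (9 * τ) + 20 * (N * τ * N))) ∎)
       (lem₂ K Y τ) (lem₃ K Y Z N τ)
       where
       open ≤-Reasoning
       X Y L Z : ℕ
       X = part (on-commodity v) (λ x y → occurrences x S)
       Y = part (on-commodity v) (λ x y → occurrences y S)
       L = part (on-commodity v) (leaving S)
       Z = part on-tree (leaving S)
       lem₁ : ∀ K Y L i N t → 20 * (K * (Y + L + i) + N * t)
              ≡ 20 * (K * Y) + (20 * (K * L) + (K * (20 * i) + 20 * (N * t)))
       lem₁ = solve-∀
       lem₂ : ∀ K Y t → 20 * (K * Y) + 9 * (K * t) + 11 * (K * t) ≡ 20 * (K * (Y + t))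
       lem₂ = solve-∀
       lem₃ : ∀ K Y Z N t → 20 * (K * Y) + (20 * (K * Z + N * (N * t)) + (K * (9 * t) + 20 * (N * t * N)))
              ≡ 20 * (K * Y) + 9 * (K * t) + (20 * (K * Z) + 40 * (N * N * t))
       lem₃ = solve-∀

  module Chosen (ws : List ℕ) (ws-unique : Unique ws) (ws⊆vs : ∀ {v} → v ∈ ws → v ∈ vs) where

   open Round ws

   -- The cost of the chains found by the auction

   module Auction where

    private
      Bids : Set
      Bids = List (ℕ × ℕ)

      ws≢0 : ∀ {v} → v ∈ ws → v ≢ 0
      ws≢0 v∈ refl with vs-bounds (ws⊆vs v∈)
      ... | () , _

    -- Complementary slackness up to one unit, the increment of the prices. `cheapest` survives
    -- later bids, because other prices only rise while the price of an owned item is fixed until it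
    -- changes hands. `low` and `total` bound the number of bids.
    record Inv (h : Bids) : Set where
      field
        unsold : ∀ u → owner h u ≡ 0 → price h u ≡ 0
        buyer  : ∀ u → owner h u ≢ 0 → owner h u ∈ ws
        item   : ∀ u → owner h u ≢ 0 → u ∈ ws
        earlier : ∀ u → owner h u ≢ 0 → before u (owner h u) ≡ true
        affordable : ∀ u → owner h u ≢ 0 → r u (owner h u) + price h u ≤ suc M
        cheapest : ∀ u → owner h u ≢ 0 → ∀ u′ → u′ ∈ ws → before u′ (owner h u) ≡ true →
                   r u (owner h u) + price h u ≤ suc (r u′ (owner h u) + price h u′)
        once   : ∀ u u′ → owner h u ≢ 0 → owner h u ≡ owner h u′ → u ≡ u′
        low    : ∀ u → price h u ≤ suc M
        total  : length h ≡ ∑ ws (price h)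

    private
      price-up : ∀ e (h : Bids) u → price h u ≤ price (e ∷ h) u
      price-up e h u = m≤n+m (price h u) _

    empty-inv : Inv []
    empty-inv = record
      { unsold = λ _ _ → refl
      ; buyer = λ _ ne → contradiction refl ne
      ; item = λ _ ne → contradiction refl ne
      ; earlier = λ _ ne → contradiction refl ne
      ; affordable = λ _ ne → contradiction refl ne
      ; cheapest = λ _ ne → contradiction refl ne
      ; once = λ _ _ ne → contradiction refl ne
      ; low = λ _ → z≤n
      ; total = sym (∑-zero ws λ _ _ → refl) }

    module Bid {h : Bids} (inv : Inv h) {v u₀ : ℕ} (e∈ : (v , u₀) ∈ ws ⊗ ws) (ok : bid h (v , u₀) ≡ true) where

      open Inv inv

      h′ : Bids
      h′ = (v , u₀) ∷ h

      v∈ : v ∈ ws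
      v∈ = proj₁ (∈-⊗⁻ ws e∈)

      u₀∈ : u₀ ∈ ws
      u₀∈ = proj₂ (∈-⊗⁻ ws e∈)

      ok₁ = ∧-true {before u₀ v} ok
      ok₂ = ∧-true {free h v} (proj₂ ok₁)
      ok₃ = ∧-true {r u₀ v + price h u₀ ≤ᵇ M} (proj₂ ok₂)

      is-free : ∀ u → u ∈ ws → owner h u ≢ v
      is-free u u∈ e = contradiction (trans (sym (not-true (every-true {xs = ws} (proj₁ ok₂) u∈))) (true-≡ᵇ e)) λ ()

      fits : r u₀ v + price h u₀ ≤ M
      fits = ≤ᵇ-true (proj₁ ok₃)

      minimal : ∀ u′ → u′ ∈ ws → before u′ v ≡ true → r u₀ v + price h u₀ ≤ r u′ v + price h u′
      minimal u′ u′∈ b = ≤ᵇ-true {r u₀ v + price h u₀} (imp-true {before u′ v} (every-true {xs = ws} (proj₂ ok₃) u′∈) b)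

      price-new : price h′ u₀ ≡ suc (price h u₀)
      price-new rewrite true-≡ᵇ {u₀} refl = refl

      not-owned : ∀ {u} → owner h u ≢ v
      not-owned {u} e = is-free u (item u (λ z → ws≢0 v∈ (trans (sym e) z))) e

      -- A bid changes the ownership of one item. Its former owner becomes free, and nothing has to
      -- be shown about free vertices.
      sale : (P : ℕ → ℕ → Set) → P u₀ v → (∀ u → u₀ ≢ u → owner h u ≢ 0 → P u (owner h u)) →
             ∀ u → owner h′ u ≢ 0 → P u (owner h′ u)
      sale P new old u ne with u₀ ≡ᵇ u in e
      ... | true  rewrite ≡ᵇ-true {u₀} e = new
      ... | false = old u (λ eq → contradiction (trans (sym e) (true-≡ᵇ {u₀} eq)) λ ()) ne

      price-old : ∀ {u} → u₀ ≢ u → price h′ u ≡ price h u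
      price-old {u} ne rewrite false-≡ᵇ {u₀} {u} ne = refl

      bid-inv : Inv h′
      bid-inv = record
        { unsold = unsold′
        ; buyer = sale (λ u w → w ∈ ws) v∈ (λ u _ ne → buyer u ne)
        ; item = sale (λ u w → u ∈ ws) u₀∈ (λ u _ ne → item u ne)
        ; earlier = sale (λ u w → before u w ≡ true) (proj₁ ok₁) (λ u _ ne → earlier u ne)
        ; affordable = sale (λ u w → r u w + price h′ u ≤ suc M)
            (≤-trans (≤-reflexive (trans (cong (r u₀ v +_) price-new) (+-suc _ _))) (s≤s fits))
            (λ u d ne → ≤-trans (≤-reflexive (cong (r u (owner h u) +_) (price-old d))) (affordable u ne))
        ; cheapest = sale (λ u w → ∀ u′ → u′ ∈ ws → before u′ w ≡ true → r u w + price h′ u ≤ suc (r u′ w + price h′ u′))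
            (λ u′ u′∈ b → ≤-trans (≤-reflexive (trans (cong (r u₀ v +_) price-new) (+-suc _ _)))
              (s≤s (≤-trans (minimal u′ u′∈ b) (+-monoʳ-≤ (r u′ v) (price-up (v , u₀) h u′)))))
            (λ u d ne u′ u′∈ b → ≤-trans (≤-reflexive (cong (r u (owner h u) +_) (price-old d)))
              (≤-trans (cheapest u ne u′ u′∈ b) (s≤s (+-monoʳ-≤ (r u′ (owner h u)) (price-up (v , u₀) h u′)))))
        ; once = once′
        ; low = low′
        ; total = total′ }
        where
        unsold′ : ∀ u → owner h′ u ≡ 0 → price h′ u ≡ 0
        unsold′ u e with u₀ ≡ᵇ u
        ... | true  = contradiction e (ws≢0 v∈)
        ... | false = unsold u e
        once′ : ∀ u u′ → owner h′ u ≢ 0 → owner h′ u ≡ owner h′ u′ → u ≡ u′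
        once′ u u′ ne eq with u₀ ≡ᵇ u in e | u₀ ≡ᵇ u′ in e′
        ... | true  | true  = trans (sym (≡ᵇ-true {u₀} e)) (≡ᵇ-true {u₀} e′)
        ... | true  | false = contradiction (sym eq) not-owned
        ... | false | true  = contradiction eq not-owned
        ... | false | false = once u u′ ne eq
        low′ : ∀ u → price h′ u ≤ suc M
        low′ u with u₀ ≡ᵇ u in e
        ... | true rewrite sym (≡ᵇ-true {u₀} e) = s≤s (≤-trans (m≤n+m _ (r u₀ v)) fits)
        ... | false = low u
        total′ : length h′ ≡ ∑ ws (price h′)
        total′ = sym (trans (∑-+ ws (λ u → δ (u₀ ≡ᵇ u)) (price h)) (cong₂ _+_
          (trans (∑-cong ws λ u → sym (*-identityʳ _)) (select ws-unique u₀∈ (λ _ → 1))) (sym total)))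

    admissible-inv : ∀ {h} → Admissible bid (ws ⊗ ws) h → Inv h
    admissible-inv [] = empty-inv
    admissible-inv (add e∈ ok a) = Bid.bid-inv (admissible-inv a) e∈ ok

    opaque
      unfolding bids

      bids-inv : Inv bids
      bids-inv = admissible-inv (greedy-admissible bid (ws ⊗ ws) (n * suc M + 1))

      bids-outcome : length bids ≡ n * suc M + 1 ⊎ (∀ e → e ∈ ws ⊗ ws → bid bids e ≡ false)
      bids-outcome = greedy-outcome bid (ws ⊗ ws) (n * suc M + 1)

    length-ws : length ws ≤ n
    length-ws = ≤-trans (length-≼ ws vs (≼-unique ws-unique ws⊆vs)) (≤-reflexive length-vs)

    bids-stuck : ∀ e → e ∈ ws ⊗ ws → bid bids e ≡ false
    bids-stuck with bids-outcome
    ... | inj₂ s = s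
    ... | inj₁ l = contradiction (≤-trans (≤-reflexive (sym l)) (≤-trans (≤-reflexive (Inv.total bids-inv))
        (≤-trans (∑-mono ws (Inv.low bids-inv)) (≤-trans (≤-reflexive (∑-const ws (suc M)))
          (*-monoˡ-≤ (suc M) length-ws))))) (<⇒≱ (≤-reflexive (+-comm 1 (n * suc M))))

    module Final (h : Bids) (inv : Inv h) (stuck : ∀ e → e ∈ ws ⊗ ws → bid h e ≡ false) where

      open Inv inv

      β : ℕ → ℕ
      β = price h

      pre : ℕ → ℕ
      pre v = nth 0 (filterᵇ (λ u → owner h u ≡ᵇ v) ws) 0

      pre-owned : ∀ {u v} → v ∈ ws → owner h u ≡ v → pre v ≡ u
      pre-owned {u} {v} v∈ e with filterᵇ (λ u → owner h u ≡ᵇ v) ws in eq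
      ... | [] = contradiction (trans (sym (empty-filter eq u (item u λ z → ws≢0 v∈ (trans (sym e) z)))) (true-≡ᵇ e)) λ ()
      ... | w ∷ _ = once w u (λ z → ws≢0 v∈ (trans (sym own) z)) (trans own (sym e))
        where
        own : owner h w ≡ v
        own = ≡ᵇ-true (proj₂ (∈-filterᵇ⁻ {xs = ws} (subst (w ∈_) (sym eq) (here refl))))

      pre-cases : ∀ v → (pre v ≡ 0 × free h v ≡ true) ⊎ (pre v ∈ ws × owner h (pre v) ≡ v)
      pre-cases v with filterᵇ (λ u → owner h u ≡ᵇ v) ws in eq
      ... | [] = inj₁ (refl , true-every ws λ u u∈ → true-not (empty-filter eq u u∈))
      ... | w ∷ _ with ∈-filterᵇ⁻ {xs = ws} (subst (w ∈_) (sym eq) (here refl))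
      ...   | w∈ , own = inj₂ (w∈ , ≡ᵇ-true own)

      -- At the end a vertex without an item declines even the cheapest one, which must therefore be
      -- as expensive as a new path.
      dear : ∀ {u v} → v ∈ ws → free h v ≡ true → u ∈ ws → before u v ≡ true → suc M ≤ r u v + β u
      dear {u} {v} v∈ fr u∈ b with r u v + β u ≤? M
      ... | no  nle = ≰⇒> nle
      ... | yes le with argmin (λ u → before u v) (λ u → r u v + β u) ws u∈ b
      ...   | w , w∈ , bw , w≤ , least = contradiction
              (trans (sym (stuck (v , w) (∈-⊗⁺ v∈ w∈)))
                (true-∧ bw (true-∧ fr (true-∧ (true-≤ᵇ {r w v + β w} (≤-trans w≤ le))
                  (true-every ws λ z z∈ → true-imp {before z v} λ bz → true-≤ᵇ {r w v + β w} (least z z∈ bz)))))) λ ()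

      -- The potentials: A is the least price at which a vertex can be
      -- reached, B the price for leaving it.
      A : ℕ → ℕ
      A v = foldr _⊓_ (suc M) (map (λ u → r u v + β u) (filterᵇ (λ u → before u v) ws))

      private
        fold-≤ : ∀ (xs : List ℕ) (f : ℕ → ℕ) → foldr _⊓_ (suc M) (map f xs) ≤ suc M
        fold-≤ []       f = ≤-refl
        fold-≤ (x ∷ xs) f = ≤-trans (m⊓n≤n (f x) _) (fold-≤ xs f)

        fold-∈ : ∀ {xs : List ℕ} {x} (f : ℕ → ℕ) → x ∈ xs → foldr _⊓_ (suc M) (map f xs) ≤ f x
        fold-∈ f (here refl) = m⊓n≤m _ _
        fold-∈ f (there x∈)  = ≤-trans (m⊓n≤n _ _) (fold-∈ f x∈)

        fold-glb : ∀ (xs : List ℕ) (f : ℕ → ℕ) {b} → b ≤ suc M → (∀ x → x ∈ xs → b ≤ f x) →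
                   b ≤ foldr _⊓_ (suc M) (map f xs)
        fold-glb []       f b≤ h = b≤
        fold-glb (x ∷ xs) f b≤ h = ⊓-glb (h x (here refl)) (fold-glb xs f b≤ λ y y∈ → h y (there y∈))

      A≤ : ∀ v → A v ≤ suc M
      A≤ v = fold-≤ (filterᵇ (λ u → before u v) ws) _

      A≤arc : ∀ {u v} → u ∈ ws → before u v ≡ true → A v ≤ r u v + β u
      A≤arc {u} {v} u∈ b = fold-∈ (λ u → r u v + β u) (∈-filterᵇ⁺ u∈ b)

      ≤A : ∀ {b v} → b ≤ suc M → (∀ u → u ∈ ws → before u v ≡ true → b ≤ r u v + β u) → b ≤ A v
      ≤A {b} {v} b≤ h = fold-glb (filterᵇ (λ u → before u v) ws) (λ u → r u v + β u) b≤
        λ u u∈ → let u∈ws , bu = ∈-filterᵇ⁻ {xs = ws} u∈ in h u u∈ws bu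

      B : ℕ → ℕ
      B zero    = 0
      -- A vertex that is not chosen is left at the price of reaching it and contributes nothing to
      -- `A - B`. For the chosen ones the minimum ensures `B ≤ A`.
      B (suc v) = if member (suc v) ws then β (suc v) ⊓ A (suc v) else A (suc v)

      B≤A : ∀ v → B v ≤ A v
      B≤A zero = z≤n
      B≤A (suc v) with member (suc v) ws
      ... | true  = m⊓n≤n _ _
      ... | false = ≤-refl

      B≤β : ∀ {v} → v ∈ ws → B v ≤ β v
      B≤β {zero}  v∈ = z≤n
      B≤β {suc v} v∈ rewrite ∈-member v∈ = m⊓n≤m _ _

      private
        before-trans : ∀ {u v w} → before u v ≡ true → before v w ≡ true → before u w ≡ true
        before-trans {u} {v} {w} b c = true-<ᵇ {rank u} {rank w} (<-trans (before-< {u} {v} b) (before-< {v} {w} c))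

        -- Whatever precedes `u` precedes `v` too, and by the triangle inequality it serves `v` for
        -- at most `r u v` more.
        through : ∀ u v → before u v ≡ true → A v ≤ r u v + A u
        through u v b = ≤-trans (m≤n+m∸n (A v) (r u v)) (+-monoʳ-≤ (r u v)
          (≤A (≤-trans (m∸n≤m (A v) (r u v)) (A≤ v)) λ x x∈ bx →
            m≤n+o⇒m∸n≤o (A v) (r u v) (≤-trans (A≤arc x∈ (before-trans {x} {u} {v} bx b))
              (≤-trans (+-monoˡ-≤ (β x) (triangle x u v)) (≤-reflexive (lem (r x u) (r u v) (β x)))))))
          where
          lem : ∀ a b c → a + b + c ≡ b + (a + c)
          lem = solve-∀

      arc : ∀ u v → u ∈ us → v ∈ us → before u v ≡ true → A v ≤ r u v + B u
      arc zero    v _ _ b = ≤-trans (A≤ v) (≤-trans (≤-reflexive (sym (depot-r v))) (m≤m+n _ 0))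
      arc (suc u) v _ _ b with member (suc u) ws in e
      ... | false = through (suc u) v b
      ... | true with ⊓-sel (β (suc u)) (A (suc u))
      ...   | inj₁ eq rewrite eq = A≤arc (member-∈ ws e) b
      ...   | inj₂ eq rewrite eq = through (suc u) v b

      paid : ℕ → ℕ
      paid v = if pre v ≡ᵇ 0 then 0 else β (pre v)

      -- A vertex without an item pays `suc M`, and so large is `A v`, all items being too dear. An
      -- owner pays at most one unit more than any other item would cost.
      expense : ∀ {v} → v ∈ ws → r (pre v) v + paid v ≤ suc (A v)
      expense {v} v∈ with pre-cases v
      ... | inj₁ (e , fr) rewrite e | depot-r v = ≤-trans (≤-reflexive (+-identityʳ _))
            (≤-trans (≤A ≤-refl λ u u∈ b → dear v∈ fr u∈ b) (n≤1+n _))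
      ... | inj₂ (p∈ , own) rewrite false-≡ᵇ {pre v} {0} (ws≢0 p∈) =
            ≤-trans (m≤n+m∸n _ 1) (s≤s (≤A
              (≤-trans (pred-mono-≤ sold) ≤-refl′)
              λ u u∈ b → pred-mono-≤ (best-buy u u∈ b)))
        where
        ≤-refl′ : M ≤ suc M
        ≤-refl′ = n≤1+n M
        ne : owner h (pre v) ≢ 0
        ne z = ws≢0 v∈ (trans (sym own) z)
        sold : r (pre v) v + β (pre v) ≤ suc M
        sold = subst (λ w → r (pre v) w + β (pre v) ≤ suc M) own (affordable (pre v) ne)
        best-buy : ∀ u → u ∈ ws → before u v ≡ true → r (pre v) v + β (pre v) ≤ suc (r u v + β u)
        best-buy = subst (λ w → ∀ u → u ∈ ws → before u w ≡ true → r (pre v) w + β (pre v) ≤ suc (r u w + β u))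
                 own (cheapest (pre v) ne)

      -- Every object with a positive price has been sold.
      revenue : ∑ ws β ≤ ∑ ws paid
      revenue = begin
        ∑ ws β                                              ≤⟨ ∑-mono∈ ws (λ u u∈ → sold u u∈) ⟩
        ∑ ws (λ u → ∑ ws (λ v → δ (pre v ≡ᵇ u) * β u))      ≡⟨ ∑-swap ws ws _ ⟩
        ∑ ws (λ v → ∑ ws (λ u → δ (pre v ≡ᵇ u) * β u))      ≤⟨ ∑-mono ws each ⟩
        ∑ ws paid                                           ∎
        where
        open ≤-Reasoning
        sold : ∀ u → u ∈ ws → β u ≤ ∑ ws (λ v → δ (pre v ≡ᵇ u) * β u)
        sold u u∈ with owner h u ≟ 0
        ... | yes e = ≤-trans (≤-reflexive (unsold u e)) z≤n
        ... | no ne = ≤-trans (≤-reflexive (sym (trans (cong (λ b → δ b * β u)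
                (true-≡ᵇ (pre-owned (buyer u ne) refl))) (+-identityʳ (β u)))))
                (∑-member (λ v → δ (pre v ≡ᵇ u) * β u) (buyer u ne))
        each : ∀ v → ∑ ws (λ u → δ (pre v ≡ᵇ u) * β u) ≤ paid v
        each v with pre v ≡ᵇ 0 in e
        ... | false = select-≤ (pre v) ws-unique β
        ... | true rewrite ≡ᵇ-true {pre v} e = ≤-reflexive (∑-zero ws λ u u∈ →
                cong (λ b → δ b * β u) (false-≡ᵇ λ z → ws≢0 u∈ (sym z)))

      -- The prices paid by the owners cover the prices of all items, and as `B` is at most the
      -- price, both cancel. The differences `A - B` remain, and one unit per vertex.
      chain-cost : ∑ ws (λ v → r (pre v) v) ≤ ∑ ws (λ v → A v ∸ B v) + n
      chain-cost = linear (∑ ws β) (begin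
          ∑ ws β + ∑ ws (λ v → r (pre v) v)           ≤⟨ +-monoˡ-≤ _ revenue ⟩
          ∑ ws paid + ∑ ws (λ v → r (pre v) v)        ≡⟨ trans (+-comm (∑ ws paid) _) (sym (∑-+ ws _ paid)) ⟩
          ∑ ws (λ v → r (pre v) v + paid v)           ≤⟨ ∑-mono∈ ws (λ v v∈ → expense v∈) ⟩
          ∑ ws (λ v → 1 + A v)                        ≡⟨ ∑-+ ws (λ _ → 1) A ⟩
          ∑ ws (λ _ → 1) + ∑ ws A
            ≤⟨ +-mono-≤ (≤-trans (≤-reflexive (trans (∑-const ws 1) (*-identityʳ _))) length-ws)
                 (∑-mono∈ ws λ v v∈ → ≤-trans (m≤n+m∸n (A v) (B v)) (+-monoˡ-≤ _ (B≤β v∈))) ⟩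
          n + ∑ ws (λ v → β v + (A v ∸ B v))          ≡⟨ cong (n +_) (∑-+ ws β _) ⟩
          n + (∑ ws β + ∑ ws (λ v → A v ∸ B v))       ∎)
        refl (lem n (∑ ws β) _)
        where
        open ≤-Reasoning
        lem : ∀ n b c → n + (b + c) ≡ b + (c + n)
        lem = solve-∀

   -- The cost of the tree

   module Tree where

    private
      Links : Set
      Links = List (ℕ × ℕ)

    targets : Links → List ℕ
    targets = map proj₂

    tree⁺ : ∀ h e x → inTree h x ≡ true → inTree (e ∷ h) x ≡ true
    tree⁺ h (u , v) x t with x ≡ᵇ 0 | member x ws
    ... | true  | _     = refl
    ... | false | true  = refl
    ... | false | false = ∈-member {x} {v ∷ targets h} (there (member-∈ (targets h) t))

    tree-new : ∀ h u v → inTree ((u , v) ∷ h) v ≡ true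
    tree-new h u v with v ≡ᵇ 0 | member v ws
    ... | true  | _     = refl
    ... | false | true  = refl
    ... | false | false = ∈-member {v} {v ∷ targets h} (here refl)

    tree⁻ : ∀ h u v x → inTree ((u , v) ∷ h) x ≡ true → x ≡ v ⊎ inTree h x ≡ true
    tree⁻ h u v x t with x ≡ᵇ 0 | member x ws
    ... | true  | _     = inj₂ refl
    ... | false | true  = inj₂ refl
    ... | false | false with member-∈ {x} (v ∷ targets h) t
    ...   | here e   = inj₁ e
    ...   | there x∈ = inj₂ (∈-member x∈)

    tree-0 : ∀ h → inTree h 0 ≡ true
    tree-0 h = refl

    tree-ws : ∀ {h v} → v ∈ ws → inTree h v ≡ true
    tree-ws {h} {v} v∈ with v ≡ᵇ 0
    ... | true = refl
    ... | false rewrite ∈-member v∈ = refl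

    tree-target : ∀ {h v} → v ∈ targets h → inTree h v ≡ true
    tree-target {h} {v} v∈ with v ≡ᵇ 0 | member v ws
    ... | true  | _     = refl
    ... | false | true  = refl
    ... | false | false = ∈-member v∈

    tree-empty⁻ : ∀ {x} → inTree [] x ≡ true → x ≡ 0 ⊎ x ∈ ws
    tree-empty⁻ {x} t with x ≡ᵇ 0 in e | member x ws in e′
    ... | true  | _    = inj₁ (≡ᵇ-true e)
    ... | false | true = inj₂ (member-∈ ws e′)

    absurd : ∀ {b : Bool} {X : Set} → b ≡ true → b ≡ false → X
    absurd refl ()

    module Link {h u v} (e∈ : (u , v) ∈ us ⊗ vs) (ok : link h (u , v) ≡ true) where
      crosses = ∧-true {crossing h (u , v)} ok
      source : inTree h u ≡ true
      source = proj₁ (∧-true {inTree h u} (proj₁ crosses))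
      target : inTree h v ≡ false
      target = not-true (proj₂ (∧-true {inTree h u} (proj₁ crosses)))
      v∈vs : v ∈ vs
      v∈vs = proj₂ (∈-⊗⁻ us e∈)
      v∉ws : v ∉ ws
      v∉ws v∈ = absurd (tree-ws {h} v∈) target
      shortest : ∀ x y → x ∈ us → y ∈ vs → inTree h x ≡ true → inTree h y ≡ false → ω u v ≤ ω x y
      shortest x y x∈ y∈ tx ty = ≤ᵇ-true {ω u v} (imp-true {crossing h (x , y)}
        (every-true {xs = us ⊗ vs} (proj₂ crosses) (∈-⊗⁺ x∈ y∈)) (true-∧ tx (true-not ty)))

    outside-vs : ∀ {h y} → y ∈ us → inTree h y ≡ false → y ∈ vs
    outside-vs {h} {zero}  y∈ t = absurd (tree-0 h) t
    outside-vs {h} {suc y} y∈ t = ∈vs (s≤s z≤n) (us≤ y∈)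

    targets-vs : ∀ {h v} → Admissible link (us ⊗ vs) h → v ∈ targets h → v ∈ vs × v ∉ ws
    targets-vs (add {h = h} e∈ ok a) (here refl) = Link.v∈vs {h} e∈ ok , Link.v∉ws {h} e∈ ok
    targets-vs (add e∈ ok a) (there v∈)  = targets-vs a v∈

    targets-unique : ∀ {h} → Admissible link (us ⊗ vs) h → Unique (targets h)
    targets-unique [] = []
    targets-unique (add {h = h} e∈ ok a) = All.tabulate (λ { x∈ refl →
      absurd (tree-target {h} x∈) (Link.target {h} e∈ ok) }) ∷ targets-unique a

    opaque
      unfolding links

      links-admissible : Admissible link (us ⊗ vs) links
      links-admissible = greedy-admissible link (us ⊗ vs) n

      links-outcome : length links ≡ n ⊎ (∀ e → e ∈ us ⊗ vs → link links e ≡ false)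
      links-outcome = greedy-outcome link (us ⊗ vs) n

    -- If all `n` rounds added an edge, their targets and a missing vertex would be more than `n`
    -- distinct customers. If they did not, the search failed although the edge from the depot to
    -- the missing vertex crosses.
    links-span : ∀ {v} → v ∈ us → inTree links v ≡ true
    links-span {v} v∈ with inTree links v in t
    ... | true  = refl
    ... | false with links-outcome
    ...   | inj₁ full = contradiction (≤-trans (length-≼ (v ∷ targets links) vs
                (≼-unique (All.tabulate (λ { x∈ refl → absurd (tree-target {links} x∈) t })
                           ∷ targets-unique links-admissible)
                  λ { (here refl) → outside-vs {links} v∈ t
                    ; (there x∈) → proj₁ (targets-vs links-admissible x∈) }))
                (≤-reflexive (trans length-vs (trans (sym full) (sym (length-map proj₂ links)))))) (<⇒≱ ≤-refl)
    ...   | inj₂ stuck with argmin (crossing links) (λ e → ω (proj₁ e) (proj₂ e)) (us ⊗ vs)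
                              (∈-⊗⁺ (∈us z≤n) (outside-vs {links} v∈ t)) (true-∧ (tree-0 links) (true-not t))
    ...     | e , e∈ , ce , _ , least = absurd (true-∧ ce (true-every (us ⊗ vs) λ z z∈ →
                true-imp {crossing links z} λ cz → true-≤ᵇ {ω (proj₁ e) (proj₂ e)} (least z z∈ cz)))
                (stuck e e∈)

    length-of : Links → ℕ
    length-of h = ∑ h (λ e → ω (proj₁ e) (proj₂ e))

    -- A maximal run of added edges shorter than θ, preceded by an edge that
    -- is not, adds a set of vertices all of whose outgoing edges are not
    -- shorter than θ.  S is the current run, later than h.
    module Bound (Z : (ℕ → ℕ → ℕ) → ℕ)
      (Z-mono : ∀ {f g} → (∀ x y → x ∈ us → y ∈ us → f x y ≤ g x y) → Z f ≤ Z g)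
      (Z-+ : ∀ f g → Z (λ x y → f x y + g x y) ≡ Z f + Z g)
      (a b : ℕ) (cut-≤ : ∀ S → Unique S → (∀ {v} → v ∈ S → v ∈ vs × v ∉ ws) → ∀ {s} → s ∈ S →
                         a ≤ b * Z (leaving S)) where

      long : ℕ → ℕ → ℕ → ℕ
      long θ x y = δ (θ <ᵇ ω x y)

      ω-sym : ∀ u v → ω u v ≡ ω v u
      ω-sym u v = +-comm (r u v) (r v u)

      long-1 : ∀ {θ x y} → θ < ω x y → long θ x y ≡ 1
      long-1 {θ} {x} {y} lt = cong δ (true-<ᵇ {θ} {ω x y} lt)

      count : ℕ → Links → ℕ
      count θ h = ∑ h (λ e → long θ (proj₁ e) (proj₂ e))

      -- By `closed` the edges from the vertices present at the end of the run to all later ones are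
      -- long. It stems from the long edge that was added next: Prim's rule would have preferred a
      -- shorter one. For the last run there are no later vertices.
      record Run (θ : ℕ) (h : Links) (S : List ℕ) : Set where
        field
          S-unique  : Unique S
          S-vs      : ∀ {x} → x ∈ S → x ∈ vs × x ∉ ws
          S-outside : ∀ {x} → x ∈ S → inTree h x ≡ false
          closed    : ∀ {x y} → x ∈ us → y ∈ us → inTree h x ≡ true ⊎ x ∈ S →
                      inTree h y ≡ false → y ∉ S → θ < ω x y

      -- Long arcs are charged to their tails. As different runs add different vertices, no arc is
      -- charged twice.
      from-tails : List ℕ → ℕ → ℕ → ℕ → ℕ
      from-tails xs θ x y = occurrences x xs * long θ x y

      from-tails-++ : ∀ xs ys θ → Z (from-tails (xs ++ ys) θ) ≡ Z (from-tails xs θ) + Z (from-tails ys θ)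
      from-tails-++ xs ys θ = trans (≤-antisym
        (Z-mono λ x y _ _ → ≤-reflexive (eq x y)) (Z-mono λ x y _ _ → ≤-reflexive (sym (eq x y)))) (Z-+ _ _)
        where
        eq : ∀ x y → from-tails (xs ++ ys) θ x y ≡ from-tails xs θ x y + from-tails ys θ x y
        eq x y = trans (cong (_* long θ x y) (∑-++ xs ys _)) (*-distribʳ-+ (long θ x y) (occurrences x xs) _)

      runs-bound : ∀ {h} θ S → Admissible link (us ⊗ vs) h → Run θ h S →
                   a * count θ h ≤ b * Z (from-tails (S ++ targets h) θ)
      runs-bound θ S [] run = ≤-trans (≤-reflexive (*-zeroʳ a)) z≤n
      runs-bound {(u , v) ∷ h} θ S (add e∈ ok adm) run = by-length (θ <? ω u v)
        where
        open Link {h} e∈ ok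
        open Run run
        S′ : List ℕ
        S′ = v ∷ S
        v∉S : v ∉ S
        v∉S v∈ = absurd (tree-new h u v) (S-outside v∈)
        S′-unique : Unique S′
        S′-unique = All.tabulate (λ { x∈ refl → v∉S x∈ }) ∷ S-unique
        S′-vs : ∀ {x} → x ∈ S′ → x ∈ vs × x ∉ ws
        S′-vs (here refl) = v∈vs , v∉ws
        S′-vs (there x∈)  = S-vs x∈
        still-outside : ∀ x → inTree ((u , v) ∷ h) x ≡ false → inTree h x ≡ false
        still-outside x t with inTree h x in e
        ... | false = refl
        ... | true  = absurd (tree⁺ h (u , v) x e) t
        S′-outside : ∀ {x} → x ∈ S′ → inTree h x ≡ false
        S′-outside (here refl) = target
        S′-outside {x} (there x∈) = still-outside x (S-outside x∈)
        still-closed : ∀ {x y} → x ∈ us → y ∈ us → inTree h x ≡ true ⊎ x ∈ S′ →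
                       inTree h y ≡ false → y ∉ S′ → θ < ω x y
        still-closed {x} {y} x∈ y∈ xin yout y∉ = closed x∈ y∈ (xin′ xin) yout′ (λ z → y∉ (there z))
          where
          xin′ : inTree h x ≡ true ⊎ x ∈ S′ → inTree ((u , v) ∷ h) x ≡ true ⊎ x ∈ S
          xin′ (inj₁ t) = inj₁ (tree⁺ h (u , v) x t)
          xin′ (inj₂ (here refl)) = inj₁ (tree-new h u v)
          xin′ (inj₂ (there x∈S)) = inj₂ x∈S
          yout′ : inTree ((u , v) ∷ h) y ≡ false
          yout′ with inTree ((u , v) ∷ h) y in e
          ... | false = refl
          ... | true with tree⁻ h u v y e
          ...   | inj₁ refl = contradiction (here refl) y∉
          ...   | inj₂ t    = absurd t yout
        by-length : Dec (θ < ω u v) → a * count θ ((u , v) ∷ h) ≤ b * Z (from-tails (S ++ targets ((u , v) ∷ h)) θ)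
        by-length (no short) = begin
          a * (long θ u v + count θ h)   ≡⟨ cong (λ z → a * (z + count θ h)) long-0 ⟩
          a * count θ h                  ≤⟨ runs-bound θ S′ adm (record
                                              { S-unique = S′-unique ; S-vs = S′-vs
                                              ; S-outside = S′-outside ; closed = still-closed }) ⟩
          b * Z (from-tails (v ∷ S ++ targets h) θ)
            ≤⟨ *-monoʳ-≤ b (Z-mono λ x y _ _ → *-monoˡ-≤ (long θ x y) (≤-reflexive (moved x))) ⟩
          b * Z (from-tails (S ++ v ∷ targets h) θ) ∎
          where
          open ≤-Reasoning
          long-0 : long θ u v ≡ 0
          long-0 with θ <ᵇ ω u v in e
          ... | false = refl
          ... | true  = contradiction (<ᵇ-true {θ} e) short
          lem : ∀ a b c → a + (b + c) ≡ b + (a + c)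
          lem = solve-∀
          moved : ∀ x → occurrences x (v ∷ S ++ targets h) ≡ occurrences x (S ++ v ∷ targets h)
          moved x = trans (cong (δ (v ≡ᵇ x) +_) (∑-++ S (targets h) _))
            (trans (lem (δ (v ≡ᵇ x)) (occurrences x S) _) (sym (∑-++ S (v ∷ targets h) _)))
        by-length (yes lt) = begin
          a * (long θ u v + count θ h)        ≡⟨ trans (*-distribˡ-+ a (long θ u v) _)
                                                   (cong (_+ a * count θ h) (trans (cong (a *_) (long-1 {θ} {u} {v} lt)) (*-identityʳ a))) ⟩
          a + a * count θ h                   ≤⟨ +-mono-≤ (cut-≤ S′ S′-unique S′-vs (here refl))
                                                   (runs-bound θ [] adm (record
                                                     { S-unique = [] ; S-vs = λ () ; S-outside = λ ()
                                                     ; closed = closed-now })) ⟩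
          b * Z (leaving S′) + b * Z (from-tails (targets h) θ)
            ≤⟨ +-monoˡ-≤ _ (*-monoʳ-≤ b (Z-mono leaves)) ⟩
          b * Z (from-tails S′ θ) + b * Z (from-tails (targets h) θ)
            ≡⟨ trans (sym (*-distribˡ-+ b _ _)) (cong (b *_) (sym (from-tails-++ S′ (targets h) θ))) ⟩
          b * Z (from-tails (v ∷ S ++ targets h) θ)
            ≤⟨ *-monoʳ-≤ b (Z-mono λ x y _ _ → *-monoˡ-≤ (long θ x y) (≤-reflexive (moved x))) ⟩
          b * Z (from-tails (S ++ v ∷ targets h) θ) ∎
          where
          open ≤-Reasoning
          lem : ∀ a b c → a + (b + c) ≡ b + (a + c)
          lem = solve-∀
          moved : ∀ x → occurrences x (v ∷ S ++ targets h) ≡ occurrences x (S ++ v ∷ targets h)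
          moved x = trans (cong (δ (v ≡ᵇ x) +_) (∑-++ S (targets h) _))
            (trans (lem (δ (v ≡ᵇ x)) (occurrences x S) _) (sym (∑-++ S (v ∷ targets h) _)))
          closed-now : ∀ {x y} → x ∈ us → y ∈ us → inTree h x ≡ true ⊎ x ∈ [] →
                       inTree h y ≡ false → y ∉ [] → θ < ω x y
          closed-now {x} {y} x∈ y∈ (inj₁ t) yout _ =
            <-≤-trans lt (shortest x y x∈ (outside-vs {h} y∈ yout) t yout)
          -- An arc that leaves the run is long: if it leads back to the older tree, its reverse has
          -- the same cost and competed with the long edge that opened the run; otherwise
          -- `still-closed` applies.
          leaves : ∀ x y → x ∈ us → y ∈ us → leaving S′ x y ≤ from-tails S′ θ x y
          leaves x y x∈ y∈ with member x S′ in ex | member y S′ in ey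
          ... | false | _ rewrite occurrences-∉ (member-∉ {x} {S′} ex) = z≤n
          ... | true | true = ≤-trans (≤-reflexive (trans (cong (occurrences x S′ *_)
                (m≤n⇒m∸n≡0 (occurrences-∈ (member-∈ S′ ey)))) (*-zeroʳ (occurrences x S′)))) z≤n
          ... | true | false = *-monoʳ-≤ (occurrences x S′)
                (≤-trans (m∸n≤m 1 (occurrences y S′)) (≤-reflexive (sym (long-1 {θ} {x} {y} outgoing))))
            where
            xS : x ∈ S′
            xS = member-∈ S′ ex
            yS : y ∉ S′
            yS = member-∉ ey
            outgoing : θ < ω x y
            outgoing with inTree h y in ty
            ... | true = <-≤-trans lt (≤-trans (shortest y x y∈ (proj₁ (S′-vs xS)) ty (S′-outside xS))
                           (≤-reflexive (ω-sym y x)))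
            ... | false = still-closed x∈ y∈ (inj₂ xS) ty yS

      -- Costs are sums of threshold indicators, for the tree as well as for the fractional
      -- solution, so that it suffices to sum `runs-bound` over the thresholds.
      tree-bound : a * length-of links ≤ b * Z ω
      tree-bound = begin
        a * length-of links
          ≡⟨ cong (a *_) (∑-cong links λ e → sym (layers (proj₁ e) (proj₂ e))) ⟩
        a * ∑ links (λ e → ∑ (downFrom m) (λ θ → long θ (proj₁ e) (proj₂ e)))
          ≡⟨ trans (cong (a *_) (∑-swap links (downFrom m) _)) (sym (∑-*ˡ (downFrom m) a _)) ⟩
        ∑ (downFrom m) (λ θ → a * count θ links)   ≤⟨ ∑-mono (downFrom m) layer ⟩
        ∑ (downFrom m) (λ θ → b * Z (long θ))      ≡⟨ ∑-*ˡ (downFrom m) b _ ⟩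
        b * ∑ (downFrom m) (λ θ → Z (long θ))      ≤⟨ *-monoʳ-≤ b (sum-Z (downFrom m)) ⟩
        b * Z (λ x y → ∑ (downFrom m) (λ θ → long θ x y))
          ≤⟨ *-monoʳ-≤ b (Z-mono λ x y _ _ → ≤-reflexive (layers x y)) ⟩
        b * Z ω ∎
        where
        open ≤-Reasoning
        m : ℕ
        m = suc M + suc M
        layers : ∀ x y → ∑ (downFrom m) (λ θ → long θ x y) ≡ ω x y
        layers x y = trans (thresholds m (ω x y)) (m≥n⇒m⊓n≡n (+-mono-≤ (capped x y) (capped y x)))
        sum-Z : ∀ θs → ∑ θs (λ θ → Z (long θ)) ≤ Z (λ x y → ∑ θs (λ θ → long θ x y))
        sum-Z []       = z≤n
        sum-Z (θ ∷ θs) = ≤-trans (+-monoʳ-≤ (Z (long θ)) (sum-Z θs)) (≤-reflexive (sym (Z-+ _ _)))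
        layer : ∀ θ → a * count θ links ≤ b * Z (long θ)
        layer θ = ≤-trans (runs-bound θ [] links-admissible (record
          { S-unique = [] ; S-vs = λ () ; S-outside = λ ()
          ; closed = λ {x} {y} _ y∈ _ yout _ → absurd (links-span y∈) yout }))
          (*-monoʳ-≤ b (Z-mono λ x y _ _ → ≤-trans
            (*-monoˡ-≤ (long θ x y) (occurrences-unique x (targets-unique links-admissible)))
            (≤-reflexive (+-identityʳ _))))

   -- From chains and tree to a tour and its pieces

   module Route where

    open Auction
    open Tree
    open Final bids bids-inv bids-stuck public using (pre; chain-cost; pre-cases; A; B; A≤; B≤A; arc)

    private
      block : ℕ → List ℕ
      block i = filterᵇ (λ v → rank v ≡ᵇ i) ws

      upto : ℕ → List ℕ
      upto m = concatMap block (reverse (downFrom m))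

      upto-suc : ∀ m → upto (suc m) ≡ upto m ++ block m
      upto-suc m = trans (cong (concatMap block) (unfold-reverse m (downFrom m)))
        (trans (concatMap-++ block (reverse (downFrom m)) (m ∷ []))
          (cong (upto m ++_) (++-identityʳ (block m))))

      block⁻ : ∀ i {v} → v ∈ block i → v ∈ ws × rank v ≡ i
      block⁻ i {v} v∈ with ∈-filterᵇ⁻ {xs = ws} v∈
      ... | v∈ws , e = v∈ws , ≡ᵇ-true e

      upto⁻ : ∀ m {v} → v ∈ upto m → v ∈ ws × rank v < m
      upto⁻ zero ()
      upto⁻ (suc m) {v} v∈ with ∈-++⁻ (upto m) (subst (v ∈_) (upto-suc m) v∈)
      ... | inj₁ a = proj₁ (upto⁻ m a) , m≤n⇒m≤1+n (proj₂ (upto⁻ m a))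
      ... | inj₂ b = proj₁ (block⁻ m b) , ≤-reflexive (cong suc (proj₂ (block⁻ m b)))

      upto⁺ : ∀ m {v} → v ∈ ws → rank v < m → v ∈ upto m
      upto⁺ (suc m) {v} v∈ lt = subst (v ∈_) (sym (upto-suc m)) (place (rank v ≟ m))
        where
        place : Dec (rank v ≡ m) → v ∈ upto m ++ block m
        place (yes e) = ∈-++⁺ʳ (upto m) (∈-filterᵇ⁺ v∈ (true-≡ᵇ e))
        place (no ne) = ∈-++⁺ˡ (upto⁺ m v∈ (≤∧≢⇒< (≤-pred lt) ne))

      block-unique : ∀ i → Unique (block i)
      block-unique i = Unique.filter⁺ _ ws-unique

      upto-unique : ∀ m → Unique (upto m)
      upto-unique zero    = []
      upto-unique (suc m) = subst Unique (sym (upto-suc m)) (Unique.++⁺ (upto-unique m) (block-unique m)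
        λ (a , b) → <⇒≢ (proj₂ (upto⁻ m a)) (proj₂ (block⁻ m b)))

      upto-sorted : ∀ m → AllPairs (λ x y → rank x ≤ rank y) (upto m)
      upto-sorted zero    = []
      upto-sorted (suc m) = subst (AllPairs _) (sym (upto-suc m)) (AllPairs.++⁺ (upto-sorted m)
        (equal-ranks (block m) (λ v∈ → proj₂ (block⁻ m v∈)))
        (All.tabulate λ x∈ → All.tabulate λ y∈ →
          ≤-trans (<⇒≤ (proj₂ (upto⁻ m x∈))) (≤-reflexive (sym (proj₂ (block⁻ m y∈))))))
        where
        equal-ranks : ∀ xs → (∀ {v} → v ∈ xs → rank v ≡ m) → AllPairs (λ x y → rank x ≤ rank y) xs
        equal-ranks []       h = []
        equal-ranks (x ∷ xs) h = All.tabulate (λ y∈ → ≤-reflexive (trans (h (here refl)) (sym (h (there y∈)))))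
                                 ∷ equal-ranks xs λ v∈ → h (there v∈)

    sorted⁺ : ∀ {v} → v ∈ ws → v ∈ sorted
    sorted⁺ v∈ = upto⁺ (suc n) v∈ (s≤s (rank≤n (us≤ (vs⊆us (ws⊆vs v∈)))))

    sorted⁻ : ∀ {v} → v ∈ sorted → v ∈ ws
    sorted⁻ v∈ = proj₁ (upto⁻ (suc n) v∈)

    sorted-unique : Unique sorted
    sorted-unique = upto-unique (suc n)

    sorted-order : ∀ p {v q u} → sorted ≡ p ++ v ∷ q → u ∈ ws → rank u < rank v → u ∈ p
    sorted-order p {v} {q} {u} e u∈ lt with ∈-++⁻ p (subst (u ∈_) e (sorted⁺ u∈))
    ... | inj₁ u∈p = u∈p
    ... | inj₂ (here refl) = contradiction lt (<-irrefl refl)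
    ... | inj₂ (there u∈q) = contradiction lt (≤⇒≯ (All.lookup
            (allPairs-split p (subst (AllPairs _) e (upto-sorted (suc n)))) u∈q))

    private
      zero-first : ∀ as {u b bs rest} → as ++ u ∷ b ∷ bs ≡ 0 ∷ rest → Unique (as ++ u ∷ b ∷ bs) → b ≢ 0
      zero-first []       refl (u∉ ∷ _) e = All.lookup u∉ (here (sym e)) refl
      zero-first (a ∷ as) {u} {b} {bs} refl (a∉ ∷ _) e =
        All.lookup a∉ (∈-++⁺ʳ as (there {x = u} (here {xs = bs} (sym e)))) refl

      still-first : ∀ as {u v bs rest} → as ++ u ∷ bs ≡ 0 ∷ rest → ∃[ rest′ ] as ++ u ∷ v ∷ bs ≡ 0 ∷ rest′
      still-first []       refl = _ , refl
      still-first (a ∷ as) refl = _ , refl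

      -- Arcs that the auction did not select are priced like new paths. Then inserting `v` after
      -- its predecessor costs at most `r (pre v) v`: the arc destroyed was already priced at the
      -- maximum, so its replacement is not dearer.
      g : ℕ → ℕ → ℕ
      g x y = if pre y ≡ᵇ x then r x y else suc M

      r≤g : ∀ x y → r x y ≤ g x y
      r≤g x y with pre y ≡ᵇ x
      ... | true  = ≤-refl
      ... | false = capped x y

      g≤ : ∀ x y → g x y ≤ suc M
      g≤ x y with pre y ≡ᵇ x
      ... | true  = capped x y
      ... | false = ≤-refl

      ws≢0 : ∀ {v} → v ∈ ws → v ≢ 0
      ws≢0 v∈ refl with vs-bounds (ws⊆vs v∈)
      ... | () , _

    record Chains (p xs : List ℕ) : Set where
      field
        uniq    : Unique xs
        first   : ∃[ rest ] xs ≡ 0 ∷ rest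
        inside  : ∀ {x} → x ∈ xs → x ≡ 0 ⊎ x ∈ p
        covered : ∀ {x} → x ≡ 0 ⊎ x ∈ p → x ∈ xs
        price-≤ : cost g xs ≤ ∑ p (λ v → r (pre v) v)

    chains-step : ∀ p {v q xs} → sorted ≡ p ++ v ∷ q → Chains p xs → Chains (p ++ v ∷ []) (insert xs (pre v , v))
    chains-step p {v} {q} {xs} e ch = result
      where
      open Chains ch
      v∈ws : v ∈ ws
      v∈ws = sorted⁻ (subst (v ∈_) (sym e) (∈-++⁺ʳ p (here refl)))
      v∉p : v ∉ p
      v∉p v∈p = disjoint p (subst Unique e sorted-unique) v∈p
        where
        disjoint : ∀ p → Unique (p ++ v ∷ q) → v ∉ p
        disjoint (_ ∷ p) (h ∷ _) (here refl) = All.lookup h (∈-++⁺ʳ p (here refl)) refl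
        disjoint (_ ∷ p) (_ ∷ h) (there v∈)  = disjoint p h v∈
      v∉xs : v ∉ xs
      v∉xs v∈ with inside v∈
      ... | inj₁ z   = ws≢0 v∈ws z
      ... | inj₂ v∈p = v∉p v∈p
      pre∈ : pre v ∈ xs
      pre∈ with pre-cases v
      ... | inj₁ (z , _) = covered (inj₁ z)
      ... | inj₂ (p∈ , own) = covered (inj₂ (sorted-order p e p∈
            (before-< {pre v} {v} (subst (λ w → before (pre v) w ≡ true) own
              (Inv.earlier bids-inv (pre v) λ z → ws≢0 v∈ws (trans (sym own) z))))))
      result : Chains (p ++ v ∷ []) (insert xs (pre v , v))
      result with insert-split v uniq pre∈
      ... | as , bs , refl , eq rewrite eq = record
        { uniq = insert-unique as v∉xs uniq
        ; first = still-first as (proj₂ first)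
        ; inside = inside′
        ; covered = covered′
        ; price-≤ = price′ }
        where
        inside′ : ∀ {x} → x ∈ as ++ pre v ∷ v ∷ bs → x ≡ 0 ⊎ x ∈ p ++ v ∷ []
        inside′ x∈ with insert-∈⁻ as x∈
        ... | inj₁ refl = inj₂ (∈-++⁺ʳ p (here refl))
        ... | inj₂ y with inside y
        ...   | inj₁ z = inj₁ z
        ...   | inj₂ x∈p = inj₂ (∈-++⁺ˡ x∈p)
        covered′ : ∀ {x} → x ≡ 0 ⊎ x ∈ p ++ v ∷ [] → x ∈ as ++ pre v ∷ v ∷ bs
        covered′ (inj₁ z) = insert-∈⁺ as (covered (inj₁ z))
        covered′ (inj₂ y) with ∈-++⁻ p y
        ... | inj₁ x∈p = insert-∈⁺ as (covered (inj₂ x∈p))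
        ... | inj₂ (here refl) = insert-new as
        -- The vertex `b` that followed `pre v` was priced at `suc M`: a predecessor in common with
        -- `v` can only be the depot, since an item has one owner, and `v` is not yet in the tour.
        hop-≤ : ∀ bs′ → bs′ ≡ bs → hop g v bs′ ≤ hop g (pre v) bs′
        hop-≤ [] _ = z≤n
        hop-≤ (b ∷ bs′) refl = ≤-trans (g≤ v b) (full (pre b ≟ pre v))
          where
          b∈ : b ∈ as ++ pre v ∷ b ∷ bs′
          b∈ = ∈-++⁺ʳ as (there (here refl))
          full : Dec (pre b ≡ pre v) → suc M ≤ g (pre v) b
          full (no ne) rewrite false-≡ᵇ ne = ≤-refl
          full (yes eq′) with pre v ≟ 0
          ... | yes z rewrite z | true-≡ᵇ eq′ | depot-r b = ≤-refl
          ... | no nz with inside b∈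
          ...   | inj₁ b≡0 = contradiction b≡0 (zero-first as (proj₂ first) uniq)
          ...   | inj₂ b∈p with pre-cases b | pre-cases v
          ...     | inj₁ (z , _) | _ = contradiction (trans (sym eq′) z) nz
          ...     | _ | inj₁ (z , _) = contradiction z nz
          ...     | inj₂ (_ , ob) | inj₂ (_ , ov) =
                    contradiction (subst (_∈ as ++ pre v ∷ b ∷ bs′)
                      (trans (sym ob) (trans (cong (owner bids) eq′) ov)) b∈) v∉xs
        price′ : cost g (as ++ pre v ∷ v ∷ bs) ≤ ∑ (p ++ v ∷ []) (λ v → r (pre v) v)
        price′ = ≤-trans (+-cancelʳ-≤ (hop g (pre v) bs) _ _ (≤-trans (≤-reflexive (cost-insert g as (pre v) v bs))
          (≤-trans (+-mono-≤ price-≤ (+-mono-≤ (≤-reflexive own-price) (hop-≤ bs refl)))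
            (≤-reflexive (sym (+-assoc (∑ p (λ v → r (pre v) v)) (r (pre v) v) _))))))
          (≤-reflexive (sym (trans (∑-++ p (v ∷ []) _) (cong (∑ p (λ v → r (pre v) v) +_) (+-identityʳ _)))))
          where
          own-price : g (pre v) v ≡ r (pre v) v
          own-price rewrite true-≡ᵇ {pre v} refl = refl

    chains-all : ∀ p q {xs} → sorted ≡ p ++ q → Chains p xs →
                 Chains sorted (foldl insert xs (map (λ v → pre v , v) q))
    chains-all p [] e ch = subst (λ z → Chains z _) (sym (trans e (++-identityʳ p))) ch
    chains-all p (v ∷ q) e ch = chains-all (p ++ v ∷ []) q (trans e (sym (++-assoc p (v ∷ []) q)))
      (chains-step p e ch)

    chains : List ℕ
    chains = foldl insert (0 ∷ []) (map (λ v → pre v , v) sorted)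

    chains-ok : Chains sorted chains
    chains-ok = chains-all [] sorted refl (record
      { uniq = [] ∷ []
      ; first = _ , refl
      ; inside = λ { (here refl) → inj₁ refl }
      ; covered = λ { (inj₁ refl) → here refl }
      ; price-≤ = z≤n })

    record Grown (h : List (ℕ × ℕ)) (xs : List ℕ) : Set where
      field
        uniq    : Unique xs
        first   : ∃[ rest ] xs ≡ 0 ∷ rest
        inside  : ∀ {x} → x ∈ xs → inTree h x ≡ true
        covered : ∀ x → inTree h x ≡ true → x ∈ xs
        price-≤ : cost r xs ≤ cost r chains + length-of h

    -- A visit from `u` to `v` and back costs `ω u v`, and by the triangle inequality the tour may
    -- go on from `v` without returning.
    grown : ∀ {h} → Admissible link (us ⊗ vs) h → Grown h (foldl insert chains (reverse h))
    grown [] = record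
      { uniq = uniq
      ; first = first
      ; inside = λ x∈ → inside′ (inside x∈)
      ; covered = λ x t → covered′ (tree-empty⁻ t)
      ; price-≤ = m≤m+n _ 0 }
      where
      open Chains chains-ok
      inside′ : ∀ {x} → x ≡ 0 ⊎ x ∈ sorted → inTree [] x ≡ true
      inside′ (inj₁ refl) = refl
      inside′ (inj₂ x∈)   = tree-ws {[]} (sorted⁻ x∈)
      covered′ : ∀ {x} → x ≡ 0 ⊎ x ∈ ws → x ∈ chains
      covered′ (inj₁ z)  = covered (inj₁ z)
      covered′ (inj₂ x∈) = covered (inj₂ (sorted⁺ x∈))
    grown {(u , v) ∷ h} (add e∈ ok adm) =
      subst (Grown ((u , v) ∷ h)) (sym (trans (cong (foldl insert chains) (unfold-reverse (u , v) h))
        (foldl-++ insert chains (reverse h) ((u , v) ∷ [])))) result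
      where
      open Grown (grown adm)
      open Link {h} e∈ ok
      v∉xs : v ∉ foldl insert chains (reverse h)
      v∉xs v∈ = absurd (inside v∈) target
      result : Grown ((u , v) ∷ h) (insert (foldl insert chains (reverse h)) (u , v))
      result with insert-split v uniq (covered u source)
      ... | as , bs , eq₀ , eq rewrite eq = record
        { uniq = insert-unique as (subst (v ∉_) eq₀ v∉xs) (subst Unique eq₀ uniq)
        ; first = still-first as (trans (sym eq₀) (proj₂ first))
        ; inside = inside′
        ; covered = covered′
        ; price-≤ = price′ }
        where
        inside′ : ∀ {x} → x ∈ as ++ u ∷ v ∷ bs → inTree ((u , v) ∷ h) x ≡ true
        inside′ {x} x∈ with insert-∈⁻ as x∈
        ... | inj₁ refl = tree-new h u v
        ... | inj₂ y = tree⁺ h (u , v) x (inside (subst (x ∈_) (sym eq₀) y))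
        covered′ : ∀ x → inTree ((u , v) ∷ h) x ≡ true → x ∈ as ++ u ∷ v ∷ bs
        covered′ x t with tree⁻ h u v x t
        ... | inj₁ refl = insert-new as
        ... | inj₂ t′ = insert-∈⁺ as (subst (x ∈_) eq₀ (covered x t′))
        hop-≤ : ∀ bs → hop r v bs ≤ r v u + hop r u bs
        hop-≤ []      = z≤n
        hop-≤ (b ∷ _) = triangle v u b
        eq₁ : ∀ c l a d h → c + l + (a + (d + h)) ≡ c + (a + d + l) + h
        eq₁ = solve-∀
        price′ : cost r (as ++ u ∷ v ∷ bs) ≤ cost r chains + length-of ((u , v) ∷ h)
        price′ = +-cancelʳ-≤ (hop r u bs) _ _ (≤-trans (≤-reflexive (cost-insert r as u v bs))
          (≤-trans (+-mono-≤ (subst (λ z → cost r z ≤ cost r chains + length-of h) eq₀ price-≤) (+-monoʳ-≤ (r u v) (hop-≤ bs)))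
            (≤-reflexive (eq₁ (cost r chains) (length-of h) (r u v) (r v u) (hop r u bs)))))

    tour-grown : Grown links tour
    tour-grown = subst (Grown links) (sym (foldl-++ insert (0 ∷ []) (map (λ v → pre v , v) sorted) (reverse links)))
                   (grown links-admissible)

    tour-cost : cost r tour ≤ ∑ ws (λ v → r (pre v) v) + length-of links
    tour-cost = ≤-trans (Grown.price-≤ tour-grown) (+-monoˡ-≤ (length-of links)
      (≤-trans (cost-mono r≤g chains) (≤-trans (Chains.price-≤ chains-ok)
        (≼-unique sorted-unique sorted⁻ (λ v → r (pre v) v)))))

    tour-∈ : ∀ {v} → v ∈ us → v ∈ tour
    tour-∈ {v} v∈ = Grown.covered tour-grown v (links-span v∈)

    tour⊆us : ∀ {v} → v ∈ tour → v ∈ us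
    tour⊆us {v} v∈ = origin (Grown.inside tour-grown v∈)
      where
      origin : ∀ {v} → inTree links v ≡ true → v ∈ us
      origin {v} t with v ≡ᵇ 0 in e | member v ws in e′
      ... | true  | _    rewrite ≡ᵇ-true {v} e = ∈us z≤n
      ... | false | true = vs⊆us (ws⊆vs (member-∈ ws e′))
      ... | false | false = vs⊆us (proj₁ (targets-vs links-admissible (member-∈ (targets links) t)))

    data Cut : List ℕ → List Piece → Set where
      []  : Cut [] []
      new : ∀ {x c y p ps xs} → Cut (y ∷ xs) ((c , y , p) ∷ ps) → M < c + r x y →
            Cut (x ∷ y ∷ xs) ((0 , x , x ∷ []) ∷ (c , y , p) ∷ ps)
      one : ∀ {x} → Cut (x ∷ []) ((0 , x , x ∷ []) ∷ [])
      old : ∀ {x c y p ps xs} → Cut (y ∷ xs) ((c , y , p) ∷ ps) → c + r x y ≤ M →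
            Cut (x ∷ y ∷ xs) ((c + r x y , x , x ∷ p) ∷ ps)

    extend-cut : ∀ x {xs ps} → Cut xs ps → Cut (x ∷ xs) (extend x ps)
    extend-cut x [] = one
    extend-cut x {y ∷ xs} {(c , .y , p) ∷ ps} ct@(new _ _) = push-on ct
      where
      push-on : ∀ {c y p ps xs} → Cut (y ∷ xs) ((c , y , p) ∷ ps) → Cut (x ∷ y ∷ xs) (extend x ((c , y , p) ∷ ps))
      push-on {c} {y} ct with c + r x y ≤ᵇ M in e
      ... | true  = old ct (≤ᵇ-true e)
      ... | false = new ct (≰⇒> λ le → absurd (true-≤ᵇ le) e)
    extend-cut x {y ∷ xs} ct@one with 0 + r x y ≤ᵇ M in e
    ... | true  = old ct (≤ᵇ-true e)
    ... | false = new ct (≰⇒> λ le → absurd (true-≤ᵇ le) e)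
    extend-cut x {y ∷ xs} {(c , .y , p) ∷ ps} ct@(old _ _) with c + r x y ≤ᵇ M in e
    ... | true  = old ct (≤ᵇ-true e)
    ... | false = new ct (≰⇒> λ le → absurd (true-≤ᵇ le) e)

    cut-all : ∀ xs → 0 ∉ xs → Cut xs (foldr cut [] xs)
    cut-all []           _  = []
    cut-all (zero ∷ xs)  0∉ = contradiction (here refl) 0∉
    cut-all (suc x ∷ xs) 0∉ = extend-cut (suc x) (cut-all xs λ z → 0∉ (there z))

    path-of : Piece → List ℕ
    path-of p = proj₂ (proj₂ p)

    cut-concat : ∀ {xs ps} → Cut xs ps → concat (map path-of ps) ≡ xs
    cut-concat [] = refl
    cut-concat (new {x} ct _) = cong (x ∷_) (cut-concat ct)
    cut-concat one = refl
    cut-concat (old {x} ct _) = cong (x ∷_) (cut-concat ct)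

    record Short (p : List ℕ) : Set where
      constructor short
      field
        head-≡ : ∃[ y ] ∃[ ys ] p ≡ y ∷ ys
        cost≤M : cost r p ≤ M

    cut-short : ∀ {xs ps} → Cut xs ps → All (λ { (c , y , p) → ∃[ ys ] p ≡ y ∷ ys × cost r p ≡ c × c ≤ M }) ps
    cut-short [] = []
    cut-short one = (_ , refl , refl , z≤n) ∷ []
    cut-short (new ct _) = (_ , refl , refl , z≤n) ∷ cut-short ct
    cut-short (old {x} {c} {y} ct le) with cut-short ct
    ... | (ys , refl , e , _) ∷ rest =
          (_ , refl , trans (cong (r x y +_) e) (+-comm (r x y) c) , le) ∷ rest

    first-cost : List Piece → ℕ
    first-cost []            = 0
    first-cost ((c , _) ∷ _) = c

    -- A removed arc and the piece behind it together exceed `M`. The cost of the front piece is not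
    -- yet used up and serves as a potential; the `suc M` on the right will be paid by the arc from
    -- the depot.
    cut-count : ∀ {xs ps} → Cut xs ps → first-cost ps + length ps * suc M ≤ cost r xs + suc M
    cut-count [] = z≤n
    cut-count one = ≤-reflexive (+-identityʳ _)
    cut-count (new {x} {c} {y} {ps = ps} {xs} ct lt) =
      ≤-trans (+-monoˡ-≤ (suc (length ps) * suc M) lt) (≤-trans (≤-reflexive (lem c (r x y) _))
        (≤-trans (+-monoʳ-≤ (r x y) (cut-count ct)) (≤-reflexive (sym (+-assoc (r x y) _ _)))))
      where
      lem : ∀ c r l → c + r + l ≡ r + (c + l)
      lem = solve-∀
    cut-count (old {x} {c} {y} {ps = ps} ct le) =
      ≤-trans (≤-reflexive (lem c (r x y) _)) (≤-trans (+-monoʳ-≤ (r x y) (cut-count ct))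
        (≤-reflexive (sym (+-assoc (r x y) _ _))))
      where
      lem : ∀ c r l → c + r + l ≡ r + (c + l)
      lem = solve-∀

    record Partition (ps : List (List ℕ)) : Set where
      field
        rest      : List ℕ
        concat-≡  : concat ps ≡ rest
        no-repeat : Unique rest
        complete  : ∀ {v} → v ∈ vs → v ∈ rest
        within-vs : ∀ {v} → v ∈ rest → v ∈ vs
        all-short : All Short ps
        few       : length ps * suc M ≤ cost r tour

    partition : Partition pieces
    partition with Grown.first tour-grown
    ... | rest , e = record
      { rest = rest
      ; concat-≡ = trans (cong (λ z → concat (map path-of (foldr cut [] z))) e) (cut-concat ct)
      ; no-repeat = tail-unique (subst Unique e (Grown.uniq tour-grown))
      ; complete = complete′
      ; within-vs = λ {v} v∈ → customer v v∈
      ; all-short = subst (λ z → All Short (map path-of (foldr cut [] z))) (sym e) (shorts (cut-short ct))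
      ; few = few′ }
      where
      tail-unique : Unique (0 ∷ rest) → Unique rest
      tail-unique (_ ∷ u) = u
      0∉ : 0 ∉ rest
      0∉ z with subst Unique e (Grown.uniq tour-grown)
      ... | h ∷ _ = All.lookup h z refl
      ct : Cut rest (foldr cut [] rest)
      ct = cut-all rest 0∉
      complete′ : ∀ {v} → v ∈ vs → v ∈ rest
      complete′ {v} v∈ with subst (v ∈_) e (tour-∈ (vs⊆us v∈))
      ... | there z = z
      ... | here refl with vs-bounds v∈
      ...   | () , _
      customer : ∀ v → v ∈ rest → v ∈ vs
      customer zero    v∈ = contradiction v∈ 0∉
      customer (suc v) v∈ = ∈vs (s≤s z≤n) (us≤ (tour⊆us (subst (suc v ∈_) (sym e) (there v∈))))
      shorts : ∀ {ps} → All (λ { (c , y , p) → ∃[ ys ] p ≡ y ∷ ys × cost r p ≡ c × c ≤ M }) ps →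
               All Short (map path-of ps)
      shorts [] = []
      shorts ((ys , e , c≡ , le) ∷ hs) = short (_ , ys , e) (≤-trans (≤-reflexive c≡) le) ∷ shorts hs
      few′ : length pieces * suc M ≤ cost r tour
      few′ rewrite e | length-map path-of (foldr cut [] rest) = bound-count rest (foldr cut [] rest) ct
        where
        bound-count : ∀ xs ps → Cut xs ps → length ps * suc M ≤ cost r (0 ∷ xs)
        bound-count [] [] [] = z≤n
        bound-count (x ∷ xs) ps ct = ≤-trans (m≤n+m _ (first-cost ps)) (≤-trans (cut-count ct)
          (≤-reflexive (trans (+-comm _ (suc M)) (cong (_+ cost r (x ∷ xs)) (sym (depot-r x))))))

  -- The approximation ratio, given a solution of the linear program

  module Ratio (M-≡ : M ≡ 20 * suc n) where

   module _ (k : ℕ) where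

     open Guess k

     chosen-vs : List ℕ
     chosen-vs = filterᵇ chosen vs

     chosen-unique : Unique chosen-vs
     chosen-unique = Unique.filter⁺ _ vs-unique

     chosen⊆vs : ∀ {v} → v ∈ chosen-vs → v ∈ vs
     chosen⊆vs v∈ = proj₁ (∈-filterᵇ⁻ {xs = vs} v∈)

     open Chosen.Route chosen-vs chosen-unique chosen⊆vs
     open Round chosen-vs using (links; tour; pieces)

     attempt-pieces : Pieces n M r (attempt k)
     attempt-pieces = subst (Pieces n M r) (sym (attempt-≡ k)) record
       { short    = All.map (λ s → Short.head-≡ s , Short.cost≤M s) all-short
       ; inside   = λ {v} v∈ → vs-bounds (within-vs (subst (v ∈_) concat-≡ v∈))
       ; distinct = subst Unique (sym concat-≡) no-repeat
       ; complete = λ {v} 1≤ ≤n → subst (v ∈_) (sym concat-≡) (complete (∈vs 1≤ ≤n)) }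
       where open Partition partition

     -- A feasible 0-1 solution for the guess `k`. The algorithm never sees it; its existence makes
     -- the perceptron succeed.
     record Certificate : Set where
       field
         E        : List Col
         E≼cols   : E ≼ cols
         feasible : ∀ ρ → ρ ∈ rows → ∑ E (pos ρ) + pos₀ ρ ≤ ∑ E (neg ρ) + neg₀ ρ

     module _ (certificate : Certificate) where

       open Certificate certificate

       private
         δ≤ : ∀ b → δ b ≤ 2 * suc M
         δ≤ b = ≤-trans (δ≤1 b) (s≤s z≤n)

         if≤ : ∀ b {m} → m ≤ 2 * suc M → (if b then m else 0) ≤ 2 * suc M
         if≤ true  h = h
         if≤ false h = z≤n

         pos≤ : ∀ ρ c → pos ρ c ≤ 2 * suc M
         pos≤ (0 , v , a , b) (t , x , y) = δ≤ _
         pos≤ (1 , v , a , b) (t , x , y) = if≤ _ (≤-trans (capped x y) (m≤m+n (suc M) _))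
         pos≤ (2 , v , a , b) (t , x , y) = if≤ _ (≤-trans (+-mono-≤ (capped x y) (capped y x))
                                              (≤-reflexive (cong (suc M +_) (sym (+-identityʳ (suc M))))))
         pos≤ (3 , v , a , b) (t , x , y) = δ≤ _
         pos≤ (suc (suc (suc (suc _))) , v , a , b) (t , x , y) = δ≤ _

         neg≤ : ∀ ρ c → neg ρ c ≤ 2 * suc M
         neg≤ (0 , v , a , b) (t , x , y) = δ≤ _
         neg≤ (1 , v , a , b) (t , x , y) = z≤n
         neg≤ (2 , v , a , b) (t , x , y) = z≤n
         neg≤ (3 , v , a , b) (t , x , y) = δ≤ _
         neg≤ (suc (suc (suc (suc _))) , v , a , b) (t , x , y) =
           ≤-trans (+-mono-≤ (δ≤1 ((t ≡ᵇ suc v) ∧ (x ≡ᵇ a))) (if-1 (v ≡ᵇ a) (δ≤1 ((t ≡ᵇ 0) ∧ (y ≡ᵇ v) ∧ before x y))))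
             (*-monoʳ-≤ 2 (s≤s (z≤n {M})))
           where
           if-1 : ∀ b {m} → m ≤ 1 → (if b then m else 0) ≤ 1
           if-1 true  h = h
           if-1 false h = z≤n

         pos₀≤ : ∀ ρ → pos₀ ρ ≤ 1
         pos₀≤ (0 , v , a , b) = z≤n
         pos₀≤ (1 , v , a , b) = z≤n
         pos₀≤ (2 , v , a , b) = z≤n
         pos₀≤ (3 , v , a , b) = z≤n
         pos₀≤ (suc (suc (suc (suc _))) , v , a , b) = δ≤1 (v ≡ᵇ a)

         neg₀≤ : ∀ ρ → neg₀ ρ ≤ flow-budget + tree-budget
         neg₀≤ (0 , v , a , b) = z≤n
         neg₀≤ (1 , v , a , b) = m≤m+n _ _
         neg₀≤ (2 , v , a , b) = m≤n+m _ flow-budget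
         neg₀≤ (suc (suc (suc _)) , v , a , b) = z≤n

         sum≤ : ∀ (f : Col → ℕ) → (∀ c → f c ≤ 2 * suc M) → ∑ cols f ≤ length cols * (2 * suc M)
         sum≤ f h = ≤-trans (∑-mono cols h) (≤-reflexive (∑-const cols (2 * suc M)))

         pos-width : ∀ ρ → ρ ∈ rows → ∑ cols (pos ρ) + pos₀ ρ ≤ width
         pos-width ρ _ = ≤-trans (+-mono-≤ (≤-trans (sum≤ (pos ρ) (pos≤ ρ)) (m≤m+n _ _)) (pos₀≤ ρ)) (≤-reflexive (sym width-≡))

         neg-width : ∀ ρ → ρ ∈ rows → ∑ cols (neg ρ) + neg₀ ρ ≤ width
         neg-width ρ _ = ≤-trans (+-mono-≤ (sum≤ (neg ρ) (neg≤ ρ)) (neg₀≤ ρ)) (≤-trans (m≤m+n _ 1) (≤-reflexive (sym width-≡)))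

         τ K N : ℕ
         τ = rounds
         K = precision
         N = suc n

         module PB = PerceptronBound rows cols pos neg pos₀ neg₀ width pos-width neg-width E E≼cols feasible

         rows-hold : ∀ ρ → ρ ∈ rows →
           K * (∑ history (pos ρ) + τ * pos₀ ρ) ≤ K * (∑ history (neg ρ) + τ * neg₀ ρ) + τ
         rows-hold = subst (λ m → ∀ ρ → ρ ∈ rows → K * (∑ (proj₂ (plays m)) (pos ρ) + m * pos₀ ρ) ≤
                                                   K * (∑ (proj₂ (plays m)) (neg ρ) + m * neg₀ ρ) + m)
                       (sym rounds-≡) (PB.nearly-feasible K)

         history-us : ∀ {t x y} → (t , x , y) ∈ history → x ∈ us × y ∈ us
         history-us {t} c∈ with ∈-⊗⁻ (downFrom (2 + n)) (subst (_ ∈_) cols-≡ (history-∈ rows cols pos neg pos₀ neg₀ rounds c∈))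
         ... | _ , xy∈ = ∈-⊗⁻ us xy∈

         open LinearProgram k K τ history history-us rows-hold

         S C Ω : ℕ
         S = ∑ chosen-vs (λ v → A v ∸ B v)
         C = ∑ chosen-vs (λ v → r (pre v) v)
         Ω = Chosen.Tree.length-of chosen-vs chosen-unique chosen⊆vs links

         1≤K : 1 ≤ K
         1≤K = subst (1 ≤_) (sym precision-≡) (*-mono-≤ {1} {400 * (N * N)} {1} {suc M} (s≤s z≤n) (s≤s z≤n))

         n*sucM≤K : n * suc M ≤ K
         n*sucM≤K = subst (n * suc M ≤_) (sym precision-≡) (*-monoˡ-≤ (suc M) (≤-trans (n≤1+n n) (≤-trans (m≤m*n N N) (m≤n*m (N * N) 400))))

         400NN≤K : 400 * (N * N) ≤ K
         400NN≤K = subst (400 * (N * N) ≤_) (sym precision-≡) (m≤m*n (400 * (N * N)) (suc M))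

         positive : ∀ {a b} → 1 ≤ a → 1 ≤ b → 1 ≤ a * b
         positive {a} {b} ha hb = *-mono-≤ {1} {a} {1} {b} ha hb

         1≤τ : 1 ≤ τ
         1≤τ = subst (1 ≤_) (sym rounds-≡) (positive {K * K} (positive {K} 1≤K 1≤K) (positive {length rows}
           (≤-trans (s≤s z≤n) (≤-trans (m≤n+m _ (length (map (λ v → 0 , v , 0 , 0) vs)))
             (≤-reflexive (trans (sym (length-++ (map (λ v → 0 , v , 0 , 0) vs))) (cong length (sym rows-≡))))))
           (positive {2} (s≤s z≤n) (positive {width} 1≤width 1≤width))))
           where
           1≤width : 1 ≤ width
           1≤width = subst (1 ≤_) (sym width-≡) (m≤n+m 1 (length cols * (2 * suc M) + (flow-budget + tree-budget)))

         cancel : ∀ m {a b} → 1 ≤ m → m * a ≤ m * b → a ≤ b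
         cancel (suc m) {a} {b} _ h = *-cancelˡ-≤ (suc m) h

         -- The 2 pays for the violation of the budget and for that of conservation, each of which
         -- costs at most `K * τ`.
         flow-total : ∑ vs (λ v → (A v ∸ B v) * inflow v) ≤ τ * (flow-budget + 2)
         flow-total = cancel K 1≤K (begin
           K * ∑ vs (λ v → (A v ∸ B v) * inflow v)
             ≤⟨ Potentials.duality A B refl B≤A A≤ arc ⟩
           K * part on-flow r + n * suc M * τ        ≤⟨ +-mono-≤ row₁ (*-monoˡ-≤ τ n*sucM≤K) ⟩
           K * (τ * flow-budget) + τ + K * τ
             ≤⟨ +-monoˡ-≤ (K * τ) (+-monoʳ-≤ (K * (τ * flow-budget))
                  (≤-trans (≤-reflexive (sym (+-identityʳ τ))) (*-monoˡ-≤ τ 1≤K))) ⟩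
           K * (τ * flow-budget) + K * τ + K * τ     ≡⟨ lem K τ flow-budget ⟩
           K * (τ * (flow-budget + 2))               ∎)
           where
           open ≤-Reasoning
           lem : ∀ K t f → K * (t * f) + K * t + K * t ≡ K * (t * (f + 2))
           lem = solve-∀

         chosen-inflow : ∀ v → v ∈ chosen-vs → 9 * τ ≤ 20 * inflow v
         chosen-inflow v v∈ = ≤ᵇ-true {9 * τ} (proj₂ (∈-filterᵇ⁻ {xs = vs} v∈))

         unchosen-inflow : ∀ v → v ∈ vs → v ∉ chosen-vs → 20 * inflow v ≤ 9 * τ
         unchosen-inflow v v∈ v∉ = ≮⇒≥ λ lt → v∉ (∈-filterᵇ⁺ {p = chosen} {xs = vs} v∈ (true-≤ᵇ {9 * τ} {20 * inflow v} (<⇒≤ lt)))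

         potential-total : 9 * S ≤ 20 * (flow-budget + 2)
         potential-total = cancel τ 1≤τ (begin
           τ * (9 * S)                                        ≡⟨ lem₁ τ S ⟩
           9 * τ * S                                          ≡⟨ sym (∑-*ˡ chosen-vs (9 * τ) _) ⟩
           ∑ chosen-vs (λ v → 9 * τ * (A v ∸ B v))
             ≤⟨ ∑-mono∈ chosen-vs (λ v v∈ → *-monoˡ-≤ (A v ∸ B v) (chosen-inflow v v∈)) ⟩
           ∑ chosen-vs (λ v → 20 * inflow v * (A v ∸ B v))    ≤⟨ ∑-filter≤ chosen vs _ ⟩
           ∑ vs (λ v → 20 * inflow v * (A v ∸ B v))
             ≡⟨ trans (∑-cong vs λ v → lem₂ (inflow v) (A v ∸ B v)) (∑-*ˡ vs 20 _) ⟩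
           20 * ∑ vs (λ v → (A v ∸ B v) * inflow v)           ≤⟨ *-monoʳ-≤ 20 flow-total ⟩
           20 * (τ * (flow-budget + 2))                       ≡⟨ lem₃ τ (flow-budget + 2) ⟩
           τ * (20 * (flow-budget + 2))                       ∎)
           where
           open ≤-Reasoning
           lem₁ : ∀ t s → t * (9 * s) ≡ 9 * t * s
           lem₁ = solve-∀
           lem₂ : ∀ i a → 20 * i * a ≡ 20 * (a * i)
           lem₂ = solve-∀
           lem₃ : ∀ t f → 20 * (t * f) ≡ t * (20 * f)
           lem₃ = solve-∀

         -- Without errors the factor would be 11/20 = 110/200; the precision is such that they
         -- consume one part in 110.
         cut-≤ : ∀ S → Unique S → (∀ {v} → v ∈ S → v ∈ vs × v ∉ chosen-vs) → ∀ {s} → s ∈ S →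
                 109 * τ ≤ 200 * part on-tree (leaving S)
         cut-≤ S un out s∈ = cancel K 1≤K (linear (K * τ) (begin
             10 * (11 * (K * τ))
               ≤⟨ *-monoʳ-≤ 10 (Cut.cut-bound S un (λ v∈ → proj₁ (out v∈))
                    (λ {v} v∈ → unchosen-inflow v (proj₁ (out v∈)) (proj₂ (out v∈))) s∈) ⟩
             10 * (20 * (K * Z) + 40 * (N * N * τ))            ≡⟨ lem₁ K Z N τ ⟩
             200 * (K * Z) + 400 * (N * N) * τ                 ≤⟨ +-monoʳ-≤ (200 * (K * Z)) (*-monoˡ-≤ τ 400NN≤K) ⟩
             200 * (K * Z) + K * τ                             ∎)
           (lem₂ K τ) (lem₃ K Z τ))
           where
           open ≤-Reasoning
           Z : ℕ
           Z = part on-tree (leaving S)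
           lem₁ : ∀ K Z N t → 10 * (20 * (K * Z) + 40 * (N * N * t)) ≡ 200 * (K * Z) + 400 * (N * N) * t
           lem₁ = solve-∀
           lem₂ : ∀ K t → K * t + K * (109 * t) ≡ 10 * (11 * (K * t))
           lem₂ = solve-∀
           lem₃ : ∀ K Z t → 200 * (K * Z) + K * t ≡ K * t + K * (200 * Z)
           lem₃ = solve-∀

         tree-total : 109 * Ω ≤ 200 * (tree-budget + 1)
         tree-total = cancel τ 1≤τ (begin
           τ * (109 * Ω)                     ≡⟨ lem₁ τ Ω ⟩
           109 * τ * Ω                       ≤⟨ Chosen.Tree.Bound.tree-bound chosen-vs chosen-unique chosen⊆vs
                                                  (part on-tree) (λ h → part-mono on-tree λ t x y x∈ y∈ _ → h x y x∈ y∈)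
                                                  (part-+ on-tree) (109 * τ) 200 cut-≤ ⟩
           200 * part on-tree ω              ≤⟨ *-monoʳ-≤ 200 budget ⟩
           200 * (τ * (tree-budget + 1))     ≡⟨ lem₂ τ (tree-budget + 1) ⟩
           τ * (200 * (tree-budget + 1))     ∎)
           where
           open ≤-Reasoning
           lem₁ : ∀ t o → t * (109 * o) ≡ 109 * t * o
           lem₁ = solve-∀
           lem₂ : ∀ t f → 200 * (t * f) ≡ t * (200 * f)
           lem₂ = solve-∀
           lem₃ : ∀ K t f → K * (t * f) + K * t ≡ K * (t * (f + 1))
           lem₃ = solve-∀
           budget : part on-tree ω ≤ τ * (tree-budget + 1)
           budget = cancel K 1≤K (≤-trans row₂ (≤-trans (+-monoʳ-≤ (K * (τ * tree-budget))
             (≤-trans (≤-reflexive (sym (+-identityʳ τ))) (*-monoˡ-≤ τ 1≤K)))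
             (≤-reflexive (lem₃ K τ tree-budget))))

       attempt-bound : length (attempt k) ≤ 10 * k
       attempt-bound = subst (λ S → length S ≤ 10 * k) (sym (attempt-≡ k))
         (ratio-arithmetic (length pieces) C S Ω k M-≡ (≤-trans (Partition.few partition) tour-cost)
           chain-cost potential-total tree-total)

 -- Properties of the rounded regret and of the ranks

 module Exact (R : ℕ) (g : ℕ → ℕ → ℕ) (D : ℕ → ℕ) (rounded : Rounded n M R g D r rank) where

  open Rounded rounded
  open Distances distances
  open Scaling M R

  module Scaled where

   closer : ℕ → ℕ → Bool
   closer = nearer D

   r-customer : ∀ {u} → u ≢ 0 → ∀ v → r u v ≡ scale (g u v)
   r-customer {u} nz v = trans (r-≡ u v) (cong (λ b → if b then suc M else scale (g u v)) (false-≡ᵇ nz))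

   r-capped : ∀ u v → r u v ≤ suc M
   r-capped u v rewrite r-≡ u v with u ≡ᵇ 0
   ... | true  = ≤-refl
   ... | false = scale-≤ (g u v)

   -- A step from the depot costs `suc M`, which is the cap, so walks that leave the depot satisfy
   -- this trivially. Otherwise the inequality for `g` survives, since rounding up is monotone and
   -- subadditive.
   r-triangle : ∀ u v w → r u w ≤ r u v + r v w
   r-triangle u v w rewrite r-≡ u w | r-≡ u v | r-≡ v w with u ≡ᵇ 0
   ... | true = m≤m+n (suc M) _
   ... | false with v ≡ᵇ 0
   ...   | true  = ≤-trans (scale-≤ (g u w)) (m≤n+m (suc M) _)
   ...   | false = ≤-trans (scale-mono (g-triangle u v w)) (scale-+ (g u v) (g v w))

   private
     Closer : ℕ → ℕ → Set
     Closer u v = D u < D v ⊎ (D u ≤ D v × u < v)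

     closer⁻ : ∀ {u v} → closer u v ≡ true → Closer u v
     closer⁻ {u} {v} e with D u <ᵇ D v in lt
     ... | true  = inj₁ (<ᵇ-true {D u} lt)
     ... | false = let a , b = ∧-true {D u ≤ᵇ D v} e in inj₂ (≤ᵇ-true {D u} a , <ᵇ-true {u} b)

     closer⁺ : ∀ {u v} → Closer u v → closer u v ≡ true
     closer⁺ {u} {v} (inj₁ lt) rewrite true-<ᵇ lt = refl
     closer⁺ {u} {v} (inj₂ (a , b)) with D u <ᵇ D v
     ... | true  = refl
     ... | false = true-∧ (true-≤ᵇ a) (true-<ᵇ b)

     closer-trans : ∀ {u v w} → Closer u v → Closer v w → Closer u w
     closer-trans (inj₁ a) (inj₁ b) = inj₁ (<-trans a b)
     closer-trans (inj₁ a) (inj₂ (b , _)) = inj₁ (<-≤-trans a b)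
     closer-trans (inj₂ (a , _)) (inj₁ b) = inj₁ (≤-<-trans a b)
     closer-trans (inj₂ (a , c)) (inj₂ (b , d)) = inj₂ (≤-trans a b , <-trans c d)

     closer-irrefl : ∀ {u} → ¬ Closer u u
     closer-irrefl (inj₁ a) = <-irrefl refl a
     closer-irrefl (inj₂ (_ , b)) = <-irrefl refl b

     closer-total : ∀ u v → u ≢ v → Closer u v ⊎ Closer v u
     closer-total u v ne with <-cmp (D u) (D v)
     ... | tri< a _ _ = inj₁ (inj₁ a)
     ... | tri> _ _ c = inj₂ (inj₁ c)
     ... | tri≈ _ b _ with <-cmp u v
     ...   | tri< a _ _ = inj₁ (inj₂ (≤-reflexive b , a))
     ...   | tri≈ _ e _ = contradiction e ne
     ...   | tri> _ _ c = inj₂ (inj₂ (≤-reflexive (sym b) , c))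

     closer-false : ∀ u → closer u u ≡ false
     closer-false u with closer u u in e
     ... | true  = contradiction (closer⁻ {u} {u} e) closer-irrefl
     ... | false = refl

     rank-< : ∀ {u v} → u ≤ n → Closer u v → rank u < rank v
     rank-< {u} {v} u≤n c = subst₂ _<_ (sym (rank-≡ u)) (sym (rank-≡ v)) (∑-strict each (∈-downFrom⁺ (s≤s u≤n))
       (subst₂ _<_ (sym (cong δ (closer-false u))) (sym (cong δ (closer⁺ {u} {v} c))) (s≤s z≤n)))
       where
       each : ∀ x → δ (closer x u) ≤ δ (closer x v)
       each x with closer x u in e
       ... | false = z≤n
       ... | true  = ≤-reflexive (sym (cong δ (closer⁺ {x} {v} (closer-trans (closer⁻ {x} {u} e) c))))

   rank-D : ∀ {u v} → v ≤ n → rank u ≤ rank v → D u ≤ D v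
   rank-D {u} {v} v≤n h = ≮⇒≥ λ lt → contradiction h (<⇒≱ (rank-< v≤n (inj₁ lt)))

   regret : Regret n M r rank
   regret = record
     { triangle = r-triangle
     ; capped   = r-capped
     ; depot-r  = λ v → r-≡ 0 v
     ; rank-inj = injective
     ; rank≤n   = bounded
     ; rank-0   = trans (rank-≡ 0) (∑-zero (downFrom (suc n)) λ u _ → cong δ (nothing-closer u)) }
     where
     injective : ∀ {u v} → u ≤ n → v ≤ n → rank u ≡ rank v → u ≡ v
     injective {u} {v} u≤ v≤ e with u ≟ v
     ... | yes eq = eq
     ... | no ne with closer-total u v ne
     ...   | inj₁ c = contradiction (≤-reflexive (sym e)) (<⇒≱ (rank-< u≤ c))
     ...   | inj₂ c = contradiction (≤-reflexive e) (<⇒≱ (rank-< v≤ c))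
     bounded : ∀ {v} → v ≤ n → rank v ≤ n
     bounded {v} v≤ = ≤-trans (≤-reflexive (rank-≡ v)) (≤-pred (≤-trans (∑-strict {f = λ u → δ (closer u v)} {g = λ _ → 1} (λ _ → δ≤1 _) (∈-downFrom⁺ (s≤s v≤))
       (subst (_< 1) (sym (cong δ (closer-false v))) (s≤s z≤n)))
       (≤-reflexive (trans (∑-const (downFrom (suc n)) 1) (trans (*-identityʳ _) (length-downFrom (suc n)))))))
     nothing-closer : ∀ u → closer u 0 ≡ false
     nothing-closer u with closer u 0 in e
     ... | false = refl
     ... | true with closer⁻ {u} {0} e
     ...   | inj₁ lt = contradiction (subst (D u <_) D-depot lt) λ ()
     ...   | inj₂ (_ , ())

  -- Decomposition of a path into blocks

  module Paths where

   open Scaled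

   -- A piece of a path which cannot be cut such that all vertices before
   -- the cut have smaller ranks than those after it.
   record Block : Set where
     field
       nodes    : List ℕ
       front    : List ℕ
       root     : ℕ
       back     : List ℕ
       split-≡  : nodes ≡ front ++ root ∷ back
       highest  : ℕ
       minimal  : ∀ {x} → x ∈ nodes → rank root ≤ rank x
       maximal  : ∀ {x} → x ∈ nodes → rank x ≤ rank highest
       high∈    : highest ∈ nodes
       in-range : ∀ {x} → x ∈ nodes → x ≤ n
       -- A step inwards from `x` to `y` costs at least `2 * (D x - D y)`, and the inward steps of
       -- an uncuttable piece cover its whole range of distances. Only this consequence is recorded.
       irreducible : 2 * D highest ≤ cost g nodes + 2 * D root

     root∈ : root ∈ nodes
     root∈ = subst (root ∈_) (sym split-≡) (∈-++⁺ʳ front (here refl))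

     D-min : ∀ {x} → x ∈ nodes → D root ≤ D x
     D-min x∈ = rank-D (in-range x∈) (minimal x∈)

     D-max : ∀ {x} → x ∈ nodes → D x ≤ D highest
     D-max x∈ = rank-D (in-range high∈) (maximal x∈)

     arcs : List (ℕ × ℕ)
     arcs = climbs root (reverse front) ++ climbs root back

     way : ℕ → List (ℕ × ℕ)
     way v = climb root (reverse front) v ++ climb root back v

   open Block

   single-block : ∀ x → x ≤ n → Block
   single-block x x≤n = record
     { nodes = x ∷ [] ; front = [] ; root = x ; back = [] ; split-≡ = refl ; highest = x
     ; minimal = λ { (here refl) → ≤-refl } ; maximal = λ { (here refl) → ≤-refl }
     ; high∈ = here refl ; in-range = λ { (here refl) → x≤n } ; irreducible = ≤-refl }

   private
     join-cost : ∀ (b b′ : Block) → ∃[ x ] ∃[ y ] x ∈ nodes b × y ∈ nodes b′ ×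
       cost g (nodes b ++ nodes b′) ≡ cost g (nodes b) + (g x y + cost g (nodes b′))
     join-cost b b′ with nodes b | root∈ b | nodes b′ | root∈ b′
     ... | x ∷ xs | _ | y ∷ ys | _ with cost-join g x xs y ys
     ...   | z , z∈ , e = z , y , z∈ , here refl , e

     drop-≤ : ∀ x y → 2 * D x ≤ g x y + 2 * D y
     drop-≤ x y = ≤-trans (m≤n+m (2 * D x) (g y x)) (≤-reflexive (sym (g-turn x y)))

   module Merge (b b′ : Block) (overlaps : rank (root b′) < rank (highest b)) where

     D-overlaps : D (root b′) ≤ D (highest b)
     D-overlaps = rank-D (in-range b (high∈ b)) (<⇒≤ overlaps)

     both : ∀ {P : ℕ → Set} → (∀ {x} → x ∈ nodes b → P x) → (∀ {x} → x ∈ nodes b′ → P x) →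
            ∀ {x} → x ∈ nodes b ++ nodes b′ → P x
     both p q x∈ with ∈-++⁻ (nodes b) x∈
     ... | inj₁ y = p y
     ... | inj₂ y = q y

     whole : ℕ
     whole = cost g (nodes b ++ nodes b′)

     c₁ : cost g (nodes b) + cost g (nodes b′) ≤ whole
     c₁ = cost-parts g (nodes b) (nodes b′)

     -- Within one block nothing is to be done. From the root of `b` to the top of `b′` the two
     -- ranges overlap and join. From the root of `b′` to the top of `b` a gap between the ranges is
     -- covered by the step that connects the blocks.
     fall : ∀ m t → (m ≡ root b ⊎ m ≡ root b′) → (t ≡ highest b ⊎ t ≡ highest b′) → 2 * D t ≤ whole + 2 * D m
     fall _ _ (inj₁ refl) (inj₁ refl) = ≤-trans (irreducible b)
       (+-monoˡ-≤ (2 * D _) (≤-trans (m≤m+n _ (cost g (nodes b′))) c₁))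
     fall _ _ (inj₁ refl) (inj₂ refl) = ≤-trans (irreducible b′)
       (≤-trans (+-monoʳ-≤ (cost g (nodes b′)) (≤-trans (*-monoʳ-≤ 2 D-overlaps) (irreducible b)))
         (≤-trans (≤-reflexive (lem (cost g (nodes b′)) (cost g (nodes b)) (2 * D (root b)))) (+-monoˡ-≤ (2 * D (root b)) c₁)))
       where
       lem : ∀ a b c → a + (b + c) ≡ b + a + c
       lem = solve-∀
     fall _ _ (inj₂ refl) (inj₂ refl) = ≤-trans (irreducible b′)
       (+-monoˡ-≤ (2 * D _) (≤-trans (m≤n+m _ (cost g (nodes b))) c₁))
     fall _ _ (inj₂ refl) (inj₁ refl) with join-cost b b′
     ... | x , y , x∈ , y∈ , e = begin
       2 * D (highest b)                                                ≤⟨ irreducible b ⟩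
       cost g (nodes b) + 2 * D (root b)                                ≤⟨ +-monoʳ-≤ (cost g (nodes b)) (*-monoʳ-≤ 2 (D-min b x∈)) ⟩
       cost g (nodes b) + 2 * D x                                       ≤⟨ +-monoʳ-≤ (cost g (nodes b)) (drop-≤ x y) ⟩
       cost g (nodes b) + (g x y + 2 * D y)
         ≤⟨ +-monoʳ-≤ (cost g (nodes b)) (+-monoʳ-≤ (g x y) (≤-trans (*-monoʳ-≤ 2 (D-max b′ y∈)) (irreducible b′))) ⟩
       cost g (nodes b) + (g x y + (cost g (nodes b′) + 2 * D (root b′)))  ≡⟨ lem (cost g (nodes b)) (g x y) (cost g (nodes b′)) (2 * D (root b′)) ⟩
       cost g (nodes b) + (g x y + cost g (nodes b′)) + 2 * D (root b′)    ≡⟨ cong (_+ 2 * D (root b′)) (sym e) ⟩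
       whole + 2 * D (root b′)                                          ∎
       where
       open ≤-Reasoning
       lem : ∀ a b c d → a + (b + (c + d)) ≡ a + (b + c) + d
       lem = solve-∀

     high-of : ∃[ t ] (t ≡ highest b ⊎ t ≡ highest b′) × rank (highest b) ≤ rank t × rank (highest b′) ≤ rank t
     high-of with ≤-total (rank (highest b)) (rank (highest b′))
     ... | inj₁ le = highest b′ , inj₂ refl , le , ≤-refl
     ... | inj₂ le = highest b , inj₁ refl , ≤-refl , le

     high-∈ : ∀ {t} → t ≡ highest b ⊎ t ≡ highest b′ → t ∈ nodes b ++ nodes b′
     high-∈ (inj₁ refl) = ∈-++⁺ˡ (high∈ b)
     high-∈ (inj₂ refl) = ∈-++⁺ʳ (nodes b) (high∈ b′)

     assemble : ∀ f m k → nodes b ++ nodes b′ ≡ f ++ m ∷ k → m ≡ root b ⊎ m ≡ root b′ →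
                rank m ≤ rank (root b) → rank m ≤ rank (root b′) → Block
     assemble f m k e which le le′ with high-of
     ... | t , t-which , ht , ht′ = record
       { nodes = nodes b ++ nodes b′ ; front = f ; root = m ; back = k ; split-≡ = e ; highest = t
       ; minimal = both {λ x → rank m ≤ rank x} (λ x∈ → ≤-trans le (minimal b x∈)) (λ x∈ → ≤-trans le′ (minimal b′ x∈))
       ; maximal = both {λ x → rank x ≤ rank t} (λ x∈ → ≤-trans (maximal b x∈) ht) (λ x∈ → ≤-trans (maximal b′ x∈) ht′)
       ; high∈ = high-∈ t-which
       ; in-range = both {λ x → x ≤ n} (in-range b) (in-range b′)
       ; irreducible = fall m t which t-which }

     merged : ∃[ c ] nodes c ≡ nodes b ++ nodes b′
     merged with ≤-total (rank (root b)) (rank (root b′))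
     ... | inj₁ le = assemble (front b) (root b) (back b ++ nodes b′)
             (trans (cong (_++ nodes b′) (split-≡ b)) (++-assoc (front b) (root b ∷ back b) (nodes b′)))
             (inj₁ refl) ≤-refl le , refl
     ... | inj₂ le = assemble (nodes b ++ front b′) (root b′) (back b′)
             (trans (cong (nodes b ++_) (split-≡ b′)) (sym (++-assoc (nodes b) (front b′) (root b′ ∷ back b′))))
             (inj₂ refl) le ≤-refl , refl

   data Separated : List Block → Set where
     []  : Separated []
     one : ∀ {b} → Separated (b ∷ [])
     sep : ∀ {b b′ bs} → rank (highest b) ≤ rank (root b′) → Separated (b′ ∷ bs) → Separated (b ∷ b′ ∷ bs)

   separated-tail : ∀ {b bs} → Separated (b ∷ bs) → Separated bs
   separated-tail one       = []
   separated-tail (sep _ s) = s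

   -- Merging enlarges the range of a block, which may then overlap the next one; hence the merged
   -- block is prepended anew.
   prepend : ∀ b bs → Separated bs →
     ∃[ cs ] Separated cs × concatMap nodes cs ≡ nodes b ++ concatMap nodes bs
   prepend b [] s = b ∷ [] , one , refl
   prepend b (b′ ∷ bs) s with rank (root b′) <? rank (highest b)
   ... | no  ge = b ∷ b′ ∷ bs , sep (≮⇒≥ ge) s , refl
   ... | yes lt with Merge.merged b b′ lt
   ...   | c , e with prepend c bs (separated-tail s)
   ...     | cs , s′ , e′ = cs , s′ , trans e′ (trans (cong (_++ concatMap nodes bs) e)
                              (++-assoc (nodes b) (nodes b′) (concatMap nodes bs)))

   decompose : ∀ p → (∀ {x} → x ∈ p → x ≤ n) → ∃[ bs ] Separated bs × concatMap nodes bs ≡ p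
   decompose [] h = [] , [] , refl
   decompose (x ∷ p) h with decompose p (λ x∈ → h (there x∈))
   ... | bs , s , e with prepend (single-block x (h (here refl))) bs s
   ...   | cs , s′ , e′ = cs , s′ , trans e′ (cong (x ∷_) e)

   private
     -- Reversing an arc changes its cost by twice the difference of the distances, and this
     -- telescopes; `z` is the last vertex.
     turn-around : ∀ x xs → ∃[ z ] z ∈ x ∷ xs × cost (flip g) (x ∷ xs) + 2 * D x ≡ cost g (x ∷ xs) + 2 * D z
     turn-around x [] = x , here refl , refl
     turn-around x (y ∷ ys) with turn-around y ys
     ... | z , z∈ , e = z , there z∈ , +-cancelʳ-≡ (2 * D y) _ _ (trans (lem (g y x) _ (2 * D x) (2 * D y))
           (trans (cong₂ _+_ (sym (g-turn x y)) e) (lem′ (g x y) (2 * D y) _ (2 * D z))))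
       where
       lem : ∀ a b c d → a + b + c + d ≡ a + c + (b + d)
       lem = solve-∀
       lem′ : ∀ a b c d → a + b + (c + d) ≡ a + c + d + b
       lem′ = solve-∀

   -- Since the block is irreducible, going back is at most twice as
   -- expensive as going forth.
   reverse-cost : ∀ b → cost (flip g) (nodes b) ≤ 2 * cost g (nodes b)
   reverse-cost b = bound-of (nodes b) refl
     where
     bound-of : ∀ xs → nodes b ≡ xs → cost (flip g) xs ≤ 2 * cost g xs
     bound-of [] e = z≤n
     bound-of (x ∷ xs) e with turn-around x xs
     ... | z , z∈ , t = linear (2 * D x) (begin
         cost (flip g) (x ∷ xs) + 2 * D x            ≡⟨ t ⟩
         cost g (x ∷ xs) + 2 * D z
           ≤⟨ +-monoʳ-≤ (cost g (x ∷ xs)) (≤-trans (*-monoʳ-≤ 2 (D-max b (subst (z ∈_) (sym e) z∈)))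
                (subst (λ w → 2 * D (highest b) ≤ cost g w + 2 * D (root b)) e (irreducible b))) ⟩
         cost g (x ∷ xs) + (cost g (x ∷ xs) + 2 * D (root b))
           ≤⟨ +-monoʳ-≤ (cost g (x ∷ xs)) (+-monoʳ-≤ (cost g (x ∷ xs)) (*-monoʳ-≤ 2 (D-min b (subst (x ∈_) (sym e) (here refl))))) ⟩
         cost g (x ∷ xs) + (cost g (x ∷ xs) + 2 * D x) ∎)
       (+-comm (2 * D x) _) (lem (cost g (x ∷ xs)) (2 * D x))
       where
       open ≤-Reasoning
       lem : ∀ c d → c + (c + d) ≡ d + 2 * c
       lem = solve-∀

   occurrences-reverse : ∀ v xs → occurrences v (reverse xs) ≡ occurrences v xs
   occurrences-reverse v [] = refl
   occurrences-reverse v (x ∷ xs) = trans (cong (occurrences v) (unfold-reverse x xs))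
     (trans (∑-++ (reverse xs) (x ∷ []) _) (trans (cong₂ _+_ (occurrences-reverse v xs) (+-identityʳ _)) (+-comm _ (δ (x ≡ᵇ v)))))

   occurrences-nodes : ∀ b v → occurrences v (nodes b) ≡ occurrences v (front b) + (δ (root b ≡ᵇ v) + occurrences v (back b))
   occurrences-nodes b v = trans (cong (occurrences v) (split-≡ b)) (∑-++ (front b) (root b ∷ back b) _)

   arcs-sources : ∀ b → map proj₁ (arcs b) ≡ reverse (front b) ++ back b
   arcs-sources b = trans (map-++ proj₁ (climbs (root b) (reverse (front b))) _)
     (cong₂ _++_ (climbs-sources (root b) (reverse (front b))) (climbs-sources (root b) (back b)))

   sources-≤ : ∀ b v → ∑ (arcs b) (λ e → δ (proj₁ e ≡ᵇ v)) ≤ occurrences v (nodes b)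
   sources-≤ b v = ≤-trans (≤-reflexive (trans (sym (∑-map proj₁ (arcs b) (λ x → δ (x ≡ᵇ v))))
     (trans (cong (occurrences v) (arcs-sources b)) (trans (∑-++ (reverse (front b)) (back b) _)
       (cong (_+ occurrences v (back b)) (occurrences-reverse v (front b)))))))
     (≤-trans (+-monoʳ-≤ (occurrences v (front b)) (m≤n+m _ (δ (root b ≡ᵇ v)))) (≤-reflexive (sym (occurrences-nodes b v))))

   arcs-cost : ∀ b → ∑ (arcs b) (λ e → ω (proj₁ e) (proj₂ e)) ≡ cost r (nodes b) + cost (flip r) (nodes b)
   arcs-cost b = begin
     ∑ (arcs b) (λ e → ω (proj₁ e) (proj₂ e))
       ≡⟨ ∑-++ (climbs (root b) (reverse (front b))) _ _ ⟩
     _ ≡⟨ cong₂ _+_ (climbs-cost ω (root b) (reverse (front b))) (climbs-cost ω (root b) (back b)) ⟩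
     cost (flip ω) (root b ∷ reverse (front b)) + cost (flip ω) (root b ∷ back b)
       ≡⟨ cong₂ _+_ (cost-reverse (flip ω) (front b) (root b)) (cost-sym (root b ∷ back b)) ⟩
     cost ω (front b ++ root b ∷ []) + cost ω (root b ∷ back b)
       ≡⟨ cost-through ω (front b) (root b) (back b) ⟨
     cost ω (front b ++ root b ∷ back b)     ≡⟨ cong (cost ω) (split-≡ b) ⟨
     cost ω (nodes b)                        ≡⟨ cost-+ r (flip r) (nodes b) ⟩
     cost r (nodes b) + cost (flip r) (nodes b) ∎
     where
     open ≡-Reasoning
     cost-sym : ∀ xs → cost (flip ω) xs ≡ cost ω xs
     cost-sym []           = refl
     cost-sym (x ∷ [])     = refl
     cost-sym (x ∷ y ∷ ys) = cong₂ _+_ (+-comm (r y x) (r x y)) (cost-sym (y ∷ ys))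

   way≼arcs : ∀ b v → way b v ≼ arcs b
   way≼arcs b v f = ≤-trans (≤-reflexive (∑-++ (climb (root b) (reverse (front b)) v) _ f))
     (≤-trans (+-mono-≤ (climb≼ (root b) (reverse (front b)) v f) (climb≼ (root b) (back b) v f))
       (≤-reflexive (sym (∑-++ (climbs (root b) (reverse (front b))) _ f))))

   private
     reverse-∈⁻ : ∀ {x} (xs : List ℕ) → x ∈ reverse xs → x ∈ xs
     reverse-∈⁻ xs x∈ = subst (_ ∈_) (reverse-involutive xs) (reverse⁺ x∈)

   way-∉ : ∀ b {v} → v ∉ nodes b → way b v ≡ []
   way-∉ b {v} v∉ = cong₂ _++_
     (climb-∉ (root b) (reverse (front b)) λ v∈ → v∉ (subst (v ∈_) (sym (split-≡ b)) (∈-++⁺ˡ (reverse-∈⁻ (front b) v∈))))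
     (climb-∉ (root b) (back b) λ v∈ → v∉ (subst (v ∈_) (sym (split-≡ b)) (∈-++⁺ʳ (front b) (there v∈))))

   module WayBalance (b : Block) (un : Unique (nodes b)) where

     private
       once : ∀ v → occurrences v (front b) + (δ (root b ≡ᵇ v) + occurrences v (back b)) ≤ 1
       once v = ≤-trans (≤-reflexive (sym (occurrences-nodes b v))) (occurrences-unique v un)

       front-unique : Unique (reverse (front b))
       front-unique = occurrences-Unique λ v → ≤-trans (≤-reflexive (occurrences-reverse v (front b)))
         (≤-trans (m≤m+n _ _) (once v))

       back-unique : Unique (back b)
       back-unique = occurrences-Unique λ v → ≤-trans (m≤n+m _ (δ (root b ≡ᵇ v))) (≤-trans (m≤n+m _ (occurrences v (front b))) (once v))

     root-way : way b (root b) ≡ []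
     root-way = cong₂ _++_
       (climb-∉ (root b) (reverse (front b)) λ v∈ → twice (reverse-∈⁻ (front b) v∈))
       (climb-∉ (root b) (back b) λ v∈ → contradiction
         (≤-trans (+-mono-≤ (≤-reflexive (sym (cong δ (true-≡ᵇ {root b} refl)))) (occurrences-∈ v∈))
           (≤-trans (m≤n+m _ (occurrences (root b) (front b))) (once (root b)))) λ { (s≤s ()) })
       where
       twice : root b ∉ front b
       twice v∈ = contradiction (≤-trans (+-mono-≤ (occurrences-∈ v∈)
         (≤-trans (≤-reflexive (sym (cong δ (true-≡ᵇ {root b} refl)))) (m≤m+n _ _))) (once (root b))) λ { (s≤s ()) }

     -- `v` lies on one side of the root only, so that one of the two climbs is empty and the other
     -- is a path to the root.
     way-balance : ∀ {v} → v ∈ nodes b → v ≢ root b → ∀ a →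
       ∑ (way b v) (λ e → δ (proj₂ e ≡ᵇ a)) + δ (v ≡ᵇ a) ≡ ∑ (way b v) (λ e → δ (proj₁ e ≡ᵇ a)) + δ (root b ≡ᵇ a)
     way-balance {v} v∈ ne a with ∈-++⁻ (front b) (subst (v ∈_) (split-≡ b) v∈)
     ... | inj₂ (here e) = contradiction e ne
     ... | inj₁ v∈f rewrite climb-∉ (root b) (back b) {v} (λ v∈b → contradiction
             (≤-trans (+-mono-≤ (occurrences-∈ v∈f) (≤-trans (occurrences-∈ v∈b) (m≤n+m _ (δ (root b ≡ᵇ v))))) (once v)) λ { (s≤s ()) })
           | ++-identityʳ (climb (root b) (reverse (front b)) v) =
           climb-balance (root b) (reverse (front b)) front-unique (reverse⁺ v∈f) a
     ... | inj₂ (there v∈b) rewrite climb-∉ (root b) (reverse (front b)) {v} (λ v∈f → contradiction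
             (≤-trans (+-mono-≤ (occurrences-∈ (reverse-∈⁻ (front b) v∈f)) (≤-trans (occurrences-∈ v∈b) (m≤n+m _ (δ (root b ≡ᵇ v))))) (once v)) λ { (s≤s ()) }) =
           climb-balance (root b) (back b) back-unique v∈b a

  -- A solution of the linear program from given paths

  module Optimum (M-≡ : M ≡ 20 * suc n) where

   open Scaled
   open Regret regret using (rank-0; rank-inj; depot-r)
   open Paths
   open Block

   record Dissection (p : List ℕ) (bl : List Block) : Set where
     field
       parts     : concatMap nodes bl ≡ p
       separated : Separated bl
       cheap     : cost g p ≤ R
       distinct  : Unique p
       customers : ∀ {v} → v ∈ p → v ∈ vs

     vs≢0 : ∀ {v} → v ∈ p → v ≢ 0
     vs≢0 v∈ refl with vs-bounds (customers v∈)
     ... | () , _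

     in-part : ∀ {b} → b ∈ bl → ∀ {v} → v ∈ nodes b → v ∈ p
     in-part {b} b∈ {v} v∈ = subst (v ∈_) parts (within bl b∈)
       where
       within : ∀ bl → b ∈ bl → v ∈ concatMap nodes bl
       within (c ∷ bl) (here refl) = ∈-++⁺ˡ v∈
       within (c ∷ bl) (there b∈)  = ∈-++⁺ʳ (nodes c) (within bl b∈)

     private
       r-on : ∀ {u} → u ∈ p → ∀ v → r u v ≡ scale (g u v)
       r-on u∈ v = r-customer (vs≢0 u∈) v

     -- A path is given by its customers, so all its arcs carry the scaled regret, and rounding adds
     -- one unit per edge.
     forth : cost r p ≤ M + length p
     forth = begin
       cost r p                                               ≡⟨ cost-edges r p ⟩
       ∑ (edges p) (λ e → r (proj₁ e) (proj₂ e))              ≡⟨ ∑-cong∈ (edges p) (λ e e∈ → r-on (proj₁ (edges-∈ p e∈)) (proj₂ e)) ⟩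
       ∑ (edges p) (λ e → scale (g (proj₁ e) (proj₂ e)))
         ≤⟨ scale-sum (edges p) (λ e → g (proj₁ e) (proj₂ e)) 1
              (≤-trans (≤-reflexive (sym (cost-edges g p))) (≤-trans cheap (≤-reflexive (sym (+-identityʳ R))))) ⟩
       1 * M + length (edges p)                               ≤⟨ +-mono-≤ (≤-reflexive (+-identityʳ M)) (length-edges p) ⟩
       M + length p                                           ∎
       where open ≤-Reasoning

     parts-cost : ∀ h → ∑ bl (λ b → cost h (nodes b)) ≤ cost h p
     parts-cost h = ≤-trans (all-parts bl) (≤-reflexive (cong (cost h) parts))
       where
       all-parts : ∀ bl → ∑ bl (λ b → cost h (nodes b)) ≤ cost h (concatMap nodes bl)
       all-parts []       = z≤n
       all-parts (b ∷ bl) = ≤-trans (+-monoʳ-≤ (cost h (nodes b)) (all-parts bl)) (cost-parts h (nodes b) (concatMap nodes bl))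

     -- Only arcs inside blocks are reversed, and there `reverse-cost` applies; this is the origin
     -- of the factor 2.
     back-and : ∑ bl (λ b → cost (flip r) (nodes b)) ≤ 2 * M + length p
     back-and = begin
       ∑ bl (λ b → cost (flip r) (nodes b))
         ≡⟨ ∑-cong∈ bl (λ b b∈ → trans (cost-edges (flip r) (nodes b)) (∑-cong∈ (edges (nodes b))
              λ e e∈ → r-on (in-part b∈ (proj₂ (edges-∈ (nodes b) e∈))) (proj₁ e))) ⟩
       ∑ bl (λ b → ∑ (edges (nodes b)) (λ e → scale (g (proj₂ e) (proj₁ e))))
         ≡⟨ ∑-concatMap (λ b → edges (nodes b)) bl _ ⟨
       ∑ all-edges (λ e → scale (g (proj₂ e) (proj₁ e)))
         ≤⟨ scale-sum all-edges (λ e → g (proj₂ e) (proj₁ e)) 2 (begin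
              ∑ all-edges (λ e → g (proj₂ e) (proj₁ e))
                ≡⟨ trans (∑-concatMap (λ b → edges (nodes b)) bl _) (∑-cong bl λ b → sym (cost-edges (flip g) (nodes b))) ⟩
              ∑ bl (λ b → cost (flip g) (nodes b))    ≤⟨ ∑-mono bl reverse-cost ⟩
              ∑ bl (λ b → 2 * cost g (nodes b))       ≡⟨ ∑-*ˡ bl 2 _ ⟩
              2 * ∑ bl (λ b → cost g (nodes b))       ≤⟨ *-monoʳ-≤ 2 (≤-trans (parts-cost g) cheap) ⟩
              2 * R ∎) ⟩
       2 * M + length all-edges
         ≤⟨ +-monoʳ-≤ (2 * M) (≤-trans (≤-reflexive (length-∑ (λ b → edges (nodes b)) bl))
              (≤-trans (∑-mono bl λ b → length-edges (nodes b)) (≤-reflexive (trans (sym (length-∑ nodes bl)) (cong length parts))))) ⟩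
       2 * M + length p ∎
       where
       open ≤-Reasoning
       all-edges : List (ℕ × ℕ)
       all-edges = concatMap (λ b → edges (nodes b)) bl

     arcs-total : ∑ bl (λ b → ∑ (arcs b) (λ e → ω (proj₁ e) (proj₂ e))) ≤ 3 * M + 2 * length p
     arcs-total = ≤-trans (≤-reflexive (trans (∑-cong bl arcs-cost) (∑-+ bl _ _)))
       (≤-trans (+-mono-≤ (≤-trans (parts-cost r) forth) back-and) (≤-reflexive (lem M (length p))))
       where
       lem : ∀ m l → m + l + (2 * m + l) ≡ 3 * m + 2 * l
       lem = solve-∀

     visits : List (ℕ × ℕ)
     visits = edges (0 ∷ map root bl)

     roots-cost : ∀ x bl → cost r (x ∷ map root bl) ≤ cost r (x ∷ concatMap nodes bl)
     roots-cost x [] = ≤-refl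
     roots-cost x (b ∷ bl) = ≤-trans (+-monoʳ-≤ (r x (root b)) (≤-trans (roots-cost (root b) bl)
         (cost-skip r-triangle (root b) (back b) (concatMap nodes bl))))
       (≤-trans (cost-skip r-triangle x (front b) (root b ∷ back b ++ concatMap nodes bl))
         (≤-reflexive (cong (λ z → cost r (x ∷ z)) (trans (sym (++-assoc (front b) (root b ∷ back b) (concatMap nodes bl)))
           (cong (_++ concatMap nodes bl) (sym (split-≡ b)))))))

     visits-cost : ∑ visits (λ e → r (proj₁ e) (proj₂ e)) ≤ suc (M + M) + length p
     visits-cost = ≤-trans (≤-reflexive (sym (cost-edges r (0 ∷ map root bl))))
       (≤-trans (roots-cost 0 bl) (≤-trans (≤-reflexive (cong (λ z → cost r (0 ∷ z)) parts)) (start-≤ p forth)))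
       where
       start-≤ : ∀ p → cost r p ≤ M + length p → cost r (0 ∷ p) ≤ suc (M + M) + length p
       start-≤ []      h = z≤n
       start-≤ (x ∷ p) h = ≤-trans (+-mono-≤ (≤-reflexive (depot-r x)) h) (≤-reflexive (sym (+-assoc (suc M) M _)))

     root-in : ∀ {b} → b ∈ bl → root b ∈ p
     root-in {b} b∈ = in-part b∈ (root∈ b)

     -- Flow may use arcs of increasing rank only, which is why it visits a single vertex per block.
     -- Separation gives that ranks do not decrease, and they differ because the roots do.
     visits-before : ∀ {e} → e ∈ visits → before (proj₁ e) (proj₂ e) ≡ true
     visits-before = chain bl separated (subst Unique (sym parts) distinct) λ b∈ → root-in b∈
       where
       strict : ∀ {u v} → u ≤ n → v ≤ n → rank u ≤ rank v → u ≢ v → before u v ≡ true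
       strict {u} {v} u≤ v≤ le ne = true-<ᵇ {rank u} {rank v} (≤∧≢⇒< le λ e → ne (rank-inj u≤ v≤ e))
       from : ∀ x bl → x ≤ n → Separated bl → Unique (concatMap nodes bl) →
              (∀ {b} → b ∈ bl → rank x ≤ rank (root b) × x ≢ root b) →
              ∀ {e} → e ∈ edges (x ∷ map root bl) → before (proj₁ e) (proj₂ e) ≡ true
       from x (b ∷ bl) x≤ s un h (here refl) =
         strict {x} {root b} x≤ (in-range b (root∈ b)) (proj₁ (h (here refl))) (proj₂ (h (here refl)))
       from x (b ∷ bl) x≤ s un h (there e∈) = from (root b) bl (in-range b (root∈ b)) (separated-tail s)
         (later (nodes b) un) (λ b∈ → higher b bl s b∈ , apart b bl un b∈) e∈
         where
         later : ∀ xs {ys : List ℕ} → Unique (xs ++ ys) → Unique ys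
         later []       u       = u
         later (_ ∷ xs) (_ ∷ u) = later xs u
         higher : ∀ b bl → Separated (b ∷ bl) → ∀ {c} → c ∈ bl → rank (root b) ≤ rank (root c)
         higher b (c ∷ bl) (sep le s) (here refl) = ≤-trans (maximal b (root∈ b)) le
         higher b (c ∷ bl) (sep le s) (there c∈) =
           ≤-trans (≤-trans (maximal b (root∈ b)) le) (higher c bl s c∈)
         apart : ∀ b bl → Unique (concatMap nodes (b ∷ bl)) → ∀ {c} → c ∈ bl → root b ≢ root c
         apart b bl un {c} c∈ e = clash (nodes b) un (root∈ b) (subst (_∈ concatMap nodes bl) (sym e) (inside bl c∈))
           where
           inside : ∀ bl → c ∈ bl → root c ∈ concatMap nodes bl
           inside (d ∷ bl) (here refl) = ∈-++⁺ˡ (root∈ c)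
           inside (d ∷ bl) (there c∈)  = ∈-++⁺ʳ (nodes d) (inside bl c∈)
           clash : ∀ xs {ys : List ℕ} {v} → Unique (xs ++ ys) → v ∈ xs → v ∉ ys
           clash (x ∷ xs) (h ∷ _) (here refl) v∈ys = All.lookup h (∈-++⁺ʳ xs v∈ys) refl
           clash (x ∷ xs) (_ ∷ u) (there v∈)  v∈ys = clash xs u v∈ v∈ys
       chain : ∀ bl → Separated bl → Unique (concatMap nodes bl) → (∀ {b} → b ∈ bl → root b ∈ p) →
               ∀ {e} → e ∈ edges (0 ∷ map root bl) → before (proj₁ e) (proj₂ e) ≡ true
       chain bl s un h = from 0 bl z≤n s un λ b∈ →
         ≤-trans (≤-reflexive rank-0) z≤n , λ e → vs≢0 (h b∈) (sym e)

     visits-targets : ∀ v → ∑ visits (λ e → δ (proj₂ e ≡ᵇ v)) ≤ occurrences v p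
     visits-targets v = ≤-trans (≤-reflexive (edges-targets 0 (map root bl) v))
       (≤-trans (count bl) (≤-reflexive (cong (occurrences v) parts)))
       where
       count : ∀ bl → occurrences v (map root bl) ≤ occurrences v (concatMap nodes bl)
       count [] = z≤n
       count (b ∷ bl) = ≤-trans (+-mono-≤ (∑-member (λ x → δ (x ≡ᵇ v)) (root∈ b)) (count bl))
         (≤-reflexive (sym (∑-++ (nodes b) (concatMap nodes bl) _)))

     visits-us : ∀ {x y} → (x , y) ∈ visits → x ∈ us × y ∈ us
     visits-us e∈ with edges-∈ (0 ∷ map root bl) e∈
     ... | x∈ , y∈ = vertex x∈ , vertex y∈
       where
       vertex : ∀ {x} → x ∈ 0 ∷ map root bl → x ∈ us
       vertex (here refl) = ∈us z≤n
       vertex (there x∈) with ∈-map⁻ root x∈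
       ... | b , b∈ , refl = vs⊆us (customers (root-in b∈))

   data Dissected : List (List ℕ) → List (List Block) → Set where
     []  : Dissected [] []
     _∷_ : ∀ {p bl ps bls} → Dissection p bl → Dissected ps bls → Dissected (p ∷ ps) (bl ∷ bls)

   dissect : ∀ ps → All (λ p → cost g p ≤ R) ps → (∀ {v} → v ∈ concat ps → v ∈ vs) → Unique (concat ps) →
             ∃[ bls ] Dissected ps bls
   dissect [] _ _ _ = [] , []
   dissect (p ∷ ps) (c ∷ cs) inside un
     with decompose p (λ x∈ → us≤ (vs⊆us (inside (∈-++⁺ˡ x∈))))
        | dissect ps cs (λ v∈ → inside (∈-++⁺ʳ p v∈)) (later p un)
     where
     later : ∀ xs {ys : List ℕ} → Unique (xs ++ ys) → Unique ys
     later []       u       = u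
     later (_ ∷ xs) (_ ∷ u) = later xs u
   ... | bl , s , e | bls , d = bl ∷ bls , record
     { parts = e ; separated = s ; cheap = c
     ; distinct = occurrences-Unique λ v → ≤-trans (m≤m+n _ (occurrences v (concat ps)))
         (≤-trans (≤-reflexive (sym (∑-++ p (concat ps) _))) (occurrences-unique v un))
     ; customers = λ v∈ → inside (∈-++⁺ˡ v∈) } ∷ d

   module Solution (ps : List (List ℕ)) (cheap : All (λ p → cost g p ≤ R) ps)
     (inside : ∀ {v} → v ∈ concat ps → v ∈ vs) (distinct : Unique (concat ps))
     (complete : ∀ {v} → v ∈ vs → v ∈ concat ps) where

     k : ℕ
     k = length ps

     open Guess k using (flow-budget; tree-budget; neg₀)

     private
       bls : List (List Block)
       bls = proj₁ (dissect ps cheap inside distinct)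

       dissected : Dissected ps bls
       dissected = proj₂ (dissect ps cheap inside distinct)

       blocks : List Block
       blocks = concat bls

       nodes-all : concatMap nodes blocks ≡ concat ps
       nodes-all = collect dissected
         where
         collect : ∀ {ps bls} → Dissected ps bls → concatMap nodes (concat bls) ≡ concat ps
         collect [] = refl
         collect (_∷_ {p} {bl} {ps} {bls} d ds) = trans (concatMap-++ nodes bl (concat bls))
           (cong₂ _++_ (Dissection.parts d) (collect ds))

       visit-arcs tree-arcs : List (ℕ × ℕ)
       visit-arcs = concatMap (λ bl → edges (0 ∷ map root bl)) bls
       tree-arcs = concatMap arcs blocks

       ways : ℕ → List (ℕ × ℕ)
       ways v = concatMap (λ b → way b v) blocks

       arcs-for : ℕ → List (ℕ × ℕ)
       arcs-for 0             = visit-arcs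
       arcs-for 1             = tree-arcs
       -- The tag `suc w` belongs to the customer `w`. Customers start with 1, which leaves the tag
       -- 1 to the tree.
       arcs-for (suc (suc v)) = ways (suc v)

       E : List Col
       E = concatMap (λ t → map (t ,_) (arcs-for t)) (downFrom (2 + n))

       length-all : length (concat ps) ≤ n
       length-all = ≤-trans (length-≼ (concat ps) vs (≼-unique distinct inside)) (≤-reflexive length-vs)

       visit-arcs-before : ∀ {e} → e ∈ visit-arcs → before (proj₁ e) (proj₂ e) ≡ true
       visit-arcs-before = each dissected
         where
         each : ∀ {ps bls} → Dissected ps bls → ∀ {e} → e ∈ concatMap (λ bl → edges (0 ∷ map root bl)) bls →
                before (proj₁ e) (proj₂ e) ≡ true
         each (_∷_ {bl = bl} d ds) e∈ with ∈-++⁻ (edges (0 ∷ map root bl)) e∈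
         ... | inj₁ a = Dissection.visits-before d a
         ... | inj₂ b = each ds b

       visit-arcs-cost : ∑ visit-arcs (λ e → r (proj₁ e) (proj₂ e)) ≤ flow-budget
       visit-arcs-cost = ≤-trans (each dissected) (+-monoʳ-≤ (k * suc (M + M)) length-all)
         where
         lem : ∀ m l k x → m + l + (k * m + x) ≡ m + k * m + (l + x)
         lem = solve-∀
         each : ∀ {ps bls} → Dissected ps bls →
           ∑ (concatMap (λ bl → edges (0 ∷ map root bl)) bls) (λ e → r (proj₁ e) (proj₂ e)) ≤
           length ps * suc (M + M) + length (concat ps)
         each [] = z≤n
         each (_∷_ {p} {bl} {ps} {bls} d ds) = ≤-trans (≤-reflexive (∑-++ (edges (0 ∷ map root bl)) _ _))
           (≤-trans (+-mono-≤ (Dissection.visits-cost d) (each ds))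
             (≤-reflexive (trans (lem (suc (M + M)) (length p) (length ps) (length (concat ps)))
               (cong (suc (M + M) + length ps * suc (M + M) +_) (sym (length-++ p))))))

       tree-arcs-cost : ∑ tree-arcs (λ e → ω (proj₁ e) (proj₂ e)) ≤ tree-budget
       tree-arcs-cost = ≤-trans (≤-reflexive (∑-concatMap arcs blocks _))
         (≤-trans (each dissected) (+-monoʳ-≤ (3 * (k * M)) (*-monoʳ-≤ 2 length-all)))
         where
         lem : ∀ m l k x → 3 * m + 2 * l + (3 * (k * m) + 2 * x) ≡ 3 * (m + k * m) + 2 * (l + x)
         lem = solve-∀
         each : ∀ {ps bls} → Dissected ps bls →
           ∑ (concat bls) (λ b → ∑ (arcs b) (λ e → ω (proj₁ e) (proj₂ e))) ≤ 3 * (length ps * M) + 2 * length (concat ps)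
         each [] = z≤n
         each (_∷_ {p} {bl} {ps} {bls} d ds) = ≤-trans (≤-reflexive (∑-++ bl (concat bls) _))
           (≤-trans (+-mono-≤ (Dissection.arcs-total d) (each ds))
             (≤-reflexive (trans (lem M (length p) (length ps) (length (concat ps)))
               (cong (λ z → 3 * (M + length ps * M) + 2 * z) (sym (length-++ p))))))

       visit-arcs-targets : ∀ v → ∑ visit-arcs (λ e → δ (proj₂ e ≡ᵇ v)) ≤ occurrences v (concat ps)
       visit-arcs-targets v = each dissected
         where
         each : ∀ {ps bls} → Dissected ps bls →
           ∑ (concatMap (λ bl → edges (0 ∷ map root bl)) bls) (λ e → δ (proj₂ e ≡ᵇ v)) ≤ occurrences v (concat ps)
         each [] = z≤n
         each (_∷_ {p} {bl} {ps} {bls} d ds) = ≤-trans (≤-reflexive (∑-++ (edges (0 ∷ map root bl)) _ _))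
           (≤-trans (+-mono-≤ (Dissection.visits-targets d v) (each ds)) (≤-reflexive (sym (∑-++ p (concat ps) _))))

       visit-arcs-sources : ∀ {v} → v ≢ 0 →
         ∑ visit-arcs (λ e → δ (proj₁ e ≡ᵇ v)) ≤ ∑ visit-arcs (λ e → δ (proj₂ e ≡ᵇ v))
       visit-arcs-sources {v} nz = each bls
         where
         each : ∀ bls → ∑ (concatMap (λ bl → edges (0 ∷ map root bl)) bls) (λ e → δ (proj₁ e ≡ᵇ v))
                      ≤ ∑ (concatMap (λ bl → edges (0 ∷ map root bl)) bls) (λ e → δ (proj₂ e ≡ᵇ v))
         each [] = z≤n
         each (bl ∷ bls) = ≤-trans (≤-reflexive (∑-++ (edges (0 ∷ map root bl)) _ _))
           (≤-trans (+-mono-≤ (≤-trans (edges-sources 0 (map root bl) v)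
               (≤-reflexive (trans (cong (λ z → δ z + occurrences v (map root bl)) (false-≡ᵇ λ e → nz (sym e)))
                 (sym (edges-targets 0 (map root bl) v))))) (each bls))
             (≤-reflexive (sym (∑-++ (edges (0 ∷ map root bl)) _ _))))

       visit-arcs-us : ∀ {e} → e ∈ visit-arcs → e ∈ us ⊗ us
       visit-arcs-us = each dissected
         where
         each : ∀ {ps bls} → Dissected ps bls → ∀ {e} → e ∈ concatMap (λ bl → edges (0 ∷ map root bl)) bls → e ∈ us ⊗ us
         each (_∷_ {bl = bl} d ds) {x , y} e∈ with ∈-++⁻ (edges (0 ∷ map root bl)) e∈
         ... | inj₁ a = let x∈ , y∈ = Dissection.visits-us d a in ∈-⊗⁺ x∈ y∈
         ... | inj₂ b = each ds b

       visits-root : ∀ {b} → b ∈ blocks → ∃[ x ] (x , root b) ∈ visit-arcs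
       visits-root {b} = each bls
         where
         along : ∀ x bl → b ∈ bl → ∃[ y ] (y , root b) ∈ edges (x ∷ map root bl)
         along x (c ∷ bl) (here refl) = x , here refl
         along x (c ∷ bl) (there b∈) with along (root c) bl b∈
         ... | y , e∈ = y , there e∈
         each : ∀ bls → b ∈ concat bls → ∃[ y ] (y , root b) ∈ concatMap (λ bl → edges (0 ∷ map root bl)) bls
         each (bl ∷ bls) b∈ with ∈-++⁻ bl b∈
         ... | inj₁ a = let y , e∈ = along 0 bl a in y , ∈-++⁺ˡ e∈
         ... | inj₂ a = let y , e∈ = each bls a in y , ∈-++⁺ʳ (edges (0 ∷ map root bl)) e∈

       tree-arcs-sources : ∀ v → ∑ tree-arcs (λ e → δ (proj₁ e ≡ᵇ v)) ≤ occurrences v (concat ps)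
       tree-arcs-sources v = ≤-trans (≤-reflexive (∑-concatMap arcs blocks _))
         (≤-trans (∑-mono blocks λ b → sources-≤ b v)
           (≤-reflexive (trans (sym (∑-concatMap nodes blocks _)) (cong (occurrences v) nodes-all))))

       arcs-nodes : ∀ b {x y} → (x , y) ∈ arcs b → x ∈ nodes b × y ∈ nodes b
       arcs-nodes b {x} {y} e∈ with ∈-++⁻ (climbs (root b) (reverse (front b))) e∈
       ... | inj₁ a = let x∈ , y∈ = climbs-∈ (root b) (reverse (front b)) a in left x∈ , left y∈
         where
         left : ∀ {x} → x ∈ root b ∷ reverse (front b) → x ∈ nodes b
         left (here refl) = root∈ b
         left {x} (there x∈) = subst (x ∈_) (sym (split-≡ b))
           (∈-++⁺ˡ (subst (x ∈_) (reverse-involutive (front b)) (reverse⁺ x∈)))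
       ... | inj₂ a = let x∈ , y∈ = climbs-∈ (root b) (back b) a in right x∈ , right y∈
         where
         right : ∀ {x} → x ∈ root b ∷ back b → x ∈ nodes b
         right {x} x∈ = subst (x ∈_) (sym (split-≡ b)) (∈-++⁺ʳ (front b) x∈)

       tree-arcs-us : ∀ {e} → e ∈ tree-arcs → e ∈ us ⊗ us
       tree-arcs-us {x , y} = each blocks
         where
         each : ∀ bs → (x , y) ∈ concatMap arcs bs → (x , y) ∈ us ⊗ us
         each (b ∷ bs) e∈ with ∈-++⁻ (arcs b) e∈
         ... | inj₁ a = let x∈ , y∈ = arcs-nodes b a in ∈-⊗⁺ (∈us (in-range b x∈)) (∈us (in-range b y∈))
         ... | inj₂ a = each bs a

       ways≼ : ∀ v → ways v ≼ tree-arcs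
       ways≼ v f = ≤-trans (≤-reflexive (∑-concatMap (λ b → way b v) blocks f))
         (≤-trans (∑-mono blocks λ b → way≼arcs b v f) (≤-reflexive (sym (∑-concatMap arcs blocks f))))

       -- A column can be used only once, so arcs must not be repeated: a flow arc is determined by
       -- its target, and below a tree arc by its source, as no customer is visited twice.
       visit-arcs≼ : visit-arcs ≼ us ⊗ us
       visit-arcs≼ = ≼-unique (unique-by proj₂ visit-arcs λ v →
         ≤-trans (visit-arcs-targets v) (occurrences-unique v distinct)) visit-arcs-us

       tree-arcs≼ : tree-arcs ≼ us ⊗ us
       tree-arcs≼ = ≼-unique (unique-by proj₁ tree-arcs λ v →
         ≤-trans (tree-arcs-sources v) (occurrences-unique v distinct)) tree-arcs-us

       arcs-for≼ : ∀ t → arcs-for t ≼ us ⊗ us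
       arcs-for≼ 0             f = visit-arcs≼ f
       arcs-for≼ 1             f = tree-arcs≼ f
       arcs-for≼ (suc (suc v)) f = ≤-trans (ways≼ (suc v) f) (tree-arcs≼ f)

       E≼cols : E ≼ cols
       E≼cols f = subst (λ z → ∑ E f ≤ ∑ z f) (sym cols-≡) (≤-trans
         (≤-reflexive (∑-concatMap (λ t → map (t ,_) (arcs-for t)) (downFrom (2 + n)) f))
         (≤-trans (∑-mono (downFrom (2 + n)) λ t → ≤-trans (≤-reflexive (∑-map (t ,_) (arcs-for t) f))
             (≤-trans (arcs-for≼ t (λ e → f (t , e))) (≤-reflexive (sym (∑-map (t ,_) (us ⊗ us) f)))))
           (≤-reflexive (sym (∑-concatMap (λ t → map (t ,_) (us ⊗ us)) (downFrom (2 + n)) f)))))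

       -- Every row looks at columns of given tags, so its sum over `E` reduces to sums over the
       -- arcs of these tags.
       tagged : ∀ s (f : ℕ → ℕ → ℕ) → s < 2 + n → ∑ E (λ c → δ (proj₁ c ≡ᵇ s) * f (proj₁ (proj₂ c)) (proj₂ (proj₂ c)))
                                  ≡ ∑ (arcs-for s) (λ e → f (proj₁ e) (proj₂ e))
       tagged s f s< = begin
         ∑ E (λ c → δ (proj₁ c ≡ᵇ s) * f (proj₁ (proj₂ c)) (proj₂ (proj₂ c)))
           ≡⟨ ∑-concatMap (λ t → map (t ,_) (arcs-for t)) (downFrom (2 + n)) _ ⟩
         ∑ (downFrom (2 + n)) (λ t → ∑ (map (t ,_) (arcs-for t)) (λ c → δ (proj₁ c ≡ᵇ s) * f (proj₁ (proj₂ c)) (proj₂ (proj₂ c))))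
           ≡⟨ ∑-cong (downFrom (2 + n)) (λ t → trans (∑-map (t ,_) (arcs-for t) _)
                (trans (∑-*ˡ (arcs-for t) (δ (t ≡ᵇ s)) _) (cong (λ z → δ z * ∑ (arcs-for t) (λ e → f (proj₁ e) (proj₂ e))) (≡ᵇ-sym t s)))) ⟩
         ∑ (downFrom (2 + n)) (λ t → δ (s ≡ᵇ t) * ∑ (arcs-for t) (λ e → f (proj₁ e) (proj₂ e)))
           ≡⟨ select (Unique.downFrom⁺ (2 + n)) (∈-downFrom⁺ s<) (λ t → ∑ (arcs-for t) (λ e → f (proj₁ e) (proj₂ e))) ⟩
         ∑ (arcs-for s) (λ e → f (proj₁ e) (proj₂ e)) ∎
         where open ≡-Reasoning

       gated : ∀ b m → (if b then m else 0) ≡ δ b * m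
       gated true  m = sym (+-identityʳ m)
       gated false m = refl

       before-1 : ∀ b {c} → c ≡ true → δ (b ∧ c) ≡ δ b
       before-1 true  refl = refl
       before-1 false _    = refl

       ∑-enters : ∀ v → ∑ E (enters v) ≡ ∑ visit-arcs (λ e → δ (proj₂ e ≡ᵇ v))
       ∑-enters v = trans (∑-cong E λ (t , x , y) → δ-∧ (t ≡ᵇ 0) ((y ≡ᵇ v) ∧ before x y))
         (trans (tagged 0 (λ x y → δ ((y ≡ᵇ v) ∧ before x y)) (s≤s z≤n))
           (∑-cong∈ visit-arcs λ e e∈ → before-1 (proj₂ e ≡ᵇ v) (visit-arcs-before e∈)))

       ∑-leaves : ∀ v → ∑ E (pos (0 , v , 0 , 0)) ≡ ∑ visit-arcs (λ e → δ (proj₁ e ≡ᵇ v))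
       ∑-leaves v = trans (∑-cong E λ (t , x , y) → δ-∧ (t ≡ᵇ 0) ((x ≡ᵇ v) ∧ before x y))
         (trans (tagged 0 (λ x y → δ ((x ≡ᵇ v) ∧ before x y)) (s≤s z≤n))
           (∑-cong∈ visit-arcs λ e e∈ → before-1 (proj₁ e ≡ᵇ v) (visit-arcs-before e∈)))

       vs≢0 : ∀ {v} → v ∈ vs → v ≢ 0
       vs≢0 v∈ refl with vs-bounds v∈
       ... | () , _

       Good : Row → Set
       Good ρ = ∑ E (pos ρ) + pos₀ ρ ≤ ∑ E (neg ρ) + neg₀ ρ

       good₀ : ∀ {v} → v ∈ vs → Good (0 , v , 0 , 0)
       good₀ {v} v∈ = +-monoˡ-≤ 0 (≤-trans (≤-reflexive (∑-leaves v))
         (≤-trans (visit-arcs-sources (vs≢0 v∈)) (≤-reflexive (sym (∑-enters v)))))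

       good₁ : Good (1 , 0 , 0 , 0)
       good₁ = ≤-trans (≤-reflexive (+-identityʳ _)) (≤-trans (begin
         ∑ E (pos (1 , 0 , 0 , 0))
           ≡⟨ ∑-cong E (λ (t , x , y) → trans (gated ((t ≡ᵇ 0) ∧ before x y) (r x y))
                (trans (cong (_* r x y) (δ-∧ (t ≡ᵇ 0) (before x y))) (*-assoc (δ (t ≡ᵇ 0)) (δ (before x y)) (r x y)))) ⟩
         ∑ E (λ (t , x , y) → δ (t ≡ᵇ 0) * (δ (before x y) * r x y))
           ≡⟨ tagged 0 (λ x y → δ (before x y) * r x y) (s≤s z≤n) ⟩
         ∑ visit-arcs (λ e → δ (before (proj₁ e) (proj₂ e)) * r (proj₁ e) (proj₂ e))
           ≤⟨ ∑-mono visit-arcs (λ e → ≤-trans (*-monoˡ-≤ (r (proj₁ e) (proj₂ e)) (δ≤1 (before (proj₁ e) (proj₂ e)))) (≤-reflexive (+-identityʳ _))) ⟩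
         ∑ visit-arcs (λ e → r (proj₁ e) (proj₂ e))   ≤⟨ visit-arcs-cost ⟩
         flow-budget ∎) (m≤n+m flow-budget (∑ E (neg (1 , 0 , 0 , 0)))))
         where open ≤-Reasoning

       1<2+n : 1 < 2 + n
       1<2+n = s≤s (s≤s z≤n)

       good₂ : Good (2 , 0 , 0 , 0)
       good₂ = ≤-trans (≤-reflexive (+-identityʳ _)) (≤-trans (≤-trans
         (≤-reflexive (trans (∑-cong E λ (t , x , y) → gated (t ≡ᵇ 1) (ω x y)) (tagged 1 ω 1<2+n)))
         tree-arcs-cost) (m≤n+m tree-budget (∑ E (neg (2 , 0 , 0 , 0)))))

       good₃ : ∀ {v a b} → v ∈ vs → Good (3 , v , a , b)
       good₃ {zero} v∈ = contradiction refl (vs≢0 v∈)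
       good₃ {suc v} {a} {b} v∈ = +-monoˡ-≤ 0 (≤-trans
         (≤-reflexive (trans (∑-cong E λ (t , x , y) → δ-∧ (t ≡ᵇ suc (suc v)) ((x ≡ᵇ a) ∧ (y ≡ᵇ b)))
           (tagged (suc (suc v)) f (s≤s (s≤s (proj₂ (vs-bounds v∈)))))))
         (≤-trans (ways≼ (suc v) (λ e → f (proj₁ e) (proj₂ e)))
           (≤-reflexive (sym (trans (∑-cong E λ (t , x , y) → δ-∧ (t ≡ᵇ 1) ((x ≡ᵇ a) ∧ (y ≡ᵇ b)))
             (tagged 1 f 1<2+n))))))
         where
         f : ℕ → ℕ → ℕ
         f x y = δ ((x ≡ᵇ a) ∧ (y ≡ᵇ b))

       -- A customer lies in one block, and the remaining blocks contribute nothing to its way.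
       locate : ∀ {v} bs → v ∈ concatMap nodes bs → Unique (concatMap nodes bs) →
                ∃[ b ] b ∈ bs × v ∈ nodes b × Unique (nodes b) × concatMap (λ b → way b v) bs ≡ way b v
       locate {v} (b ∷ bs) v∈ un with ∈-++⁻ (nodes b) v∈
       ... | inj₁ v∈b = b , here refl , v∈b , firstly (nodes b) un ,
             trans (cong (way b v ++_) (none bs (apart (nodes b) un v∈b))) (++-identityʳ (way b v))
         where
         firstly : ∀ xs {ys : List ℕ} → Unique (xs ++ ys) → Unique xs
         firstly []       u       = []
         firstly (x ∷ xs) (h ∷ u) = All.tabulate (λ y∈ → All.lookup h (∈-++⁺ˡ y∈)) ∷ firstly xs u
         apart : ∀ xs {ys : List ℕ} → Unique (xs ++ ys) → v ∈ xs → v ∉ ys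
         apart (x ∷ xs) (h ∷ _) (here refl) v∈ys = All.lookup h (∈-++⁺ʳ xs v∈ys) refl
         apart (x ∷ xs) (_ ∷ u) (there v∈)  v∈ys = apart xs u v∈ v∈ys
         none : ∀ bs → v ∉ concatMap nodes bs → concatMap (λ b → way b v) bs ≡ []
         none []       _  = refl
         none (c ∷ bs) v∉ = cong₂ _++_ (way-∉ c λ z → v∉ (∈-++⁺ˡ z)) (none bs λ z → v∉ (∈-++⁺ʳ (nodes c) z))
       ... | inj₂ v∈bs with locate bs v∈bs (lastly (nodes b) un)
         where
         lastly : ∀ xs {ys : List ℕ} → Unique (xs ++ ys) → Unique ys
         lastly []       u       = u
         lastly (_ ∷ xs) (_ ∷ u) = lastly xs u
       ...   | c , c∈ , v∈c , u , e = c , there c∈ , v∈c , u ,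
               trans (cong (_++ concatMap (λ b → way b v) bs) (way-∉ b λ v∈b → apart (nodes b) un v∈b v∈bs)) e
         where
         apart : ∀ xs {ys : List ℕ} → Unique (xs ++ ys) → v ∈ xs → v ∉ ys
         apart (x ∷ xs) (h ∷ _) (here refl) v∈ys = All.lookup h (∈-++⁺ʳ xs v∈ys) refl
         apart (x ∷ xs) (_ ∷ u) (there v∈)  v∈ys = apart xs u v∈ v∈ys

       -- The root of a block is entered by the flow and has an empty commodity. Any other `v` sends
       -- one unit to the root of its block, which has smaller rank and hence is not among the
       -- vertices `a` where conservation is demanded.
       connected : ∀ {v a} → v ∈ vs → rank v ≤ rank a →
         ∑ (ways v) (λ e → δ (proj₂ e ≡ᵇ a)) + δ (v ≡ᵇ a) ≤
         ∑ (ways v) (λ e → δ (proj₁ e ≡ᵇ a)) + (if v ≡ᵇ a then ∑ visit-arcs (λ e → δ (proj₂ e ≡ᵇ v)) else 0)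
       connected {v} {a} v∈ le with locate blocks (subst (v ∈_) (sym nodes-all) (complete v∈)) (subst Unique (sym nodes-all) distinct)
       ... | b , b∈ , v∈b , un , e rewrite e with v ≟ root b
       ...   | no ne = ≤-trans (≤-reflexive (WayBalance.way-balance b un v∈b ne a)) (+-monoʳ-≤ _ (≤-trans (≤-reflexive
                 (cong δ (false-≡ᵇ {root b} {a} λ eq → ne (rank-inj (in-range b v∈b) (in-range b (root∈ b))
                   (≤-antisym (subst (λ z → rank v ≤ rank z) (sym eq) le) (minimal b v∈b)))))) z≤n))
       ...   | yes refl rewrite WayBalance.root-way b un = reached (root b ≡ᵇ a)
         where
         reached : ∀ c → δ c ≤ (if c then ∑ visit-arcs (λ e → δ (proj₂ e ≡ᵇ root b)) else 0)
         reached false = z≤n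
         reached true with visits-root b∈
         ... | x , e∈ = ≤-trans (≤-reflexive (sym (cong δ (true-≡ᵇ {root b} refl)))) (∑-member (λ e → δ (proj₂ e ≡ᵇ root b)) e∈)

       good₄ : ∀ {v a} → v ∈ vs → rank v ≤ rank a → Good (4 , v , a , 0)
       good₄ {zero} v∈ = contradiction refl (vs≢0 v∈)
       good₄ {suc v} {a} v∈ le = ≤-trans (+-monoˡ-≤ _ (≤-reflexive
           (trans (∑-cong E λ (t , x , y) → δ-∧ (t ≡ᵇ suc (suc v)) (y ≡ᵇ a)) (tagged (suc (suc v)) (λ x y → δ (y ≡ᵇ a)) s<))))
         (≤-trans (connected v∈ le) (≤-trans (≤-reflexive (sym (trans (∑-+ E _ _) (cong₂ _+_
           (trans (∑-cong E λ (t , x , y) → δ-∧ (t ≡ᵇ suc (suc v)) (x ≡ᵇ a)) (tagged (suc (suc v)) (λ x y → δ (x ≡ᵇ a)) s<))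
           (only-if (suc v ≡ᵇ a)))))) (m≤m+n _ 0)))
         where
         s< : suc (suc v) < 2 + n
         s< = s≤s (s≤s (proj₂ (vs-bounds v∈)))
         only-if : ∀ c → ∑ E (λ z → if c then enters (suc v) z else 0)
                       ≡ (if c then ∑ visit-arcs (λ e → δ (proj₂ e ≡ᵇ suc v)) else 0)
         only-if true  = ∑-enters (suc v)
         only-if false = ∑-zero E λ _ _ → refl

       feasible : ∀ ρ → ρ ∈ rows → Good ρ
       feasible ρ ρ∈ with ∈-++⁻ (map (λ v → 0 , v , 0 , 0) vs) (subst (ρ ∈_) rows-≡ ρ∈)
       ... | inj₁ a with ∈-map⁻ (λ v → 0 , v , 0 , 0) a
       ...   | v , v∈ , refl = good₀ v∈
       feasible ρ ρ∈ | inj₂ (here refl) = good₁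
       feasible ρ ρ∈ | inj₂ (there (here refl)) = good₂
       feasible ρ ρ∈ | inj₂ (there (there a)) with ∈-++⁻ (map (3 ,_) (vs ⊗ us ⊗ us)) a
       ... | inj₁ b with ∈-map⁻ (3 ,_) b
       ...   | (v , x , y) , e∈ , refl = good₃ {v} {x} {y} (proj₁ (∈-⊗⁻ vs e∈))
       feasible ρ ρ∈ | inj₂ (there (there a)) | inj₂ b with ∈-map⁻ (λ (v , a) → 4 , v , a , 0) b
       ... | (v , x) , e∈ , refl with ∈-filterᵇ⁻ {xs = vs ⊗ vs} e∈
       ...   | e∈′ , le = good₄ {v} {x} (proj₁ (∈-⊗⁻ vs e∈′)) (≤ᵇ-true {rank v} {rank x} le)

     certificate : WithRegret.Ratio.Certificate regret M-≡ k
     certificate = record { E = E ; E≼cols = E≼cols ; feasible = feasible }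

     bounded-attempt : length (attempt k) ≤ 10 * k
     bounded-attempt = WithRegret.Ratio.attempt-bound regret M-≡ k certificate

  -- Feasibility and ratio of the best attempt

  module Bridge (M-≡ : M ≡ 20 * suc n) where

   open Scaled

   open Best attempt (length (attempt 0)) best best-≡

   record Tours (ps : List (List ℕ)) : Set where
     field
       cheap    : All (λ p → cost g p ≤ R) ps
       all-started : All (λ p → ∃[ y ] ∃[ ys ] p ≡ y ∷ ys) ps
       inside   : ∀ {v} → v ∈ concat ps → 1 ≤ v × v ≤ n
       distinct : Unique (concat ps)
       complete : ∀ {v} → 1 ≤ v → v ≤ n → v ∈ concat ps

   private
     positive : 1 ≤ M
     positive rewrite M-≡ = s≤s z≤n

     -- Rounding up is safe in this direction: `j` units bound the regret by `j * R / M`. Capped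
     -- arcs, for which this fails, do not fit into a cost of at most `M`.
     scaled-cost : ∀ x ys → (∀ {v} → v ∈ x ∷ ys → v ≢ 0) → cost r (x ∷ ys) ≤ M →
                   M * cost g (x ∷ ys) ≤ cost r (x ∷ ys) * R
     scaled-cost x []       nz h = ≤-reflexive (*-zeroʳ M)
     scaled-cost x (y ∷ ys) nz h = begin
       M * (g x y + cost g (y ∷ ys))            ≡⟨ *-distribˡ-+ M (g x y) _ ⟩
       M * g x y + M * cost g (y ∷ ys)
         ≤⟨ +-mono-≤ (subst (λ s → M * g x y ≤ s * R) (sym e) (scale-exceeds (subst (_≤ M) e (≤-trans (m≤m+n (r x y) (cost r (y ∷ ys))) h))))
              (scaled-cost y ys (nz ∘ there) (≤-trans (m≤n+m (cost r (y ∷ ys)) (r x y)) h)) ⟩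
       r x y * R + cost r (y ∷ ys) * R          ≡⟨ *-distribʳ-+ R (r x y) _ ⟨
       (r x y + cost r (y ∷ ys)) * R            ∎
       where
       open ≤-Reasoning
       e : r x y ≡ scale (g x y)
       e = r-customer (nz (here refl)) y

     cancel-M : ∀ {a b} → M * a ≤ M * b → a ≤ b
     cancel-M {a} {b} = cancel M positive
       where
       cancel : ∀ M → 1 ≤ M → M * a ≤ M * b → a ≤ b
       cancel (suc m) _ h = *-cancelˡ-≤ (suc m) h

   pieces-tours : ∀ {ps} → Pieces n M r ps → Tours ps
   pieces-tours {ps} pieces = record
     { cheap    = All.tabulate λ p∈ → cheap (All.lookup short p∈) λ v∈ → ≢0 (inside (∈-concat⁺′ v∈ p∈))
     ; all-started = All.map proj₁ short
     ; inside   = inside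
     ; distinct = distinct
     ; complete = complete }
     where
     open Pieces pieces
     ≢0 : ∀ {v} → 1 ≤ v × v ≤ n → v ≢ 0
     ≢0 (() , _) refl
     cheap : ∀ {p} → (∃[ y ] ∃[ ys ] p ≡ y ∷ ys) × cost r p ≤ M → (∀ {v} → v ∈ p → v ≢ 0) → cost g p ≤ R
     cheap ((x , ys , refl) , c≤) nz = cancel-M (≤-trans (scaled-cost x ys nz c≤) (*-monoˡ-≤ R c≤))

   first-tours : Tours (attempt 0)
   first-tours = pieces-tours (WithRegret.Ratio.attempt-pieces regret M-≡ 0)

   best-tours : Tours best
   best-tours = from best-attempt
     where
     from : ∃[ k ] best ≡ attempt k → Tours best
     from (k , e) = subst Tours (sym e) (pieces-tours (WithRegret.Ratio.attempt-pieces regret M-≡ k))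

   private
     bounded : (ps : List (List ℕ)) → All (λ p → cost g p ≤ R) ps → (∀ {v} → v ∈ concat ps → v ∈ vs) →
       Unique (concat ps) → (∀ {v} → v ∈ vs → v ∈ concat ps) → length (attempt (length ps)) ≤ 10 * length ps
     bounded = Optimum.Solution.bounded-attempt M-≡

   -- Minimality is applied to the feasible `attempt 0`, which puts the number of paths among the
   -- guesses. For this guess the paths themselves, with repeated visits removed, provide the
   -- certificate.
   best-bounded : ∀ ps → All (λ p → cost g p ≤ R) ps → All Unique ps →
     (∀ {v} → v ∈ concat ps → 1 ≤ v × v ≤ n) → (∀ {v} → 1 ≤ v → v ≤ n → v ∈ concat ps) →
     (∀ {ps′} → Tours ps′ → length ps ≤ length ps′) → length best ≤ 10 * length ps
   best-bounded ps cheap unique inside complete least = best-ratio (unvisited-length [] ps) (least first-tours)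
     (bounded (unvisited [] ps)
       (unvisited-cost g-triangle [] ps cheap)
       (λ v∈ → let a , b = inside (proj₂ (unvisited-∈ [] ps v∈)) in ∈vs a b)
       (unvisited-unique [] ps unique) covered)
     where
     visited : ∀ {v} → v ∈ [] ⊎ v ∈ concat (unvisited [] ps) → v ∈ concat (unvisited [] ps)
     visited (inj₂ v∈) = v∈
     covered : ∀ {v} → v ∈ vs → v ∈ concat (unvisited [] ps)
     covered v∈ = visited (unvisited-complete [] ps (complete (proj₁ (vs-bounds v∈)) (proj₂ (vs-bounds v∈))))

-- Rational distances as multiples of a common unit

module IntegralDistances where

 open Algorithm
 open Sums
 open Selection
 open Sequences
 open BinaryNumbers
 open Encodings
 open Parsing
 open import Defs
 open import Data.Fin using (suc)
 open import Data.Integer as ℤ using (ℤ; +_; ∣_∣)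
 import Data.Integer.Properties as ℤ
 open import Data.List.NonEmpty using (_∷_)
 open import Data.Nat.Divisibility using (_∣_; quotient; divides)
 open import Data.Nat.ListAction using (product)
 open import Data.Nat.ListAction.Properties using (∈⇒∣product; product≢0)
 open import Data.Rational as ℚ using (ℚ; 0ℚ; mkℚ; toℚᵘ)
 import Data.Rational.Properties as ℚ
 open import Data.Rational.Unnormalised as ℚᵘ using (mkℚᵘ; *≡*; *≤*)
 import Data.Rational.Unnormalised.Properties as ℚᵘ
 open import Function.Metric.Rational using (module IsMetric)

 module Multiples (K : ℕ) where

   infix 4 _≐_

   -- `q` is `x` over the common denominator `suc K`. The bound and all distances have this form for
   -- one `K`, so that the analysis can be carried out in natural numbers.
   _≐_ : ℚ → ℕ → Set
   q ≐ x = toℚᵘ q ℚᵘ.≃ mkℚᵘ (+ x) K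

   ≐-scaled : ∀ q x → 0ℚ ℚ.≤ q → ∣ ℚ.numerator q ∣ * suc K ≡ x * ℚ.denominatorℕ q → q ≐ x
   ≐-scaled q@(mkℚ a d _) x 0≤q e = *≡* (begin
     a ℤ.* + suc K              ≡⟨ cong (ℤ._* + suc K) (sym (ℤ.0≤i⇒+∣i∣≡i 0≤a)) ⟩
     + ∣ a ∣ ℤ.* + suc K        ≡⟨ ℤ.pos-* ∣ a ∣ (suc K) ⟨
     + (∣ a ∣ * suc K)          ≡⟨ cong +_ e ⟩
     + (x * suc d)              ≡⟨ ℤ.pos-* x (suc d) ⟩
     + x ℤ.* + suc d            ∎)
     where
     open ≡-Reasoning
     0≤a : ℤ.0ℤ ℤ.≤ a
     0≤a = subst₂ ℤ._≤_ (ℤ.*-zeroˡ (+ suc d)) (ℤ.*-identityʳ a) (ℚ.drop-*≤* 0≤q)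

   ≐-0 : 0ℚ ≐ 0
   ≐-0 = *≡* refl

   ≐-+ : ∀ {p q x y} → p ≐ x → q ≐ y → p ℚ.+ q ≐ x + y
   ≐-+ {p} {q} {x} {y} h h′ = ℚᵘ.≃-trans (ℚ.toℚᵘ-homo-+ p q) (ℚᵘ.≃-trans (ℚᵘ.+-cong h h′) (*≡* (begin
     (+ x ℤ.* + L ℤ.+ + y ℤ.* + L) ℤ.* + L
       ≡⟨ cong (ℤ._* + L) (cong₂ ℤ._+_ (sym (ℤ.pos-* x L)) (sym (ℤ.pos-* y L))) ⟩
     (+ (x * L + y * L)) ℤ.* + L            ≡⟨ ℤ.pos-* (x * L + y * L) L ⟨
     + ((x * L + y * L) * L)                ≡⟨ cong +_ (lem x y L) ⟩
     + ((x + y) * (L * L))                  ≡⟨ ℤ.pos-* (x + y) (L * L) ⟩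
     + (x + y) ℤ.* + (L * L)                ∎)))
     where
     open ≡-Reasoning
     L : ℕ
     L = suc K
     lem : ∀ x y L → (x * L + y * L) * L ≡ (x + y) * (L * L)
     lem = solve-∀

   ≐-≤⁺ : ∀ {p q x y} → p ≐ x → q ≐ y → x ≤ y → p ℚ.≤ q
   ≐-≤⁺ h h′ x≤y = ℚ.toℚᵘ-cancel-≤ (ℚᵘ.≤-respˡ-≃ (ℚᵘ.≃-sym h) (ℚᵘ.≤-respʳ-≃ (ℚᵘ.≃-sym h′)
     (*≤* (ℤ.*-monoʳ-≤-nonNeg (+ suc K) (ℤ.+≤+ x≤y)))))

   ≐-≤⁻ : ∀ {p q x y} → p ≐ x → q ≐ y → p ℚ.≤ q → x ≤ y
   ≐-≤⁻ {x = x} {y} h h′ p≤q with ℚᵘ.≤-respˡ-≃ h (ℚᵘ.≤-respʳ-≃ h′ (ℚ.toℚᵘ-mono-≤ p≤q))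
   ... | *≤* i = ℤ.drop‿+≤+ (ℤ.*-cancelʳ-≤-pos (+ x) (+ y) (+ suc K) i)

   ≐-injective : ∀ {p x y} → p ≐ x → p ≐ y → x ≡ y
   ≐-injective {p} h h′ = ≤-antisym (≐-≤⁻ {p} {p} h h′ ℚ.≤-refl) (≐-≤⁻ {p} {p} h′ h ℚ.≤-refl)

 <ᵇ-≡ : ∀ {a b c d} → (a < b → c < d) → (c < d → a < b) → (a <ᵇ b) ≡ (c <ᵇ d)
 <ᵇ-≡ {a} {b} {c} {d} f g with a <ᵇ b in e | c <ᵇ d in e′
 ... | true  | true  = refl
 ... | false | false = refl
 ... | true  | false = trans (sym (true-<ᵇ (f (<ᵇ-true {a} e)))) e′
 ... | false | true  = trans (sym e) (true-<ᵇ (g (<ᵇ-true {c} e′)))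

 -- Up to the positive factor `p / s`, the numbers `a` and `b` are `c` and `d` shifted by `z`:
 -- neither clearing denominators nor moving a subtracted term to the other side affects a
 -- comparison.
 <ᵇ-scaled : ∀ {a b c d} s p z → 0 < s → 0 < p → a * s ≡ p * (c + z) → b * s ≡ p * (d + z) → (a <ᵇ b) ≡ (c <ᵇ d)
 <ᵇ-scaled {a} {b} {c} {d} (suc s) (suc p) z _ _ e e′ = <ᵇ-≡
   (λ lt → +-cancelʳ-< z c d (*-cancelˡ-< (suc p) _ _ (subst₂ _<_ e e′ (*-monoˡ-< (suc s) lt))))
   (λ lt → *-cancelʳ-< (suc s) a b (subst₂ _<_ (sym e) (sym e′) (*-monoʳ-< (suc p) (+-monoˡ-< z lt))))

 not-<ᵇ : ∀ a b → not (a <ᵇ b) ≡ (b ≤ᵇ a)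
 not-<ᵇ a b with a <ᵇ b in e | b ≤ᵇ a in e′
 ... | true  | false = refl
 ... | false | true  = refl
 ... | true  | true  = contradiction (≤ᵇ-true {b} e′) (<⇒≱ (<ᵇ-true {a} e))
 ... | false | false = contradiction (trans (sym e′) (true-≤ᵇ {b} {a} (≮⇒≥ λ lt → contradiction (trans (sym e) (true-<ᵇ {a} {b} lt)) λ ()))) λ ()

 module Integral (I : Instance) where

   open Instance I
   open Lookup I
   open IsMetric isMetric using (nonNegative; ≈⇒0; triangle) renaming (sym to c-sym)

   private
     V : List (Vertex n)
     V = allFin (suc n)

     denominators : List ℕ
     denominators = ℚ.denominatorℕ R ∷ concatMap (λ u → map (λ v → ℚ.denominatorℕ (c u v)) V) V

     nonzero : NonZero (product denominators)
     nonzero = product≢0 {denominators} (_ ∷ All.concat⁺ {xss = map (λ u → map (λ v → ℚ.denominatorℕ (c u v)) V) V}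
       (All.map⁺ (All.universal (λ u → All.map⁺ (All.universal (λ v → _) V)) V)))

   -- The product of all denominators can be exponentially large, which is harmless since it occurs
   -- only in the proof: the algorithm compares fractions by cross-multiplication.
   K : ℕ
   K = pred (product denominators)

   open Multiples K public

   private
     divides-L : ∀ {d} → d ∈ denominators → d ∣ suc K
     divides-L {d} d∈ = subst (d ∣_) (sym (suc-pred (product denominators) ⦃ nonzero ⦄)) (∈⇒∣product d∈)

     c∈ : ∀ u v → ℚ.denominatorℕ (c u v) ∈ denominators
     c∈ u v = there (∈-concatMap⁺ (λ u → map (λ v → ℚ.denominatorℕ (c u v)) V) (Any.map (λ { refl → ∈-map⁺ (λ v → ℚ.denominatorℕ (c u v)) (∈-allFin v) }) (∈-allFin u)))

     scaled : (q : ℚ) → ℚ.denominatorℕ q ∣ suc K → ℕ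
     scaled q h = ∣ ℚ.numerator q ∣ * quotient h

     scaled-≡ : ∀ q h → ∣ ℚ.numerator q ∣ * suc K ≡ scaled q h * ℚ.denominatorℕ q
     scaled-≡ q (divides k e) = trans (cong (∣ ℚ.numerator q ∣ *_) e) (sym (*-assoc ∣ ℚ.numerator q ∣ k _))

   distance : ℕ → ℕ → ℕ
   distance u v = scaled (c (vertex u) (vertex v)) (divides-L (c∈ (vertex u) (vertex v)))

   bound : ℕ
   bound = scaled R (divides-L (here refl))

   distance-≐ : ∀ u v → c (vertex u) (vertex v) ≐ distance u v
   distance-≐ u v = ≐-scaled (c (vertex u) (vertex v)) (distance u v) nonNegative (scaled-≡ (c (vertex u) (vertex v)) (divides-L (c∈ (vertex u) (vertex v))))

   bound-≐ : R ≐ bound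
   bound-≐ = ≐-scaled R bound 0≤R (scaled-≡ R (divides-L (here refl)))

   distance-triangle : ∀ u v w → distance u w ≤ distance u v + distance v w
   distance-triangle u v w = ≐-≤⁻ (distance-≐ u w) (≐-+ {c (vertex u) (vertex v)} {c (vertex v) (vertex w)} (distance-≐ u v) (distance-≐ v w)) (triangle (vertex u) (vertex v) (vertex w))

   distance-sym : ∀ u v → distance u v ≡ distance v u
   distance-sym u v = ≐-injective (distance-≐ u v) (subst (_≐ distance v u) (c-sym (vertex v) (vertex u)) (distance-≐ v u))

   radius : ℕ → ℕ
   radius = distance 0

   -- By the triangle inequality the truncated subtraction is exact; see `excess-≡`.
   excess : ℕ → ℕ → ℕ
   excess u v = radius u + distance u v ∸ radius v

   excess-≡ : ∀ u v → excess u v + radius v ≡ radius u + distance u v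
   excess-≡ u v = m∸n+n≡m (distance-triangle 0 u v)

   distances : Distances excess radius
   distances = record
     { g-triangle = λ u v w → +-cancelʳ-≤ (radius v + radius w) _ _ (begin
         excess u w + (radius v + radius w)                     ≡⟨ lem₁ (excess u w) (radius v) (radius w) ⟩
         (excess u w + radius w) + radius v                     ≡⟨ cong (_+ radius v) (excess-≡ u w) ⟩
         radius u + distance u w + radius v
           ≤⟨ +-monoˡ-≤ (radius v) (+-monoʳ-≤ (radius u) (distance-triangle u v w)) ⟩
         radius u + (distance u v + distance v w) + radius v    ≡⟨ lem₂ (radius u) (distance u v) (distance v w) (radius v) ⟩
         (radius u + distance u v) + (radius v + distance v w)  ≡⟨ cong₂ _+_ (excess-≡ u v) (excess-≡ v w) ⟨
         (excess u v + radius v) + (excess v w + radius w)      ≡⟨ lem₃ (excess u v) (radius v) (excess v w) (radius w) ⟩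
         excess u v + excess v w + (radius v + radius w)        ∎)
     ; g-turn = λ u v → begin-equality
         excess u v + 2 * radius v              ≡⟨ lem₄ (excess u v) (radius v) ⟩
         excess u v + radius v + radius v       ≡⟨ cong (_+ radius v) (excess-≡ u v) ⟩
         radius u + distance u v + radius v     ≡⟨ cong (λ d → radius u + d + radius v) (distance-sym u v) ⟩
         radius u + distance v u + radius v     ≡⟨ lem₅ (radius u) (distance v u) (radius v) ⟩
         radius v + distance v u + radius u     ≡⟨ cong (_+ radius u) (excess-≡ v u) ⟨
         excess v u + radius u + radius u       ≡⟨ lem₄ (excess v u) (radius u) ⟨
         excess v u + 2 * radius u              ∎
     ; D-depot = ≐-injective (distance-≐ 0 0) (subst (_≐ 0) (sym (≈⇒0 refl)) ≐-0) }
     where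
     open ≤-Reasoning
     lem₁ : ∀ a b c → a + (b + c) ≡ a + c + b
     lem₁ = solve-∀
     lem₂ : ∀ a b c d → a + (b + c) + d ≡ a + b + (d + c)
     lem₂ = solve-∀
     lem₃ : ∀ a b c d → a + b + (c + d) ≡ a + c + (b + d)
     lem₃ = solve-∀
     lem₄ : ∀ a b → a + 2 * b ≡ a + b + b
     lem₄ = solve-∀
     lem₅ : ∀ a b c → a + b + c ≡ c + b + a
     lem₅ = solve-∀

   private
     ρ : Rows
     ρ = table I

     L : ℕ
     L = suc K

     up low : ℕ → ℕ → ℕ
     up u v = value (upper ρ u v)
     low u v = value (lower ρ u v)

     same-ratio : ∀ {a a′ b b′} x → a ≡ a′ → b ≡ b′ → a′ * L ≡ x * b′ → a * L ≡ x * b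
     same-ratio x refl refl e = e

     up-≡ : ∀ u v → up u v * L ≡ distance u v * low u v
     up-≡ u v = same-ratio (distance u v) (value-upper u v) (value-lower u v)
       (scaled-≡ (c (vertex u) (vertex v)) (divides-L (c∈ (vertex u) (vertex v))))

     low-positive : ∀ u v → 0 < low u v
     low-positive u v = subst (0 <_) (sym (value-lower u v)) (s≤s z≤n)

     top bottom : ℕ
     top = value (bound-upper ρ)
     bottom = value (bound-lower ρ)

     top-≡ : top * L ≡ bound * bottom
     top-≡ = same-ratio bound value-bound-upper value-bound-lower (scaled-≡ R (divides-L (here refl)))

     bottom-positive : 0 < bottom
     bottom-positive = subst (0 <_) (sym value-bound-lower) (s≤s z≤n)

     positive-* : ∀ {a b} → 0 < a → 0 < b → 0 < a * b
     positive-* {suc a} {suc b} _ _ = s≤s z≤n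

   exceeds-≡ : ∀ u v j → exceeds ρ u v j ≡ (j * bound <ᵇ unit-of ρ * excess u v)
   exceeds-≡ u v j = trans (less-≡ (multiple j A ++ multiple M B) (multiple M (product-of C E))) (trans (cong₂ _<ᵇ_ left-≡ right-≡)
       (<ᵇ-scaled {left-value} {right-value} {j * bound} {M * excess u v} L (low 0 u * (low u v * (low 0 v * bottom))) (unit-of ρ * radius v) (s≤s z≤n)
         (positive-* (low-positive 0 u) (positive-* (low-positive u v) (positive-* (low-positive 0 v) bottom-positive)))
         scaled-left scaled-right))
     where
     open ≡-Reasoning
     M : ℕ
     M = unit-of ρ
     A B C E : List ℕ
     A = product-of (bound-upper ρ) (product-of (lower ρ 0 u) (product-of (lower ρ u v) (lower ρ 0 v)))
     B = product-of (upper ρ 0 v) (product-of (lower ρ 0 u) (product-of (lower ρ u v) (bound-lower ρ)))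
     C = product-of (upper ρ 0 u) (lower ρ u v) ++ product-of (upper ρ u v) (lower ρ 0 u)
     E = product-of (lower ρ 0 v) (bound-lower ρ)
     left-value right-value : ℕ
     left-value = j * (top * (low 0 u * (low u v * low 0 v))) + M * (up 0 v * (low 0 u * (low u v * bottom)))
     right-value = M * ((up 0 u * low u v + up u v * low 0 u) * (low 0 v * bottom))
     left-≡ : value (multiple j A ++ multiple M B) ≡ left-value
     left-≡ = trans (value-++ (multiple j A) (multiple M B)) (cong₂ _+_
         (trans (value-multiple j A) (cong (j *_) (product₄ (bound-upper ρ) (lower ρ 0 u) (lower ρ u v) (lower ρ 0 v))))
         (trans (value-multiple M B) (cong (M *_) (product₄ (upper ρ 0 v) (lower ρ 0 u) (lower ρ u v) (bound-lower ρ)))))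
       where
       product₄ : ∀ xs ys zs ws → value (product-of xs (product-of ys (product-of zs ws))) ≡ value xs * (value ys * (value zs * value ws))
       product₄ xs ys zs ws = trans (value-product xs (product-of ys (product-of zs ws))) (cong (value xs *_)
         (trans (value-product ys (product-of zs ws)) (cong (value ys *_) (value-product zs ws))))
     right-≡ : value (multiple M (product-of C E)) ≡ right-value
     right-≡ = trans (value-multiple M (product-of C E)) (cong (M *_) (trans (value-product C E)
       (cong₂ _*_ (trans (value-++ (product-of (upper ρ 0 u) (lower ρ u v)) (product-of (upper ρ u v) (lower ρ 0 u)))
           (cong₂ _+_ (value-product (upper ρ 0 u) (lower ρ u v)) (value-product (upper ρ u v) (lower ρ 0 u))))
         (value-product (lower ρ 0 v) (bound-lower ρ)))))
     lem₁ : ∀ j t a b c M x d L → (j * (t * (a * (b * c))) + M * (x * (a * (b * d)))) * L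
          ≡ j * (t * L) * (a * (b * c)) + M * (x * L) * (a * (b * d))
     lem₁ = solve-∀
     lem₂ : ∀ j R d a b c M D → j * (R * d) * (a * (b * c)) + M * (D * c) * (a * (b * d)) ≡ a * (b * (c * d)) * (j * R + M * D)
     lem₂ = solve-∀
     scaled-left : left-value * L ≡ low 0 u * (low u v * (low 0 v * bottom)) * (j * bound + M * radius v)
     scaled-left = begin
       left-value * L
         ≡⟨ lem₁ j top (low 0 u) (low u v) (low 0 v) M (up 0 v) bottom L ⟩
       j * (top * L) * (low 0 u * (low u v * low 0 v)) + M * (up 0 v * L) * (low 0 u * (low u v * bottom))
         ≡⟨ cong₂ (λ s t → j * s * (low 0 u * (low u v * low 0 v)) + M * t * (low 0 u * (low u v * bottom))) top-≡ (up-≡ 0 v) ⟩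
       j * (bound * bottom) * (low 0 u * (low u v * low 0 v)) + M * (radius v * low 0 v) * (low 0 u * (low u v * bottom))
         ≡⟨ lem₂ j bound bottom (low 0 u) (low u v) (low 0 v) M (radius v) ⟩
       low 0 u * (low u v * (low 0 v * bottom)) * (j * bound + M * radius v) ∎
     lem₃ : ∀ M x b y a c d L → M * ((x * b + y * a) * (c * d)) * L ≡ M * ((x * L * b + y * L * a) * (c * d))
     lem₃ = solve-∀
     lem₄ : ∀ M D C a b c d → M * ((D * a * b + C * b * a) * (c * d)) ≡ a * (b * (c * d)) * (M * (D + C))
     lem₄ = solve-∀
     scaled-right : right-value * L ≡ low 0 u * (low u v * (low 0 v * bottom)) * (M * excess u v + M * radius v)
     scaled-right = begin
       right-value * L
         ≡⟨ lem₃ M (up 0 u) (low u v) (up u v) (low 0 u) (low 0 v) bottom L ⟩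
       M * ((up 0 u * L * low u v + up u v * L * low 0 u) * (low 0 v * bottom))
         ≡⟨ cong₂ (λ s t → M * ((s * low u v + t * low 0 u) * (low 0 v * bottom))) (up-≡ 0 u) (up-≡ u v) ⟩
       M * ((radius u * low 0 u * low u v + distance u v * low u v * low 0 u) * (low 0 v * bottom))
         ≡⟨ lem₄ M (radius u) (distance u v) (low 0 u) (low u v) (low 0 v) bottom ⟩
       low 0 u * (low u v * (low 0 v * bottom)) * (M * (radius u + distance u v))
         ≡⟨ cong (λ s → low 0 u * (low u v * (low 0 v * bottom)) * s)
              (trans (cong (M *_) (sym (excess-≡ u v))) (*-distribˡ-+ M (excess u v) (radius v))) ⟩
       low 0 u * (low u v * (low 0 v * bottom)) * (M * excess u v + M * radius v) ∎

   nearer-≡ : ∀ u v → nearer? ρ u v ≡ (radius u <ᵇ radius v)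
   nearer-≡ u v = trans (less-≡ (product-of (upper ρ 0 u) (lower ρ 0 v)) (product-of (upper ρ 0 v) (lower ρ 0 u))) (trans (cong₂ _<ᵇ_ (value-product (upper ρ 0 u) (lower ρ 0 v)) (value-product (upper ρ 0 v) (lower ρ 0 u)))
     (<ᵇ-scaled {up 0 u * low 0 v} {up 0 v * low 0 u} {radius u} {radius v} L (low 0 u * low 0 v) 0 (s≤s z≤n) (positive-* (low-positive 0 u) (low-positive 0 v))
       (trans (lem₁ (up 0 u) (low 0 v) L) (trans (cong (_* low 0 v) (up-≡ 0 u)) (lem₂ (radius u) (low 0 u) (low 0 v))))
       (trans (lem₁ (up 0 v) (low 0 u) L) (trans (cong (_* low 0 u) (up-≡ 0 v)) (lem₃ (radius v) (low 0 v) (low 0 u))))))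
     where
     lem₁ : ∀ a b L → a * b * L ≡ a * L * b
     lem₁ = solve-∀
     lem₂ : ∀ a b c → a * b * c ≡ b * c * (a + 0)
     lem₂ = solve-∀
     lem₃ : ∀ a b c → a * b * c ≡ c * b * (a + 0)
     lem₃ = solve-∀

   rounded : Rounded (count-of ρ) (unit-of ρ) bound excess radius (regret-of ρ) (rank-of ρ)
   rounded = record
     { distances = distances
     ; r-≡ = λ u v → cong (λ s → if u ≡ᵇ 0 then suc (unit-of ρ) else s)
         (∑-cong (downFrom (suc (unit-of ρ))) λ j → cong δ (exceeds-≡ u v j))
     ; rank-≡ = λ v → ∑-cong (downFrom (suc (count-of ρ))) λ u → cong δ (cong₂ _∨_ (nearer-≡ u v)
         (cong (_∧ (u <ᵇ v)) (trans (cong not (nearer-≡ v u)) (not-<ᵇ (radius v) (radius u))))) }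

-- Correctness of the Turing machine

module Correctness where

 open StackMachine
 open Polytime
 open Sequences
 open Encodings
 open InputOutput
 open Parsing
 open IntegralDistances
 open import Defs
 open import Data.Fin as Fin using (Fin; zero; suc; toℕ; fromℕ<)
 open import Data.Fin.Properties using (toℕ-injective; toℕ-fromℕ<; toℕ≤pred[n])
 open import Data.List.NonEmpty as List⁺ using (List⁺; _∷_; toList)
 open import Data.Rational as ℚ using (ℚ)
 import Data.Rational.Properties as ℚ

 -≤⁺ : ∀ p q r → p ℚ.≤ r ℚ.+ q → p ℚ.- q ℚ.≤ r
 -≤⁺ p q r h = ℚ.≤-trans (ℚ.+-monoˡ-≤ (ℚ.- q) h) (ℚ.≤-reflexive
   (trans (ℚ.+-assoc r q (ℚ.- q)) (trans (cong (r ℚ.+_) (ℚ.+-inverseʳ q)) (ℚ.+-identityʳ r))))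

 -≤⁻ : ∀ p q r → p ℚ.- q ℚ.≤ r → p ℚ.≤ r ℚ.+ q
 -≤⁻ p q r h = ℚ.≤-trans (ℚ.≤-reflexive (sym
   (trans (ℚ.+-assoc p (ℚ.- q) q) (trans (cong (p ℚ.+_) (ℚ.+-inverseˡ q)) (ℚ.+-identityʳ p))))) (ℚ.+-monoˡ-≤ q h)

 vertex-toℕ-map : ∀ {n} (vs : List (Vertex n)) → map vertex (map toℕ vs) ≡ vs
 vertex-toℕ-map []       = refl
 vertex-toℕ-map (v ∷ vs) = cong₂ _∷_ (vertex-toℕ v) (vertex-toℕ-map vs)

 toℕ-vertex-map : ∀ {n p} → All (_≤ n) p → map toℕ (map (vertex {n}) p) ≡ p
 toℕ-vertex-map []       = refl
 toℕ-vertex-map (h ∷ hs) = cong₂ _∷_ (toℕ-vertex-≤ h) (toℕ-vertex-map hs)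

 path : ∀ {n} → List ℕ → VertexSequence n
 path p = depot ∷ map vertex p

 end : ℕ → List ℕ → ℕ
 end u []       = u
 end u (w ∷ ws) = end w ws

 last-∷ : ∀ {X : Set} (x y : X) ys → List⁺.last (x ∷ y ∷ ys) ≡ List⁺.last (y ∷ ys)
 last-∷ x y ys with initLast ys
 ... | []       = refl
 ... | _ ∷ʳ′ _ = refl

 last-vertex : ∀ {n} u p → List⁺.last (vertex {n} u ∷ map vertex p) ≡ vertex (end u p)
 last-vertex u []       = refl
 last-vertex u (w ∷ ws) = trans (last-∷ (vertex u) (vertex w) (map vertex ws)) (last-vertex w ws)

 path-injective : ∀ {n p q} → All (_≤ n) p → All (_≤ n) q → path {n} p ≡ path q → p ≡ q
 path-injective p≤ q≤ e = trans (sym (toℕ-vertex-map p≤)) (trans (cong (map toℕ ∘ List⁺.tail) e) (toℕ-vertex-map q≤))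

 -- Disjoint paths are distinct as soon as each of them visits a customer; this is what nonemptiness
 -- of the pieces is for.
 paths-unique : ∀ {n} ps → All (λ p → ∃[ y ] ∃[ ys ] p ≡ y ∷ ys) ps → All (All (_≤ n)) ps → Unique (concat ps) →
                Unique (paths {n} ps)
 paths-unique []       []       []       u = []
 paths-unique {n} (p ∷ ps) ((y , ys , refl) ∷ ne) (p≤ ∷ ps≤) u with unique-parts {xs = p} u
 ... | _ , us , disjoint = All.map⁺ {f = path} (All.tabulate λ {q} q∈ e →
         disjoint (here refl) (∈-concat⁺′ (subst (y ∈_) (path-injective p≤ (All.lookup ps≤ q∈) e) (here refl)) q∈))
       ∷ paths-unique ps ne ps≤ us

 module Correspondence (I : Instance) where

   open Instance I
   open Integral I
   open Distances distances

   length-≐ : ∀ u p → pathLength I (vertex u ∷ map vertex p) ≐ cost distance (u ∷ p)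
   length-≐ u []       = ≐-0
   length-≐ u (w ∷ ws) = ≐-+ {c (vertex u) (vertex w)} (distance-≐ u w) (length-≐ w ws)

   -- The distances from the depot cancel between consecutive steps, so that length and regret
   -- differ only by the distances of the two ends.
   telescope : ∀ u p → radius u + cost distance (u ∷ p) ≡ cost excess (u ∷ p) + radius (end u p)
   telescope u []       = +-identityʳ (radius u)
   telescope u (w ∷ ws) = begin
     radius u + (distance u w + cost distance (w ∷ ws))                ≡⟨ +-assoc (radius u) _ _ ⟨
     radius u + distance u w + cost distance (w ∷ ws)                  ≡⟨ cong (_+ cost distance (w ∷ ws)) (excess-≡ u w) ⟨
     excess u w + radius w + cost distance (w ∷ ws)                    ≡⟨ +-assoc (excess u w) _ _ ⟩
     excess u w + (radius w + cost distance (w ∷ ws))                  ≡⟨ cong (excess u w +_) (telescope w ws) ⟩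
     excess u w + (cost excess (w ∷ ws) + radius (end w ws))           ≡⟨ +-assoc (excess u w) _ _ ⟨
     excess u w + cost excess (w ∷ ws) + radius (end w ws)             ∎
     where open ≡-Reasoning

   -- The first step, from the depot, has no regret, so the detour of a path depends on its
   -- customers alone.
   from-depot : ∀ p → cost excess (0 ∷ p) ≡ cost excess p
   from-depot []      = refl
   from-depot (x ∷ p) = cong (_+ cost excess (x ∷ p)) (trans (m+n∸n≡m (radius 0) (radius x)) D-depot)

   path-cost : ∀ p → cost distance (0 ∷ p) ≡ cost excess p + radius (end 0 p)
   path-cost p = trans (cong (_+ cost distance (0 ∷ p)) (sym D-depot))
     (trans (telescope 0 p) (cong (_+ radius (end 0 p)) (from-depot p)))

   private
     last-≐ : ∀ p → c depot (List⁺.last (path p)) ≐ radius (end 0 p)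
     last-≐ p = subst (λ v → c depot v ≐ radius (end 0 p)) (sym (last-vertex 0 p)) (distance-≐ 0 (end 0 p))

     path-≐ : ∀ p → pathLength I (path p) ≐ cost excess p + radius (end 0 p)
     path-≐ p = subst (pathLength I (path p) ≐_) (path-cost p) (length-≐ 0 p)

     limit-≐ : ∀ p → R ℚ.+ c depot (List⁺.last (path p)) ≐ bound + radius (end 0 p)
     limit-≐ p = ≐-+ {R} bound-≐ (last-≐ p)

   detour⁺ : ∀ p → cost excess p ≤ bound → detour I (path p) ℚ.≤ R
   detour⁺ p h = -≤⁺ (pathLength I (path p)) (c depot (List⁺.last (path p))) R
     (≐-≤⁺ {pathLength I (path p)} (path-≐ p) (limit-≐ p) (+-monoˡ-≤ (radius (end 0 p)) h))

   detour⁻ : ∀ p → detour I (path p) ℚ.≤ R → cost excess p ≤ bound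
   detour⁻ p h = +-cancelʳ-≤ (radius (end 0 p)) _ _ (≐-≤⁻ {pathLength I (path p)} (path-≐ p) (limit-≐ p)
     (-≤⁻ (pathLength I (path p)) (c depot (List⁺.last (path p))) R h))

   feasible : ∀ ps → All (λ p → cost excess p ≤ bound) ps → All (λ p → ∃[ y ] ∃[ ys ] p ≡ y ∷ ys) ps →
     (∀ {v} → v ∈ concat ps → 1 ≤ v × v ≤ n) → Unique (concat ps) → (∀ {v} → 1 ≤ v → v ≤ n → v ∈ concat ps) →
     Feasible I (paths ps)
   feasible ps cheap started inside distinct complete = record
     { isSet         = paths-unique ps started (All.tabulate λ p∈ → All.tabulate λ v∈ → proj₂ (inside (∈-concat⁺′ v∈ p∈))) distinct
     ; feasiblePaths = All.map⁺ {f = path} (All.tabulate feasible-path)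
     ; covers        = covers }
     where
     parts-unique : ∀ {ps p} → Unique (concat ps) → p ∈ ps → Unique p
     parts-unique {q ∷ _} u (here refl) = proj₁ (unique-parts {xs = q} u)
     parts-unique {q ∷ _} u (there p∈)  = parts-unique (proj₁ (proj₂ (unique-parts {xs = q} u))) p∈
     feasible-path : ∀ {p} → p ∈ ps → FeasiblePath I (path p)
     feasible-path {p} p∈ = record
       { startsAtDepot = refl
       ; isPath        = Unique.map⁻ {f = toℕ} (subst (λ xs → Unique (0 ∷ xs)) (sym (toℕ-vertex-map {n} (All.map proj₂ bounds)))
           (All.map (λ { (() , _) refl }) bounds ∷ parts-unique {ps} distinct p∈))
       ; detour≤R      = detour⁺ p (All.lookup cheap p∈) }
       where
       bounds : All (λ v → 1 ≤ v × v ≤ n) p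
       bounds = All.tabulate λ v∈ → inside (∈-concat⁺′ v∈ p∈)
     covers : ∀ (v : Fin n) → Any (λ P → suc v ∈ toList P) (paths ps)
     covers v with ∈-concat⁻′ ps (complete {toℕ (Fin.suc v)} (s≤s z≤n) (toℕ≤pred[n] (Fin.suc v)))
     ... | p , v∈ , p∈ = lose (∈-map⁺ path p∈) (there (subst (_∈ map vertex p) (vertex-toℕ (Fin.suc v)) (∈-map⁺ vertex v∈)))

   customers : Solution n → List (List ℕ)
   customers = map (λ P → map toℕ (List⁺.tail P))

   module _ {S : Solution n} (S-feasible : Feasible I S) where

     open Feasible S-feasible

     private
       path-≡ : ∀ {P} → FeasiblePath I P → path (map toℕ (List⁺.tail P)) ≡ P
       path-≡ {v ∷ vs} f = cong₂ _∷_ (sym (FeasiblePath.startsAtDepot f)) (vertex-toℕ-map vs)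

       customer : ∀ {P : VertexSequence n} → FeasiblePath I P → ∀ {v} → v ∈ List⁺.tail P → v ≢ depot
       customer {u ∷ us} f v∈ refl with FeasiblePath.isPath f
       ... | u∉ ∷ _ = All.lookup u∉ v∈ (FeasiblePath.startsAtDepot f)

       positive : ∀ {v : Vertex n} → v ≢ depot → 1 ≤ toℕ v
       positive {zero}  ne = contradiction refl ne
       positive {suc v} ne = s≤s z≤n

     customers-cheap : All (λ p → cost excess p ≤ bound) (customers S)
     customers-cheap = All.map⁺ (All.map (λ {P} f → detour⁻ (map toℕ (List⁺.tail P))
       (subst (λ P → detour I P ℚ.≤ R) (sym (path-≡ f)) (FeasiblePath.detour≤R f))) feasiblePaths)

     customers-unique : All Unique (customers S)
     customers-unique = All.map⁺ (All.map (λ f → Unique.map⁺ toℕ-injective (rest (FeasiblePath.isPath f))) feasiblePaths)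
       where
       rest : ∀ {P : VertexSequence n} → Unique (toList P) → Unique (List⁺.tail P)
       rest (_ ∷ u) = u

     customers-inside : ∀ {v} → v ∈ concat (customers S) → 1 ≤ v × v ≤ n
     customers-inside v∈ with ∈-concat⁻′ (customers S) v∈
     ... | p , v∈p , p∈ with ∈-map⁻ (λ P → map toℕ (List⁺.tail P)) p∈
     ...   | P , P∈ , refl with ∈-map⁻ toℕ v∈p
     ...     | w , w∈ , refl = positive (customer (All.lookup feasiblePaths P∈) w∈) , toℕ≤pred[n] w

     customers-complete : ∀ {v} → 1 ≤ v → v ≤ n → v ∈ concat (customers S)
     customers-complete {suc v} _ v<n with find (covers (fromℕ< v<n))
     ... | u ∷ us , P∈ , here e   = contradiction (trans e (FeasiblePath.startsAtDepot (All.lookup feasiblePaths P∈))) λ ()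
     ... | u ∷ us , P∈ , there v∈ = ∈-concat⁺′ (subst (_∈ map toℕ us) (cong suc (toℕ-fromℕ< v<n)) (∈-map⁺ toℕ v∈))
       (∈-map⁺ (λ P → map toℕ (List⁺.tail P)) P∈)

 answer-parsed : ∀ {xs ρ} → parse xs ≡ ρ → answer xs ≡ write (best-of ρ)
 answer-parsed refl = refl

 module Correct (I : Instance) where

   open Instance I
   open Integral I
   open Correspondence I
   open Lookup I

   private
     ρ : Rows
     ρ = table I

   module B = Vertices.Exact.Bridge (count-of ρ) (unit-of ρ) (regret-of ρ) (rank-of ρ) bound excess radius rounded refl

   tours-feasible : ∀ {ps} → B.Tours ps → Feasible I (paths ps)
   tours-feasible {ps} tours = feasible ps cheap all-started
     (λ v∈ → let a , b = inside v∈ in a , ≤-trans b (≤-reflexive count-table))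
     distinct (λ a b → complete a (≤-trans b (≤-reflexive (sym count-table))))
     where open B.Tours tours

   best-encoding : map symbol-code (encodeSolution (paths {n} (best-of ρ))) ≡ write (best-of ρ)
   best-encoding = encode-paths (best-of ρ) (All.tabulate λ p∈ → All.tabulate λ v∈ →
     ≤-trans (proj₂ (B.Tours.inside B.best-tours (∈-concat⁺′ v∈ p∈))) (≤-reflexive count-table))

   best-feasible : Feasible I (paths (best-of ρ))
   best-feasible = tours-feasible B.best-tours

   best-ratio : ∀ opt → IsMinimum I opt → length (paths {n} (best-of ρ)) ≤ 10 * opt
   best-ratio opt ((S , S-feasible , e) , minimum) = subst₂ _≤_ (sym (length-map path (best-of ρ))) (cong (10 *_) length-≡)
     (B.best-bounded (customers S) (customers-cheap S-feasible) (customers-unique S-feasible)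
       (λ v∈ → let a , b = customers-inside S-feasible v∈ in a , ≤-trans b (≤-reflexive (sym count-table)))
       (λ a b → customers-complete S-feasible a (≤-trans b (≤-reflexive count-table)))
       λ {ps} tours → ≤-trans (≤-reflexive length-≡)
         (≤-trans (minimum (paths ps) (tours-feasible tours)) (≤-reflexive (length-map path ps))))
     where
     length-≡ : length (customers S) ≡ opt
     length-≡ = trans (length-map _ S) e

   answer-encoding : answer (map symbol-code (encodeInstance I)) ≡ map symbol-code (encodeSolution (paths {n} (best-of ρ)))
   answer-encoding = trans {j = write (best-of ρ)} (answer-parsed {map symbol-code (encodeInstance I)} {ρ} (parse-encoding I)) (sym best-encoding)

 open Machine answerP

 algorithm : TuringMachine
 algorithm = machine whole

 running-time : List ℕ
 running-time = power (Poly.degree stepsᵖ)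

 correct : ∀ I → ∃[ S ] Feasible I S × (∀ opt → IsMinimum I opt → length S ≤ 10 * opt)
   × ComputesWithin algorithm (evaluate running-time (length (encodeInstance I))) (encodeInstance I) (encodeSolution S)
 correct I = paths (best-of (table I)) , Correct.best-feasible I , Correct.best-ratio I ,
   whole-computes (encodeInstance I) (encodeSolution (paths (best-of (table I)))) (Correct.answer-encoding I)

open Correctness using (algorithm; running-time; correct)

theorem41 : ∃[ M ] IsApproximationAlgorithm 10 M
theorem41 = algorithm , running-time , correct
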